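{- Let $n$ be a positive integer and $X,Y>0$. Then \[ \#\{f\in\Sigma_n: |\Delta(f)|<X,\ h(f)<Y\}\ll \nu(\Sigma_n)\bigl(Y^2+n\bigr)\min\{Y^3,X^{1/2}\}+nY^2 . \]
   Context: For a ring $R$, $V(R)$ is the set of monic cubic polynomials $x^3+tx^2+Ax+B$ with $t\in\{ -1,0,1\}$ and $A,B\in R$; $\Delta(f)$ is the discriminant and $h(f)$ is the maximum absolute value of the complex roots of $f$. For $f\in V(\mathbb{Z})$ with $\Delta(f)\ne0$, $\mathrm{ind}(f)$ is the index of $\mathbb{Z}[x]/(f)$ in the ring of integral elements of $\mathbb{Q}[x]/(f)$. $\Sigma_n$ is the set of $f\in V(\mathbb{Z})$ with $\Delta(f)\neq0$ and $n\mid\mathrm{ind}(f)$. $\nu(\Sigma_n)$ is the measure of the closure of $\Sigma_n$ in $V(\hat{\mathbb{Z}})=\{ -1,0,1\}\times\hat{\mathbb{Z}}^2$ with respect to the probability measure (uniform in $t$, normalized Haar in $(A,B)$). -}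

module Defs where

open import Data.Bool.Base using (Bool; true)
open import Data.Fin.Base using (Fin; toℕ; fromℕ<)
open import Data.Integer.Base as ℤ using (ℤ; +_; 0ℤ; 1ℤ; -1ℤ)
open import Data.Integer.DivMod using (_%ℕ_; n%ℕd<d)
open import Data.List.Base using (List; []; _∷_; allFin; cartesianProductWith; filterᵇ; foldr; length)
open import Data.List.Relation.Unary.All using (All)
open import Data.List.Relation.Unary.Unique.Propositional using (Unique)
open import Data.Nat.Base as ℕ using (ℕ; zero; suc; NonZero)
open import Data.Nat.Divisibility using (_∣_)
import Data.Nat.Properties as ℕ
open import Data.Product.Base using (∃; _×_; _,_)
open import Data.Rational.Base as ℚ
  using (ℚ; 0ℚ; 1ℚ; ½; _+_; _*_; _-_; -_; _≤_; _<_; _⊓_; ∣_∣; 1/_; positive; nonNegative)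
open import Data.Rational.Properties
open import Data.Rational.Solver using (module +-*-Solver)
open import Data.Sum.Base using (inj₁; inj₂)
open import Relation.Binary.PropositionalEquality
  using (_≡_; _≢_; refl; sym; trans; cong; cong₂; subst; subst₂)

open +-*-Solver using (solve; _:=_; _:+_; _:-_; _:*_; :-_)

------------------------------------------------------------------------
-- Real numbers: Cauchy sequences of rationals, with x ≃ℝ y as equality

Cauchy : (ℕ → ℚ) → Set
Cauchy x = ∀ ε → 0ℚ < ε → ∃ λ N → ∀ m n → N ℕ.≤ m → N ℕ.≤ n → ∣ x m - x n ∣ ≤ ε

record ℝ : Set where
  constructor mkℝ
  field
    seq    : ℕ → ℚ
    cauchy : Cauchy seq

open ℝ

infix  4 _≤ℝ_ _<ℝ_ _≃ℝ_
infixl 6 _+ℝ_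
infixl 7 _*ℝ_
infixl 7 _⊓ℝ_
infixr 8 _^ℝ_
infix  8 -ℝ_

_≤ℝ_ : ℝ → ℝ → Set
x ≤ℝ y = ∀ ε → 0ℚ < ε → ∃ λ N → ∀ n → N ℕ.≤ n → seq x n ≤ seq y n + ε

_<ℝ_ : ℝ → ℝ → Set
x <ℝ y = ∃ λ ε → 0ℚ < ε × ∃ λ N → ∀ n → N ℕ.≤ n → seq x n + ε ≤ seq y n

_≃ℝ_ : ℝ → ℝ → Set
x ≃ℝ y = x ≤ℝ y × y ≤ℝ x

private
  p≤∣p∣ : ∀ p → p ≤ ∣ p ∣
  p≤∣p∣ p with ≤-total 0ℚ p
  ... | inj₁ 0≤p = ≤-reflexive (sym (0≤p⇒∣p∣≡p 0≤p))
  ... | inj₂ p≤0 = ≤-trans p≤0 (0≤∣p∣ p)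

  ∣p-q∣≤ε⇒p≤q+ε : ∀ p q {ε} → ∣ p - q ∣ ≤ ε → p ≤ q + ε
  ∣p-q∣≤ε⇒p≤q+ε p q le =
    subst (_≤ _) (solve 2 (λ p q → q :+ (p :- q) := p) refl p q)
      (+-monoʳ-≤ q (≤-trans (p≤∣p∣ (p - q)) le))

  p≤q+ε⇒p-q≤ε : ∀ p q {ε} → p ≤ q + ε → p - q ≤ ε
  p≤q+ε⇒p-q≤ε p q {ε} le =
    subst (p - q ≤_) (solve 2 (λ q ε → (q :+ ε) :- q := ε) refl q ε)
      (+-monoˡ-≤ (- q) le)

  ∣∣-swap : ∀ p q → ∣ p - q ∣ ≡ ∣ q - p ∣
  ∣∣-swap p q = trans (sym (∣-p∣≡∣p∣ (p - q)))
    (cong ∣_∣ (solve 2 (λ p q → :- (p :- q) := q :- p) refl p q))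

  ∣∣-intro : ∀ p q {ε} → p ≤ q + ε → q ≤ p + ε → ∣ p - q ∣ ≤ ε
  ∣∣-intro p q le₁ le₂ with ∣p∣≡p∨∣p∣≡-p (p - q)
  ... | inj₁ eq = subst (_≤ _) (sym eq) (p≤q+ε⇒p-q≤ε p q le₁)
  ... | inj₂ eq = subst (_≤ _)
        (sym (trans eq (solve 2 (λ p q → :- (p :- q) := q :- p) refl p q)))
        (p≤q+ε⇒p-q≤ε q p le₂)

  ⊓-≤ : ∀ p q r s {ε} → p ≤ r + ε → q ≤ s + ε → p ⊓ q ≤ (r ⊓ s) + ε
  ⊓-≤ p q r s {ε} le₁ le₂ with ⊓-sel r s
  ... | inj₁ eq = subst (λ u → p ⊓ q ≤ u + ε) (sym eq) (≤-trans (p⊓q≤p p q) le₁)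
  ... | inj₂ eq = subst (λ u → p ⊓ q ≤ u + ε) (sym eq) (≤-trans (p⊓q≤q p q) le₂)

  0<½* : ∀ ε → 0ℚ < ε → 0ℚ < ½ * ε
  0<½* ε 0<ε = subst (_< ½ * ε) (*-zeroʳ ½) (*-monoʳ-<-pos ½ 0<ε)

  ½+½ : ∀ ε → ½ * ε + ½ * ε ≡ ε
  ½+½ ε = trans (sym (*-distribʳ-+ ε ½ ½)) (*-identityˡ ε)

  +-Cauchy : ∀ x y → Cauchy x → Cauchy y → Cauchy (λ n → x n + y n)
  +-Cauchy x y cx cy ε 0<ε with cx (½ * ε) (0<½* ε 0<ε) | cy (½ * ε) (0<½* ε 0<ε)
  ... | N₁ , h₁ | N₂ , h₂ = N₁ ℕ.⊔ N₂ , λ m n m≥ n≥ →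
    let a≤ = h₁ m n (ℕ.m⊔n≤o⇒m≤o N₁ N₂ m≥) (ℕ.m⊔n≤o⇒m≤o N₁ N₂ n≥)
        b≤ = h₂ m n (ℕ.m⊔n≤o⇒n≤o N₁ N₂ m≥) (ℕ.m⊔n≤o⇒n≤o N₁ N₂ n≥)
    in subst₂ _≤_
         (cong ∣_∣ (solve 4 (λ a b c d → (a :- c) :+ (b :- d) := (a :+ b) :- (c :+ d))
                      refl (x m) (y m) (x n) (y n)))
         (½+½ ε)
         (≤-trans (∣p+q∣≤∣p∣+∣q∣ (x m - x n) (y m - y n)) (+-mono-≤ a≤ b≤))

  neg-Cauchy : ∀ x → Cauchy x → Cauchy (λ n → - x n)
  neg-Cauchy x cx ε 0<ε with cx ε 0<ε
  ... | N , h = N , λ m n m≥ n≥ →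
    subst (λ u → ∣ u ∣ ≤ ε) (solve 2 (λ a b → a :- b := (:- b) :- (:- a)) refl (x n) (x m))
      (h n m n≥ m≥)

  ⊓-Cauchy : ∀ x y → Cauchy x → Cauchy y → Cauchy (λ n → x n ⊓ y n)
  ⊓-Cauchy x y cx cy ε 0<ε with cx ε 0<ε | cy ε 0<ε
  ... | N₁ , h₁ | N₂ , h₂ = N₁ ℕ.⊔ N₂ , λ m n m≥ n≥ →
    let half m n m≥ n≥ = ⊓-≤ (x m) (y m) (x n) (y n)
          (∣p-q∣≤ε⇒p≤q+ε (x m) (x n) (h₁ m n (ℕ.m⊔n≤o⇒m≤o N₁ N₂ m≥) (ℕ.m⊔n≤o⇒m≤o N₁ N₂ n≥)))
          (∣p-q∣≤ε⇒p≤q+ε (y m) (y n) (h₂ m n (ℕ.m⊔n≤o⇒n≤o N₁ N₂ m≥) (ℕ.m⊔n≤o⇒n≤o N₁ N₂ n≥)))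
    in ∣∣-intro (x m ⊓ y m) (x n ⊓ y n) (half m n m≥ n≥) (half n m n≥ m≥)

  Cauchy-bounded : ∀ x → Cauchy x →
    ∃ λ K → 0ℚ < K × ∃ λ N → ∀ n → N ℕ.≤ n → ∣ x n ∣ ≤ K
  Cauchy-bounded x cx with cx 1ℚ (positive⁻¹ 1ℚ)
  ... | N , h = ∣ x N ∣ + 1ℚ , +-mono-≤-< (0≤∣p∣ (x N)) (positive⁻¹ 1ℚ) , N , λ n n≥ →
    ≤-trans
      (subst (λ u → ∣ u ∣ ≤ ∣ x N ∣ + ∣ x n - x N ∣)
        (solve 2 (λ a b → a :+ (b :- a) := b) refl (x N) (x n))
        (∣p+q∣≤∣p∣+∣q∣ (x N) (x n - x N)))
      (+-monoʳ-≤ ∣ x N ∣ (h n N n≥ ℕ.≤-refl))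

  shrink : ∀ K ε → 0ℚ < K → 0ℚ < ε → ∃ λ δ → 0ℚ < δ × K * δ ≡ ½ * ε
  shrink K ε 0<K 0<ε = ½ * ε * K⁻¹ , 0<δ , eq
    where
    instance
      K>0 = positive 0<K
      K≢0 = pos⇒nonZero K
    K⁻¹ = 1/ K
    instance
      K⁻¹>0 = 1/pos⇒pos K
    0<δ : 0ℚ < ½ * ε * K⁻¹
    0<δ = subst (_< ½ * ε * K⁻¹) (*-zeroˡ K⁻¹) (*-monoˡ-<-pos K⁻¹ (0<½* ε 0<ε))
    eq : K * (½ * ε * K⁻¹) ≡ ½ * ε
    eq = trans (solve 3 (λ k e i → k :* (e :* i) := e :* (k :* i)) refl K (½ * ε) K⁻¹)
           (trans (cong ((½ * ε) *_) (*-inverseʳ K)) (*-identityʳ (½ * ε)))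

  *-≤ : ∀ p q K δ → 0ℚ < K → ∣ p ∣ ≤ K → ∣ q ∣ ≤ δ → ∣ p * q ∣ ≤ K * δ
  *-≤ p q K δ 0<K p≤ q≤ = subst (_≤ K * δ) (sym (∣p*q∣≡∣p∣*∣q∣ p q))
    (≤-trans (*-monoʳ-≤-nonNeg ∣ q ∣ {{nonNegative (0≤∣p∣ q)}} p≤)
             (*-monoˡ-≤-nonNeg K {{nonNegative (<⇒≤ 0<K)}} q≤))

  *-diff : ∀ a b c d → a * (b - d) + d * (a - c) ≡ a * b - c * d
  *-diff = solve 4 (λ a b c d → a :* (b :- d) :+ d :* (a :- c) := a :* b :- c :* d) refl

  ∣*-diff∣ : ∀ a b c d {ε₁ ε₂ ε} → ∣ a * (b - d) ∣ ≤ ε₁ → ∣ d * (a - c) ∣ ≤ ε₂ →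
    ε₁ + ε₂ ≡ ε → ∣ a * b - c * d ∣ ≤ ε
  ∣*-diff∣ a b c d le₁ le₂ eq = subst₂ (λ u v → ∣ u ∣ ≤ v) (*-diff a b c d) eq
    (≤-trans (∣p+q∣≤∣p∣+∣q∣ (a * (b - d)) (d * (a - c))) (+-mono-≤ le₁ le₂))

  *-Cauchy : ∀ x y → Cauchy x → Cauchy y → Cauchy (λ n → x n * y n)
  *-Cauchy x y cx cy ε 0<ε =
    let K , 0<K , M₁ , bx = Cauchy-bounded x cx
        L , 0<L , M₂ , by = Cauchy-bounded y cy
        δ , 0<δ , Kδ = shrink K ε 0<K 0<ε
        η , 0<η , Lη = shrink L ε 0<L 0<ε
        N₁ , h₁ = cy δ 0<δ
        N₂ , h₂ = cx η 0<η
        M = M₁ ℕ.⊔ M₂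
        N = N₁ ℕ.⊔ N₂
    in M ℕ.⊔ N , λ m n m≥ n≥ →
      ∣*-diff∣ (x m) (y m) (x n) (y n)
        (*-≤ (x m) (y m - y n) K δ 0<K
          (bx m (ℕ.m⊔n≤o⇒m≤o M₁ M₂ (ℕ.m⊔n≤o⇒m≤o M N m≥)))
          (h₁ m n (ℕ.m⊔n≤o⇒m≤o N₁ N₂ (ℕ.m⊔n≤o⇒n≤o M N m≥))
                  (ℕ.m⊔n≤o⇒m≤o N₁ N₂ (ℕ.m⊔n≤o⇒n≤o M N n≥))))
        (*-≤ (y n) (x m - x n) L η 0<L
          (by n (ℕ.m⊔n≤o⇒n≤o M₁ M₂ (ℕ.m⊔n≤o⇒m≤o M N n≥)))
          (h₂ m n (ℕ.m⊔n≤o⇒n≤o N₁ N₂ (ℕ.m⊔n≤o⇒n≤o M N m≥))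
                  (ℕ.m⊔n≤o⇒n≤o N₁ N₂ (ℕ.m⊔n≤o⇒n≤o M N n≥))))
        (trans (cong₂ _+_ Kδ Lη) (½+½ ε))

  const-Cauchy : ∀ q → Cauchy (λ _ → q)
  const-Cauchy q ε 0<ε = 0 , λ _ _ _ _ →
    subst (λ u → ∣ u ∣ ≤ ε) (sym (+-inverseʳ q)) (<⇒≤ 0<ε)

_+ℝ_ : ℝ → ℝ → ℝ
x +ℝ y = mkℝ (λ n → seq x n + seq y n) (+-Cauchy (seq x) (seq y) (cauchy x) (cauchy y))

-ℝ_ : ℝ → ℝ
-ℝ x = mkℝ (λ n → - seq x n) (neg-Cauchy (seq x) (cauchy x))

_*ℝ_ : ℝ → ℝ → ℝ
x *ℝ y = mkℝ (λ n → seq x n * seq y n) (*-Cauchy (seq x) (seq y) (cauchy x) (cauchy y))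

_⊓ℝ_ : ℝ → ℝ → ℝ
x ⊓ℝ y = mkℝ (λ n → seq x n ⊓ seq y n) (⊓-Cauchy (seq x) (seq y) (cauchy x) (cauchy y))

ℚ→ℝ : ℚ → ℝ
ℚ→ℝ q = mkℝ (λ _ → q) (const-Cauchy q)

ℤ→ℚ : ℤ → ℚ
ℤ→ℚ a = a ℚ./ 1

ℤ→ℝ : ℤ → ℝ
ℤ→ℝ a = ℚ→ℝ (ℤ→ℚ a)

ℕ→ℝ : ℕ → ℝ
ℕ→ℝ n = ℤ→ℝ (+ n)

0ℝ 1ℝ : ℝ
0ℝ = ℕ→ℝ 0
1ℝ = ℕ→ℝ 1

_^ℝ_ : ℝ → ℕ → ℝ
x ^ℝ zero  = 1ℝ
x ^ℝ suc k = x *ℝ x ^ℝ k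

IsSqrt : ℝ → ℝ → Set
IsSqrt x s = 0ℝ ≤ℝ s × s ^ℝ 2 ≃ℝ x

------------------------------------------------------------------------
-- Complex numbers

record ℂ : Set where
  constructor _+i_
  field
    re im : ℝ

open ℂ

_+ℂ_ _*ℂ_ : ℂ → ℂ → ℂ
(a +i b) +ℂ (c +i d) = (a +ℝ c) +i (b +ℝ d)
(a +i b) *ℂ (c +i d) = (a *ℝ c +ℝ -ℝ (b *ℝ d)) +i (a *ℝ d +ℝ b *ℝ c)

infixl 6 _+ℂ_
infixl 7 _*ℂ_

ℤ→ℂ : ℤ → ℂ
ℤ→ℂ a = ℤ→ℝ a +i 0ℝ

IsAbs : ℂ → ℝ → Set
IsAbs z r = IsSqrt (re z ^ℝ 2 +ℝ im z ^ℝ 2) r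

------------------------------------------------------------------------
-- The cubics x³ + t x² + A x + B with t ∈ {-1,0,1}

data T : Set where
  t₋₁ t₀ t₁ : T

⟦_⟧ : T → ℤ
⟦ t₋₁ ⟧ = -1ℤ
⟦ t₀  ⟧ = 0ℤ
⟦ t₁  ⟧ = 1ℤ

record V (R : Set) : Set where
  constructor cubic
  field
    t   : T
    A B : R

open V

mapV : ∀ {R S : Set} → (R → S) → V R → V S
mapV φ f = cubic (t f) (φ (A f)) (φ (B f))

-- b²c² - 4c³ - 4b³d + 18bcd - 27d² for x³ + bx² + cx + d.
Δ : V ℤ → ℤ
Δ f = b ℤ.^ 2 ℤ.* c ℤ.^ 2 ℤ.- + 4 ℤ.* c ℤ.^ 3 ℤ.- + 4 ℤ.* b ℤ.^ 3 ℤ.* d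
      ℤ.+ + 18 ℤ.* b ℤ.* c ℤ.* d ℤ.- + 27 ℤ.* d ℤ.^ 2
  where
  b = ⟦ t f ⟧
  c = A f
  d = B f

evalℂ : V ℤ → ℂ → ℂ
evalℂ f z = z *ℂ z *ℂ z +ℂ ℤ→ℂ ⟦ t f ⟧ *ℂ (z *ℂ z) +ℂ ℤ→ℂ (A f) *ℂ z +ℂ ℤ→ℂ (B f)

IsRoot : V ℤ → ℂ → Set
IsRoot f z = re (evalℂ f z) ≃ℝ 0ℝ × im (evalℂ f z) ≃ℝ 0ℝ

-- r = h(f)
IsHeight : V ℤ → ℝ → Set
IsHeight f r = (∃ λ z → IsRoot f z × IsAbs z r)
             × (∀ z s → IsRoot f z → IsAbs z s → s ≤ℝ r)

------------------------------------------------------------------------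
-- The ℚ-algebra ℚ[x]/(f), in the basis 1, x, x²

record Alg : Set where
  constructor ⟨_,_,_⟩
  field
    c₀ c₁ c₂ : ℚ

_+ᴬ_ _-ᴬ_ : Alg → Alg → Alg
⟨ a , b , c ⟩ +ᴬ ⟨ a′ , b′ , c′ ⟩ = ⟨ a + a′ , b + b′ , c + c′ ⟩
⟨ a , b , c ⟩ -ᴬ ⟨ a′ , b′ , c′ ⟩ = ⟨ a - a′ , b - b′ , c - c′ ⟩

_·ᴬ_ : ℚ → Alg → Alg
q ·ᴬ ⟨ a , b , c ⟩ = ⟨ q * a , q * b , q * c ⟩

ℤ→Alg : ℤ → Alg
ℤ→Alg a = ⟨ ℤ→ℚ a , 0ℚ , 0ℚ ⟩

-- Multiplication by the class of x, using x³ = -t x² - A x - B.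
x·[_] : V ℤ → Alg → Alg
x·[ f ] ⟨ a , b , c ⟩ =
  ⟨ - (ℤ→ℚ (B f) * c) , a - ℤ→ℚ (A f) * c , b - ℤ→ℚ ⟦ t f ⟧ * c ⟩

mul : V ℤ → Alg → Alg → Alg
mul f ⟨ a , b , c ⟩ v = (a ·ᴬ v) +ᴬ x·[ f ] ((b ·ᴬ v) +ᴬ x·[ f ] (c ·ᴬ v))

-- The list c₀ ∷ … ∷ c_{d-1} stands for the monic polynomial
-- X^d + c_{d-1} X^{d-1} + … + c₀, evaluated by Horner's rule.
evalMonic : V ℤ → List ℤ → Alg → Alg
evalMonic f cs u = foldr (λ c v → ℤ→Alg c +ᴬ mul f u v) (ℤ→Alg 1ℤ) cs

Integral : V ℤ → Alg → Set
Integral f u = ∃ λ cs → evalMonic f cs u ≡ ℤ→Alg 0ℤ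

-- The elements of ℤ[x]/(f).
InOrder : Alg → Set
InOrder u = ∃ λ a → ∃ λ b → ∃ λ c → u ≡ ⟨ ℤ→ℚ a , ℤ→ℚ b , ℤ→ℚ c ⟩

-- k = ind(f): there is a system of exactly k representatives of the cosets of
-- ℤ[x]/(f) in the integral elements.
record IsIndex (f : V ℤ) (k : ℕ) : Set where
  field
    rep      : Fin k → Alg
    integral : ∀ i → Integral f (rep i)
    distinct : ∀ i j → InOrder (rep i -ᴬ rep j) → i ≡ j
    covers   : ∀ u → Integral f u → ∃ λ i → InOrder (u -ᴬ rep i)

Σ[_] : ℕ → V ℤ → Set
Σ[ n ] f = Δ f ≢ 0ℤ × ∃ λ k → IsIndex f k × n ∣ k

------------------------------------------------------------------------
-- Profinite integers, closures and Haar measure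

record Ẑ : Set where
  field
    residue    : ∀ m .{{_ : NonZero m}} → Fin m
    compatible : ∀ m k .{{_ : NonZero m}} .{{_ : NonZero k}} → m ∣ k →
                 toℕ (residue k) ℕ.% m ≡ toℕ (residue m)

_modℤ_ : ℤ → ∀ m .{{_ : NonZero m}} → Fin m
a modℤ m = fromℕ< (n%ℕd<d a m)

_modẐ_ : Ẑ → ∀ m .{{_ : NonZero m}} → Fin m
a modẐ m = Ẑ.residue a m

-- The sets of points with a prescribed t and prescribed residues of A and B
-- modulo m are a basis of the topology of V(Ẑ).
Closure : (V ℤ → Set) → V Ẑ → Set
Closure S x = ∀ m .{{_ : NonZero m}} →
  ∃ λ f → S f × mapV (_modℤ m) f ≡ mapV (_modẐ m) x

-- Every clopen subset of V(Ẑ) is the preimage of a set of cubics modulo some m.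
record Clopen : Set where
  field
    level       : ℕ
    {{level≢0}} : NonZero level
    member      : V (Fin level) → Bool

  _∋_ : V Ẑ → Set
  _∋_ x = member (mapV (_modẐ level) x) ≡ true

allV : ∀ m → List (V (Fin m))
allV m = cartesianProductWith (λ s g → g s) (t₋₁ ∷ t₀ ∷ t₁ ∷ [])
           (cartesianProductWith (λ a b s → cubic s a b) (allFin m) (allFin m))

-- The probability measure gives each class modulo m mass 1/(3m²).
mass : Clopen → ℚ
mass U = + length (filterᵇ member (allV level)) ℚ./ (3 ℕ.* (level ℕ.* level))
  where
  open Clopen U
  instance
    m²≢0 : NonZero (level ℕ.* level)
    m²≢0 = ℕ.m*n≢0 level level
    3m²≢0 : NonZero (3 ℕ.* (level ℕ.* level))
    3m²≢0 = ℕ.m*n≢0 3 (level ℕ.* level)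

-- v is the measure of the closed set Z. By regularity and compactness this is the
-- infimum of the masses of the clopen sets containing Z. (A closed set is assumed:
-- for a general set the infimum is that of its closure.)
IsMeasureOfClosed : (V Ẑ → Set) → ℝ → Set
IsMeasureOfClosed Z v =
    (∀ U → Contains U → v ≤ℝ ℚ→ℝ (mass U))
  × (∀ w → (∀ U → Contains U → w ≤ℝ ℚ→ℝ (mass U)) → w ≤ℝ v)
  where
  Contains : Clopen → Set
  Contains U = ∀ x → Z x → Clopen._∋_ U x

-- v = ν(S)
Isν : (V ℤ → Set) → ℝ → Set
Isν S = IsMeasureOfClosed (Closure S)

-- #S ≤ b, including that S is finite.
Card≤ : (V ℤ → Set) → ℝ → Set
Card≤ S b = ∀ fs → Unique fs → All S fs → ℕ→ℝ (length fs) ≤ℝ b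

Counted : ℕ → ℝ → ℝ → V ℤ → Set
Counted n X Y f =
  Σ[ n ] f × ℕ→ℝ ℤ.∣ Δ f ∣ <ℝ X × ∃ λ r → IsHeight f r × r <ℝ Y

{-# OPTIONS --safe #-}
module Submission where

-- Write e = v_p(n). A cubic f with Δ(f) ≠ 0 satisfies n ∣ ind(f) iff for every prime p some
-- pair (κ, μ) of controlled shape and some r satisfy p^κ ∣ f″(r)/2, p^(2κ+μ) ∣ f′(r) and
-- p^(3κ+2μ) ∣ f(r): the elements (x - r)/p^κ and (f(x) - f(r))/((x - r)p^(2κ+μ)) are then
-- integral, and conversely a triangular basis of the integral elements has this form. So for
-- fixed t and A the admissible B form a set S_A that is periodic modulo n² and, locally at each
-- p, a union of balls that are nested or disjoint. Three facts about S_A follow.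
--   * S_A has at most c(A) ℓ / n² + n elements in a window of length ℓ, where c(A) counts its
--     residues modulo n².
--   * If n ∣ A' - A then translating B by a multiple of an approximate double root r maps S_A to
--     S_A', at most four to one, so c(A) ≤ 4 c(A').
--   * Hence ν(Σ_n) ≥ ω, where 12 n³ ω is the sum of c(A) over t and over A modulo n.
-- The roots give |A| ≤ 3Y² and |B| ≤ Y³. For fixed t and A the resolvent Q = 27 f(-t/3) has
-- Q² + 27 Δ constant, so two values of B for which Q has the same sign differ by at most √X.
-- Summing the window bound over A gives the theorem; 1 ≤ 4Y² absorbs the lower order terms.

-- Why four to one. Adding δ(x - r) to f with n ∣ δ keeps f(r) and f″(r) and changes f′(r) by a
-- multiple of n, but the resulting shift of B is δ r, and r depends on B. The map can be inverted
-- only if r is a function of something visible in the image. The image shows B modulo n, and if the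
-- constant terms of two cubics agree modulo n, their approximate double roots satisfy a cubic
-- congruence that makes them interchangeable at every odd p. At p = 2 the even term in f′(y) -
-- f′(x) = (y - x)(f″(x) + 3(y - x)) costs up to two binary digits of the root, hence four labels.
--
-- Neither c(A) nor ν(Σ_n) is ever computed. The same numbers c(A) bound the count from above and
-- the mass of every clopen neighbourhood of the closure from below, and the comparison loses only
-- constants.
--
-- Real bounds such as 3Y² and 2 min(Y³, √X) have no computable floor. The natural numbers that
-- replace them are maxima over the given finite list of cubics.

-- Divisibility data of approximate double roots at one prime.

module Valuations where

  open import Data.Integer.Base hiding (suc)
  open import Data.Integer.Divisibility.Signed
  open import Data.Integer.Properties using (pos-*; *-comm; *-identityʳ)
  import Data.Integer.Tactic.RingSolver as ℤ-Solver
  open import Data.Nat.Base as ℕ using (ℕ; suc; zero)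
  open import Data.Nat.Primality using (Prime; prime⇒nonZero)
  import Data.Nat.Properties as ℕ
  import Data.Nat.Tactic.RingSolver as ℕ-Solver
  open import Data.Product.Base using (∃₂; _×_; _,_)
  open import Data.Sum.Base using (inj₁; inj₂)
  open import Data.Empty using (⊥-elim)
  open import Relation.Binary.PropositionalEquality hiding ([_]; J)
  open import Relation.Nullary

  -- f(r), f′(r) and f″(r)/2 for f = x³ + t x² + A x + B.
  val : ℤ → ℤ → ℤ → ℤ → ℤ
  val t A B r = r * r * r + t * (r * r) + A * r + B

  der : ℤ → ℤ → ℤ → ℤ
  der t A r = + 3 * (r * r) + + 2 * (t * r) + A

  der₂ : ℤ → ℤ → ℤ
  der₂ t r = + 3 * r + t

  val-shift : ∀ t A B y d →
    val t A B (y - d) ≡ val t A B y - der t A y * d + der₂ t y * (d * d) - d * d * d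
  val-shift = expanded
    where
    expanded : ∀ t A B y d →
      (y - d) * (y - d) * (y - d) + t * ((y - d) * (y - d)) + A * (y - d) + B
      ≡ (y * y * y + t * (y * y) + A * y + B) - (+ 3 * (y * y) + + 2 * (t * y) + A) * d
        + (+ 3 * y + t) * (d * d) - d * d * d
    expanded = ℤ-Solver.solve-∀

  der-shift : ∀ t A y d → der t A (y - d) ≡ der t A y - + 2 * (der₂ t y * d) + + 3 * (d * d)
  der-shift = expanded
    where
    expanded : ∀ t A y d →
      + 3 * ((y - d) * (y - d)) + + 2 * (t * (y - d)) + A
      ≡ (+ 3 * (y * y) + + 2 * (t * y) + A) - + 2 * ((+ 3 * y + t) * d) + + 3 * (d * d)
    expanded = ℤ-Solver.solve-∀

  der₂-shift : ∀ t y d → der₂ t (y - d) ≡ der₂ t y - + 3 * d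
  der₂-shift = expanded
    where
    expanded : ∀ t y d → + 3 * (y - d) + t ≡ (+ 3 * y + t) - + 3 * d
    expanded = ℤ-Solver.solve-∀

  *-mono-∣ : ∀ {i j m n} → i ∣ m → j ∣ n → i * j ∣ m * n
  *-mono-∣ {i} {j} (divides p refl) (divides q refl) = divides (p * q) (swap p i q j)
    where
    swap : ∀ p i q j → (p * i) * (q * j) ≡ (p * q) * (i * j)
    swap = ℤ-Solver.solve-∀

  opaque
    pw : ℕ → ℕ → ℤ
    pw p k = + (p ℕ.^ k)

    pw-def : ∀ p k → pw p k ≡ + (p ℕ.^ k)
    pw-def p k = refl

    pw-nonZero : ∀ {p} → Prime p → ∀ k → NonZero (pw p k)
    pw-nonZero {p} pr k = ℕ.m^n≢0 p k {{prime⇒nonZero pr}}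

    pw-0 : ∀ p → pw p 0 ≡ 1ℤ
    pw-0 p = refl

    pw-+ : ∀ p a b → pw p (a ℕ.+ b) ≡ pw p a * pw p b
    pw-+ p a b = trans (cong +_ (ℕ.^-distribˡ-+-* p a b)) (pos-* (p ℕ.^ a) (p ℕ.^ b))

    pw-suc : ∀ p a → pw p (suc a) ≡ pw p a * + p
    pw-suc p a = trans (pos-* p (p ℕ.^ a)) (*-comm (+ p) (pw p a))

  pw0-∣ : ∀ p z → pw p 0 ∣ z
  pw0-∣ p z = divides z (sym (trans (cong (z *_) (pw-0 p)) (*-identityʳ z)))

  pw-∣ : ∀ p {a b} → a ℕ.≤ b → pw p a ∣ pw p b
  pw-∣ p {a} {b} a≤b = divides (pw p (b ℕ.∸ a))
    (trans (cong (pw p) (sym (ℕ.m∸n+n≡m a≤b))) (pw-+ p (b ℕ.∸ a) a))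

  pw-∣* : ∀ p a b {x y} → pw p a ∣ x → pw p b ∣ y → pw p (a ℕ.+ b) ∣ x * y
  pw-∣* p a b h k = subst (_∣ _) (sym (pw-+ p a b)) (*-mono-∣ h k)

  -- Divisibility data showing that (x - r)/k and (f(x) - f(r))/((x - r)k²m),
  -- with k = p^κ and m = p^μ, are integral modulo f.
  record Data (p κ μ : ℕ) (t A B r : ℤ) : Set where
    constructor mkData
    field
      ∣der₂ : pw p κ ∣ der₂ t r
      ∣der  : pw p (κ ℕ.+ κ ℕ.+ μ) ∣ der t A r
      ∣val  : pw p (κ ℕ.+ κ ℕ.+ κ ℕ.+ (μ ℕ.+ μ)) ∣ val t A B r

  -- Taylor expansion at y: if p^(κ+μ) ∣ d, every correction term has at least the required
  -- exponent, and several have exactly that exponent. So the root of a datum matters only modulo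
  -- p^(κ+μ).
  data-shift : ∀ {p κ μ t A B y} d → pw p (κ ℕ.+ μ) ∣ d → Data p κ μ t A B y → Data p κ μ t A B (y - d)
  data-shift {p} {κ} {μ} {t} {A} {B} {y} d h (mkData h₂ h₁ h₀) = mkData
    (subst (_ ∣_) (sym (der₂-shift t y d)) (∣m∣n⇒∣m-n h₂ (∣n⇒∣m*n (+ 3) (∣-trans (pw-∣ p (ℕ.m≤m+n κ μ)) h))))
    (subst (_ ∣_) (sym (der-shift t A y d))
      (∣m∣n⇒∣m+n (∣m∣n⇒∣m-n h₁ (∣n⇒∣m*n (+ 2)
        (at (κ ℕ.+ (κ ℕ.+ μ)) (ℕ.≤-reflexive (ℕ.+-assoc κ κ μ)) (pw-∣* p κ (κ ℕ.+ μ) h₂ h))))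
        (∣n⇒∣m*n (+ 3) (at (κ ℕ.+ μ ℕ.+ (κ ℕ.+ μ))
          (ℕ.≤-trans (ℕ.m≤m+n _ μ) (ℕ.≤-reflexive (e₁ κ μ))) (pw-∣* p (κ ℕ.+ μ) (κ ℕ.+ μ) h h)))))
    (subst (_ ∣_) (sym (val-shift t A B y d))
      (∣m∣n⇒∣m-n (∣m∣n⇒∣m+n (∣m∣n⇒∣m-n h₀
        (at (κ ℕ.+ κ ℕ.+ μ ℕ.+ (κ ℕ.+ μ)) (ℕ.≤-reflexive (e₂ κ μ)) (pw-∣* p (κ ℕ.+ κ ℕ.+ μ) (κ ℕ.+ μ) h₁ h)))
        (at (κ ℕ.+ (κ ℕ.+ μ ℕ.+ (κ ℕ.+ μ))) (ℕ.≤-reflexive (e₃ κ μ)) (pw-∣* p κ (κ ℕ.+ μ ℕ.+ (κ ℕ.+ μ)) h₂ (pw-∣* p (κ ℕ.+ μ) (κ ℕ.+ μ) h h))))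
        (at (κ ℕ.+ μ ℕ.+ (κ ℕ.+ μ) ℕ.+ (κ ℕ.+ μ)) (ℕ.≤-trans (ℕ.m≤m+n _ μ) (ℕ.≤-reflexive (e₄ κ μ)))
          (pw-∣* p (κ ℕ.+ μ ℕ.+ (κ ℕ.+ μ)) (κ ℕ.+ μ) (pw-∣* p (κ ℕ.+ μ) (κ ℕ.+ μ) h h) h))))
    where
    at : ∀ a {b x} → b ℕ.≤ a → pw p a ∣ x → pw p b ∣ x
    at a le = ∣-trans (pw-∣ p le)
    e₁ : ∀ κ μ → κ ℕ.+ κ ℕ.+ μ ℕ.+ μ ≡ κ ℕ.+ μ ℕ.+ (κ ℕ.+ μ)
    e₁ = ℕ-Solver.solve-∀
    e₂ : ∀ κ μ → κ ℕ.+ κ ℕ.+ κ ℕ.+ (μ ℕ.+ μ) ≡ κ ℕ.+ κ ℕ.+ μ ℕ.+ (κ ℕ.+ μ)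
    e₂ = ℕ-Solver.solve-∀
    e₃ : ∀ κ μ → κ ℕ.+ κ ℕ.+ κ ℕ.+ (μ ℕ.+ μ) ≡ κ ℕ.+ (κ ℕ.+ μ ℕ.+ (κ ℕ.+ μ))
    e₃ = ℕ-Solver.solve-∀
    e₄ : ∀ κ μ → κ ℕ.+ κ ℕ.+ κ ℕ.+ (μ ℕ.+ μ) ℕ.+ μ ≡ κ ℕ.+ μ ℕ.+ (κ ℕ.+ μ) ℕ.+ (κ ℕ.+ μ)
    e₄ = ℕ-Solver.solve-∀

  -- The pair (κ, μ) contributes p^(3κ+μ) to the index, and e is the exponent wanted. If 3κ = e + 1,
  -- the divisibilities of (κ, 0) do not contain those of any pair of weight exactly e, so `over`
  -- admits this pair separately.
  data Shape (e κ μ : ℕ) : Set where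
    exact : e ≡ κ ℕ.+ κ ℕ.+ κ ℕ.+ μ → Shape e κ μ
    over  : suc e ≡ κ ℕ.+ κ ℕ.+ κ → μ ≡ 0 → Shape e κ μ

  Valid : (p e : ℕ) (t A B r : ℤ) → Set
  Valid p e t A B r = ∃₂ λ κ μ → Shape e κ μ × Data p κ μ t A B r

  shape-≤ : ∀ {e κ μ} → Shape e κ μ → e ℕ.≤ κ ℕ.+ κ ℕ.+ κ ℕ.+ μ
  shape-≤ (exact eq) = ℕ.≤-reflexive eq
  shape-≤ {κ = κ} (over eq refl) = ℕ.≤-trans (ℕ.≤-trans (ℕ.n≤1+n _) (ℕ.≤-reflexive eq)) (ℕ.m≤m+n _ 0)

  shape-3κ : ∀ {e κ μ} → Shape e κ μ → κ ℕ.+ κ ℕ.+ κ ℕ.≤ suc e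
  shape-3κ {κ = κ} {μ} (exact refl) = ℕ.≤-trans (ℕ.m≤m+n _ μ) (ℕ.n≤1+n _)
  shape-3κ (over eq _) = ℕ.≤-reflexive (sym eq)

  cancel≤ : ∀ {x y a b c d} → c ≡ x ℕ.+ a → d ≡ y ℕ.+ b → c ℕ.≤ d → y ℕ.≤ x → a ℕ.≤ b
  cancel≤ {x} {y} {a} {b} refl refl le y≤x = ℕ.+-cancelˡ-≤ x a b (ℕ.≤-trans le (ℕ.+-monoˡ-≤ b y≤x))

  -- A shape dominates every pair with enough total weight and no larger κ.
  dominate : ∀ {e κ μ} κ′ μ′ → Shape e κ μ → e ℕ.≤ κ′ ℕ.+ κ′ ℕ.+ κ′ ℕ.+ μ′ → κ′ ℕ.≤ κ →
    κ ℕ.+ κ ℕ.+ μ ℕ.≤ κ′ ℕ.+ κ′ ℕ.+ μ′ ×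
    κ ℕ.+ κ ℕ.+ κ ℕ.+ (μ ℕ.+ μ) ℕ.≤ κ′ ℕ.+ κ′ ℕ.+ κ′ ℕ.+ (μ′ ℕ.+ μ′)
  dominate {κ = κ} {μ} κ′ μ′ (exact refl) le κ′≤κ =
    cancel≤ (f₁ κ μ) (f₁ κ′ μ′) le κ′≤κ ,
    cancel≤ (f₂ κ μ) (f₂ κ′ μ′) (ℕ.+-mono-≤ le le) (ℕ.+-mono-≤ (ℕ.+-mono-≤ κ′≤κ κ′≤κ) κ′≤κ)
    where
    f₁ : ∀ κ μ → κ ℕ.+ κ ℕ.+ κ ℕ.+ μ ≡ κ ℕ.+ (κ ℕ.+ κ ℕ.+ μ)
    f₁ = ℕ-Solver.solve-∀
    f₂ : ∀ κ μ → κ ℕ.+ κ ℕ.+ κ ℕ.+ μ ℕ.+ (κ ℕ.+ κ ℕ.+ κ ℕ.+ μ) ≡ κ ℕ.+ κ ℕ.+ κ ℕ.+ (κ ℕ.+ κ ℕ.+ κ ℕ.+ (μ ℕ.+ μ))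
    f₂ = ℕ-Solver.solve-∀
  dominate {e} {κ} κ′ μ′ (over eq refl) le κ′≤κ with ℕ.m≤n⇒m<n∨m≡n κ′≤κ
  ... | inj₂ refl = ℕ.+-monoʳ-≤ (κ ℕ.+ κ) ℕ.z≤n , ℕ.+-monoʳ-≤ (κ ℕ.+ κ ℕ.+ κ) ℕ.z≤n
  ... | inj₁ κ′<κ =
    cancel≤ (g₁ κ) (g₂ κ′ μ′) (ℕ.≤-trans (ℕ.≤-reflexive (sym eq)) (ℕ.s≤s le)) κ′<κ ,
    ℕ.≤-trans (ℕ.n≤1+n _) (cancel≤ (g₃ κ) (g₄ κ′ μ′)
      (ℕ.s≤s (ℕ.≤-trans (ℕ.≤-reflexive (cong₂ ℕ._+_ (sym eq) (sym eq))) (ℕ.+-mono-≤ (ℕ.s≤s le) (ℕ.s≤s le))))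
      (ℕ.+-mono-≤ (ℕ.+-mono-≤ κ′<κ κ′<κ) κ′<κ))
    where
    g₁ : ∀ κ → κ ℕ.+ κ ℕ.+ κ ≡ κ ℕ.+ (κ ℕ.+ κ ℕ.+ 0)
    g₁ = ℕ-Solver.solve-∀
    g₂ : ∀ κ μ → suc (κ ℕ.+ κ ℕ.+ κ ℕ.+ μ) ≡ suc κ ℕ.+ (κ ℕ.+ κ ℕ.+ μ)
    g₂ = ℕ-Solver.solve-∀
    g₃ : ∀ κ → suc (κ ℕ.+ κ ℕ.+ κ ℕ.+ (κ ℕ.+ κ ℕ.+ κ)) ≡ κ ℕ.+ κ ℕ.+ κ ℕ.+ suc (κ ℕ.+ κ ℕ.+ κ ℕ.+ 0)
    g₃ = ℕ-Solver.solve-∀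
    g₄ : ∀ κ μ → suc (suc (κ ℕ.+ κ ℕ.+ κ ℕ.+ μ) ℕ.+ suc (κ ℕ.+ κ ℕ.+ κ ℕ.+ μ))
      ≡ suc κ ℕ.+ suc κ ℕ.+ suc κ ℕ.+ (κ ℕ.+ κ ℕ.+ κ ℕ.+ (μ ℕ.+ μ))
    g₄ = ℕ-Solver.solve-∀

  data-dominate : ∀ {p e κ μ κ′ μ′ t A B r} → Shape e κ μ → e ℕ.≤ κ′ ℕ.+ κ′ ℕ.+ κ′ ℕ.+ μ′ → κ′ ℕ.≤ κ →
    pw p κ ∣ der₂ t r → Data p κ′ μ′ t A B r → Data p κ μ t A B r
  data-dominate {p} {κ′ = κ′} {μ′} sh le κ′≤κ h₂ (mkData _ h₁ h₀) =
    let le₁ , le₂ = dominate κ′ μ′ sh le κ′≤κ in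
    mkData h₂ (∣-trans (pw-∣ p le₁) h₁) (∣-trans (pw-∣ p le₂) h₀)

  -- The shape with the largest κ, which is e/3 rounded to the nearest integer. The fields `e≤3J`
  -- and `3J≤e+2` say that κ + μ = ⌈e/3⌉.
  record Final (e : ℕ) : Set where
    field
      {κ μ}  : ℕ
      shape  : Shape e κ μ
      e≤1+3κ : e ℕ.≤ suc (κ ℕ.+ κ ℕ.+ κ)
      e≤3J   : e ℕ.≤ (κ ℕ.+ μ) ℕ.+ (κ ℕ.+ μ) ℕ.+ (κ ℕ.+ μ)
      3J≤e+2 : (κ ℕ.+ μ) ℕ.+ (κ ℕ.+ μ) ℕ.+ (κ ℕ.+ μ) ℕ.≤ 2 ℕ.+ e
      μ≤1    : μ ℕ.≤ 1

  data Mod3 : ℕ → Set where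
    r0 : ∀ j → Mod3 (j ℕ.+ j ℕ.+ j)
    r1 : ∀ j → Mod3 (suc (j ℕ.+ j ℕ.+ j))
    r2 : ∀ j → Mod3 (suc (suc (j ℕ.+ j ℕ.+ j)))

  mod3 : ∀ e → Mod3 e
  mod3 zero = r0 0
  mod3 (suc e) with mod3 e
  ... | r0 j = r1 j
  ... | r1 j = r2 j
  ... | r2 j = subst Mod3 (g j) (r0 (suc j))
    where
    g : ∀ j → suc j ℕ.+ suc j ℕ.+ suc j ≡ suc (suc (suc (j ℕ.+ j ℕ.+ j)))
    g = ℕ-Solver.solve-∀

  final : ∀ e → Final e
  final e with mod3 e
  ... | r0 j = record
    { κ = j ; μ = 0 ; shape = exact (sym (ℕ.+-identityʳ _)) ; e≤1+3κ = ℕ.n≤1+n _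
    ; e≤3J = ℕ.≤-reflexive (g j) ; 3J≤e+2 = ℕ.≤-trans (ℕ.≤-reflexive (sym (g j))) (ℕ.m≤n+m _ 2) ; μ≤1 = ℕ.z≤n }
    where
    g : ∀ j → j ℕ.+ j ℕ.+ j ≡ (j ℕ.+ 0) ℕ.+ (j ℕ.+ 0) ℕ.+ (j ℕ.+ 0)
    g = ℕ-Solver.solve-∀
  ... | r1 j = record
    { κ = j ; μ = 1 ; shape = exact (h j) ; e≤1+3κ = ℕ.≤-refl
    ; e≤3J = ℕ.≤-trans (ℕ.m≤n+m _ 2) (ℕ.≤-reflexive (sym (g j))) ; 3J≤e+2 = ℕ.≤-reflexive (g j) ; μ≤1 = ℕ.≤-refl }
    where
    h : ∀ j → suc (j ℕ.+ j ℕ.+ j) ≡ j ℕ.+ j ℕ.+ j ℕ.+ 1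
    h = ℕ-Solver.solve-∀
    g : ∀ j → (j ℕ.+ 1) ℕ.+ (j ℕ.+ 1) ℕ.+ (j ℕ.+ 1) ≡ suc (suc (suc (j ℕ.+ j ℕ.+ j)))
    g = ℕ-Solver.solve-∀
  ... | r2 j = record
    { κ = suc j ; μ = 0 ; shape = over (h j) refl
    ; e≤1+3κ = ℕ.≤-trans (ℕ.m≤n+m _ 2) (ℕ.≤-reflexive (cong suc (h j)))
    ; e≤3J = ℕ.≤-trans (ℕ.n≤1+n _) (ℕ.≤-reflexive (sym (g j)))
    ; 3J≤e+2 = ℕ.≤-trans (ℕ.≤-reflexive (g j)) (ℕ.n≤1+n _) ; μ≤1 = ℕ.z≤n }
    where
    h : ∀ j → suc (suc (suc (j ℕ.+ j ℕ.+ j))) ≡ suc j ℕ.+ suc j ℕ.+ suc j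
    h = ℕ-Solver.solve-∀
    g : ∀ j → (suc j ℕ.+ 0) ℕ.+ (suc j ℕ.+ 0) ℕ.+ (suc j ℕ.+ 0) ≡ suc (suc (suc (j ℕ.+ j ℕ.+ j)))
    g = ℕ-Solver.solve-∀

  triple-cancel-< : ∀ {a b} → a ℕ.+ a ℕ.+ a ℕ.≤ suc (suc (b ℕ.+ b ℕ.+ b)) → a ℕ.≤ b
  triple-cancel-< {a} {b} le with a ℕ.≤? b
  ... | yes a≤b = a≤b
  ... | no a≰b = ⊥-elim (ℕ.<-irrefl refl (ℕ.≤-trans
    (ℕ.≤-reflexive (g b)) (ℕ.≤-trans (ℕ.+-mono-≤ (ℕ.+-mono-≤ b<a b<a) b<a) le)))
    where
    b<a = ℕ.≰⇒> a≰b
    g : ∀ b → suc (suc (suc (b ℕ.+ b ℕ.+ b))) ≡ suc b ℕ.+ suc b ℕ.+ suc b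
    g = ℕ-Solver.solve-∀

  final-κ : ∀ {e κ μ} (F : Final e) → Shape e κ μ → κ ℕ.≤ Final.κ F
  final-κ F sh = triple-cancel-< (ℕ.≤-trans (shape-3κ sh) (ℕ.s≤s (Final.e≤1+3κ F)))

  -- The index may be divisible by more than p^e. If 3κ ≤ e, the excess is taken off μ; otherwise κ
  -- ≥ ⌈e/3⌉, and the data then imply those of the final shape.
  normalise : ∀ {p} e κ μ {t A B r} → e ℕ.≤ κ ℕ.+ κ ℕ.+ κ ℕ.+ μ → Data p κ μ t A B r → Valid p e t A B r
  normalise {p} e κ μ le d@(mkData h₂ h₁ h₀) with κ ℕ.+ κ ℕ.+ κ ℕ.≤? e
  ... | yes 3κ≤e = κ , e ℕ.∸ (κ ℕ.+ κ ℕ.+ κ) , exact (sym (ℕ.m+[n∸m]≡n 3κ≤e)) ,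
    data-dominate (exact (sym (ℕ.m+[n∸m]≡n 3κ≤e))) le ℕ.≤-refl h₂ d
  ... | no 3κ≰e = κ₀ , μ₀ , shape ,
    mkData (∣-trans (pw-∣ p κ₀≤κ) h₂) (∣-trans (pw-∣ p le₁) h₁) (∣-trans (pw-∣ p le₀) h₀)
    where
    open Final (final e) renaming (κ to κ₀; μ to μ₀)
    κ₀+μ₀≤κ : κ₀ ℕ.+ μ₀ ℕ.≤ κ
    κ₀+μ₀≤κ = triple-cancel-< (ℕ.≤-trans 3J≤e+2 (ℕ.s≤s (ℕ.s≤s (ℕ.<⇒≤ (ℕ.≰⇒> 3κ≰e)))))
    κ₀≤κ = ℕ.≤-trans (ℕ.m≤m+n κ₀ μ₀) κ₀+μ₀≤κ
    3κ₀+2μ₀≤3κ : κ₀ ℕ.+ κ₀ ℕ.+ κ₀ ℕ.+ (μ₀ ℕ.+ μ₀) ℕ.≤ κ ℕ.+ κ ℕ.+ κ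
    3κ₀+2μ₀≤3κ = ℕ.≤-trans (ℕ.≤-trans (ℕ.m≤m+n _ μ₀) (ℕ.≤-reflexive (g κ₀ μ₀)))
      (ℕ.+-mono-≤ (ℕ.+-mono-≤ κ₀+μ₀≤κ κ₀+μ₀≤κ) κ₀+μ₀≤κ)
      where
      g : ∀ κ μ → κ ℕ.+ κ ℕ.+ κ ℕ.+ (μ ℕ.+ μ) ℕ.+ μ ≡ (κ ℕ.+ μ) ℕ.+ (κ ℕ.+ μ) ℕ.+ (κ ℕ.+ μ)
      g = ℕ-Solver.solve-∀
    le₀ = ℕ.≤-trans 3κ₀+2μ₀≤3κ (ℕ.m≤m+n _ (μ ℕ.+ μ))
    le₁ : κ₀ ℕ.+ κ₀ ℕ.+ μ₀ ℕ.≤ κ ℕ.+ κ ℕ.+ μ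
    le₁ = ℕ.≤-trans (ℕ.≤-trans (ℕ.≤-reflexive (ℕ.+-assoc κ₀ κ₀ μ₀)) (ℕ.+-mono-≤ κ₀≤κ κ₀+μ₀≤κ)) (ℕ.m≤m+n _ μ)

-- Comparing approximate double roots of cubics that differ only in B.

module CommonRoots where

  open import Data.Integer.Base hiding (suc) renaming (∣_∣ to abs)
  open import Data.Integer.Divisibility.Signed
  open import Data.Integer.Properties using (abs-*)
  import Data.Integer.Tactic.RingSolver as ℤ-Solver
  open import Data.Nat.Base as ℕ using (ℕ; suc; zero)
  import Data.Nat.Divisibility as ℕ∣
  open import Data.Nat.Primality using (Prime; euclidsLemma; prime⇒irreducible)
  import Data.Nat.Properties as ℕ
  import Data.Nat.Tactic.RingSolver as ℕ-Solver
  open import Data.Product.Base using (∃; _×_; _,_)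
  open import Data.Sum.Base using (_⊎_; inj₁; inj₂; [_,_]′)
  open import Data.Empty using (⊥-elim)
  open import Function.Base using (id)
  open import Relation.Binary.PropositionalEquality hiding ([_]; J)
  open import Relation.Nullary
  open Valuations

  prime-∣* : ∀ {p a b} → Prime p → + p ∣ a * b → + p ∣ a ⊎ + p ∣ b
  prime-∣* {a = a} {b} pr h with euclidsLemma (abs a) (abs b) pr (subst (_ ℕ∣.∣_) (abs-* a b) (∣⇒∣ᵤ h))
  ... | inj₁ h′ = inj₁ (∣ᵤ⇒∣ h′)
  ... | inj₂ h′ = inj₂ (∣ᵤ⇒∣ h′)

  pw-cancel : ∀ {p} → Prime p → ∀ k x y → pw p k * x ∣ pw p k * y → x ∣ y
  pw-cancel {p} pr k x y = *-cancelˡ-∣ (pw p k) {x} {y} {{pw-nonZero pr k}}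

  pw-∣-cancel : ∀ {p} → Prime p → ∀ k {d w} → ¬ + p ∣ w → pw p k ∣ d * w → pw p k ∣ d
  pw-∣-cancel pr zero {d} _ _ = pw0-∣ _ d
  pw-∣-cancel {p} pr (suc k) {d} {w} p∤w h =
    step (pw-∣-cancel pr k {d} {w} p∤w (∣-trans (pw-∣ p (ℕ.n≤1+n k)) h))
    where
    g : ∀ q P w → q * P * w ≡ P * (q * w)
    g = ℤ-Solver.solve-∀
    c : ∀ P q → P * q ≡ q * P
    c = ℤ-Solver.solve-∀
    step : pw p k ∣ d → pw p (suc k) ∣ d
    step (divides q refl) = [ (λ p∣q → subst₂ _∣_ (sym (pw-suc p k)) (c (pw p k) q) (*-monoʳ-∣ (pw p k) p∣q))
                            , (λ p∣w → ⊥-elim (p∤w p∣w)) ]′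
      (prime-∣* {a = q} {w} pr (pw-cancel pr k (+ p) (q * w)
        (subst₂ _∣_ (pw-suc p k) (g q (pw p k) w) h)))

  prime-∣-root : ∀ {p} → Prime p → ∀ q x → + p ∣ q * (q * q - x * + p) → + p ∣ q
  prime-∣-root {p} pr q x h = [ id , (λ r → [ id , id ]′ (prime-∣* {p} {q} {q} pr (square r))) ]′
    (prime-∣* {p} {q} {q * q - x * + p} pr h)
    where
    cancel : ∀ q x π → q * q - x * π + x * π ≡ q * q
    cancel = ℤ-Solver.solve-∀
    square : + p ∣ q * q - x * + p → + p ∣ q * q
    square r = subst (+ p ∣_) (cancel q x (+ p)) (∣m∣n⇒∣m+n {+ p} {q * q - x * + p} {x * + p} r (∣n⇒∣m*n x {+ p} ∣-refl))

  -- Induction on J. If d = q p^i and c = x p^(2i+1), the product is p^(3i) q (q² - x p); as 3i + 1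
  -- ≤ e, the prime p divides q. The outcome is p^⌈e/3⌉ ∣ d.
  cube : ∀ {p} → Prime p → ∀ e c d →
    (∀ i → suc (i ℕ.+ i ℕ.+ i) ℕ.≤ e → pw p (suc (i ℕ.+ i)) ∣ c) →
    pw p e ∣ d * (d * d - c) → ∀ J → J ℕ.+ J ℕ.+ J ℕ.≤ 2 ℕ.+ e → pw p J ∣ d
  cube pr e c d hc h zero le = pw0-∣ _ d
  cube {p} pr e c d hc h (suc i) le = step (cube pr e c d hc h i (ℕ.≤-trans (ℕ.≤-trans (ℕ.n≤1+n _) (ℕ.m≤n+m _ 2)) le′)) (hc i 3i+1≤e)
    where
    g : ∀ i → suc (suc (suc (i ℕ.+ i ℕ.+ i))) ≡ suc i ℕ.+ suc i ℕ.+ suc i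
    g = ℕ-Solver.solve-∀
    le′ : suc (suc (suc (i ℕ.+ i ℕ.+ i))) ℕ.≤ 2 ℕ.+ e
    le′ = ℕ.≤-trans (ℕ.≤-reflexive (g i)) le
    3i+1≤e : suc (i ℕ.+ i ℕ.+ i) ℕ.≤ e
    3i+1≤e = ℕ.≤-pred (ℕ.≤-pred le′)
    P = pw p i
    comm : ∀ P q → P * q ≡ q * P
    comm = ℤ-Solver.solve-∀
    factor : ∀ q P x π → q * P * (q * P * (q * P) - x * (P * P * π)) ≡ P * P * P * (q * (q * q - x * π))
    factor = ℤ-Solver.solve-∀
    pw-2 : pw p (suc (i ℕ.+ i)) ≡ P * P * + p
    pw-2 = trans (pw-suc p (i ℕ.+ i)) (cong (_* + p) (pw-+ p i i))
    pw-3 : pw p (i ℕ.+ i ℕ.+ i) ≡ P * P * P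
    pw-3 = trans (pw-+ p (i ℕ.+ i) i) (cong (_* P) (pw-+ p i i))
    step : pw p i ∣ d → pw p (suc (i ℕ.+ i)) ∣ c → pw p (suc i) ∣ d
    step (divides q d≡) (divides x c≡) =
      subst₂ _∣_ (sym (pw-suc p i)) (trans (comm P q) (sym d≡)) (*-monoʳ-∣ P p∣q)
      where
      w = q * q - x * + p
      h≡ : d * (d * d - c) ≡ pw p (i ℕ.+ i ℕ.+ i) * (q * w)
      h≡ = trans (cong₂ (λ d c → d * (d * d - c)) d≡ (trans c≡ (cong (x *_) pw-2)))
        (trans (factor q P x (+ p)) (cong (_* (q * w)) (sym pw-3)))
      h′ : pw p (i ℕ.+ i ℕ.+ i) * + p ∣ pw p (i ℕ.+ i ℕ.+ i) * (q * w)
      h′ = subst₂ _∣_ (pw-suc p (i ℕ.+ i ℕ.+ i)) h≡ (∣-trans (pw-∣ p 3i+1≤e) h)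
      p∣q : + p ∣ q
      p∣q = prime-∣-root pr q x (pw-cancel pr (i ℕ.+ i ℕ.+ i) (+ p) (q * w) h′)

  max-pw : ∀ p J z → pw p J ∣ z ⊎ ∃ λ κ → κ ℕ.< J × pw p κ ∣ z × ¬ pw p (suc κ) ∣ z
  max-pw p zero z = inj₁ (pw0-∣ p z)
  max-pw p (suc J) z with max-pw p J z
  ... | inj₂ (κ , κ<J , h) = inj₂ (κ , ℕ.m<n⇒m<1+n κ<J , h)
  ... | inj₁ h with pw p (suc J) ∣? z
  ...   | yes h′ = inj₁ h′
  ...   | no ¬h = inj₂ (J , ℕ.≤-refl , h , ¬h)

  -- Supplies the hypothesis of `cube` for a sum of two derivatives. For κ ≤ i the exponent 2κ + μ
  -- is at least e - κ; for κ > i the term 2κ alone suffices.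
  shape-cube : ∀ {e κ μ} → Shape e κ μ → ∀ i → suc (i ℕ.+ i ℕ.+ i) ℕ.≤ e → suc (i ℕ.+ i) ℕ.≤ κ ℕ.+ κ ℕ.+ μ
  shape-cube {κ = κ} {μ} sh i le with κ ℕ.≤? i
  ... | yes κ≤i = cancel≤ (g i) (f κ μ) (ℕ.≤-trans le (shape-≤ sh)) κ≤i
    where
    f : ∀ κ μ → κ ℕ.+ κ ℕ.+ κ ℕ.+ μ ≡ κ ℕ.+ (κ ℕ.+ κ ℕ.+ μ)
    f = ℕ-Solver.solve-∀
    g : ∀ i → suc (i ℕ.+ i ℕ.+ i) ≡ i ℕ.+ suc (i ℕ.+ i)
    g = ℕ-Solver.solve-∀
  ... | no κ≰i = ℕ.≤-trans (ℕ.+-mono-≤ i<κ (ℕ.<⇒≤ i<κ)) (ℕ.m≤m+n _ μ)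
    where i<κ = ℕ.≰⇒> κ≰i

  shape-val : ∀ {e κ μ} → Shape e κ μ → e ℕ.≤ κ ℕ.+ κ ℕ.+ κ ℕ.+ (μ ℕ.+ μ)
  shape-val {κ = κ} {μ} sh = ℕ.≤-trans (shape-≤ sh) (ℕ.+-monoʳ-≤ (κ ℕ.+ κ ℕ.+ κ) (ℕ.m≤m+n μ μ))

  der-diff : ∀ t A x y → der t A y - der t A x ≡ (y - x) * (+ 2 * der₂ t x + + 3 * (y - x))
  der-diff = expanded
    where
    expanded : ∀ t A x y → (+ 3 * (y * y) + + 2 * (t * y) + A) - (+ 3 * (x * x) + + 2 * (t * x) + A)
      ≡ (y - x) * (+ 2 * (+ 3 * x + t) + + 3 * (y - x))
    expanded = ℤ-Solver.solve-∀

  -- Two approximate double roots x, y satisfy a cubic congruence in y - x.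
  val-diff : ∀ t A B₁ B₂ x y →
    (y - x) * ((y - x) * (y - x) - (der t A x + der t A y))
    ≡ - (+ 2 * (val t A B₂ y - val t A B₁ x - (B₂ - B₁)))
  val-diff = expanded
    where
    expanded : ∀ t A B₁ B₂ x y →
      (y - x) * ((y - x) * (y - x) - ((+ 3 * (x * x) + + 2 * (t * x) + A) + (+ 3 * (y * y) + + 2 * (t * y) + A)))
      ≡ - (+ 2 * ((y * y * y + t * (y * y) + A * y + B₂) - (x * x * x + t * (x * x) + A * x + B₁) - (B₂ - B₁)))
    expanded = ℤ-Solver.solve-∀

  -- The step of the comparison in which odd primes and 2 differ: κ is the exact exponent of
  -- f″(x)/2, the cubic congruence has given a weak bound on y - x, and the precision κ + μ is asked
  -- for.
  Linked : (p e : ℕ) (t A x y : ℤ) → Set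
  Linked p e t A x y = ∀ κ μ → e ≡ κ ℕ.+ κ ℕ.+ κ ℕ.+ μ → pw p κ ∣ der₂ t x → ¬ pw p (suc κ) ∣ der₂ t x →
    pw p (suc κ) ∣ y - x → pw p (κ ℕ.+ κ ℕ.+ μ) ∣ der t A y - der t A x →
    (∀ J → J ℕ.+ J ℕ.+ J ℕ.≤ 2 ℕ.+ e → pw p J ∣ y - x) → pw p (κ ℕ.+ μ) ∣ y - x

  -- The difference d = y - x solves d(d² - c) ≡ 0 modulo p^e with c = f′(x) + f′(y), so p^⌈e/3⌉ ∣ d
  -- by `cube`. If f″(x)/2 is divisible by that power as well, the final shape holds at y and may be
  -- shifted to x. Otherwise the exact exponent of f″(x)/2 dictates the shape, and `Linked` gives
  -- the precision needed for the shift.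
  common-root : ∀ {p e t A B₁ B₂ x y} → Prime p → pw p e ∣ B₂ - B₁ → Linked p e t A x y →
    Valid p e t A B₁ x → Valid p e t A B₂ y → Valid p e t A B₂ x
  common-root {p} {e} {t} {A} {B₁} {B₂} {x} {y} pr hB link (κ₁ , μ₁ , sh₁ , D₁) (κ₂ , μ₂ , sh₂ , D₂)
    with max-pw p (Final.κ F ℕ.+ Final.μ F) (der₂ t x)
    where F = final e
  ... | inj₁ pJ∣ = κ , μ , shape , subst (Data p κ μ t A B₂) (g x y) (data-shift {A = A} (y - x) (pJ∣d _ 3J≤e+2) Dy)
    where
    open Final (final e)
    g : ∀ x y → y - (y - x) ≡ x
    g = ℤ-Solver.solve-∀
    pJ∣d : ∀ J → J ℕ.+ J ℕ.+ J ℕ.≤ 2 ℕ.+ e → pw p J ∣ y - x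
    pJ∣d = cube pr e (der t A x + der t A y) (y - x)
      (λ i le → ∣m∣n⇒∣m+n (∣-trans (pw-∣ p (shape-cube sh₁ i le)) (Data.∣der D₁))
                          (∣-trans (pw-∣ p (shape-cube sh₂ i le)) (Data.∣der D₂)))
      (subst (_ ∣_) (sym (val-diff t A B₁ B₂ x y)) (∣m⇒∣-m (∣n⇒∣m*n (+ 2)
        (∣m∣n⇒∣m-n (∣m∣n⇒∣m-n (∣-trans (pw-∣ p (shape-val sh₂)) (Data.∣val D₂))
                              (∣-trans (pw-∣ p (shape-val sh₁)) (Data.∣val D₁))) hB))))
    der₂-y : ∀ t x y → (+ 3 * x + t) + + 3 * (y - x) ≡ + 3 * y + t
    der₂-y = ℤ-Solver.solve-∀
    pκ≤ = pw-∣ p (ℕ.m≤m+n κ μ)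
    Dy : Data p κ μ t A B₂ y
    Dy = data-dominate shape (shape-≤ sh₂) (final-κ (final e) sh₂)
      (subst (_ ∣_) (der₂-y t x y) (∣m∣n⇒∣m+n (∣-trans pκ≤ pJ∣) (∣n⇒∣m*n (+ 3) (∣-trans pκ≤ (pJ∣d _ 3J≤e+2))))) D₂
  ... | inj₂ (κ , κ<J , pκ∣ , pκ+1∤) = κ , μ , sh , subst (Data p κ μ t A B₂) (g x y) (data-shift {A = A} (y - x) pκμ∣d Dy)
    where
    module F = Final (final e)
    J = F.κ ℕ.+ F.μ
    g : ∀ x y → y - (y - x) ≡ x
    g = ℤ-Solver.solve-∀
    pJ∣d : ∀ J → J ℕ.+ J ℕ.+ J ℕ.≤ 2 ℕ.+ e → pw p J ∣ y - x
    pJ∣d = cube pr e (der t A x + der t A y) (y - x)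
      (λ i le → ∣m∣n⇒∣m+n (∣-trans (pw-∣ p (shape-cube sh₁ i le)) (Data.∣der D₁))
                          (∣-trans (pw-∣ p (shape-cube sh₂ i le)) (Data.∣der D₂)))
      (subst (_ ∣_) (sym (val-diff t A B₁ B₂ x y)) (∣m⇒∣-m (∣n⇒∣m*n (+ 2)
        (∣m∣n⇒∣m-n (∣m∣n⇒∣m-n (∣-trans (pw-∣ p (shape-val sh₂)) (Data.∣val D₂))
                              (∣-trans (pw-∣ p (shape-val sh₁)) (Data.∣val D₁))) hB))))
    κ+1≤ : suc κ ℕ.+ suc κ ℕ.+ suc κ ℕ.≤ 2 ℕ.+ e
    κ+1≤ = ℕ.≤-trans (ℕ.+-mono-≤ (ℕ.+-mono-≤ κ<J κ<J) κ<J) F.3J≤e+2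
    3κ≤e : κ ℕ.+ κ ℕ.+ κ ℕ.≤ e
    3κ≤e = ℕ.≤-trans (ℕ.n≤1+n _) (ℕ.≤-pred (ℕ.≤-pred (ℕ.≤-trans (ℕ.≤-reflexive (s κ)) κ+1≤)))
      where
      s : ∀ κ → suc (suc (suc (κ ℕ.+ κ ℕ.+ κ))) ≡ suc κ ℕ.+ suc κ ℕ.+ suc κ
      s = ℕ-Solver.solve-∀
    μ = e ℕ.∸ (κ ℕ.+ κ ℕ.+ κ)
    e≡ : e ≡ κ ℕ.+ κ ℕ.+ κ ℕ.+ μ
    e≡ = sym (ℕ.m+[n∸m]≡n 3κ≤e)
    sh : Shape e κ μ
    sh = exact e≡
    -- Consequently f″/2 has the same exact exponent κ at x and at y, and neither given datum can
    -- have a larger one.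
    pκ+1∣d = pJ∣d _ κ+1≤
    der₂-y : ∀ t x y → (+ 3 * x + t) + + 3 * (y - x) ≡ + 3 * y + t
    der₂-y = ℤ-Solver.solve-∀
    der₂-x : ∀ t x y → (+ 3 * y + t) - + 3 * (y - x) ≡ + 3 * x + t
    der₂-x = ℤ-Solver.solve-∀
    κ₁≤κ : κ₁ ℕ.≤ κ
    κ₁≤κ with κ₁ ℕ.≤? κ
    ... | yes le = le
    ... | no ¬le = ⊥-elim (pκ+1∤ (∣-trans (pw-∣ p (ℕ.≰⇒> ¬le)) (Data.∣der₂ D₁)))
    κ₂≤κ : κ₂ ℕ.≤ κ
    κ₂≤κ with κ₂ ℕ.≤? κ
    ... | yes le = le
    ... | no ¬le = ⊥-elim (pκ+1∤ (subst (_ ∣_) (der₂-x t x y)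
          (∣m∣n⇒∣m-n (∣-trans (pw-∣ p (ℕ.≰⇒> ¬le)) (Data.∣der₂ D₂)) (∣n⇒∣m*n (+ 3) pκ+1∣d))))
    Dx : Data p κ μ t A B₁ x
    Dx = data-dominate sh (shape-≤ sh₁) κ₁≤κ pκ∣ D₁
    Dy : Data p κ μ t A B₂ y
    Dy = data-dominate sh (shape-≤ sh₂) κ₂≤κ
      (subst (_ ∣_) (der₂-y t x y) (∣m∣n⇒∣m+n pκ∣ (∣n⇒∣m*n (+ 3) (∣-trans (pw-∣ p (ℕ.n≤1+n κ)) pκ+1∣d)))) D₂
    pκμ∣d : pw p (κ ℕ.+ μ) ∣ y - x
    pκμ∣d = link κ μ e≡ pκ∣ pκ+1∤ pκ+1∣d (∣m∣n⇒∣m-n (Data.∣der Dy) (Data.∣der Dx)) pJ∣d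

  -- In f′(y) - f′(x) = (y - x)(f″(x) + 3(y - x)) the second factor has exact exponent κ, because p
  -- ∤ 2 and p^(κ+1) ∣ y - x.
  linked-odd : ∀ {p} → Prime p → p ≢ 2 → ∀ e t A x y → Linked p e t A x y
  linked-odd {p} pr p≢2 e t A x y κ μ e≡ (divides u u≡) ¬h (divides d d≡) hder _ =
    pw-∣-cancel pr (κ ℕ.+ μ) p∤w (pw-cancel pr κ (pw p (κ ℕ.+ μ)) ((y - x) * (+ 2 * u + + 3 * d * + p)) (subst₂ _∣_
      (trans (cong (pw p) (ℕ.+-assoc κ κ μ)) (pw-+ p κ (κ ℕ.+ μ)))
      (trans (der-diff t A x y) (trans (cong₂ (λ a b → (y - x) * (+ 2 * a + + 3 * b)) u≡ (trans d≡ (cong (d *_) (pw-suc p κ))))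
        (g (y - x) u (pw p κ) d (+ p)))) hder))
    where
    g : ∀ z u P d π → z * (+ 2 * (u * P) + + 3 * (d * (P * π))) ≡ P * (z * (+ 2 * u + + 3 * d * π))
    g = ℤ-Solver.solve-∀
    p∤2 : ¬ + p ∣ + 2
    p∤2 h with prime⇒irreducible prime[2] (∣⇒∣ᵤ h)
      where open import Data.Nat.Primality using (prime[2])
    ... | inj₁ refl = ⊥-elim (¬prime[1] pr)
      where open import Data.Nat.Primality using (¬prime[1])
    ... | inj₂ eq = p≢2 eq
    p∤u : ¬ + p ∣ u
    p∤u h = ¬h (subst₂ _∣_ (sym (pw-suc p κ)) (trans (c (pw p κ) u) (sym u≡)) (*-monoʳ-∣ (pw p κ) h))
      where
      c : ∀ P u → P * u ≡ u * P
      c = ℤ-Solver.solve-∀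
    p∤w : ¬ + p ∣ + 2 * u + + 3 * d * + p
    p∤w h = [ p∤2 , p∤u ]′ (prime-∣* {p} {+ 2} {u} pr (∣m+n∣n⇒∣m {+ p} {+ 2 * u} {+ 3 * d * + p} h (∣n⇒∣m*n (+ 3 * d) {+ p} ∣-refl)))

  -- Here f″(x) has exponent κ + 1, and 3(y - x) may interfere with it. For μ ≤ 3 the known 2^(κ+1)
  -- ∣ y - x already reaches κ + μ - 2. For μ ≥ 4 the cubic congruence gives 2^(κ+2) ∣ y - x, and
  -- then the factorisation loses a single digit. The last two digits are left to `strengthen`.
  linked-two : ∀ e t A x y →
    (∀ κ μ → e ≡ κ ℕ.+ κ ℕ.+ κ ℕ.+ μ → pw 2 κ ∣ der₂ t x → ¬ pw 2 (suc κ) ∣ der₂ t x → pw 2 (suc κ) ∣ y - x →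
      pw 2 (κ ℕ.+ μ ℕ.∸ 2) ∣ y - x → pw 2 (κ ℕ.+ μ) ∣ y - x) → Linked 2 e t A x y
  linked-two e t A x y strengthen κ μ e≡ (divides u u≡) ¬h hd hder cb =
    strengthen κ μ e≡ (divides u u≡) ¬h hd goal
    where
    open import Data.Integer.Properties using (*-comm)
    open import Data.Nat.Primality using (prime[2])
    halve : ∀ k z → pw 2 k ∣ + 2 * z → pw 2 (k ℕ.∸ 1) ∣ z
    halve zero z _ = pw0-∣ 2 z
    halve (suc k) z h = *-cancelˡ-∣ (+ 2) {pw 2 k} {z} (subst (_∣ + 2 * z) (trans (pw-suc 2 k) (*-comm (pw 2 k) (+ 2))) h)
    P = pw 2 κ
    g : ∀ z u P d → z * (+ 2 * (u * P) + + 3 * (d * (P * + 2 * + 2))) ≡ P * (+ 2 * z * (u + + 3 * d * + 2))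
    g = ℤ-Solver.solve-∀
    c : ∀ P u → P * u ≡ u * P
    c = ℤ-Solver.solve-∀
    large : pw 2 (suc (suc κ)) ∣ y - x → pw 2 (κ ℕ.+ μ ℕ.∸ 2) ∣ y - x
    large (divides d d≡) = ∣-trans (pw-∣ 2 (ℕ.∸-monoʳ-≤ (κ ℕ.+ μ) (ℕ.s≤s ℕ.z≤n))) (halve (κ ℕ.+ μ) (y - x) twice)
      where
      w = u + + 3 * d * + 2
      odd : ¬ + 2 ∣ w
      odd h = ¬h (subst₂ _∣_ (sym (pw-suc 2 κ)) (trans (c P u) (sym u≡))
          (*-monoʳ-∣ P (∣m+n∣n⇒∣m {+ 2} {u} {+ 3 * d * + 2} h (∣n⇒∣m*n (+ 3 * d) {+ 2} (∣-refl {+ 2})))))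
      d≡′ : y - x ≡ d * (P * + 2 * + 2)
      d≡′ = trans d≡ (cong (d *_) (trans (pw-suc 2 (suc κ)) (cong (_* + 2) (pw-suc 2 κ))))
      factored : der t A y - der t A x ≡ P * (+ 2 * (y - x) * w)
      factored = trans (der-diff t A x y)
        (trans (cong₂ (λ a b → (y - x) * (+ 2 * a + + 3 * b)) u≡ d≡′) (g (y - x) u P d))
      twice : pw 2 (κ ℕ.+ μ) ∣ + 2 * (y - x)
      twice = pw-∣-cancel prime[2] (κ ℕ.+ μ) {+ 2 * (y - x)} {w} odd (pw-cancel prime[2] κ (pw 2 (κ ℕ.+ μ)) (+ 2 * (y - x) * w)
        (subst₂ _∣_ (trans (cong (pw 2) (ℕ.+-assoc κ κ μ)) (pw-+ 2 κ (κ ℕ.+ μ))) factored hder))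
    s : ∀ κ → suc (suc κ) ℕ.+ suc (suc κ) ℕ.+ suc (suc κ) ≡ suc (suc (κ ℕ.+ κ ℕ.+ κ ℕ.+ 4))
    s = ℕ-Solver.solve-∀
    goal : pw 2 (κ ℕ.+ μ ℕ.∸ 2) ∣ y - x
    goal with μ ℕ.≤? 3
    ... | yes μ≤3 = ∣-trans (pw-∣ 2 (ℕ.≤-trans (ℕ.∸-monoˡ-≤ 2 (ℕ.+-monoʳ-≤ κ μ≤3))
            (ℕ.≤-reflexive (cong (ℕ._∸ 2) (ℕ.+-comm κ 3))))) hd
    ... | no μ≰3 = large (cb (suc (suc κ)) (ℕ.≤-trans (ℕ.≤-reflexive (s κ))
                       (ℕ.≤-trans (ℕ.+-monoʳ-≤ 2 (ℕ.+-monoʳ-≤ (κ ℕ.+ κ ℕ.+ κ) (ℕ.≰⇒> μ≰3)))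
                         (ℕ.≤-reflexive (cong (2 ℕ.+_) (sym e≡))))))

-- Residues, valuations of integers, and the labels at 2.

module Residues where

  open import Data.Integer.Base hiding (suc) renaming (∣_∣ to abs)
  open import Data.Integer.Divisibility.Signed
  open import Data.Integer.Properties using (pos-*)
  import Data.Integer.Tactic.RingSolver as ℤ-Solver
  open import Data.Nat.Base as ℕ using (ℕ; suc; zero)
  import Data.Nat.Divisibility as ℕ∣
  open import Data.Nat.Primality using (Prime)
  import Data.Nat.Properties as ℕ
  import Data.Nat.Tactic.RingSolver as ℕ-Solver
  open import Data.Product.Base using (∃; _×_; _,_)
  open import Data.Sum.Base using (inj₁; inj₂)
  open import Data.Empty using (⊥; ⊥-elim)
  open import Relation.Binary.PropositionalEquality hiding ([_]; J)
  open import Relation.Nullary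
  open import Data.Integer.DivMod using (_%ℕ_; _/ℕ_; a≡a%ℕn+[a/ℕn]*n)
  import Data.Integer.Properties as ℤ
  open import Data.List.Base using ([]; _∷_)
  open import Data.List.Relation.Unary.All using ([]; _∷_)
  open import Data.Nat.DivMod using (m∣n⇒o%n%m≡o%m; m<n*o⇒m/o<n; m%n<n; m%n%n≡m%n; m≡m%n+[m/n]*n)
  open import Data.Nat.GCD using (gcd; gcd[m,n]∣m; gcd[m,n]∣n; gcd-greatest; gcd[m,n]≢0)
  open import Data.Nat.ListAction using (product)
  open import Data.Nat.Primality using (prime⇒nonTrivial)
  open import Data.Nat.Primality.Factorisation using (factorise)
  open import Relation.Binary.Definitions using (tri<; tri≈; tri>)
  open Valuations
  open CommonRoots

  %ℕ-∣ : ∀ z n .{{_ : ℕ.NonZero n}} → + n ∣ z - + (z %ℕ n)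
  %ℕ-∣ z n = divides (z /ℕ n) (trans (cong (_- + (z %ℕ n)) (a≡a%ℕn+[a/ℕn]*n z n)) (g (+ (z %ℕ n)) (z /ℕ n * + n)))
    where
    g : ∀ a b → (a + b) - a ≡ b
    g = ℤ-Solver.solve-∀

  ∣-<⇒≡ : ∀ {n a b} → a ℕ.< n → b ℕ.< n → + n ∣ + a - + b → a ≡ b
  ∣-<⇒≡ {n} {a} {b} a<n b<n h with ℕ.<-cmp a b
  ... | tri≈ _ eq _ = eq
  ... | tri< a<b _ _ = ⊥-elim (ℕ.<-irrefl refl (ℕ.<-≤-trans b<n (ℕ.≤-trans (ℕ∣.∣⇒≤ {{ℕ.>-nonZero (ℕ.m<n⇒0<n∸m a<b)}} n∣) (ℕ.m∸n≤m b a))))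
    where
    n∣ : n ℕ∣.∣ b ℕ.∸ a
    n∣ = subst (n ℕ∣.∣_) (trans (cong abs (trans (ℤ.m-n≡m⊖n a b) (ℤ.⊖-< a<b))) (ℤ.∣-i∣≡∣i∣ (+ (b ℕ.∸ a)))) (∣⇒∣ᵤ h)
  ... | tri> _ _ b<a = ⊥-elim (ℕ.<-irrefl refl (ℕ.<-≤-trans a<n (ℕ.≤-trans (ℕ∣.∣⇒≤ {{ℕ.>-nonZero (ℕ.m<n⇒0<n∸m b<a)}} n∣) (ℕ.m∸n≤m a b))))
    where
    n∣ : n ℕ∣.∣ a ℕ.∸ b
    n∣ = subst (n ℕ∣.∣_) (cong abs (trans (ℤ.m-n≡m⊖n a b) (ℤ.⊖-≥ (ℕ.<⇒≤ b<a)))) (∣⇒∣ᵤ h)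

  %≡⇒∣ : ∀ n a b .{{_ : ℕ.NonZero n}} → a ℕ.% n ≡ b ℕ.% n → + n ∣ + a - + b
  %≡⇒∣ n a b eq = divides (+ (a ℕ./ n) - + (b ℕ./ n))
    (trans (cong₂ _-_ (split a) (trans (split b) (cong (λ r → + r + + (b ℕ./ n) * + n) (sym eq))))
      (g (+ (a ℕ.% n)) (+ (a ℕ./ n)) (+ (b ℕ./ n)) (+ n)))
    where
    split : ∀ a → + a ≡ + (a ℕ.% n) + + (a ℕ./ n) * + n
    split a = trans (cong +_ (m≡m%n+[m/n]*n a n))
      (trans (ℤ.pos-+ (a ℕ.% n) _) (cong (λ z → + (a ℕ.% n) + z) (pos-* (a ℕ./ n) n)))
    g : ∀ r p q n → (r + p * n) - (r + q * n) ≡ (p - q) * n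
    g = ℤ-Solver.solve-∀

  ∣⇒%≡ : ∀ n a b .{{_ : ℕ.NonZero n}} → + n ∣ + a - + b → a ℕ.% n ≡ b ℕ.% n
  ∣⇒%≡ n a b h = ∣-<⇒≡ (m%n<n a n) (m%n<n b n)
    (subst (+ n ∣_) (g (+ a) (+ b) (+ (a ℕ.% n)) (+ (b ℕ.% n)))
      (∣m∣n⇒∣m+n (∣m∣n⇒∣m-n h (%-∣ a)) (%-∣ b)))
    where
    g : ∀ a b c d → (a - b) - (a - c) + (b - d) ≡ c - d
    g = ℤ-Solver.solve-∀
    %-∣ : ∀ a → + n ∣ + a - + (a ℕ.% n)
    %-∣ a = %≡⇒∣ n a (a ℕ.% n) (sym (m%n%n≡m%n a n))

  vmax : ℕ → ℕ → ℕ → ℕ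
  vmax p n zero = 0
  vmax p n (suc J) with pw p (suc J) ∣? + n
  ... | yes _ = suc J
  ... | no _ = vmax p n J

  vmax-∣ : ∀ p n J → pw p (vmax p n J) ∣ + n
  vmax-∣ p n zero = pw0-∣ p (+ n)
  vmax-∣ p n (suc J) with pw p (suc J) ∣? + n
  ... | yes h = h
  ... | no _ = vmax-∣ p n J

  vmax-∤ : ∀ p n J k → k ℕ.≤ J → pw p k ∣ + n → k ℕ.≤ vmax p n J
  vmax-∤ p n zero k k≤0 h = k≤0
  vmax-∤ p n (suc J) k k≤ h with pw p (suc J) ∣? + n
  ... | yes _ = k≤
  ... | no ¬h with ℕ.m≤n⇒m<n∨m≡n k≤
  ...   | inj₁ k< = vmax-∤ p n J k (ℕ.≤-pred k<) h
  ...   | inj₂ refl = ⊥-elim (¬h h)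

  -- The search may stop at the exponent n because p^k > k for a prime p.
  v : ℕ → ℕ → ℕ
  v p n = vmax p n n

  v-∣ : ∀ p n → pw p (v p n) ∣ + n
  v-∣ p n = vmax-∣ p n n

  m<p^m : ∀ {p} m → 2 ℕ.≤ p → m ℕ.< p ℕ.^ m
  m<p^m zero 2≤p = ℕ.s≤s ℕ.z≤n
  m<p^m {p} (suc m) 2≤p = ℕ.≤-trans (ℕ.s≤s ih) (ℕ.≤-trans (ℕ.+-monoˡ-≤ _ (ℕ.≤-trans (ℕ.s≤s ℕ.z≤n) ih))
      (ℕ.≤-trans (ℕ.≤-reflexive (cong (p ℕ.^ m ℕ.+_) (sym (ℕ.+-identityʳ _)))) (ℕ.*-monoˡ-≤ (p ℕ.^ m) 2≤p)))
    where ih = m<p^m {p} m 2≤p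

  2≤prime : ∀ {p} → Prime p → 2 ℕ.≤ p
  2≤prime pr = ℕ.nonTrivial⇒n>1 _ {{prime⇒nonTrivial pr}}

  v-max : ∀ {p} → Prime p → ∀ n .{{_ : ℕ.NonZero n}} k → pw p k ∣ + n → k ℕ.≤ v p n
  v-max {p} pr n k h = vmax-∤ p n n k (ℕ.<⇒≤ (ℕ.<-≤-trans (m<p^m k (2≤prime pr))
    (ℕ∣.∣⇒≤ (∣⇒∣ᵤ (subst (_∣ + n) (pw-def p k) h))))) h

  prime-divisor : ∀ n → n ≢ 0 → n ≢ 1 → ∃ λ p → Prime p × p ℕ∣.∣ n
  prime-divisor n n≢0 n≢1 with factorise n {{ℕ.≢-nonZero n≢0}}
  ... | record { factors = []     ; isFactorisation = eq } = ⊥-elim (n≢1 eq)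
  ... | record { factors = p ∷ ps ; isFactorisation = eq ; factorsPrime = pr ∷ _ } =
    p , pr , ℕ∣.divides (product ps) (trans eq (ℕ.*-comm p (product ps)))

  -- If n / gcd(n, k) is not 1, take a prime p dividing it. Then p does not divide k / gcd(n, k), so
  -- the full power of p in n divides the gcd, and n would contain one factor p more.
  valuations⇒∣ : ∀ n .{{_ : ℕ.NonZero n}} k → (∀ p → Prime p → pw p (v p n) ∣ + k) → n ℕ∣.∣ k
  valuations⇒∣ n k h = cofactors (gcd[m,n]∣m n k) (gcd[m,n]∣n n k)
    where
    g = gcd n k
    g≢0 : g ≢ 0
    g≢0 = gcd[m,n]≢0 n k (inj₁ (ℕ.≢-nonZero⁻¹ n))
    cofactors : g ℕ∣.∣ n → g ℕ∣.∣ k → n ℕ∣.∣ k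
    cofactors (ℕ∣.divides a n≡) (ℕ∣.divides b k≡) with a ℕ.≟ 1 | a ℕ.≟ 0
    ... | yes a≡1 | _ = subst (ℕ∣._∣ k) (sym (trans n≡ (trans (cong (ℕ._* g) a≡1) (ℕ.*-identityˡ g)))) (gcd[m,n]∣n n k)
    ... | no _ | yes a≡0 = ⊥-elim (ℕ.≢-nonZero⁻¹ n (trans n≡ (cong (ℕ._* g) a≡0)))
    ... | no a≢1 | no a≢0 = ⊥-elim (absurd (prime-divisor a a≢0 a≢1))
      where
      absurd : (∃ λ p → Prime p × p ℕ∣.∣ a) → ⊥
      absurd (p , pr , ℕ∣.divides a′ a≡) = ℕ.<-irrefl refl (v-max pr n (suc e) pe+1∣n)
        where
        e = v p n
        p∤b : ¬ + p ∣ + b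
        p∤b p∣b = ℕ.<-irrefl refl (ℕ.<-≤-trans (ℕ.m<m*n g p {{ℕ.≢-nonZero g≢0}} (2≤prime pr))
            (ℕ∣.∣⇒≤ {{ℕ.≢-nonZero g≢0}} (gcd-greatest
              (subst₂ ℕ∣._∣_ (ℕ.*-comm p g) (sym n≡) (ℕ∣.*-monoˡ-∣ g (ℕ∣.divides a′ a≡)))
              (subst₂ ℕ∣._∣_ (ℕ.*-comm p g) (sym k≡) (ℕ∣.*-monoˡ-∣ g (∣⇒∣ᵤ p∣b))))))
        pe∣g : pw p e ∣ + g
        pe∣g = pw-∣-cancel pr e {+ g} {+ b} p∤b
          (subst (pw p e ∣_) (trans (cong +_ (trans k≡ (ℕ.*-comm b g))) (pos-* g b)) (h p pr))
        pe+1∣n : pw p (suc e) ∣ + n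
        pe+1∣n = subst₂ _∣_ (sym (pw-suc p e)) (sym (trans (cong +_ (trans n≡ (ℕ.*-comm a g))) (pos-* g a)))
          (*-mono-∣ {pw p e} {+ p} {+ g} {+ a} pe∣g (∣ᵤ⇒∣ (ℕ∣.divides a′ a≡)))

  -- Labels separating the approximate double roots modulo powers of 2

  kap : ℕ → ℤ → ℤ → ℕ
  kap e t x with max-pw 2 (Final.κ (final e) ℕ.+ Final.μ (final e)) (der₂ t x)
  -- Default value: in this case the final shape settles the comparison of roots.
  ... | inj₁ _ = 0
  ... | inj₂ (κ , _) = κ

  -- A positive second exponent puts κ strictly below ⌈e/3⌉, where `max-pw` detects it.
  kap-≡ : ∀ e t x κ μ → e ≡ κ ℕ.+ κ ℕ.+ κ ℕ.+ suc μ → pw 2 κ ∣ der₂ t x → ¬ pw 2 (suc κ) ∣ der₂ t x → kap e t x ≡ κ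
  kap-≡ e t x κ μ e≡ h ¬h with max-pw 2 (Final.κ (final e) ℕ.+ Final.μ (final e)) (der₂ t x)
  ... | inj₁ hJ = ⊥-elim (¬h (∣-trans (pw-∣ 2 κ<J) hJ))
    where
    κ<J : suc κ ℕ.≤ Final.κ (final e) ℕ.+ Final.μ (final e)
    κ<J = triple-cancel-< (ℕ.≤-trans (ℕ.≤-reflexive (s κ))
      (ℕ.s≤s (ℕ.s≤s (ℕ.≤-trans (ℕ.≤-trans (ℕ.m≤m+n _ μ) (ℕ.≤-reflexive (trans (s′ κ μ) (sym e≡)))) (Final.e≤3J (final e))))))
      where
      s : ∀ κ → suc κ ℕ.+ suc κ ℕ.+ suc κ ≡ 2 ℕ.+ suc (κ ℕ.+ κ ℕ.+ κ)
      s = ℕ-Solver.solve-∀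
      s′ : ∀ κ μ → suc (κ ℕ.+ κ ℕ.+ κ) ℕ.+ μ ≡ κ ℕ.+ κ ℕ.+ κ ℕ.+ suc μ
      s′ = ℕ-Solver.solve-∀
  ... | inj₂ (κ′ , _ , h′ , ¬h′) with ℕ.<-cmp κ′ κ
  ...   | tri≈ _ eq _ = eq
  ...   | tri< lt _ _ = ⊥-elim (¬h′ (∣-trans (pw-∣ 2 lt) h))
  ...   | tri> _ _ gt = ⊥-elim (¬h (∣-trans (pw-∣ 2 gt) h′))

  2^≢0 : ∀ b → ℕ.NonZero (2 ℕ.^ b)
  2^≢0 b = ℕ.m^n≢0 2 b

  4*2^≢0 : ∀ b → ℕ.NonZero (4 ℕ.* 2 ℕ.^ b)
  4*2^≢0 b = ℕ.m*n≢0 4 (2 ℕ.^ b) {{_}} {{2^≢0 b}}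

  -- The binary digits of x at the places b and b + 1, read as one number.
  digit : ℕ → ℕ → ℕ
  digit b x = ((x ℕ.% (4 ℕ.* 2 ℕ.^ b)) {{4*2^≢0 b}} ℕ./ (2 ℕ.^ b)) {{2^≢0 b}}

  digit<4 : ∀ b x → digit b x ℕ.< 4
  digit<4 b x = m<n*o⇒m/o<n {o = 2 ℕ.^ b} {{2^≢0 b}} (m%n<n x (4 ℕ.* 2 ℕ.^ b) {{4*2^≢0 b}})

  label-exponent : ℕ → ℤ → ℕ → ℕ
  label-exponent e t x = let κ = kap e t (+ x) in κ ℕ.+ (e ℕ.∸ (κ ℕ.+ κ ℕ.+ κ)) ℕ.∸ 2

  label : ℕ → ℤ → ℕ → ℕ
  label e t x = digit (label-exponent e t x) x

  label<4 : ∀ e t x → label e t x ℕ.< 4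
  label<4 e t x = digit<4 (label-exponent e t x) x

  digit-∣ : ∀ b x y → digit b x ≡ digit b y → pw 2 b ∣ + y - + x → pw 2 (2 ℕ.+ b) ∣ + y - + x
  digit-∣ b x y eq h = subst (_∣ + y - + x) (trans (cong +_ 4*2^b) (sym (pw-def 2 (2 ℕ.+ b))))
    (%≡⇒∣ (4 ℕ.* 2 ℕ.^ b) y x {{4*2^≢0 b}} (trans (split y) (trans (cong₂ (λ r q → r ℕ.+ q ℕ.* 2 ℕ.^ b)
      (∣⇒%≡ (2 ℕ.^ b) y x {{2^≢0 b}} (subst (_∣ + y - + x) (pw-def 2 b) h)) (sym eq)) (sym (split x)))))
    where
    4*2^b : 4 ℕ.* 2 ℕ.^ b ≡ 2 ℕ.* (2 ℕ.* 2 ℕ.^ b)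
    4*2^b = ℕ.*-assoc 2 2 (2 ℕ.^ b)
    split : ∀ x → (x ℕ.% (4 ℕ.* 2 ℕ.^ b)) {{4*2^≢0 b}} ≡ (x ℕ.% (2 ℕ.^ b)) {{2^≢0 b}} ℕ.+ digit b x ℕ.* 2 ℕ.^ b
    split x = trans (m≡m%n+[m/n]*n _ (2 ℕ.^ b) {{2^≢0 b}}) (cong (ℕ._+ digit b x ℕ.* 2 ℕ.^ b)
      (m∣n⇒o%n%m≡o%m (2 ℕ.^ b) (4 ℕ.* 2 ℕ.^ b) x {{2^≢0 b}} {{4*2^≢0 b}} (ℕ∣.divides 4 refl)))

  -- The missing digits are at the places κ + μ - 2 and κ + μ - 1. Both roots store the digits of
  -- the same places, since f″/2 agrees at x and y modulo 2^(κ+1).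
  label-linked : ∀ e t A x y → label e t x ≡ label e t y → Linked 2 e t A (+ x) (+ y)
  label-linked e t A x y eq = linked-two e t A (+ x) (+ y) strengthen
    where
    der₂-y : ∀ t x y → + 3 * y + t ≡ (+ 3 * x + t) + + 3 * (y - x)
    der₂-y = ℤ-Solver.solve-∀
    der₂-x : ∀ t x y → + 3 * x + t ≡ (+ 3 * y + t) - + 3 * (y - x)
    der₂-x = ℤ-Solver.solve-∀
    strengthen : ∀ κ μ → e ≡ κ ℕ.+ κ ℕ.+ κ ℕ.+ μ → pw 2 κ ∣ der₂ t (+ x) → ¬ pw 2 (suc κ) ∣ der₂ t (+ x) →
      pw 2 (suc κ) ∣ + y - + x → pw 2 (κ ℕ.+ μ ℕ.∸ 2) ∣ + y - + x → pw 2 (κ ℕ.+ μ) ∣ + y - + x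
    strengthen κ zero _ _ _ hd _ = ∣-trans (pw-∣ 2 (ℕ.≤-trans (ℕ.≤-reflexive (ℕ.+-identityʳ κ)) (ℕ.n≤1+n κ))) hd
    strengthen κ (suc μ) e≡ h ¬h hd hb = ∣-trans (pw-∣ 2 (ℕ.m≤n+m∸n (κ ℕ.+ suc μ) 2)) (digit-∣ b x y
        (subst₂ (λ bx by → digit bx x ≡ digit by y) (exponent x κx) (exponent y κy) eq) hb)
      where
      b = κ ℕ.+ suc μ ℕ.∸ 2
      κx : kap e t (+ x) ≡ κ
      κx = kap-≡ e t (+ x) κ μ e≡ h ¬h
      κy : kap e t (+ y) ≡ κ
      κy = kap-≡ e t (+ y) κ μ e≡
        (subst (_ ∣_) (sym (der₂-y t (+ x) (+ y))) (∣m∣n⇒∣m+n h (∣n⇒∣m*n (+ 3) (∣-trans (pw-∣ 2 (ℕ.n≤1+n κ)) hd))))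
        (λ h′ → ¬h (subst (_ ∣_) (sym (der₂-x t (+ x) (+ y))) (∣m∣n⇒∣m-n h′ (∣n⇒∣m*n (+ 3) hd))))
      exponent : ∀ x → kap e t (+ x) ≡ κ → label-exponent e t x ≡ b
      exponent x eq rewrite eq | e≡ = cong (λ m → κ ℕ.+ m ℕ.∸ 2) (ℕ.m+n∸m≡n (κ ℕ.+ κ ℕ.+ κ) (suc μ))

-- Local solvability, periods, and balls of solutions.

module LocalConditions where

  open import Data.Integer.Base hiding (suc) renaming (∣_∣ to abs)
  open import Data.Integer.Divisibility.Signed
  import Data.Integer.Tactic.RingSolver as ℤ-Solver
  open import Data.Nat.Base as ℕ using (ℕ; suc; zero)
  import Data.Nat.Divisibility as ℕ∣
  open import Data.Nat.Primality using (Prime)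
  import Data.Nat.Properties as ℕ
  import Data.Nat.Tactic.RingSolver as ℕ-Solver
  open import Data.Product.Base using (∃; _×_; _,_)
  open import Data.Sum.Base using (inj₁; inj₂; [_,_]′)
  open import Data.Empty using (⊥-elim)
  open import Relation.Binary.PropositionalEquality hiding ([_]; J)
  open import Relation.Nullary
  open import Data.Integer.DivMod using (_%ℕ_; n%ℕd<d)
  open import Data.Nat.Primality using (prime?)
  open import Relation.Nullary.Decidable using (map′; _×-dec_; _→-dec_; _⊎-dec_)
  open Valuations
  open CommonRoots
  open Residues

  shape-κ+μ : ∀ {e κ μ} → Shape e κ μ → κ ℕ.+ μ ℕ.≤ e
  shape-κ+μ {κ = κ} {μ} (exact refl) = ℕ.+-monoˡ-≤ μ (ℕ.m≤n+m κ (κ ℕ.+ κ))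
  shape-κ+μ {e} {zero} (over () refl)
  shape-κ+μ {e} {suc k} (over eq refl) = ℕ.≤-trans
    (ℕ.≤-trans (ℕ.m≤m+n _ (k ℕ.+ suc k)) (ℕ.≤-reflexive (g k))) (ℕ.≤-reflexive (sym (ℕ.suc-injective eq)))
    where
    g : ∀ k → suc k ℕ.+ 0 ℕ.+ (k ℕ.+ suc k) ≡ k ℕ.+ suc k ℕ.+ suc k
    g = ℕ-Solver.solve-∀

  -- The reason why A may move by multiples of n: the condition on f′(r) is no finer than p^e.
  shape-der : ∀ {e κ μ} → Shape e κ μ → κ ℕ.+ κ ℕ.+ μ ℕ.≤ e
  shape-der {κ = κ} {μ} (exact refl) = ℕ.+-monoˡ-≤ μ (ℕ.m≤m+n (κ ℕ.+ κ) κ)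
  shape-der {e} {zero} (over () refl)
  shape-der {e} {suc k} (over eq refl) = ℕ.≤-trans
    (ℕ.≤-trans (ℕ.m≤m+n _ k) (ℕ.≤-reflexive (g k))) (ℕ.≤-reflexive (sym (ℕ.suc-injective eq)))
    where
    g : ∀ k → suc k ℕ.+ suc k ℕ.+ 0 ℕ.+ k ≡ k ℕ.+ suc k ℕ.+ suc k
    g = ℕ-Solver.solve-∀

  -- The reason why n² is a period in B: the condition on f(r) is no finer than p^(2e).
  shape-val≤ : ∀ {e κ μ} → Shape e κ μ → κ ℕ.+ κ ℕ.+ κ ℕ.+ (μ ℕ.+ μ) ℕ.≤ e ℕ.+ e
  shape-val≤ {κ = κ} {μ} (exact refl) = ℕ.≤-trans (ℕ.m≤n+m _ (κ ℕ.+ κ ℕ.+ κ)) (ℕ.≤-reflexive (g κ μ))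
    where
    g : ∀ κ μ → κ ℕ.+ κ ℕ.+ κ ℕ.+ (κ ℕ.+ κ ℕ.+ κ ℕ.+ (μ ℕ.+ μ)) ≡ κ ℕ.+ κ ℕ.+ κ ℕ.+ μ ℕ.+ (κ ℕ.+ κ ℕ.+ κ ℕ.+ μ)
    g = ℕ-Solver.solve-∀
  shape-val≤ {zero} {suc k} (over eq refl) with trans eq (g k)
    where
    g : ∀ k → suc k ℕ.+ suc k ℕ.+ suc k ≡ suc (suc (suc (k ℕ.+ k ℕ.+ k)))
    g = ℕ-Solver.solve-∀
  ... | ()
  shape-val≤ {suc e} {κ} (over eq refl) = ℕ.≤-trans (ℕ.≤-reflexive (trans (ℕ.+-identityʳ _) (sym eq)))
    (ℕ.s≤s (ℕ.m≤n+m (suc e) e))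

  data-move : ∀ {p κ μ t A B r} B′ → pw p (κ ℕ.+ κ ℕ.+ κ ℕ.+ (μ ℕ.+ μ)) ∣ B′ - B →
    Data p κ μ t A B r → Data p κ μ t A B′ r
  data-move {t = t} {A} {B} {r} B′ h (mkData h₂ h₁ h₀) =
    mkData h₂ h₁ (subst (_ ∣_) (g t A B B′ r) (∣m∣n⇒∣m+n h₀ h))
    where
    g : ∀ t A B B′ r → (r * r * r + t * (r * r) + A * r + B) + (B′ - B) ≡ r * r * r + t * (r * r) + A * r + B′
    g = ℤ-Solver.solve-∀

  val-sub : ∀ t A B B′ r → val t A B′ r - val t A B r ≡ B′ - B
  val-sub = expanded
    where
    expanded : ∀ t A B B′ r →
      (r * r * r + t * (r * r) + A * r + B′) - (r * r * r + t * (r * r) + A * r + B) ≡ B′ - B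
    expanded = ℤ-Solver.solve-∀

  module Local (n : ℕ) {{n≢0 : ℕ.NonZero n}} (t : ℤ) where

    pe∣n : ∀ p → pw p (v p n) ∣ + n
    pe∣n p = v-∣ p n

    -- One integer r serves all primes here, whereas in `Sol` each prime has its own. The passage
    -- from local roots to a common one is made later through integral bases instead of the Chinese
    -- remainder theorem.
    V : ℤ → ℤ → ℤ → Set
    V A B r = ∀ p → Prime p → Valid p (v p n) t A B r

    Sol : ℤ → ℤ → Set
    Sol A B = ∀ p → Prime p → ∃ λ r → Valid p (v p n) t A B r

    S : ℤ → ℤ → Set
    S A B = ∃ λ r → r ℕ.< n × V A B (+ r)

    data-mod : ∀ {p κ μ A B} r → Shape (v p n) κ μ → Data p κ μ t A B r → Data p κ μ t A B (+ (r %ℕ n))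
    data-mod {p} {κ} {μ} {A} {B} r sh D = subst (Data p κ μ t A B) (g r (+ (r %ℕ n)))
      (data-shift {A = A} (r - + (r %ℕ n)) (∣-trans (pw-∣ p (shape-κ+μ sh)) (∣-trans (pe∣n p) (%ℕ-∣ r n))) D)
      where
      g : ∀ r s → r - (r - s) ≡ s
      g = ℤ-Solver.solve-∀

    V⇒S : ∀ A B r → V A B r → S A B
    V⇒S A B r V₁ = r %ℕ n , n%ℕd<d r n , λ p pr → let κ , μ , sh , D = V₁ p pr in κ , μ , sh , data-mod r sh D

    -- Adding δ(x - r) to f leaves f(r) and f″(r) unchanged and changes f′(r) by δ.
    V-translate : ∀ {A B} r δ → + n ∣ δ → V A B r → V (A + δ) (B - δ * r) r
    V-translate {A} {B} r δ n∣δ V₁ p pr =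
      let κ , μ , sh , mkData h₂ h₁ h₀ = V₁ p pr in
      κ , μ , sh , mkData h₂
        (subst (_ ∣_) (g₁ t A δ r) (∣m∣n⇒∣m+n h₁ (∣-trans (pw-∣ p (shape-der sh)) (∣-trans (pe∣n p) n∣δ))))
        (subst (_ ∣_) (g₀ t A B δ r) h₀)
      where
      g₁ : ∀ t A δ r → (+ 3 * (r * r) + + 2 * (t * r) + A) + δ ≡ + 3 * (r * r) + + 2 * (t * r) + (A + δ)
      g₁ = ℤ-Solver.solve-∀
      g₀ : ∀ t A B δ r → r * r * r + t * (r * r) + A * r + B ≡ r * r * r + t * (r * r) + (A + δ) * r + (B - δ * r)
      g₀ = ℤ-Solver.solve-∀

    n² : ℤ
    n² = + n * + n

    pM∣n² : ∀ {κ μ} p → Shape (v p n) κ μ → pw p (κ ℕ.+ κ ℕ.+ κ ℕ.+ (μ ℕ.+ μ)) ∣ n²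
    pM∣n² p sh = ∣-trans (pw-∣ p (shape-val≤ sh)) (pw-∣* p (v p n) (v p n) (pe∣n p) (pe∣n p))

    V-period : ∀ {A B} B′ r → n² ∣ B′ - B → V A B r → V A B′ r
    V-period B′ r h V₁ p pr = let κ , μ , sh , D = V₁ p pr in
      κ , μ , sh , data-move B′ (∣-trans (pM∣n² p sh) h) D

    Sol-period : ∀ {A B} B′ → n² ∣ B′ - B → Sol A B → Sol A B′
    Sol-period B′ h s p pr = let r , κ , μ , sh , D = s p pr in
      r , κ , μ , sh , data-move B′ (∣-trans (pM∣n² p sh) h) D

    S⇒Sol : ∀ {A B} → S A B → Sol A B
    S⇒Sol (r , _ , V₁) p pr = + r , V₁ p pr

    S-period : ∀ {A B} B′ → n² ∣ B′ - B → S A B → S A B′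
    S-period B′ h (r , r<n , V₁) = r , r<n , V-period B′ (+ r) h V₁

    lab : ℕ → ℕ
    lab = label (v 2 n) t

    -- Lets a single root serve all solutions B in a class modulo n whose own root carries the same
    -- label.
    V-common : ∀ {A B₁ B₂} x y → + n ∣ B₂ - B₁ → lab x ≡ lab y → V A B₁ (+ x) → V A B₂ (+ y) → V A B₂ (+ x)
    V-common {A} {B₁} {B₂} x y h eq V₁ V₂ p pr with p ℕ.≟ 2
    ... | yes refl = common-root pr (∣-trans (pe∣n 2) h) (label-linked (v 2 n) t A x y eq) (V₁ 2 pr) (V₂ 2 pr)
    ... | no p≢2 = common-root pr (∣-trans (pe∣n p) h) (linked-odd pr p≢2 (v p n) t A (+ x) (+ y)) (V₁ p pr) (V₂ p pr)

    -- B and B′ lie in a common ball of solutions at p.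
    Link : ℕ → ℤ → ℤ → ℤ → Set
    Link p A B B′ = ∃ λ r → r ℕ.< n × ∃ λ κ → κ ℕ.< suc (v p n) × ∃ λ μ → μ ℕ.< suc (v p n) ×
      Shape (v p n) κ μ × Data p κ μ t A B (+ r) × pw p (κ ℕ.+ κ ℕ.+ κ ℕ.+ (μ ℕ.+ μ)) ∣ B′ - B

    link : ∀ {p A B κ μ} B′ r → Shape (v p n) κ μ → Data p κ μ t A B r →
      pw p (κ ℕ.+ κ ℕ.+ κ ℕ.+ (μ ℕ.+ μ)) ∣ B′ - B → Link p A B B′
    link {p} {κ = κ} {μ} B′ r sh D h = r %ℕ n , n%ℕd<d r n ,
      κ , ℕ.s≤s (ℕ.≤-trans (ℕ.m≤m+n κ μ) (shape-κ+μ sh)) , μ , ℕ.s≤s (ℕ.≤-trans (ℕ.m≤n+m μ κ) (shape-κ+μ sh)) ,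
      sh , data-mod r sh D , h

    -- An equivalence relation on solutions. At each p the balls around B are nested, so the class
    -- of B is cut out by the largest one at every p and is an arithmetic progression in ℤ.
    Rel : ℤ → ℤ → ℤ → Set
    Rel A B B′ = ∀ p → Prime p → Link p A B B′

    Rel⇒Sol : ∀ {A B B′} → Rel A B B′ → Sol A B′
    Rel⇒Sol {B′ = B′} R p pr = let r , _ , κ , _ , μ , _ , sh , D , h = R p pr in
      + r , κ , μ , sh , data-move B′ h D

    Rel-period : ∀ {A B} B′ → n² ∣ B′ - B → Sol A B → Rel A B B′
    Rel-period B′ h s p pr = let r , κ , μ , sh , D = s p pr in
      link B′ r sh D (∣-trans (pM∣n² p sh) h)

    private
      ∣-swap : ∀ {i} a b → i ∣ a - b → i ∣ b - a
      ∣-swap a b h = subst (_ ∣_) (g a b) (∣m⇒∣-m h)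
        where
        g : ∀ a b → - (a - b) ≡ b - a
        g = ℤ-Solver.solve-∀

      ∣-chain : ∀ {i} a b c → i ∣ b - a → i ∣ c - b → i ∣ c - a
      ∣-chain a b c h k = subst (_ ∣_) (g a b c) (∣m∣n⇒∣m+n h k)
        where
        g : ∀ a b c → (b - a) + (c - b) ≡ c - a
        g = ℤ-Solver.solve-∀

    Rel-sym : ∀ {A} B B′ → Rel A B B′ → Rel A B′ B
    Rel-sym B B′ R p pr = let r , _ , κ , _ , μ , _ , sh , D , h = R p pr in
      link B (+ r) sh (data-move B′ h D) (∣-swap B′ B h)

    -- Two balls with a common point are nested: keep the data of the larger one.
    Rel-trans : ∀ {A} B B′ B″ → Rel A B B′ → Rel A B′ B″ → Rel A B B″
    Rel-trans {A} B B′ B″ R R′ p pr = go (R p pr) (R′ p pr)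
      where
      go : Link p A B B′ → Link p A B′ B″ → Link p A B B″
      go (r , _ , κ , _ , μ , _ , sh , D , h) (r′ , _ , κ′ , _ , μ′ , _ , sh′ , D′ , h′)
        with ℕ.≤-total (κ ℕ.+ κ ℕ.+ κ ℕ.+ (μ ℕ.+ μ)) (κ′ ℕ.+ κ′ ℕ.+ κ′ ℕ.+ (μ′ ℕ.+ μ′))
      ... | inj₁ le = link B″ (+ r) sh D (∣-chain B B′ B″ h (∣-trans (pw-∣ p le) h′))
      ... | inj₂ ge = link B″ (+ r′) sh′ (data-move B (∣-swap B′ B h″) D′) (∣-chain B B′ B″ h″ h′)
        where h″ = ∣-trans (pw-∣ p ge) h

    -- At each prime the larger of the two given balls contains B′, and its radius absorbs x. This
    -- makes the steps within a class independent of the starting point.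
    Rel-translate : ∀ {A} B B′ x → Rel A B B′ → Rel A B (B + x) → Rel A B′ (B′ + x)
    Rel-translate {A} B B′ x R R′ p pr = go (R p pr) (R′ p pr)
      where
      g : ∀ B B′ x → (B + x) - B ≡ (B′ + x) - B′
      g = ℤ-Solver.solve-∀
      go : Link p A B B′ → Link p A B (B + x) → Link p A B′ (B′ + x)
      go (r , _ , κ , _ , μ , _ , sh , D , h) (r′ , _ , κ′ , _ , μ′ , _ , sh′ , D′ , h′)
        with ℕ.≤-total (κ ℕ.+ κ ℕ.+ κ ℕ.+ (μ ℕ.+ μ)) (κ′ ℕ.+ κ′ ℕ.+ κ′ ℕ.+ (μ′ ℕ.+ μ′))
      ... | inj₁ le = link (B′ + x) (+ r) sh (data-move B′ h D) (∣-trans (pw-∣ p le) (subst (_ ∣_) (g B B′ x) h′))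
      ... | inj₂ ge = link (B′ + x) (+ r′) sh′ (data-move B′ (∣-trans (pw-∣ p ge) h) D′) (subst (_ ∣_) (g B B′ x) h′)

    -- With a common r the two values f(r) differ by B′ - B, so the larger of the two balls contains
    -- both points. Hence each r accounts for at most one class.
    V-rel : ∀ {A} B B′ r → V A B r → V A B′ r → Rel A B B′
    V-rel {A} B B′ r V₁ V₂ p pr = go (V₁ p pr) (V₂ p pr)
      where
      go : Valid p (v p n) t A B r → Valid p (v p n) t A B′ r → Link p A B B′
      go (κ , μ , sh , D) (κ′ , μ′ , sh′ , D′)
        with ℕ.≤-total (κ ℕ.+ κ ℕ.+ κ ℕ.+ (μ ℕ.+ μ)) (κ′ ℕ.+ κ′ ℕ.+ κ′ ℕ.+ (μ′ ℕ.+ μ′))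
      ... | inj₁ le = link B′ r sh D (subst (_ ∣_) (val-sub t A B B′ r)
                        (∣m∣n⇒∣m-n (∣-trans (pw-∣ p le) (Data.∣val D′)) (Data.∣val D)))
      ... | inj₂ ge = link B′ r sh′ (data-move B (∣-swap B′ B h) D′) h
        where
        h = subst (_ ∣_) (val-sub t A B B′ r) (∣m∣n⇒∣m-n (Data.∣val D′) (∣-trans (pw-∣ p ge) (Data.∣val D)))

    data? : ∀ p κ μ A B r → Dec (Data p κ μ t A B r)
    data? p κ μ A B r = map′ (λ (a , b , c) → mkData a b c) (λ (mkData a b c) → a , b , c)
      (pw p κ ∣? der₂ t r ×-dec pw p (κ ℕ.+ κ ℕ.+ μ) ∣? der t A r ×-dec
       pw p (κ ℕ.+ κ ℕ.+ κ ℕ.+ (μ ℕ.+ μ)) ∣? val t A B r)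

    shape? : ∀ e κ μ → Dec (Shape e κ μ)
    shape? e κ μ = map′ [ exact , (λ (a , b) → over a b) ]′ (λ { (exact a) → inj₁ a ; (over a b) → inj₂ (a , b) })
      (e ℕ.≟ κ ℕ.+ κ ℕ.+ κ ℕ.+ μ ⊎-dec (suc e ℕ.≟ κ ℕ.+ κ ℕ.+ κ ×-dec μ ℕ.≟ 0))

    valid? : ∀ p A B r → Dec (Valid p (v p n) t A B r)
    valid? p A B r = map′ (λ (κ , _ , μ , _ , sh , D) → κ , μ , sh , D)
      (λ (κ , μ , sh , D) → κ , ℕ.s≤s (ℕ.≤-trans (ℕ.m≤m+n κ μ) (shape-κ+μ sh)) ,
                            μ , ℕ.s≤s (ℕ.≤-trans (ℕ.m≤n+m μ κ) (shape-κ+μ sh)) , sh , D)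
      (ℕ.anyUpTo? (λ κ → ℕ.anyUpTo? (λ μ → shape? (v p n) κ μ ×-dec data? p κ μ A B r) (suc (v p n))) (suc (v p n)))

    link? : ∀ p A B B′ → Dec (Link p A B B′)
    link? p A B B′ = ℕ.anyUpTo? (λ r → ℕ.anyUpTo? (λ κ → ℕ.anyUpTo? (λ μ →
      shape? (v p n) κ μ ×-dec data? p κ μ A B (+ r) ×-dec pw p (κ ℕ.+ κ ℕ.+ κ ℕ.+ (μ ℕ.+ μ)) ∣? B′ - B)
      (suc (v p n))) (suc (v p n))) n

    v-large : ∀ {p} → Prime p → n ℕ.< p → v p n ≡ 0
    v-large {p} pr n<p = go (v p n) (v-∣ p n)
      where
      go : ∀ e → pw p e ∣ + n → e ≡ 0
      go zero _ = refl
      go (suc e) h = ⊥-elim (ℕ.<-irrefl refl (ℕ.<-≤-trans n<p (ℕ∣.∣⇒≤ (∣⇒∣ᵤ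
        (∣-trans (divides (pw p e) (pw-suc p e)) h)))))

    data-0 : ∀ p A B r → Data p 0 0 t A B r
    data-0 p A B r = mkData (pw0-∣ p _) (pw0-∣ p _) (pw0-∣ p _)

    -- A finite search over the primes up to n suffices: beyond n the exponent of p in n is 0, and
    -- the conditions in question are then satisfied by the trivial shape.
    primes? : ∀ {ℓ} {P : ℕ → Set ℓ} → (∀ p → Dec (P p)) → (∀ p → Prime p → n ℕ.< p → P p) → Dec (∀ p → Prime p → P p)
    primes? {P = P} P? large = map′ from (λ h {p} _ → h p) (ℕ.allUpTo? (λ p → prime? p →-dec P? p) (suc n))
      where
      from : (∀ {p} → p ℕ.< suc n → Prime p → P p) → ∀ p → Prime p → P p
      from h p pr with p ℕ.≤? n
      ... | yes p≤n = h (ℕ.s≤s p≤n) pr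
      ... | no p≰n = large p pr (ℕ.≰⇒> p≰n)

    opaque
      V? : ∀ A B r → Dec (V A B r)
      V? A B r = primes? (λ p → valid? p A B r)
        (λ p pr n<p → 0 , 0 , subst (λ e → Shape e 0 0) (sym (v-large pr n<p)) (exact refl) , data-0 p A B r)

      S? : ∀ A B → Dec (S A B)
      S? A B = ℕ.anyUpTo? (λ r → V? A B (+ r)) n

      Rel? : ∀ A B B′ → Dec (Rel A B B′)
      Rel? A B B′ = primes? (λ p → link? p A B B′)
        (λ p pr n<p → link B′ (+ 0) (subst (λ e → Shape e 0 0) (sym (v-large pr n<p)) (exact refl)) (data-0 p A B (+ 0)) (pw0-∣ p _))

-- Counting solutions modulo n², and comparing the counts for different A.

module ResidueCounts where

  open import Data.Integer.Base hiding (suc) renaming (∣_∣ to abs)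
  open import Data.Integer.Divisibility.Signed
  open import Data.Integer.Properties using (pos-*)
  import Data.Integer.Tactic.RingSolver as ℤ-Solver
  open import Data.Nat.Base as ℕ using (ℕ; suc)
  import Data.Nat.Properties as ℕ
  open import Data.Product.Base using (∃; _×_; _,_; proj₁; proj₂)
  open import Data.Sum.Base using (inj₁; inj₂)
  open import Data.Empty using (⊥-elim)
  open import Relation.Binary.PropositionalEquality hiding ([_]; J)
  open import Relation.Nullary
  open import Data.Integer.DivMod using (_%ℕ_; n%ℕd<d)
  open import Relation.Nullary.Decidable using (¬?; _×-dec_)
  open Valuations
  open CommonRoots
  open Residues
  open import Data.List.Base using (List; []; _∷_; _++_; length; filter; map; downFrom; cartesianProduct)
  open import Data.List.Membership.Propositional using (_∈_)
  open import Data.List.Membership.Propositional.Properties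
    using (∈-∃++; ∈-++⁻; ∈-++⁺ˡ; ∈-++⁺ʳ; ∈-filter⁺; ∈-filter⁻; ∈-downFrom⁺; ∈-downFrom⁻; ∈-cartesianProduct⁺; ∈-cartesianProduct⁻)
  open import Data.List.Properties using (length-++; length-map)
  open import Data.List.Relation.Unary.All as All using (All; []; _∷_)
  open import Data.List.Relation.Unary.Any using (here; there)
  open import Data.List.Relation.Unary.AllPairs using (_∷_)
  open import Data.List.Relation.Unary.Unique.Propositional using (Unique)
  import Data.List.Relation.Unary.Unique.Propositional.Properties as Unique
  open LocalConditions

  module _ {a b} {X : Set a} {Y : Set b} (f : X → Y) where

    injection-length : ∀ {xs ys} → Unique xs → (∀ {x} → x ∈ xs → f x ∈ ys) →
      (∀ {x y} → x ∈ xs → y ∈ xs → f x ≡ f y → x ≡ y) → length xs ℕ.≤ length ys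
    injection-length {[]} _ _ _ = ℕ.z≤n
    injection-length {x ∷ xs} {ys} (x∉ ∷ u) into inj with ∈-∃++ (into (here refl))
    ... | as , bs , refl = ℕ.≤-trans (ℕ.s≤s (injection-length u into′ (λ p q → inj (there p) (there q))))
          (ℕ.≤-reflexive (trans (cong suc (length-++ as))
            (trans (sym (ℕ.+-suc (length as) (length bs))) (sym (length-++ as)))))
      where
      into′ : ∀ {y} → y ∈ xs → f y ∈ as ++ bs
      into′ {y} y∈ with ∈-++⁻ as (into (there y∈))
      ... | inj₁ h = ∈-++⁺ˡ h
      ... | inj₂ (there h) = ∈-++⁺ʳ as h
      ... | inj₂ (here eq) = ⊥-elim (All.lookup x∉ y∈ (sym (inj (there y∈) (here refl) eq)))

  module _ {a b} {X : Set a} {Y : Set b} where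

    length-cartesianProduct : ∀ (xs : List X) (ys : List Y) →
      length (cartesianProduct xs ys) ≡ length xs ℕ.* length ys
    length-cartesianProduct [] ys = refl
    length-cartesianProduct (x ∷ xs) ys = trans (length-++ (map (x ,_) ys))
      (cong₂ ℕ._+_ (length-map (x ,_) ys) (length-cartesianProduct xs ys))

  module _ {a p} {X : Set a} {P : X → Set p} (P? : ∀ x → Dec (P x)) where

    length-partition : ∀ xs → length xs ≡ length (filter P? xs) ℕ.+ length (filter (λ x → ¬? (P? x)) xs)
    length-partition [] = refl
    length-partition (x ∷ xs) with P? x
    ... | yes _ = cong suc (length-partition xs)
    ... | no _ = trans (cong suc (length-partition xs)) (sym (ℕ.+-suc _ _))

  module _ {p} {P : ℕ → Set p} (P? : ∀ x → Dec (P x)) where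

    least : ∀ N → P N → ∃ λ m → m ℕ.≤ N × P m × (∀ k → P k → m ℕ.≤ k)
    least N PN with ℕ.anyUpTo? P? N
    ... | no none = N , ℕ.≤-refl , PN , λ k Pk → ℕ.≮⇒≥ (λ k<N → none (k , k<N , Pk))
    ... | yes (k , k<N , Pk) = descend N k k<N Pk
      where
      descend : ∀ N k → k ℕ.< N → P k → ∃ λ m → m ℕ.≤ N × P m × (∀ k → P k → m ℕ.≤ k)
      descend (suc N) k k<N Pk with ℕ.anyUpTo? P? k
      ... | no none = k , ℕ.<⇒≤ k<N , Pk , λ j Pj → ℕ.≮⇒≥ (λ j<k → none (j , j<k , Pj))
      ... | yes (j , j<k , Pj) =
        let m , m≤N , rest = descend N j (ℕ.<-≤-trans j<k (ℕ.≤-pred k<N)) Pj in m , ℕ.m≤n⇒m≤1+n m≤N , rest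

  module Count (n : ℕ) {{n≢0 : ℕ.NonZero n}} (t : ℤ) where

    open Local n t public

    N : ℕ
    N = n ℕ.* n

    instance
      N≢0 : ℕ.NonZero N
      N≢0 = ℕ.m*n≢0 n n

    n²≡N : + N ≡ n²
    n²≡N = pos-* n n

    sols : ℤ → List ℕ
    sols A = filter (λ b → S? A (+ b)) (downFrom N)

    c : ℤ → ℕ
    c A = length (sols A)

    ∈-sols : ∀ A B → S A B → B %ℕ N ∈ sols A
    ∈-sols A B s = ∈-filter⁺ (λ b → S? A (+ b)) (∈-downFrom⁺ (n%ℕd<d B N)) (S-period (+ (B %ℕ N))
      (subst (_∣ + (B %ℕ N) - B) n²≡N (∣-flip B (+ (B %ℕ N)) (%ℕ-∣ B N))) s)
      where
      ∣-flip : ∀ a b → + N ∣ a - b → + N ∣ b - a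
      ∣-flip a b h = subst (_ ∣_) (g a b) (∣m⇒∣-m h)
        where
        g : ∀ a b → - (a - b) ≡ b - a
        g = ℤ-Solver.solve-∀

    %ℕ-≡⇒∣ : ∀ a b → a %ℕ N ≡ b %ℕ N → + N ∣ a - b
    %ℕ-≡⇒∣ a b eq = subst (_ ∣_) (g a b (+ (b %ℕ N)))
      (∣m∣n⇒∣m-n (subst (λ r → + N ∣ a - + r) eq (%ℕ-∣ a N)) (%ℕ-∣ b N))
      where
      g : ∀ a b r → (a - r) - (b - r) ≡ a - b
      g = ℤ-Solver.solve-∀

    module Transport (A δ : ℤ) (n∣δ : + n ∣ δ) where

      Candidate : ℕ → ℕ → ℕ → Set
      Candidate b l r = lab r ≡ l × ∃ λ B → B ℕ.< N × B ℕ.% n ≡ b × V A (+ B) (+ r)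

      opaque
        candidate? : ∀ b l → Dec (∃ λ r → r ℕ.< n × Candidate b l r)
        candidate? b l = ℕ.anyUpTo? (λ r → lab r ℕ.≟ l ×-dec
          ℕ.anyUpTo? (λ B → B ℕ.% n ℕ.≟ b ×-dec V? A (+ B) (+ r)) N) n

      -- A root chosen from the class modulo n and the label alone; the value is 0 if no solution in
      -- the class has a root with this label.
      ρ : ℕ → ℕ → ℕ
      ρ b l with candidate? b l
      ... | yes (r , _) = r
      ... | no _ = 0

      ρ-candidate : ∀ b l r → r ℕ.< n → Candidate b l r → Candidate b l (ρ b l)
      ρ-candidate b l r r<n cand with candidate? b l
      ... | yes (_ , _ , cand′) = cand′
      ... | no none = ⊥-elim (none (r , r<n , cand))

      root : ℕ → ℕ
      root B with S? A (+ B)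
      ... | yes (r , _) = r
      ... | no _ = 0

      root-V : ∀ B → S A (+ B) → root B ℕ.< n × V A (+ B) (+ (root B))
      root-V B s with S? A (+ B)
      ... | yes (r , r<n , V₁) = r<n , V₁
      ... | no ¬s = ⊥-elim (¬s s)

      -- Replaces the root of B by one that can be recovered from the image of B and a label. By
      -- `V-common` it is again a root for B.
      root′ : ℕ → ℕ
      root′ B = ρ (B ℕ.% n) (lab (root B))

      root′-V : ∀ B → B ℕ.< N → S A (+ B) → V A (+ B) (+ (root′ B))
      root′-V B B<N s = go (root-V B s)
        where
        r = root B
        go : r ℕ.< n × V A (+ B) (+ r) → V A (+ B) (+ (root′ B))
        go (r<n , V₁) = common (ρ-candidate (B ℕ.% n) (lab r) r r<n (refl , B , B<N , refl , V₁))
          where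
          common : Candidate (B ℕ.% n) (lab r) (root′ B) → V A (+ B) (+ (root′ B))
          common (eq , B′ , _ , %≡ , V′) = V-common (root′ B) r (%≡⇒∣ n B B′ (sym %≡)) eq V′ V₁

      image : ℕ → ℤ
      image B = + B - δ * + (root′ B)

      φ : ℕ → ℕ × ℕ
      φ B = lab (root B) , image B %ℕ N

      -- Since n ∣ δ, the image determines B modulo n. Together with the label this determines the
      -- root, and undoing the shift recovers B modulo n².
      φ-injective : ∀ {B₁ B₂} → B₁ ∈ sols A → B₂ ∈ sols A → φ B₁ ≡ φ B₂ → B₁ ≡ B₂
      φ-injective {B₁} {B₂} B₁∈ B₂∈ eq = ∣-<⇒≡
        (∈-downFrom⁻ (proj₁ (∈-filter⁻ (λ b → S? A (+ b)) B₁∈)))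
        (∈-downFrom⁻ (proj₁ (∈-filter⁻ (λ b → S? A (+ b)) B₂∈)))
        (subst (+ N ∣_) (trans (cong (λ r → (+ B₁ - δ * + (root′ B₁)) - (+ B₂ - δ * + r)) (sym same-root))
          (g₂ (+ B₁) (+ B₂) (δ * + (root′ B₁)))) images)
        where
        images : + N ∣ image B₁ - image B₂
        images = %ℕ-≡⇒∣ (image B₁) (image B₂) (cong proj₂ eq)
        g₁ : ∀ B₁ B₂ d r₁ r₂ → ((B₁ - d * r₁) - (B₂ - d * r₂)) + d * (r₁ - r₂) ≡ B₁ - B₂
        g₁ = ℤ-Solver.solve-∀
        g₂ : ∀ B₁ B₂ x → (B₁ - x) - (B₂ - x) ≡ B₁ - B₂
        g₂ = ℤ-Solver.solve-∀
        n∣N : + n ∣ + N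
        n∣N = divides (+ n) n²≡N
        same-% : B₁ ℕ.% n ≡ B₂ ℕ.% n
        same-% = ∣⇒%≡ n B₁ B₂ (subst (+ n ∣_) (g₁ (+ B₁) (+ B₂) δ (+ (root′ B₁)) (+ (root′ B₂)))
          (∣m∣n⇒∣m+n (∣-trans n∣N images) (∣m⇒∣m*n _ n∣δ)))
        same-root : root′ B₁ ≡ root′ B₂
        same-root = cong₂ ρ same-% (cong proj₁ eq)

      transport : c A ℕ.≤ 4 ℕ.* c (A + δ)
      transport = ℕ.≤-trans
        (injection-length φ {ys = cartesianProduct (downFrom 4) (sols (A + δ))}
          (Unique.filter⁺ (λ b → S? A (+ b)) (Unique.downFrom⁺ N)) into φ-injective)
        (ℕ.≤-reflexive (length-cartesianProduct (downFrom 4) (sols (A + δ))))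
        where
        into : ∀ {B} → B ∈ sols A → φ B ∈ cartesianProduct (downFrom 4) (sols (A + δ))
        into {B} B∈ = ∈-cartesianProduct⁺ (∈-downFrom⁺ (label<4 (v 2 n) t (root B)))
          (∈-sols (A + δ) (image B) (V⇒S (A + δ) (image B) (+ (root′ B))
            (V-translate (+ (root′ B)) δ n∣δ (root′-V B (∈-downFrom⁻ (proj₁ B∈′)) (proj₂ B∈′)))))
          where B∈′ = ∈-filter⁻ (λ b → S? A (+ b)) {xs = downFrom N} B∈

-- Counting solutions in an interval.

module Windows where

  open import Data.Integer.Base hiding (suc) renaming (∣_∣ to abs)
  open import Data.Integer.Divisibility.Signed
  open import Data.Integer.Properties using (pos-*)
  import Data.Integer.Tactic.RingSolver as ℤ-Solver
  open import Data.Nat.Base as ℕ using (ℕ; suc; zero)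
  import Data.Nat.Properties as ℕ
  open import Data.Product.Base using (_×_; _,_; proj₁; proj₂)
  open import Data.Empty using (⊥-elim)
  open import Relation.Binary.PropositionalEquality hiding ([_]; J)
  open import Relation.Nullary
  open import Data.Integer.DivMod using (_%ℕ_)
  import Data.Integer.Properties as ℤ
  open import Data.Nat.DivMod using (m%n<n; m≡m%n+[m/n]*n)
  open import Relation.Nullary.Decidable using (¬?)
  open Valuations
  open CommonRoots
  open Residues
  open import Data.List.Base using (List; length; filter; downFrom; cartesianProduct)
  open import Data.List.Membership.Propositional using (_∈_)
  open import Data.List.Membership.Propositional.Properties
  open import Data.List.Properties using (length-downFrom)
  open import Data.List.Relation.Unary.Unique.Propositional using (Unique)
  import Data.List.Relation.Unary.Unique.Propositional.Properties as Unique
  open LocalConditions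
  open ResidueCounts

  module Window (n : ℕ) {{n≢0 : ℕ.NonZero n}} (t : ℤ) (Sol⇒S : ∀ A B → Local.Sol n t A B → Local.S n t A B) where

    open Count n t

    multiple : ∀ A B x → Sol A B → Rel A B (B + x) → ∀ q → Rel A B (B + + q * x)
    multiple A B x s R zero = Rel-period (B + + 0 * x) (divides (+ 0) (g B x)) s
      where
      g : ∀ B x → (B + + 0 * x) - B ≡ + 0
      g = ℤ-Solver.solve-∀
    multiple A B x s R (suc q) = Rel-trans B (B + x) (B + + suc q * x) R
      (subst (Rel A (B + x)) (trans (g B x (+ q)) (cong (λ y → B + y * x) (sym (ℤ.pos-+ 1 q))))
        (Rel-translate B (B + x) (+ q * x) R (multiple A B x s R q)))
      where
      g : ∀ B x q → B + x + q * x ≡ B + (+ 1 + q) * x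
      g = ℤ-Solver.solve-∀

    module _ (A lo : ℤ) (ℓ : ℕ) where

      at : ℕ → ℤ
      at b = lo + + b

      at-+ : ∀ b x → at (b ℕ.+ x) ≡ at b + + x
      at-+ b x = trans (cong (λ y → lo + y) (ℤ.pos-+ b x)) (sym (ℤ.+-assoc lo (+ b) (+ x)))

      -- The step is `suc k`, so that a search for the least k finds a positive difference.
      Step : ℕ → ℕ → Set
      Step b k = Rel A (at b) (at b + + suc k)

      -- The period n² is always a step within the class, which bounds the search for the least one.
      step-N : ∀ b → S A (at b) → Step b (ℕ.pred N)
      step-N b s = Rel-period (at b + + suc (ℕ.pred N)) (divides (+ 1) (trans (g (at b) (+ suc (ℕ.pred N)))
        (trans (cong +_ (ℕ.suc-pred N)) (trans n²≡N (sym (ℤ.*-identityˡ n²)))))) (S⇒Sol s)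
        where
        g : ∀ B x → (B + x) - B ≡ x
        g = ℤ-Solver.solve-∀

      -- The ball of at b among the solutions meets ℤ in a progression with difference M b.
      opaque
        M : ℕ → ℕ
        M b with S? A (at b)
        ... | yes s = suc (proj₁ (least (λ k → Rel? A (at b) (at b + + suc k)) (ℕ.pred N) (step-N b s)))
        ... | no _ = 1

        M≢0 : ∀ b → ℕ.NonZero (M b)
        M≢0 b with S? A (at b)
        ... | yes _ = _
        ... | no _ = _

        M-rel : ∀ b → S A (at b) → Rel A (at b) (at b + + M b)
        M-rel b s with S? A (at b)
        ... | yes s′ = proj₁ (proj₂ (proj₂ (least (λ k → Rel? A (at b) (at b + + suc k)) (ℕ.pred N) (step-N b s′))))
        ... | no ¬s = ⊥-elim (¬s s)

        M-least : ∀ b → S A (at b) → ∀ k → Step b k → M b ℕ.≤ suc k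
        M-least b s k R with S? A (at b)
        ... | yes s′ = ℕ.s≤s (proj₂ (proj₂ (proj₂ (least (λ k → Rel? A (at b) (at b + + suc k)) (ℕ.pred N) (step-N b s′)))) k R)
        ... | no ¬s = ⊥-elim (¬s s)

        root : ℕ → ℕ
        root b with S? A (at b)
        ... | yes (r , _) = r
        ... | no _ = 0

        root-V : ∀ b → S A (at b) → root b ℕ.< n × V A (at b) (+ root b)
        root-V b s with S? A (at b)
        ... | yes (r , r<n , V₁) = r<n , V₁
        ... | no ¬s = ⊥-elim (¬s s)

      instance
        M-nonZero : ∀ {b} → ℕ.NonZero (M b)
        M-nonZero {b} = M≢0 b

      gap : ∀ {b b′} → b ℕ.< b′ → S A (at b) → Rel A (at b) (at b′) → b ℕ.+ M b ℕ.≤ b′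
      gap {b} {b′} b<b′ s R = ℕ.≤-trans (ℕ.+-monoʳ-≤ b (M-least b s k
          (subst (Rel A (at b)) (trans (cong at (sym b+k)) (at-+ b (suc k))) R))) (ℕ.≤-reflexive b+k)
        where
        k = b′ ℕ.∸ suc b
        b+k : b ℕ.+ suc k ≡ b′
        b+k = trans (ℕ.+-suc b k) (ℕ.m+[n∸m]≡n b<b′)

      -- The next member of the class of b lies beyond the window, so b is the last one in it.
      Top : ℕ → Set
      Top b = ℓ ℕ.< b ℕ.+ M b

      top? : ∀ b → Dec (Top b)
      top? b = ℓ ℕ.<? b ℕ.+ M b

      module _ {bs : List ℕ} (unique : Unique bs) (bounded : ∀ {b} → b ∈ bs → b ℕ.≤ ℓ × S A (at b)) where

        tops rest : List ℕ
        tops = filter top? bs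
        rest = filter (λ b → ¬? (top? b)) bs

        ∈-tops : ∀ {b} → b ∈ tops → b ℕ.≤ ℓ × S A (at b) × Top b
        ∈-tops b∈ = let b∈bs , top = ∈-filter⁻ top? {xs = bs} b∈ ; b≤ℓ , s = bounded b∈bs in b≤ℓ , s , top

        ∈-rest : ∀ {b} → b ∈ rest → S A (at b) × b ℕ.+ M b ℕ.≤ ℓ
        ∈-rest b∈ = let b∈bs , ¬top = ∈-filter⁻ (λ b → ¬? (top? b)) {xs = bs} b∈ in
          proj₂ (bounded b∈bs) , ℕ.≮⇒≥ ¬top

        same-top : ∀ {b b′} → b ∈ tops → b′ ∈ tops → Rel A (at b) (at b′) → ¬ b ℕ.< b′
        same-top b∈ b′∈ R b<b′ = let _ , s , top = ∈-tops b∈ ; b′≤ℓ , _ = ∈-tops b′∈ in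
          ℕ.<-irrefl refl (ℕ.<-≤-trans top (ℕ.≤-trans (gap b<b′ s R) b′≤ℓ))

        -- A class has at most one last element in the window, and by `V-rel` it is determined by
        -- the root of that element, a residue below n.
        tops-≤ : length tops ℕ.≤ n
        tops-≤ = ℕ.≤-trans (injection-length root {ys = downFrom n} (Unique.filter⁺ top? unique)
            (λ {b} b∈ → ∈-downFrom⁺ (proj₁ (root-V b (proj₁ (proj₂ (∈-tops b∈)))))) inj)
          (ℕ.≤-reflexive (length-downFrom n))
          where
          inj : ∀ {b b′} → b ∈ tops → b′ ∈ tops → root b ≡ root b′ → b ≡ b′
          inj {b} {b′} b∈ b′∈ eq = ℕ.≤-antisym (ℕ.≮⇒≥ (same-top b′∈ b∈ (Rel-sym (at b) (at b′) R)))
              (ℕ.≮⇒≥ (same-top b∈ b′∈ R))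
            where
            R : Rel A (at b) (at b′)
            R = V-rel (at b) (at b′) (+ root b) (proj₂ (root-V b (proj₁ (proj₂ (∈-tops b∈)))))
              (subst (λ r → V A (at b′) (+ r)) (sym eq) (proj₂ (root-V b′ (proj₁ (proj₂ (∈-tops b′∈))))))

        point : ℕ × ℕ → ℤ
        point (b , j) = at b + + (j ℕ./ M b) * + M b

        -- For j = q M + i with 0 ≤ i < M, the class of b contributes the residue of b + q M modulo
        -- n², and the interval [b, b + M) contributes the position b + i. Each b in `rest` thereby
        -- occupies n² cells of a grid with c(A) rows and ℓ columns, and no two of them share a
        -- cell.
        φ : ℕ × ℕ → ℕ × ℕ
        φ (b , j) = point (b , j) %ℕ N , b ℕ.+ j ℕ.% M b

        point-rel : ∀ {b} → S A (at b) → ∀ j → Rel A (at b) (point (b , j))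
        point-rel {b} s j = multiple A (at b) (+ M b) (S⇒Sol s) (M-rel b s) (j ℕ./ M b)

        point-S : ∀ {b} → S A (at b) → ∀ j → S A (point (b , j))
        point-S {b} s j = Sol⇒S A (point (b , j)) (Rel⇒Sol (point-rel s j))

        module _ {b b′ j j′} (s : S A (at b)) (s′ : S A (at b′)) (j<N : j ℕ.< N) (j′<N : j′ ℕ.< N)
                 (eq : φ (b , j) ≡ φ (b′ , j′)) where

          C C′ : ℤ
          C = point (b , j)
          C′ = point (b′ , j′)

          N∣C-C′ : + N ∣ C - C′
          N∣C-C′ = %ℕ-≡⇒∣ C C′ (cong proj₁ eq)

          N∣C′-C : n² ∣ C′ - C
          N∣C′-C = subst₂ _∣_ n²≡N (g C C′) (∣m⇒∣-m N∣C-C′)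
            where
            g : ∀ a b → - (a - b) ≡ b - a
            g = ℤ-Solver.solve-∀

          R : Rel A (at b) (at b′)
          R = Rel-trans (at b) C (at b′) (point-rel s j) (Rel-trans C C′ (at b′)
            (Rel-period C′ N∣C′-C (S⇒Sol (point-S s j))) (Rel-sym (at b′) C′ (point-rel s′ j′)))

          -- Congruent points put b and b′ into one class. The intervals [b, b + M b) of members of
          -- a class are disjoint, while both of these contain the common position.
          b≮b′ : ¬ b ℕ.< b′
          b≮b′ b<b′ = ℕ.<-irrefl refl (ℕ.<-≤-trans (ℕ.+-monoʳ-< b (m%n<n j (M b)))
            (ℕ.≤-trans (gap b<b′ s R) (ℕ.≤-trans (ℕ.m≤m+n b′ _) (ℕ.≤-reflexive (sym (cong proj₂ eq))))))

        φ-injective : ∀ {x y} → x ∈ cartesianProduct rest (downFrom N) → y ∈ cartesianProduct rest (downFrom N) →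
          φ x ≡ φ y → x ≡ y
        φ-injective {b , j} {b′ , j′} x∈ y∈ eq = conclude b≡b′
          where
          x∈′ = ∈-cartesianProduct⁻ rest (downFrom N) x∈
          y∈′ = ∈-cartesianProduct⁻ rest (downFrom N) y∈
          s = proj₁ (∈-rest (proj₁ x∈′))
          s′ = proj₁ (∈-rest (proj₁ y∈′))
          j<N = ∈-downFrom⁻ (proj₂ x∈′)
          j′<N = ∈-downFrom⁻ (proj₂ y∈′)
          b≡b′ : b ≡ b′
          b≡b′ = ℕ.≤-antisym (ℕ.≮⇒≥ (b≮b′ s′ s j′<N j<N (sym eq))) (ℕ.≮⇒≥ (b≮b′ s s′ j<N j′<N eq))
          quotient< : ∀ {j} → j ℕ.< N → j ℕ./ M b ℕ.* M b ℕ.< N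
          quotient< {j} j<N = ℕ.≤-<-trans (ℕ.≤-trans (ℕ.m≤n+m _ (j ℕ.% M b))
            (ℕ.≤-reflexive (sym (m≡m%n+[m/n]*n j (M b))))) j<N
          conclude : b ≡ b′ → (b , j) ≡ (b′ , j′)
          conclude refl = cong (b ,_) (trans (m≡m%n+[m/n]*n j (M b))
            (trans (cong₂ ℕ._+_ (ℕ.+-cancelˡ-≡ b _ _ (cong proj₂ eq)) quotients) (sym (m≡m%n+[m/n]*n j′ (M b)))))
            where
            g : ∀ a x y → (a + x) - (a + y) ≡ x - y
            g = ℤ-Solver.solve-∀
            quotients : j ℕ./ M b ℕ.* M b ≡ j′ ℕ./ M b ℕ.* M b
            quotients = ∣-<⇒≡ (quotient< j<N) (quotient< j′<N)
              (subst (+ N ∣_) (trans (g (at b) (+ (j ℕ./ M b) * + M b) (+ (j′ ℕ./ M b) * + M b))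
                (cong₂ _-_ (sym (pos-* (j ℕ./ M b) (M b))) (sym (pos-* (j′ ℕ./ M b) (M b)))))
                (N∣C-C′ s s′ j<N j′<N eq))

        rest-≤ : length rest ℕ.* N ℕ.≤ c A ℕ.* ℓ
        rest-≤ = subst₂ ℕ._≤_
          (trans (length-cartesianProduct rest (downFrom N)) (cong (length rest ℕ.*_) (length-downFrom N)))
          (trans (length-cartesianProduct (sols A) (downFrom ℓ)) (cong (c A ℕ.*_) (length-downFrom ℓ)))
          (injection-length φ (Unique.cartesianProduct⁺ (Unique.filter⁺ (λ b → ¬? (top? b)) unique) (Unique.downFrom⁺ N))
            into φ-injective)
          where
          into : ∀ {x} → x ∈ cartesianProduct rest (downFrom N) → φ x ∈ cartesianProduct (sols A) (downFrom ℓ)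
          into {b , j} x∈ = ∈-cartesianProduct⁺ (∈-sols A (point (b , j)) (point-S s j))
            (∈-downFrom⁺ (ℕ.<-≤-trans (ℕ.+-monoʳ-< b (m%n<n j (M b))) (proj₂ b-rest)))
            where
            b-rest = ∈-rest (proj₁ (∈-cartesianProduct⁻ rest (downFrom N) x∈))
            s = proj₁ b-rest

        window : length bs ℕ.* N ℕ.≤ c A ℕ.* ℓ ℕ.+ n ℕ.* N
        window = ℕ.≤-trans (ℕ.≤-reflexive (trans (cong (ℕ._* N) (trans (length-partition top? bs) (ℕ.+-comm (length tops) (length rest))))
            (ℕ.*-distribʳ-+ N (length rest) (length tops))))
          (ℕ.+-mono-≤ rest-≤ (ℕ.*-monoˡ-≤ N tops-≤))

-- Integers among the rational numbers.

module RationalIntegers where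

  open import Data.Empty using (⊥-elim)
  open import Data.Integer.Base as ℤ using (ℤ; -[1+_]; 0ℤ; 1ℤ)
  import Data.Integer.Properties as ℤ
  open import Data.Nat.Base as ℕ using (ℕ; zero; suc)
  open import Data.Nat.Coprimality as Coprime using (Coprime; coprime-divisor; 1-coprimeTo)
  import Data.Nat.Divisibility as ℕ∣
  import Data.Nat.Properties as ℕ
  open import Data.Product.Base using (∃; _,_; proj₁; proj₂)
  open import Data.Rational.Base hiding (_/_; truncate)
  open import Data.Rational.Properties
  import Data.Rational.Unnormalised.Base as ℚᵘ
  import Data.Rational.Unnormalised.Properties as ℚᵘ
  open import Relation.Binary.PropositionalEquality hiding ([_]; J)
  open import Relation.Nullary using (Dec; yes; no)
  import Data.Rational.Solver
  open Data.Rational.Solver.+-*-Solver using (solve; _:=_; _:-_; _:*_; :-_)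

  open import Defs using (ℤ→ℚ)
  open Residues using (m<p^m)

  coprime-1 : ∀ a → Coprime ℤ.∣ a ∣ 1
  coprime-1 a = Coprime.sym (1-coprimeTo ℤ.∣ a ∣)

  ℤ→ℚ-mkℚ : ∀ a → ℤ→ℚ a ≡ mkℚ a 0 (coprime-1 a)
  ℤ→ℚ-mkℚ a = ↥p/↧p≡p (mkℚ a 0 (coprime-1 a))

  ℤ→ℚ-injective : ∀ {a b} → ℤ→ℚ a ≡ ℤ→ℚ b → a ≡ b
  ℤ→ℚ-injective {a} {b} eq = cong ↥_ (trans (sym (ℤ→ℚ-mkℚ a)) (trans eq (ℤ→ℚ-mkℚ b)))

  ℤ→ℚ-+ : ∀ a b → ℤ→ℚ (a ℤ.+ b) ≡ ℤ→ℚ a + ℤ→ℚ b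
  ℤ→ℚ-+ a b = trans (cong ℤ→ℚ (sym (cong₂ ℤ._+_ (ℤ.*-identityʳ a) (ℤ.*-identityʳ b))))
    (sym (cong₂ _+_ (ℤ→ℚ-mkℚ a) (ℤ→ℚ-mkℚ b)))

  ℤ→ℚ-* : ∀ a b → ℤ→ℚ (a ℤ.* b) ≡ ℤ→ℚ a * ℤ→ℚ b
  ℤ→ℚ-* a b = sym (cong₂ _*_ (ℤ→ℚ-mkℚ a) (ℤ→ℚ-mkℚ b))

  ℤ→ℚ-neg : ∀ a → ℤ→ℚ (ℤ.- a) ≡ - ℤ→ℚ a
  ℤ→ℚ-neg (ℤ.+ zero)  = refl
  ℤ→ℚ-neg (ℤ.+ suc n) = refl
  ℤ→ℚ-neg -[1+ n ]  = sym (neg-involutive (ℤ→ℚ (ℤ.+ suc n)))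
    where
    neg-involutive : ∀ p → - - p ≡ p
    neg-involutive = solve 1 (λ p → :- (:- p) := p) refl

  ℤ→ℚ-sub : ∀ a b → ℤ→ℚ (a ℤ.- b) ≡ ℤ→ℚ a - ℤ→ℚ b
  ℤ→ℚ-sub a b = trans (ℤ→ℚ-+ a (ℤ.- b)) (cong (ℤ→ℚ a +_) (ℤ→ℚ-neg b))

  IsInt : ℚ → Set
  IsInt q = ∃ λ a → q ≡ ℤ→ℚ a

  int : ∀ a → IsInt (ℤ→ℚ a)
  int a = a , refl

  int-0 : IsInt 0ℚ
  int-0 = 0ℤ , refl

  int-1 : IsInt 1ℚ
  int-1 = 1ℤ , refl

  int-+ : ∀ {p q} → IsInt p → IsInt q → IsInt (p + q)
  int-+ (a , refl) (b , refl) = a ℤ.+ b , sym (ℤ→ℚ-+ a b)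

  int-* : ∀ {p q} → IsInt p → IsInt q → IsInt (p * q)
  int-* (a , refl) (b , refl) = a ℤ.* b , sym (ℤ→ℚ-* a b)

  int-neg : ∀ {p} → IsInt p → IsInt (- p)
  int-neg (a , refl) = ℤ.- a , sym (ℤ→ℚ-neg a)

  int-sub : ∀ {p q} → IsInt p → IsInt q → IsInt (p - q)
  int-sub p q = int-+ p (int-neg q)

  int? : ∀ q → Dec (IsInt q)
  int? q@(mkℚ a zero c) = yes (a , sym (ℤ→ℚ-mkℚ a))
  int? q@(mkℚ a (suc d) c) = no λ (b , eq) → ℕ.1+n≢0 (ℕ.suc-injective (cong ↧ₙ_ (trans eq (ℤ→ℚ-mkℚ b))))

  opaque
    scale : ∀ q → q * ℤ→ℚ (↧ q) ≡ ℤ→ℚ (↥ q)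
    scale q@(mkℚ a d-1 _) = trans (cong (q *_) (ℤ→ℚ-mkℚ (↧ q)))
      (trans (toℚᵘ-injective (ℚᵘ.≃-trans (toℚᵘ-homo-* q (mkℚ (↧ q) 0 (coprime-1 (↧ q))))
        (ℚᵘ.*≡* {q = toℚᵘ (mkℚ a 0 (coprime-1 a))} (g a (↧ q))))) (sym (ℤ→ℚ-mkℚ a)))
      where
      g : ∀ a d → a ℤ.* d ℤ.* 1ℤ ≡ a ℤ.* (d ℤ.* 1ℤ)
      g a d = ℤ.*-assoc a d 1ℤ

  infixr 8 _^_
  _^_ : ℚ → ℕ → ℚ
  q ^ zero = 1ℚ
  q ^ suc i = q * q ^ i

  ^-* : ∀ p q i → (p * q) ^ i ≡ p ^ i * q ^ i
  ^-* p q zero = refl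
  ^-* p q (suc i) = trans (cong (p * q *_) (^-* p q i)) (g p q (p ^ i) (q ^ i))
    where
    g : ∀ p q x y → p * q * (x * y) ≡ p * x * (q * y)
    g = solve 4 (λ p q x y → p :* q :* (x :* y) := p :* x :* (q :* y)) refl

  ℤ→ℚ-^ : ∀ a i → ℤ→ℚ (a ℤ.^ i) ≡ ℤ→ℚ a ^ i
  ℤ→ℚ-^ a zero = refl
  ℤ→ℚ-^ a (suc i) = trans (ℤ→ℚ-* a (a ℤ.^ i)) (cong (ℤ→ℚ a *_) (ℤ→ℚ-^ a i))

  abs-^ : ∀ a i → ℤ.∣ a ℤ.^ i ∣ ≡ ℤ.∣ a ∣ ℕ.^ i
  abs-^ a zero = refl
  abs-^ a (suc i) = trans (ℤ.abs-* a (a ℤ.^ i)) (cong (ℤ.∣ a ∣ ℕ.*_) (abs-^ a i))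

  coprime-^ʳ : ∀ {m n} → Coprime m n → ∀ i → Coprime m (n ℕ.^ i)
  coprime-^ʳ c zero = Coprime.sym (1-coprimeTo _)
  coprime-^ʳ {m} {n} c (suc i) {d} (d∣m , d∣n^) = coprime-^ʳ c i
    (d∣m , coprime-divisor (λ (e∣d , e∣n) → c (ℕ∣.∣-trans e∣d d∣m , e∣n)) d∣n^)

  -- If d is the denominator of q in lowest terms, d^i divides K for every i, which is impossible
  -- for d ≥ 2.
  bounded-denominator⇒int : ∀ K q → K ≢ 0ℤ → (∀ i → IsInt (ℤ→ℚ K * q ^ i)) → IsInt q
  bounded-denominator⇒int K q@(mkℚ a zero c) _ _ = a , sym (ℤ→ℚ-mkℚ a)
  bounded-denominator⇒int K q@(mkℚ a (suc e) c) K≢0 h = ⊥-elim (ℕ.<-irrefl refl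
    (ℕ.<-≤-trans (m<p^m ℤ.∣ K ∣ (ℕ.s≤s (ℕ.s≤s ℕ.z≤n))) (ℕ∣.∣⇒≤ {{ℕ.≢-nonZero (λ eq → K≢0 (ℤ.∣i∣≡0⇒i≡0 eq))}} (d^i∣K ℤ.∣ K ∣))))
    where
    d = suc (suc e)
    coprime : ∀ i → Coprime (d ℕ.^ i) (ℤ.∣ a ∣ ℕ.^ i)
    coprime i = coprime-^ʳ (Coprime.sym (coprime-^ʳ (Coprime.recompute c) i)) i
    cleared : ∀ i → ∃ λ z → K ℤ.* a ℤ.^ i ≡ z ℤ.* (ℤ.+ d) ℤ.^ i
    cleared i = let z , eq = h i in z , ℤ→ℚ-injective
      (trans (ℤ→ℚ-* K (a ℤ.^ i)) (trans (cong (ℤ→ℚ K *_) (trans (ℤ→ℚ-^ a i)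
        (trans (cong (_^ i) (sym (scale q))) (^-* q (ℤ→ℚ (ℤ.+ d)) i))))
      (trans (sym (*-assoc (ℤ→ℚ K) (q ^ i) (ℤ→ℚ (ℤ.+ d) ^ i)))
      (trans (cong₂ _*_ eq (sym (ℤ→ℚ-^ (ℤ.+ d) i))) (sym (ℤ→ℚ-* z ((ℤ.+ d) ℤ.^ i)))))))
    d^i∣K : ∀ i → d ℕ.^ i ℕ∣.∣ ℤ.∣ K ∣
    d^i∣K i = coprime-divisor (coprime i) (ℕ∣.divides ℤ.∣ proj₁ (cleared i) ∣ (trans (sym eqₗ) (trans (cong ℤ.∣_∣ (proj₂ (cleared i))) eqᵣ)))
      where
      eqₗ : ℤ.∣ K ℤ.* a ℤ.^ i ∣ ≡ ℤ.∣ a ∣ ℕ.^ i ℕ.* ℤ.∣ K ∣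
      eqₗ = trans (ℤ.abs-* K (a ℤ.^ i)) (trans (cong (ℤ.∣ K ∣ ℕ.*_) (abs-^ a i)) (ℕ.*-comm ℤ.∣ K ∣ _))
      eqᵣ : ℤ.∣ proj₁ (cleared i) ℤ.* (ℤ.+ d) ℤ.^ i ∣ ≡ ℤ.∣ proj₁ (cleared i) ∣ ℕ.* d ℕ.^ i
      eqᵣ = trans (ℤ.abs-* (proj₁ (cleared i)) ((ℤ.+ d) ℤ.^ i)) (cong (ℤ.∣ proj₁ (cleared i) ∣ ℕ.*_) (abs-^ (ℤ.+ d) i))

-- Multiplication, trace and norm in a cubic algebra.

module CubicAlgebra where

  open import Data.Integer.Base using (ℤ)
  open import Data.Product.Base using (_×_; _,_)
  open import Data.Rational.Base hiding (_/_; truncate)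
  open import Data.Rational.Properties
  open import Relation.Binary.PropositionalEquality hiding ([_]; J)
  import Data.Rational.Solver
  open Data.Rational.Solver.+-*-Solver using (Polynomial; solve; con; _:=_; _:+_; _:-_; _:*_; :-_)

  open import Defs
  open RationalIntegers

  cong₃ : ∀ {a b c a′ b′ c′} → a ≡ a′ → b ≡ b′ → c ≡ c′ → ⟨ a , b , c ⟩ ≡ ⟨ a′ , b′ , c′ ⟩
  cong₃ refl refl refl = refl

  -- A copy of the algebra over solver expressions: an identity between algebra elements is written
  -- once and solved in each coordinate.
  record Alg[_] (R : Set) : Set where
    constructor ⟨_,_,_⟩ᴾ
    field
      d₀ d₁ d₂ : R

  infixl 7 _∙_
  infixl 6 _⊕_

  _⊕_ : ∀ {n} → Alg[ Polynomial n ] → Alg[ Polynomial n ] → Alg[ Polynomial n ]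
  ⟨ a , b , c ⟩ᴾ ⊕ ⟨ d , e , g ⟩ᴾ = ⟨ a :+ d , b :+ e , c :+ g ⟩ᴾ

  _∙_ : ∀ {n} → Polynomial n → Alg[ Polynomial n ] → Alg[ Polynomial n ]
  q ∙ ⟨ a , b , c ⟩ᴾ = ⟨ q :* a , q :* b , q :* c ⟩ᴾ

  module Sym {n} (τ α β : Polynomial n) where

    X : Alg[ Polynomial n ] → Alg[ Polynomial n ]
    X ⟨ a , b , c ⟩ᴾ = ⟨ :- (β :* c) , a :- α :* c , b :- τ :* c ⟩ᴾ

    _⊗_ : Alg[ Polynomial n ] → Alg[ Polynomial n ] → Alg[ Polynomial n ]
    ⟨ a , b , c ⟩ᴾ ⊗ v = (a ∙ v) ⊕ X ((b ∙ v) ⊕ X (c ∙ v))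

  open Alg[_]

  detᴾ : ∀ {n} → Alg[ Polynomial n ] → Alg[ Polynomial n ] → Alg[ Polynomial n ] → Polynomial n
  detᴾ ⟨ a , b , c ⟩ᴾ ⟨ d , e , g ⟩ᴾ ⟨ h , i , j ⟩ᴾ = a :* (e :* j :- g :* i) :- b :* (d :* j :- g :* h) :+ c :* (d :* i :- e :* h)

  trᴾ minorsᴾ : ∀ {n} → Alg[ Polynomial n ] → Alg[ Polynomial n ] → Alg[ Polynomial n ] → Polynomial n
  trᴾ ⟨ a , b , c ⟩ᴾ ⟨ d , e , g ⟩ᴾ ⟨ h , i , j ⟩ᴾ = a :+ e :+ j
  minorsᴾ ⟨ a , b , c ⟩ᴾ ⟨ d , e , g ⟩ᴾ ⟨ h , i , j ⟩ᴾ = (a :* e :- b :* d) :+ (a :* j :- c :* h) :+ (e :* j :- g :* i)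

  applyᴾ : ∀ {n} → (p q r v : Alg[ Polynomial n ]) → Alg[ Polynomial n ]
  applyᴾ p q r ⟨ a , b , c ⟩ᴾ = (a ∙ p) ⊕ (b ∙ q) ⊕ (c ∙ r)

  -- Determinant, trace and sum of principal minors of the matrix with columns p, q, r.
  det tr minors : Alg → Alg → Alg → ℚ
  det ⟨ a , b , c ⟩ ⟨ d , e , g ⟩ ⟨ h , i , j ⟩ = a * (e * j - g * i) - b * (d * j - g * h) + c * (d * i - e * h)
  tr ⟨ a , b , c ⟩ ⟨ d , e , g ⟩ ⟨ h , i , j ⟩ = a + e + j
  minors ⟨ a , b , c ⟩ ⟨ d , e , g ⟩ ⟨ h , i , j ⟩ = (a * e - b * d) + (a * j - c * h) + (e * j - g * i)

  -- The matrix with columns p, q, r applied to the vector v.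
  apply : (p q r v : Alg) → Alg
  apply p q r ⟨ a , b , c ⟩ = ((a ·ᴬ p) +ᴬ (b ·ᴬ q)) +ᴬ (c ·ᴬ r)

  det-apply : ∀ p q r u v w → det (apply p q r u) (apply p q r v) (apply p q r w) ≡ det p q r * det u v w
  det-apply ⟨ a , b , c ⟩ ⟨ d , e , g ⟩ ⟨ h , i , j ⟩ ⟨ a′ , b′ , c′ ⟩ ⟨ d′ , e′ , g′ ⟩ ⟨ h′ , i′ , j′ ⟩ =
    solve 18 (λ a b c d e g h i j a′ b′ c′ d′ e′ g′ h′ i′ j′ →
      let M = applyᴾ ⟨ a , b , c ⟩ᴾ ⟨ d , e , g ⟩ᴾ ⟨ h , i , j ⟩ᴾ in
      detᴾ (M ⟨ a′ , b′ , c′ ⟩ᴾ) (M ⟨ d′ , e′ , g′ ⟩ᴾ) (M ⟨ h′ , i′ , j′ ⟩ᴾ)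
      := detᴾ ⟨ a , b , c ⟩ᴾ ⟨ d , e , g ⟩ᴾ ⟨ h , i , j ⟩ᴾ :* detᴾ ⟨ a′ , b′ , c′ ⟩ᴾ ⟨ d′ , e′ , g′ ⟩ᴾ ⟨ h′ , i′ , j′ ⟩ᴾ)
      refl a b c d e g h i j a′ b′ c′ d′ e′ g′ h′ i′ j′

  tr-apply : ∀ p q r → tr (apply p q r p) (apply p q r q) (apply p q r r) ≡ tr p q r * tr p q r - (minors p q r + minors p q r)
  tr-apply ⟨ a , b , c ⟩ ⟨ d , e , g ⟩ ⟨ h , i , j ⟩ =
    solve 9 (λ a b c d e g h i j →
      let p = ⟨ a , b , c ⟩ᴾ ; q = ⟨ d , e , g ⟩ᴾ ; r = ⟨ h , i , j ⟩ᴾ ; M = applyᴾ p q r in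
      trᴾ (M p) (M q) (M r) := trᴾ p q r :* trᴾ p q r :- (minorsᴾ p q r :+ minorsᴾ p q r))
      refl a b c d e g h i j

  -- The matrix identity is evaluated at the first basis vector, which the matrix sends to p. For
  -- multiplication by u this vector is 1, and the identity becomes the cubic equation of u.
  cayley-hamilton : ∀ p q r → apply p q r (apply p q r p) ≡
    ((tr p q r ·ᴬ apply p q r p) +ᴬ ((- minors p q r) ·ᴬ p)) +ᴬ ⟨ det p q r , 0ℚ , 0ℚ ⟩
  cayley-hamilton ⟨ a , b , c ⟩ ⟨ d , e , g ⟩ ⟨ h , i , j ⟩ = cong₃
    (solve 9 (λ a b c d e g h i j → comp d₀ a b c d e g h i j) refl a b c d e g h i j)
    (solve 9 (λ a b c d e g h i j → comp d₁ a b c d e g h i j) refl a b c d e g h i j)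
    (solve 9 (λ a b c d e g h i j → comp d₂ a b c d e g h i j) refl a b c d e g h i j)
    where
    comp : (Alg[ Polynomial 9 ] → Polynomial 9) → (a b c d e g h i j : Polynomial 9) → Polynomial 9 × Polynomial 9
    comp π a b c d e g h i j =
      let p = ⟨ a , b , c ⟩ᴾ ; q = ⟨ d , e , g ⟩ᴾ ; r = ⟨ h , i , j ⟩ᴾ ; M = applyᴾ p q r in
      π (M (M p)) := π ((trᴾ p q r ∙ M p) ⊕ ((:- minorsᴾ p q r) ∙ p) ⊕ ⟨ detᴾ p q r , con 0ℚ , con 0ℚ ⟩ᴾ)

  -- Up to sign the characteristic polynomial at -1. It makes trace and minors accessible through
  -- norms, which are multiplicative.
  det-1+ : ∀ p q r → det (⟨ 1ℚ , 0ℚ , 0ℚ ⟩ +ᴬ p) (⟨ 0ℚ , 1ℚ , 0ℚ ⟩ +ᴬ q) (⟨ 0ℚ , 0ℚ , 1ℚ ⟩ +ᴬ r)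
    ≡ 1ℚ + tr p q r + minors p q r + det p q r
  det-1+ ⟨ a , b , c ⟩ ⟨ d , e , g ⟩ ⟨ h , i , j ⟩ = solve 9 (λ a b c d e g h i j →
      let p = ⟨ a , b , c ⟩ᴾ ; q = ⟨ d , e , g ⟩ᴾ ; r = ⟨ h , i , j ⟩ᴾ ; o = con 0ℚ ; l = con 1ℚ in
      detᴾ (⟨ l , o , o ⟩ᴾ ⊕ p) (⟨ o , l , o ⟩ᴾ ⊕ q) (⟨ o , o , l ⟩ᴾ ⊕ r)
      := l :+ trᴾ p q r :+ minorsᴾ p q r :+ detᴾ p q r)
      refl a b c d e g h i j

  det-scale : ∀ k p q r → det (k ·ᴬ p) (k ·ᴬ q) (k ·ᴬ r) ≡ k * (k * (k * det p q r))
  det-scale k ⟨ a , b , c ⟩ ⟨ d , e , g ⟩ ⟨ h , i , j ⟩ = solve 10 (λ k a b c d e g h i j →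
      let p = ⟨ a , b , c ⟩ᴾ ; q = ⟨ d , e , g ⟩ᴾ ; r = ⟨ h , i , j ⟩ᴾ in
      detᴾ (k ∙ p) (k ∙ q) (k ∙ r) := k :* (k :* (k :* detᴾ p q r)))
      refl k a b c d e g h i j

  minors-scale : ∀ k p q r → minors (k ·ᴬ p) (k ·ᴬ q) (k ·ᴬ r) ≡ k * (k * minors p q r)
  minors-scale k ⟨ a , b , c ⟩ ⟨ d , e , g ⟩ ⟨ h , i , j ⟩ = solve 10 (λ k a b c d e g h i j →
      let p = ⟨ a , b , c ⟩ᴾ ; q = ⟨ d , e , g ⟩ᴾ ; r = ⟨ h , i , j ⟩ᴾ in
      minorsᴾ (k ∙ p) (k ∙ q) (k ∙ r) := k :* (k :* minorsᴾ p q r))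
      refl k a b c d e g h i j

  tr-scale : ∀ k p q r → tr (k ·ᴬ p) (k ·ᴬ q) (k ·ᴬ r) ≡ k * tr p q r
  tr-scale k ⟨ a , b , c ⟩ ⟨ d , e , g ⟩ ⟨ h , i , j ⟩ =
    solve 4 (λ k a e j → k :* a :+ k :* e :+ k :* j := k :* (a :+ e :+ j)) refl k a e j

  module Mul (f : V ℤ) where

    τ α β : ℚ
    τ = ℤ→ℚ ⟦ V.t f ⟧
    α = ℤ→ℚ (V.A f)
    β = ℤ→ℚ (V.B f)

    infixl 25 _⊛_
    _⊛_ : Alg → Alg → Alg
    u ⊛ v = mul f u v

    X : Alg → Alg
    X = x·[ f ]

    𝟙 : Alg
    𝟙 = ⟨ 1ℚ , 0ℚ , 0ℚ ⟩

    *-comm₃ : ∀ u v → u ⊛ v ≡ v ⊛ u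
    *-comm₃ ⟨ a , b , c ⟩ ⟨ d , e , g ⟩ = cong₃
      (solve 9 (λ τ α β a b c d e g → comp d₀ τ α β a b c d e g) refl τ α β a b c d e g)
      (solve 9 (λ τ α β a b c d e g → comp d₁ τ α β a b c d e g) refl τ α β a b c d e g)
      (solve 9 (λ τ α β a b c d e g → comp d₂ τ α β a b c d e g) refl τ α β a b c d e g)
      where
      comp : (Alg[ Polynomial 9 ] → Polynomial 9) → (τ α β a b c d e g : Polynomial 9) → Polynomial 9 × Polynomial 9
      comp π τ α β a b c d e g = let open Sym τ α β ; u = ⟨ a , b , c ⟩ᴾ ; v = ⟨ d , e , g ⟩ᴾ in
        π (u ⊗ v) := π (v ⊗ u)

    X-+ : ∀ u v → X (u +ᴬ v) ≡ X u +ᴬ X v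
    X-+ ⟨ a , b , c ⟩ ⟨ d , e , g ⟩ = cong₃
      (solve 3 (λ β c g → :- (β :* (c :+ g)) := :- (β :* c) :+ :- (β :* g)) refl β c g)
      (solve 5 (λ α a c d g → (a :+ d) :- α :* (c :+ g) := (a :- α :* c) :+ (d :- α :* g)) refl α a c d g)
      (solve 5 (λ α a c d g → (a :+ d) :- α :* (c :+ g) := (a :- α :* c) :+ (d :- α :* g)) refl τ b c e g)

    X-· : ∀ k u → X (k ·ᴬ u) ≡ k ·ᴬ X u
    X-· k ⟨ a , b , c ⟩ = cong₃
      (solve 3 (λ k β c → :- (β :* (k :* c)) := k :* (:- (β :* c))) refl k β c)
      (solve 4 (λ k α a c → k :* a :- α :* (k :* c) := k :* (a :- α :* c)) refl k α a c)
      (solve 4 (λ k α a c → k :* a :- α :* (k :* c) := k :* (a :- α :* c)) refl k τ b c)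

    +-assoc₃ : ∀ u v w → (u +ᴬ v) +ᴬ w ≡ u +ᴬ (v +ᴬ w)
    +-assoc₃ ⟨ a , b , c ⟩ ⟨ d , e , g ⟩ ⟨ h , i , j ⟩ = cong₃ (+-assoc a d h) (+-assoc b e i) (+-assoc c g j)

    -- Identifies multiplication by u with the matrix whose columns are u, x u and x² u.
    mul-apply : ∀ u v → u ⊛ v ≡ apply u (X u) (X (X u)) v
    mul-apply u v@(⟨ a , b , c ⟩) = trans (*-comm₃ u v) (trans
      (cong ((a ·ᴬ u) +ᴬ_) (trans (X-+ (b ·ᴬ u) (X (c ·ᴬ u)))
        (cong₂ _+ᴬ_ (X-· b u) (trans (cong X (X-· c u)) (X-· c (X u))))))
      (sym (+-assoc₃ (a ·ᴬ u) (b ·ᴬ X u) (c ·ᴬ X (X u)))))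

    apply-+ : ∀ p q r u v → apply p q r (u +ᴬ v) ≡ apply p q r u +ᴬ apply p q r v
    apply-+ ⟨ x₀ , x₁ , x₂ ⟩ ⟨ y₀ , y₁ , y₂ ⟩ ⟨ z₀ , z₁ , z₂ ⟩ ⟨ a , b , c ⟩ ⟨ d , e , i ⟩ =
      cong₃ (g a b c d e i x₀ y₀ z₀) (g a b c d e i x₁ y₁ z₁) (g a b c d e i x₂ y₂ z₂)
      where
      g : ∀ a b c d e f x y z → (a + d) * x + (b + e) * y + (c + f) * z ≡ (a * x + b * y + c * z) + (d * x + e * y + f * z)
      g = solve 9 (λ a b c d e f x y z → (a :+ d) :* x :+ (b :+ e) :* y :+ (c :+ f) :* z
            := (a :* x :+ b :* y :+ c :* z) :+ (d :* x :+ e :* y :+ f :* z)) refl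

    apply-· : ∀ p q r k u → apply p q r (k ·ᴬ u) ≡ k ·ᴬ apply p q r u
    apply-· ⟨ x₀ , x₁ , x₂ ⟩ ⟨ y₀ , y₁ , y₂ ⟩ ⟨ z₀ , z₁ , z₂ ⟩ k ⟨ a , b , c ⟩ =
      cong₃ (g k a b c x₀ y₀ z₀) (g k a b c x₁ y₁ z₁) (g k a b c x₂ y₂ z₂)
      where
      g : ∀ k a b c x y z → (k * a) * x + (k * b) * y + (k * c) * z ≡ k * (a * x + b * y + c * z)
      g = solve 7 (λ k a b c x y z → (k :* a) :* x :+ (k :* b) :* y :+ (k :* c) :* z := k :* (a :* x :+ b :* y :+ c :* z)) refl

    *-distribˡ : ∀ u v w → u ⊛ (v +ᴬ w) ≡ u ⊛ v +ᴬ u ⊛ w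
    *-distribˡ u v w = trans (mul-apply u (v +ᴬ w)) (trans (apply-+ _ _ _ v w)
      (sym (cong₂ _+ᴬ_ (mul-apply u v) (mul-apply u w))))

    *-·ʳ : ∀ k u v → u ⊛ (k ·ᴬ v) ≡ k ·ᴬ (u ⊛ v)
    *-·ʳ k u v = trans (mul-apply u (k ·ᴬ v)) (trans (apply-· _ _ _ k v) (cong (k ·ᴬ_) (sym (mul-apply u v))))

    *-distribʳ : ∀ u v w → (v +ᴬ w) ⊛ u ≡ v ⊛ u +ᴬ w ⊛ u
    *-distribʳ u v w = trans (*-comm₃ (v +ᴬ w) u) (trans (*-distribˡ u v w) (cong₂ _+ᴬ_ (*-comm₃ u v) (*-comm₃ u w)))

    *-·ˡ : ∀ k u v → (k ·ᴬ u) ⊛ v ≡ k ·ᴬ (u ⊛ v)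
    *-·ˡ k u v = trans (*-comm₃ (k ·ᴬ u) v) (trans (*-·ʳ k v u) (cong (k ·ᴬ_) (*-comm₃ v u)))

    X-⊛ : ∀ u v → X (v ⊛ u) ≡ v ⊛ X u
    X-⊛ u v = trans (cong X (mul-apply′ v u)) (trans (X-apply v u) (sym (mul-apply′ v (X u))))
      where
      mul-apply′ : ∀ v u → v ⊛ u ≡ apply u (X u) (X (X u)) v
      mul-apply′ v u = trans (*-comm₃ v u) (mul-apply u v)
      X-apply : ∀ v u → X (apply u (X u) (X (X u)) v) ≡ apply (X u) (X (X u)) (X (X (X u))) v
      X-apply ⟨ a , b , c ⟩ u = trans (X-+ ((a ·ᴬ u) +ᴬ (b ·ᴬ X u)) (c ·ᴬ X (X u)))
        (cong₂ _+ᴬ_ (trans (X-+ (a ·ᴬ u) (b ·ᴬ X u)) (cong₂ _+ᴬ_ (X-· a u) (X-· b (X u)))) (X-· c (X (X u))))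

    *-assoc₃ : ∀ u v w → (u ⊛ v) ⊛ w ≡ u ⊛ (v ⊛ w)
    *-assoc₃ u v w@(⟨ a , b , c ⟩) = trans (mul-apply (u ⊛ v) w) (trans
      (cong₂ (λ y z → ((a ·ᴬ (u ⊛ v)) +ᴬ (b ·ᴬ y)) +ᴬ (c ·ᴬ z)) (X-⊛ v u) (trans (cong X (X-⊛ v u)) (X-⊛ (X v) u)))
      (trans (sym (cong₂ _+ᴬ_ (cong₂ _+ᴬ_ (*-·ʳ a u v) (*-·ʳ b u (X v))) (*-·ʳ c u (X (X v)))))
      (trans (sym (trans (*-distribˡ u ((a ·ᴬ v) +ᴬ (b ·ᴬ X v)) (c ·ᴬ X (X v)))
        (cong (_+ᴬ u ⊛ (c ·ᴬ X (X v))) (*-distribˡ u (a ·ᴬ v) (b ·ᴬ X v)))))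
        (cong (u ⊛_) (sym (mul-apply v w))))))

    *-identityˡ₃ : ∀ u → 𝟙 ⊛ u ≡ u
    *-identityˡ₃ ⟨ a , b , c ⟩ = cong₃
      (solve 6 (λ τ α β a b c → d₀ (Sym._⊗_ τ α β ⟨ con 1ℚ , con 0ℚ , con 0ℚ ⟩ᴾ ⟨ a , b , c ⟩ᴾ) := a) refl τ α β a b c)
      (solve 6 (λ τ α β a b c → d₁ (Sym._⊗_ τ α β ⟨ con 1ℚ , con 0ℚ , con 0ℚ ⟩ᴾ ⟨ a , b , c ⟩ᴾ) := b) refl τ α β a b c)
      (solve 6 (λ τ α β a b c → d₂ (Sym._⊗_ τ α β ⟨ con 1ℚ , con 0ℚ , con 0ℚ ⟩ᴾ ⟨ a , b , c ⟩ᴾ) := c) refl τ α β a b c)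

    Tr Mi No : Alg → ℚ
    Tr u = tr u (X u) (X (X u))
    Mi u = minors u (X u) (X (X u))
    No u = det u (X u) (X (X u))

    No-⊛ : ∀ u v → No (u ⊛ v) ≡ No u * No v
    No-⊛ u v = trans (cong₃′ det (mul-apply u v) (trans (X-⊛ v u) (mul-apply u (X v)))
        (trans (cong X (X-⊛ v u)) (trans (X-⊛ (X v) u) (mul-apply u (X (X v))))))
      (det-apply u (X u) (X (X u)) v (X v) (X (X v)))
      where
      cong₃′ : ∀ (g : Alg → Alg → Alg → ℚ) {a b c a′ b′ c′} → a ≡ a′ → b ≡ b′ → c ≡ c′ → g a b c ≡ g a′ b′ c′
      cong₃′ g refl refl refl = refl

    Tr-square : ∀ u → Tr (u ⊛ u) ≡ Tr u * Tr u - (Mi u + Mi u)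
    Tr-square u = trans (cong₃′ tr (mul-apply u u) (trans (X-⊛ u u) (mul-apply u (X u)))
        (trans (cong X (X-⊛ u u)) (trans (X-⊛ (X u) u) (mul-apply u (X (X u))))))
      (tr-apply u (X u) (X (X u)))
      where
      cong₃′ : ∀ (g : Alg → Alg → Alg → ℚ) {a b c a′ b′ c′} → a ≡ a′ → b ≡ b′ → c ≡ c′ → g a b c ≡ g a′ b′ c′
      cong₃′ g refl refl refl = refl

    cubic-relation : ∀ u → u ⊛ (u ⊛ u) ≡ ((Tr u ·ᴬ (u ⊛ u)) +ᴬ ((- Mi u) ·ᴬ u)) +ᴬ ⟨ No u , 0ℚ , 0ℚ ⟩
    cubic-relation u = trans (trans (mul-apply u (u ⊛ u)) (cong (apply u (X u) (X (X u))) (mul-apply u u)))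
      (trans (cayley-hamilton u (X u) (X (X u)))
        (cong (λ w → ((Tr u ·ᴬ w) +ᴬ ((- Mi u) ·ᴬ u)) +ᴬ ⟨ No u , 0ℚ , 0ℚ ⟩) (sym (mul-apply u u))))

    X𝟙 : X 𝟙 ≡ ⟨ 0ℚ , 1ℚ , 0ℚ ⟩
    X𝟙 = cong₃ (solve 1 (λ β → :- (β :* con 0ℚ) := con 0ℚ) refl β)
      (solve 1 (λ β → con 1ℚ :- β :* con 0ℚ := con 1ℚ) refl α)
      (solve 1 (λ β → con 0ℚ :- β :* con 0ℚ := con 0ℚ) refl τ)

    XX𝟙 : X (X 𝟙) ≡ ⟨ 0ℚ , 0ℚ , 1ℚ ⟩
    XX𝟙 = trans (cong X X𝟙) (cong₃ (solve 1 (λ β → :- (β :* con 0ℚ) := con 0ℚ) refl β)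
      (solve 1 (λ β → con 0ℚ :- β :* con 0ℚ := con 0ℚ) refl α)
      (solve 1 (λ β → con 1ℚ :- β :* con 0ℚ := con 1ℚ) refl τ))

    No-1+ : ∀ u → No (𝟙 +ᴬ u) ≡ 1ℚ + Tr u + Mi u + No u
    No-1+ u = trans (cong₂ (det (𝟙 +ᴬ u)) (trans (X-+ 𝟙 u) (cong (_+ᴬ X u) X𝟙))
        (trans (cong X (X-+ 𝟙 u)) (trans (X-+ (X 𝟙) (X u)) (cong (_+ᴬ X (X u)) XX𝟙))))
      (det-1+ u (X u) (X (X u)))

    No-· : ∀ k u → No (k ·ᴬ u) ≡ k * (k * (k * No u))
    No-· k u = trans (cong₂ (det (k ·ᴬ u)) (X-· k u) (trans (cong X (X-· k u)) (X-· k (X u)))) (det-scale k u (X u) (X (X u)))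

    Mi-· : ∀ k u → Mi (k ·ᴬ u) ≡ k * (k * Mi u)
    Mi-· k u = trans (cong₂ (minors (k ·ᴬ u)) (X-· k u) (trans (cong X (X-· k u)) (X-· k (X u)))) (minors-scale k u (X u) (X (X u)))

    Tr-· : ∀ k u → Tr (k ·ᴬ u) ≡ k * Tr u
    Tr-· k u = trans (cong₂ (tr (k ·ᴬ u)) (X-· k u) (trans (cong X (X-· k u)) (X-· k (X u)))) (tr-scale k u (X u) (X (X u)))

-- Integral elements: integral characteristic polynomials and the ring property.

module IntegralElements where

  open import Data.Integer.Base as ℤ using (ℤ; 0ℤ; 1ℤ)
  import Data.Integer.Properties as ℤ
  open import Data.Integer.Divisibility.Signed using (divides; _∣_)
  open import Data.List.Base using ([]; _∷_; length)
  open import Data.Nat.Base as ℕ using (ℕ; zero; suc)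
  open import Data.Nat.Primality using (prime[2])
  import Data.Nat.Properties as ℕ
  open import Data.Product.Base using (_×_; _,_; proj₁)
  open import Data.Rational.Base hiding (_/_; truncate)
  open import Data.Rational.Properties
  open import Data.Sum.Base using ([_,_]′)
  open import Function.Base using (id)
  open import Relation.Binary.PropositionalEquality hiding ([_]; J)
  open import Relation.Nullary using (Dec; yes; no)
  open import Relation.Nullary.Decidable using (map′; _×-dec_)
  import Data.Rational.Solver
  open Data.Rational.Solver.+-*-Solver using (solve; con; _:=_; _:+_; _:-_; _:*_; :-_)

  open import Defs
  open CommonRoots using (prime-∣*)
  open RationalIntegers
  open CubicAlgebra

  IntA : Alg → Set
  IntA ⟨ a , b , c ⟩ = IsInt a × IsInt b × IsInt c

  IntA⇒InOrder : ∀ {u} → IntA u → InOrder u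
  IntA⇒InOrder ((a , refl) , (b , refl) , (c , refl)) = a , b , c , refl

  InOrder⇒IntA : ∀ {u} → InOrder u → IntA u
  InOrder⇒IntA (a , b , c , refl) = int a , int b , int c

  intA-+ : ∀ {u v} → IntA u → IntA v → IntA (u +ᴬ v)
  intA-+ (a , b , c) (d , e , g) = int-+ a d , int-+ b e , int-+ c g

  intA-· : ∀ {k u} → IsInt k → IntA u → IntA (k ·ᴬ u)
  intA-· k (a , b , c) = int-* k a , int-* k b , int-* k c

  ·-assoc : ∀ j k u → (j * k) ·ᴬ u ≡ j ·ᴬ (k ·ᴬ u)
  ·-assoc j k ⟨ a , b , c ⟩ = cong₃ (*-assoc j k a) (*-assoc j k b) (*-assoc j k c)

  ·-distrib : ∀ k u v → k ·ᴬ (u +ᴬ v) ≡ (k ·ᴬ u) +ᴬ (k ·ᴬ v)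
  ·-distrib k ⟨ a , b , c ⟩ ⟨ d , e , g ⟩ = cong₃ (*-distribˡ-+ k a d) (*-distribˡ-+ k b e) (*-distribˡ-+ k c g)

  1·_ : ∀ u → 1ℚ ·ᴬ u ≡ u
  1· ⟨ a , b , c ⟩ = cong₃ (*-identityˡ a) (*-identityˡ b) (*-identityˡ c)

  𝟘 : Alg
  𝟘 = ⟨ 0ℚ , 0ℚ , 0ℚ ⟩

  ℤ→ℚ≢0 : ∀ {a} → a ≢ 0ℤ → ℤ→ℚ a ≢ 0ℚ
  ℤ→ℚ≢0 a≢0 eq = a≢0 (ℤ→ℚ-injective eq)

  -- With n = 2q the integer 2q² is n²/2, so n² is even and therefore n is.
  halve-int : ∀ q → IsInt (q + q) → IsInt (q * q + q * q) → IsInt q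
  halve-int q (n , 2q) (m , 2q²) = go ([ id , id ]′ (prime-∣* {2} {n} {n} prime[2] (divides m n²≡)))
    where
    n²≡ : n ℤ.* n ≡ m ℤ.* ℤ.+ 2
    n²≡ = ℤ→ℚ-injective (trans (ℤ→ℚ-* n n) (trans (cong₂ _*_ (sym 2q) (sym 2q)) (trans (g q)
      (trans (cong (_* ℤ→ℚ (ℤ.+ 2)) 2q²) (sym (ℤ→ℚ-* m (ℤ.+ 2)))))))
      where
      g : ∀ q → (q + q) * (q + q) ≡ (q * q + q * q) * ℤ→ℚ (ℤ.+ 2)
      g = solve 1 (λ q → (q :+ q) :* (q :+ q) := (q :* q :+ q :* q) :* con (ℤ→ℚ (ℤ.+ 2))) refl
    go : ℤ.+ 2 ∣ n → IsInt q
    go (divides k n≡) = k , trans (g₁ q) (trans (cong (½ *_) (trans 2q (trans (cong ℤ→ℚ n≡) (ℤ→ℚ-* k (ℤ.+ 2))))) (g₂ (ℤ→ℚ k)))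
      where
      g₁ : ∀ q → q ≡ ½ * (q + q)
      g₁ = solve 1 (λ q → q := con ½ :* (q :+ q)) refl
      g₂ : ∀ k → ½ * (k * ℤ→ℚ (ℤ.+ 2)) ≡ k
      g₂ = solve 1 (λ k → con ½ :* (k :* con (ℤ→ℚ (ℤ.+ 2))) := k) refl

  module Integrality (f : V ℤ) where

    open Mul f public

    intA-X : ∀ {u} → IntA u → IntA (X u)
    intA-X (a , b , c) = int-neg (int-* (int (V.B f)) c) , int-sub a (int-* (int (V.A f)) c) ,
      int-sub b (int-* (int ⟦ V.t f ⟧) c)

    intA-⊛ : ∀ {u v} → IntA u → IntA v → IntA (u ⊛ v)
    intA-⊛ (a , b , c) v = intA-+ (intA-· a v) (intA-X (intA-+ (intA-· b v) (intA-X (intA-· c v))))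

    intA-𝟙 : IntA 𝟙
    intA-𝟙 = int-1 , int-0 , int-0

    int-No : ∀ {u} → IntA u → IsInt (No u)
    int-No u = go u (intA-X u) (intA-X (intA-X u))
      where
      go : ∀ {p q r} → IntA p → IntA q → IntA r → IsInt (det p q r)
      go (a , b , c) (d , e , g) (h , i , j) = int-+ (int-sub
        (int-* a (int-sub (int-* e j) (int-* g i))) (int-* b (int-sub (int-* d j) (int-* g h))))
        (int-* c (int-sub (int-* d i) (int-* e h)))

    scalar-⊛ : ∀ q u → ⟨ q , 0ℚ , 0ℚ ⟩ ⊛ u ≡ q ·ᴬ u
    scalar-⊛ q ⟨ a , b , c ⟩ = cong₃
      (solve 7 (λ τ α β q a b c → d₀ (Sym._⊗_ τ α β ⟨ q , con 0ℚ , con 0ℚ ⟩ᴾ ⟨ a , b , c ⟩ᴾ) := q :* a) refl τ α β q a b c)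
      (solve 7 (λ τ α β q a b c → d₁ (Sym._⊗_ τ α β ⟨ q , con 0ℚ , con 0ℚ ⟩ᴾ ⟨ a , b , c ⟩ᴾ) := q :* b) refl τ α β q a b c)
      (solve 7 (λ τ α β q a b c → d₂ (Sym._⊗_ τ α β ⟨ q , con 0ℚ , con 0ℚ ⟩ᴾ ⟨ a , b , c ⟩ᴾ) := q :* c) refl τ α β q a b c)
      where open Alg[_]

    *-identityʳ₃ : ∀ u → u ⊛ 𝟙 ≡ u
    *-identityʳ₃ u = trans (*-comm₃ u 𝟙) (*-identityˡ₃ u)

    ·-⊛ : ∀ j k u v → (j * k) ·ᴬ (u ⊛ v) ≡ (j ·ᴬ u) ⊛ (k ·ᴬ v)
    ·-⊛ j k u v = trans (·-assoc j k (u ⊛ v)) (trans (cong (j ·ᴬ_) (sym (*-·ʳ k u v))) (sym (*-·ˡ j u (k ·ᴬ v))))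

    *-left-comm : ∀ u v w → (u ⊛ v) ⊛ w ≡ v ⊛ (u ⊛ w)
    *-left-comm u v w = trans (cong (_⊛ w) (*-comm₃ u v)) (*-assoc₃ v u w)

    pow : Alg → ℕ → Alg
    pow u zero = 𝟙
    pow u (suc i) = u ⊛ pow u i

    pow-⊛ : ∀ u v i → pow (u ⊛ v) i ≡ pow u i ⊛ pow v i
    pow-⊛ u v zero = sym (*-identityˡ₃ 𝟙)
    pow-⊛ u v (suc i) = trans (cong ((u ⊛ v) ⊛_) (pow-⊛ u v i)) (trans (*-assoc₃ u v _)
      (trans (cong (u ⊛_) (trans (sym (*-assoc₃ v (pow u i) (pow v i))) (*-left-comm v (pow u i) (pow v i))))
        (sym (*-assoc₃ u (pow u i) (v ⊛ pow v i)))))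

    pow-· : ∀ k u i → pow (k ·ᴬ u) i ≡ (k ^ i) ·ᴬ pow u i
    pow-· k u zero = sym (1· 𝟙)
    pow-· k u (suc i) = trans (cong ((k ·ᴬ u) ⊛_) (pow-· k u i)) (sym (·-⊛ k (k ^ i) u (pow u i)))

    intA-pow : ∀ {u} → IntA u → ∀ i → IntA (pow u i)
    intA-pow h zero = intA-𝟙
    intA-pow h (suc i) = intA-⊛ h (intA-pow h i)

    -- Almost integrality: one denominator clears all powers of u. Sums and products preserve this
    -- directly, without constructing a monic equation for them.
    record Bounded (u : Alg) : Set where
      constructor bounded
      field
        D     : ℤ
        D≢0   : D ≢ 0ℤ
        clear : ∀ i → IntA (ℤ→ℚ D ·ᴬ pow u i)

    ≢0-* : ∀ {a b} → a ≢ 0ℤ → b ≢ 0ℤ → a ℤ.* b ≢ 0ℤ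
    ≢0-* {a} a≢0 b≢0 eq = b≢0 (ℤ.*-cancelˡ-≡ a _ _ {{ℤ.≢-nonZero a≢0}} (trans eq (sym (ℤ.*-zeroʳ a))))

    bounded-int : ∀ {u} → IntA u → Bounded u
    bounded-int h = bounded 1ℤ (λ ()) (λ i → intA-· int-1 (intA-pow h i))

    bounded-⊛ : ∀ {u v} → Bounded u → Bounded v → Bounded (u ⊛ v)
    bounded-⊛ {u} {v} (bounded D D≢0 h) (bounded E E≢0 k) = bounded (D ℤ.* E) (≢0-* D≢0 E≢0) λ i →
      subst IntA (trans (sym (·-⊛ (ℤ→ℚ D) (ℤ→ℚ E) (pow u i) (pow v i))) (cong₂ _·ᴬ_ (sym (ℤ→ℚ-* D E)) (sym (pow-⊛ u v i))))
        (intA-⊛ (h i) (k i))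

    -- Expanding one factor u + v at a time, with the powers of u and v already split off as
    -- accumulators, reduces everything to monomials u^a v^b, which D E clears.
    bounded-+ : ∀ {u v} → Bounded u → Bounded v → Bounded (u +ᴬ v)
    bounded-+ {u} {v} (bounded D D≢0 h) (bounded E E≢0 k) = bounded (D ℤ.* E) (≢0-* D≢0 E≢0) λ i →
      subst IntA (cong (K ·ᴬ_) (trans (*-identityʳ₃ _) (*-identityʳ₃ _))) (mixed i 0 0)
      where
      K = ℤ→ℚ (D ℤ.* E)
      mixed : ∀ i a b → IntA (K ·ᴬ ((pow (u +ᴬ v) i ⊛ pow u a) ⊛ pow v b))
      mixed zero a b = subst IntA (trans (sym (·-⊛ (ℤ→ℚ D) (ℤ→ℚ E) (pow u a) (pow v b)))
          (cong₂ _·ᴬ_ (sym (ℤ→ℚ-* D E)) (cong (_⊛ pow v b) (sym (*-identityˡ₃ (pow u a)))))) (intA-⊛ (h a) (k b))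
      mixed (suc i) a b = subst IntA (sym (trans (cong (K ·ᴬ_) expand) (·-distrib K _ _)))
        (intA-+ (mixed i (suc a) b) (mixed i a (suc b)))
        where
        P = pow (u +ᴬ v) i
        U = pow u a
        W = pow v b
        expand : (((u +ᴬ v) ⊛ P) ⊛ U) ⊛ W ≡ ((P ⊛ (u ⊛ U)) ⊛ W) +ᴬ ((P ⊛ U) ⊛ (v ⊛ W))
        expand = trans (cong (λ z → (z ⊛ U) ⊛ W) (*-distribʳ P u v))
          (trans (cong (_⊛ W) (*-distribʳ U (u ⊛ P) (v ⊛ P)))
          (trans (*-distribʳ W ((u ⊛ P) ⊛ U) ((v ⊛ P) ⊛ U))
            (cong₂ _+ᴬ_ (cong (_⊛ W) (*-left-comm u P U))
              (trans (cong (_⊛ W) (*-assoc₃ v P U)) (*-left-comm v (P ⊛ U) W)))))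

    bounded-· : ∀ {k u} → IsInt k → Bounded u → Bounded (k ·ᴬ u)
    bounded-· {k} {u} hk h = subst Bounded (scalar-⊛ k u) (bounded-⊛ (bounded-int (hk , int-0 , int-0)) h)

    bounded-X : ∀ {u} → Bounded u → Bounded (X u)
    bounded-X {u} h = subst Bounded (trans (sym (X-⊛ 𝟙 u)) (cong X (*-identityʳ₃ u)))
      (bounded-⊛ h (bounded-int (intA-X intA-𝟙)))

    No-𝟙 : No 𝟙 ≡ 1ℚ
    No-𝟙 = trans (cong₂ (det 𝟙) X𝟙 XX𝟙) refl

    No-pow : ∀ u i → No (pow u i) ≡ No u ^ i
    No-pow u zero = No-𝟙
    No-pow u (suc i) = trans (No-⊛ u (pow u i)) (cong (No u *_) (No-pow u i))

    -- The norm is multiplicative and homogeneous of degree 3, so D³ clears all powers of the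
    -- rational number No(u).
    bounded⇒No : ∀ {u} → Bounded u → IsInt (No u)
    bounded⇒No {u} (bounded D D≢0 h) = bounded-denominator⇒int (D ℤ.* (D ℤ.* D)) (No u) (≢0-* D≢0 (≢0-* D≢0 D≢0)) λ i →
      subst IsInt (trans (No-· (ℤ→ℚ D) (pow u i)) (trans (g (ℤ→ℚ D) (No (pow u i)))
        (cong₂ _*_ (sym (trans (ℤ→ℚ-* D (D ℤ.* D)) (cong (ℤ→ℚ D *_) (ℤ→ℚ-* D D)))) (No-pow u i)))) (int-No (h i))
      where
      g : ∀ d x → d * (d * (d * x)) ≡ d * (d * d) * x
      g = solve 2 (λ d x → d :* (d :* (d :* x)) := d :* (d :* d) :* x) refl

    private
      No-1- : ∀ u → No (𝟙 +ᴬ ((- 1ℚ) ·ᴬ u)) ≡ 1ℚ - Tr u + Mi u - No u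
      No-1- u = trans (No-1+ ((- 1ℚ) ·ᴬ u)) (trans
        (cong₂ _+_ (cong₂ _+_ (cong (1ℚ +_) (Tr-· (- 1ℚ) u)) (Mi-· (- 1ℚ) u)) (No-· (- 1ℚ) u))
        (g (Tr u) (Mi u) (No u)))
        where
        g : ∀ t s n → 1ℚ + - 1ℚ * t + - 1ℚ * (- 1ℚ * s) + - 1ℚ * (- 1ℚ * (- 1ℚ * n)) ≡ 1ℚ - t + s - n
        g = solve 3 (λ t s n → con 1ℚ :+ con (- 1ℚ) :* t :+ con (- 1ℚ) :* (con (- 1ℚ) :* s)
              :+ con (- 1ℚ) :* (con (- 1ℚ) :* (con (- 1ℚ) :* n)) := con 1ℚ :- t :+ s :- n) refl

    -- The characteristic polynomial takes integral values at -1, 0 and 1; the remaining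
    -- ambiguity of a half is excluded by applying this to u² as well.
    module _ {u} (h : Bounded u) where

      private
        n+ = bounded⇒No (bounded-+ (bounded-int intA-𝟙) h)
        n- = bounded⇒No (bounded-+ (bounded-int intA-𝟙) (bounded-· (int-neg int-1) h))
        n₀ = bounded⇒No h

      bounded⇒Tr+Mi : IsInt (Tr u + Mi u)
      bounded⇒Tr+Mi = subst IsInt (trans (cong (λ x → x - 1ℚ - No u) (No-1+ u)) (g (Tr u) (Mi u) (No u)))
        (int-sub (int-sub n+ int-1) n₀)
        where
        g : ∀ t s n → 1ℚ + t + s + n - 1ℚ - n ≡ t + s
        g = solve 3 (λ t s n → con 1ℚ :+ t :+ s :+ n :- con 1ℚ :- n := t :+ s) refl

      bounded⇒2Tr : IsInt (Tr u + Tr u)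
      bounded⇒2Tr = subst IsInt (trans (cong₂ (λ x y → x - y - (No u + No u)) (No-1+ u) (No-1- u)) (g (Tr u) (Mi u) (No u)))
        (int-sub (int-sub n+ n-) (int-+ n₀ n₀))
        where
        g : ∀ t s n → (1ℚ + t + s + n) - (1ℚ - t + s - n) - (n + n) ≡ t + t
        g = solve 3 (λ t s n → (con 1ℚ :+ t :+ s :+ n) :- (con 1ℚ :- t :+ s :- n) :- (n :+ n) := t :+ t) refl

    bounded⇒Tr : ∀ {u} → Bounded u → IsInt (Tr u)
    bounded⇒Tr {u} h = halve-int (Tr u) (bounded⇒2Tr h) (subst IsInt
        (trans (cong (λ x → (x + x) + (M + M)) (Tr-square u)) (g (Tr u) (Mi u)))
        (int-+ (bounded⇒2Tr (bounded-⊛ h h)) (int-+ 2M 2M)))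
      where
      M = Mi u + Mi u
      2M : IsInt M
      2M = subst IsInt (g′ (Tr u) (Mi u)) (int-sub (int-+ (bounded⇒Tr+Mi h) (bounded⇒Tr+Mi h)) (bounded⇒2Tr h))
        where
        g′ : ∀ t s → (t + s) + (t + s) - (t + t) ≡ s + s
        g′ = solve 2 (λ t s → (t :+ s) :+ (t :+ s) :- (t :+ t) := s :+ s) refl
      g : ∀ t s → (t * t - (s + s)) + (t * t - (s + s)) + ((s + s) + (s + s)) ≡ t * t + t * t
      g = solve 2 (λ t s → (t :* t :- (s :+ s)) :+ (t :* t :- (s :+ s)) :+ ((s :+ s) :+ (s :+ s)) := t :* t :+ t :* t) refl

    bounded⇒Mi : ∀ {u} → Bounded u → IsInt (Mi u)
    bounded⇒Mi {u} h = subst IsInt (g (Tr u) (Mi u)) (int-sub (bounded⇒Tr+Mi h) (bounded⇒Tr h))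
      where
      g : ∀ t s → (t + s) - t ≡ s
      g = solve 2 (λ t s → (t :+ s) :- t := s) refl

    CharInt : Alg → Set
    CharInt u = IsInt (Tr u) × IsInt (Mi u) × IsInt (No u)

    -- The characteristic polynomial is the monic equation; unfolding Horner's rule turns it into
    -- the Cayley-Hamilton relation.
    charInt⇒integral : ∀ u → CharInt u → Integral f u
    charInt⇒integral u ((T , Tr≡) , (S , Mi≡) , (N , No≡)) = ℤ.- N ∷ S ∷ ℤ.- T ∷ [] ,
      trans (cong₂ (λ n w → ⟨ n , 0ℚ , 0ℚ ⟩ +ᴬ w) (trans (ℤ→ℚ-neg N) (cong -_ (sym No≡)))
        (trans (*-distribˡ u (ℤ→Alg S) (u ⊛ w₁)) (cong₂ _+ᴬ_
          (trans (*-comm₃ u (ℤ→Alg S)) (trans (scalar-⊛ (ℤ→ℚ S) u) (cong (_·ᴬ u) (sym Mi≡))))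
          (trans (cong (u ⊛_) w₁≡) (trans (*-distribˡ u ((- Tr u) ·ᴬ u) (u ⊛ u))
            (cong₂ _+ᴬ_ (*-·ʳ (- Tr u) u u) (cubic-relation u)))))))
      (cancel (Tr u) (Mi u) (No u) u (u ⊛ u))
      where
      w₁ = ℤ→Alg (ℤ.- T) +ᴬ u ⊛ 𝟙
      w₁≡ : u ⊛ w₁ ≡ ((- Tr u) ·ᴬ u) +ᴬ (u ⊛ u)
      w₁≡ = trans (*-distribˡ u (ℤ→Alg (ℤ.- T)) (u ⊛ 𝟙)) (cong₂ _+ᴬ_
        (trans (*-comm₃ u (ℤ→Alg (ℤ.- T))) (trans (scalar-⊛ (ℤ→ℚ (ℤ.- T)) u)
          (cong (_·ᴬ u) (trans (ℤ→ℚ-neg T) (cong -_ (sym Tr≡))))))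
        (cong (u ⊛_) (*-identityʳ₃ u)))
      cancel : ∀ t s n u w → ⟨ - n , 0ℚ , 0ℚ ⟩ +ᴬ ((s ·ᴬ u) +ᴬ (((- t) ·ᴬ w) +ᴬ (((t ·ᴬ w) +ᴬ ((- s) ·ᴬ u)) +ᴬ ⟨ n , 0ℚ , 0ℚ ⟩))) ≡ 𝟘
      cancel t s n ⟨ a , b , c ⟩ ⟨ d , e , g ⟩ = cong₃ (g₀ t s n a d) (g₁ t s b e) (g₁ t s c g)
        where
        g₀ : ∀ t s n a d → - n + (s * a + (- t * d + (t * d + - s * a + n))) ≡ 0ℚ
        g₀ = solve 5 (λ t s n a d → :- n :+ (s :* a :+ (:- t :* d :+ (t :* d :+ :- s :* a :+ n))) := con 0ℚ) refl
        g₁ : ∀ t s a d → 0ℚ + (s * a + (- t * d + (t * d + - s * a + 0ℚ))) ≡ 0ℚ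
        g₁ = solve 4 (λ t s a d → con 0ℚ :+ (s :* a :+ (:- t :* d :+ (t :* d :+ :- s :* a :+ con 0ℚ))) := con 0ℚ) refl

    module _ (u : Alg) where

      private
        D₀ : ℤ
        D₀ = ↧ (Alg.c₀ u) ℤ.* (↧ (Alg.c₁ u) ℤ.* ↧ (Alg.c₂ u))

        ↧≢0 : ∀ q → ↧ q ≢ 0ℤ
        ↧≢0 q eq = ℕ.≢-nonZero⁻¹ (↧ₙ q) (ℤ.+-injective eq)

        D₀≢0 : D₀ ≢ 0ℤ
        D₀≢0 = ≢0-* (↧≢0 (Alg.c₀ u)) (≢0-* (↧≢0 (Alg.c₁ u)) (↧≢0 (Alg.c₂ u)))

        denominators : ∀ a b c → IsInt (ℤ→ℚ (↧ a ℤ.* (↧ b ℤ.* ↧ c)) * a) × IsInt (ℤ→ℚ (↧ a ℤ.* (↧ b ℤ.* ↧ c)) * b)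
          × IsInt (ℤ→ℚ (↧ a ℤ.* (↧ b ℤ.* ↧ c)) * c)
        denominators a b c =
          subst IsInt (trans (cong₂ _*_ (sym (scale a)) (ℤ→ℚ-* (↧ b) (↧ c))) (trans (g₁ a (ℤ→ℚ (↧ a)) (ℤ→ℚ (↧ b)) (ℤ→ℚ (↧ c))) (cong (_* a) (sym D≡))))
            (int-* (int (↥ a)) (int (↧ b ℤ.* ↧ c))) ,
          subst IsInt (trans (cong₂ _*_ (sym (scale b)) (ℤ→ℚ-* (↧ a) (↧ c))) (trans (g₂ b (ℤ→ℚ (↧ a)) (ℤ→ℚ (↧ b)) (ℤ→ℚ (↧ c))) (cong (_* b) (sym D≡))))
            (int-* (int (↥ b)) (int (↧ a ℤ.* ↧ c))) ,
          subst IsInt (trans (cong₂ _*_ (sym (scale c)) (ℤ→ℚ-* (↧ a) (↧ b))) (trans (g₃ c (ℤ→ℚ (↧ a)) (ℤ→ℚ (↧ b)) (ℤ→ℚ (↧ c))) (cong (_* c) (sym D≡))))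
            (int-* (int (↥ c)) (int (↧ a ℤ.* ↧ b)))
          where
          D≡ : ℤ→ℚ (↧ a ℤ.* (↧ b ℤ.* ↧ c)) ≡ ℤ→ℚ (↧ a) * (ℤ→ℚ (↧ b) * ℤ→ℚ (↧ c))
          D≡ = trans (ℤ→ℚ-* (↧ a) (↧ b ℤ.* ↧ c)) (cong (ℤ→ℚ (↧ a) *_) (ℤ→ℚ-* (↧ b) (↧ c)))
          g₁ : ∀ q x y z → q * x * (y * z) ≡ x * (y * z) * q
          g₁ = solve 4 (λ q x y z → q :* x :* (y :* z) := x :* (y :* z) :* q) refl
          g₂ : ∀ q x y z → q * y * (x * z) ≡ x * (y * z) * q
          g₂ = solve 4 (λ q x y z → q :* y :* (x :* z) := x :* (y :* z) :* q) refl
          g₃ : ∀ q x y z → q * z * (x * y) ≡ x * (y * z) * q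
          g₃ = solve 4 (λ q x y z → q :* z :* (x :* y) := x :* (y :* z) :* q) refl

        low : ∀ d j → j ℕ.≤ d → IntA (ℤ→ℚ (D₀ ℤ.^ d) ·ᴬ pow u j)
        low d j j≤d = subst IntA (trans (cong (ℤ→ℚ (D₀ ℤ.^ (d ℕ.∸ j)) ·ᴬ_) (pow-· (ℤ→ℚ D₀) u j))
            (trans (sym (·-assoc (ℤ→ℚ (D₀ ℤ.^ (d ℕ.∸ j))) (ℤ→ℚ D₀ ^ j) (pow u j))) (cong (_·ᴬ pow u j) (trans (cong (ℤ→ℚ (D₀ ℤ.^ (d ℕ.∸ j)) *_) (sym (ℤ→ℚ-^ D₀ j)))
              (trans (sym (ℤ→ℚ-* (D₀ ℤ.^ (d ℕ.∸ j)) (D₀ ℤ.^ j))) (cong ℤ→ℚ (trans (sym (ℤ.^-distribˡ-+-* D₀ (d ℕ.∸ j) j)) (cong (D₀ ℤ.^_) (ℕ.m∸n+n≡m j≤d)))))))))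
          (intA-· (int (D₀ ℤ.^ (d ℕ.∸ j))) (intA-pow (denominators (Alg.c₀ u) (Alg.c₁ u) (Alg.c₂ u)) j))

        -- Follows Horner's rule. Peeling off one coefficient passes a factor u from the remaining
        -- polynomial to the power u^i, until only the leading term is left.
        extend : ∀ K cs i → (∀ j → i ℕ.≤ j → j ℕ.< i ℕ.+ length cs → IntA (K ·ᴬ pow u j)) →
          IntA (K ·ᴬ (evalMonic f cs u ⊛ pow u i)) → IntA (K ·ᴬ pow u (i ℕ.+ length cs))
        extend K [] i _ h = subst IntA (cong (K ·ᴬ_) (trans (*-identityˡ₃ (pow u i)) (cong (pow u) (sym (ℕ.+-identityʳ i))))) h
        extend K (c ∷ cs) i lower h = subst (λ j → IntA (K ·ᴬ pow u j)) (sym (ℕ.+-suc i (length cs)))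
          (extend K cs (suc i) (λ j i<j j< → lower j (ℕ.<⇒≤ i<j) (ℕ.<-≤-trans j< (ℕ.≤-reflexive (sym (ℕ.+-suc i (length cs))))))
            (subst IntA rearrange (intA-+ h (intA-· (int-neg (int c)) (lower i ℕ.≤-refl (ℕ.m<m+n i (ℕ.s≤s ℕ.z≤n)))))))
          where
          W = evalMonic f cs u
          P = pow u i
          kill : ∀ K c p w → (K ·ᴬ ((c ·ᴬ p) +ᴬ w)) +ᴬ ((- c) ·ᴬ (K ·ᴬ p)) ≡ K ·ᴬ w
          kill K c ⟨ x , y , z ⟩ ⟨ x′ , y′ , z′ ⟩ = cong₃ (g K c x x′) (g K c y y′) (g K c z z′)
            where
            g : ∀ K c p w → K * (c * p + w) + - c * (K * p) ≡ K * w
            g = solve 4 (λ K c p w → K :* (c :* p :+ w) :+ :- c :* (K :* p) := K :* w) refl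
          rearrange : (K ·ᴬ ((ℤ→Alg c +ᴬ u ⊛ W) ⊛ P)) +ᴬ ((- ℤ→ℚ c) ·ᴬ (K ·ᴬ P)) ≡ K ·ᴬ (W ⊛ (u ⊛ P))
          rearrange = trans (cong (λ z → (K ·ᴬ z) +ᴬ ((- ℤ→ℚ c) ·ᴬ (K ·ᴬ P))) (trans (*-distribʳ P (ℤ→Alg c) (u ⊛ W))
            (cong (_+ᴬ ((u ⊛ W) ⊛ P)) (scalar-⊛ (ℤ→ℚ c) P)))) (trans (kill K (ℤ→ℚ c) P ((u ⊛ W) ⊛ P)) (cong (K ·ᴬ_) (*-left-comm u W P)))

      -- For an equation of degree d, the d-th power of a common denominator of the coordinates
      -- clears u^j for j ≤ d. Higher powers are integral combinations of lower ones and need no new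
      -- denominator.
      integral⇒bounded : Integral f u → Bounded u
      integral⇒bounded (cs , eq) = bounded (D₀ ℤ.^ d) (D^≢0 d) (λ i → below (suc i) i ℕ.≤-refl)
        where
        d = length cs
        K = ℤ→ℚ (D₀ ℤ.^ d)
        D^≢0 : ∀ d → D₀ ℤ.^ d ≢ 0ℤ
        D^≢0 zero ()
        D^≢0 (suc d) = ≢0-* D₀≢0 (D^≢0 d)
        zero-int : ∀ i → IntA (K ·ᴬ (evalMonic f cs u ⊛ pow u i))
        zero-int i = subst IntA (cong (λ z → K ·ᴬ (z ⊛ pow u i)) (sym eq))
          (intA-· (int (D₀ ℤ.^ d)) (subst IntA (sym (scalar-⊛ 0ℚ (pow u i))) (zeros (pow u i))))
          where
          zeros : ∀ w → IntA (0ℚ ·ᴬ w)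
          zeros ⟨ a , b , c ⟩ = (0ℤ , *-zeroˡ a) , (0ℤ , *-zeroˡ b) , (0ℤ , *-zeroˡ c)
        below : ∀ m j → j ℕ.< m → IntA (K ·ᴬ pow u j)
        below (suc m) j j<m with j ℕ.≤? d
        ... | yes j≤d = low d j j≤d
        ... | no j≰d = subst (λ j → IntA (K ·ᴬ pow u j)) (ℕ.m∸n+n≡m d≤j)
            (extend K cs (j ℕ.∸ d) (λ i _ i< → below m i (ℕ.<-≤-trans i< (ℕ.≤-trans (ℕ.≤-reflexive (ℕ.m∸n+n≡m d≤j)) (ℕ.≤-pred j<m)))) (zero-int (j ℕ.∸ d)))
          where d≤j = ℕ.<⇒≤ (ℕ.≰⇒> j≰d)

    integral⇒charInt : ∀ u → Integral f u → CharInt u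
    integral⇒charInt u h = let b = integral⇒bounded u h in bounded⇒Tr b , bounded⇒Mi b , bounded⇒No b

    record 𝒪 (u : Alg) : Set where
      constructor 𝒪-intro
      field
        integral : Integral f u

    open 𝒪 public

    𝒪-bounded : ∀ {u} → 𝒪 u → Bounded u
    𝒪-bounded {u} (𝒪-intro h) = integral⇒bounded u h

    bounded-𝒪 : ∀ {u} → Bounded u → 𝒪 u
    bounded-𝒪 {u} b = 𝒪-intro (charInt⇒integral u (bounded⇒Tr b , bounded⇒Mi b , bounded⇒No b))

    opaque
      -- Integrality amounts to three rational numbers being integers. Its decidability allows the
      -- least denominators of integral elements to be found by search.
      𝒪? : ∀ u → Dec (𝒪 u)
      𝒪? u = map′ (λ h → 𝒪-intro (charInt⇒integral u h)) (λ h → integral⇒charInt u (integral h))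
        (int? (Tr u) ×-dec int? (Mi u) ×-dec int? (No u))

    𝒪-int : ∀ {u} → IntA u → 𝒪 u
    𝒪-int h = bounded-𝒪 (bounded-int h)

    𝒪-+ : ∀ {u v} → 𝒪 u → 𝒪 v → 𝒪 (u +ᴬ v)
    𝒪-+ h k = bounded-𝒪 (bounded-+ (𝒪-bounded h) (𝒪-bounded k))

    𝒪-⊛ : ∀ {u v} → 𝒪 u → 𝒪 v → 𝒪 (u ⊛ v)
    𝒪-⊛ h k = bounded-𝒪 (bounded-⊛ (𝒪-bounded h) (𝒪-bounded k))

    𝒪-· : ∀ {k u} → IsInt k → 𝒪 u → 𝒪 (k ·ᴬ u)
    𝒪-· hk h = bounded-𝒪 (bounded-· hk (𝒪-bounded h))

    -ᴬ-as-+ : ∀ u v → u -ᴬ v ≡ u +ᴬ ((- 1ℚ) ·ᴬ v)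
    -ᴬ-as-+ ⟨ a , b , c ⟩ ⟨ d , e , g ⟩ = cong₃ (k a d) (k b e) (k c g)
      where
      k : ∀ x y → x - y ≡ x + - 1ℚ * y
      k = solve 2 (λ x y → x :- y := x :+ con (- 1ℚ) :* y) refl

    𝒪-- : ∀ {u v} → 𝒪 u → 𝒪 v → 𝒪 (u -ᴬ v)
    𝒪-- {u} {v} h k = subst 𝒪 (sym (-ᴬ-as-+ u v)) (𝒪-+ h (𝒪-· (int-neg int-1) k))

    𝒪-X : ∀ {u} → 𝒪 u → 𝒪 (X u)
    𝒪-X h = bounded-𝒪 (bounded-X (𝒪-bounded h))

    𝒪-rational : ∀ {q} → 𝒪 ⟨ q , 0ℚ , 0ℚ ⟩ → IsInt q
    𝒪-rational {q} h = let bounded D D≢0 clear = 𝒪-bounded h in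
      bounded-denominator⇒int D q D≢0 (λ i → subst (λ w → IsInt (ℤ→ℚ D * Alg.c₀ w)) (scalar-pow i) (proj₁ (clear i)))
      where
      scalar-pow : ∀ i → pow ⟨ q , 0ℚ , 0ℚ ⟩ i ≡ ⟨ q ^ i , 0ℚ , 0ℚ ⟩
      scalar-pow zero = refl
      scalar-pow (suc i) = trans (cong (⟨ q , 0ℚ , 0ℚ ⟩ ⊛_) (scalar-pow i)) (trans (scalar-⊛ q _)
        (cong₂ (λ y z → ⟨ q * q ^ i , y , z ⟩) (*-zeroʳ q) (*-zeroʳ q)))

-- Denominators of integral elements and uniqueness of the index.

module OrderLattice where

  open import Data.Empty using (⊥-elim)
  open import Data.Fin.Base as Fin using (Fin)
  import Data.Fin.Properties as Fin
  open import Data.Integer.Base as ℤ using (ℤ; 0ℤ)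
  open import Data.Integer.DivMod using (_%ℕ_; _/ℕ_; n%ℕd<d; a≡a%ℕn+[a/ℕn]*n)
  import Data.Integer.Properties as ℤ
  open import Data.Integer.Divisibility.Signed using (_∣_)
  open import Data.Nat.Base as ℕ using (ℕ; zero; suc)
  import Data.Nat.Properties as ℕ
  open import Data.Product.Base using (∃; _×_; _,_; proj₁; proj₂)
  open import Data.Rational.Base hiding (_/_; truncate)
  open import Data.Rational.Properties
  open import Relation.Binary.PropositionalEquality hiding ([_]; J)
  open import Relation.Nullary using (Dec)
  import Data.Rational.Solver
  open Data.Rational.Solver.+-*-Solver using (Polynomial; solve; con; _:=_; _:+_; _:-_; _:*_; :-_)

  open import Defs
  open ResidueCounts using (least)
  open RationalIntegers
  open CubicAlgebra
  open IntegralElements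

  infixl 6 _⟨+⟩_ _⟨-⟩_
  infixl 7 _⟨*⟩_

  -- Certificates, assembled along the syntax, that an integer expression maps to the same
  -- expression over ℚ.
  record _↦_ (a : ℤ) (q : ℚ) : Set where
    constructor ↦-intro
    field image : ℤ→ℚ a ≡ q

  _⟨+⟩_ : ∀ {a b p q} → a ↦ p → b ↦ q → (a ℤ.+ b) ↦ (p + q)
  _⟨+⟩_ {a} {b} (↦-intro refl) (↦-intro refl) = ↦-intro (ℤ→ℚ-+ a b)

  _⟨-⟩_ : ∀ {a b p q} → a ↦ p → b ↦ q → (a ℤ.- b) ↦ (p - q)
  _⟨-⟩_ {a} {b} (↦-intro refl) (↦-intro refl) = ↦-intro (ℤ→ℚ-sub a b)

  _⟨*⟩_ : ∀ {a b p q} → a ↦ p → b ↦ q → (a ℤ.* b) ↦ (p * q)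
  _⟨*⟩_ {a} {b} (↦-intro refl) (↦-intro refl) = ↦-intro (ℤ→ℚ-* a b)

  Δℚ : ℚ → ℚ → ℚ → ℚ
  Δℚ b c d = b ^ 2 * c ^ 2 - ℤ→ℚ (ℤ.+ 4) * c ^ 3 - ℤ→ℚ (ℤ.+ 4) * b ^ 3 * d
    + ℤ→ℚ (ℤ.+ 18) * b * c * d - ℤ→ℚ (ℤ.+ 27) * d ^ 2

  ℤ→ℚ-Δ : ∀ f → ℤ→ℚ (Δ f) ≡ Δℚ (ℤ→ℚ ⟦ V.t f ⟧) (ℤ→ℚ (V.A f)) (ℤ→ℚ (V.B f))
  ℤ→ℚ-Δ f = _↦_.image (pow b 2 ⟨*⟩ pow c 2 ⟨-⟩ lit (ℤ.+ 4) ⟨*⟩ pow c 3 ⟨-⟩ lit (ℤ.+ 4) ⟨*⟩ pow b 3 ⟨*⟩ lit d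
    ⟨+⟩ lit (ℤ.+ 18) ⟨*⟩ lit b ⟨*⟩ lit c ⟨*⟩ lit d ⟨-⟩ lit (ℤ.+ 27) ⟨*⟩ pow d 2)
    where
    b = ⟦ V.t f ⟧
    c = V.A f
    d = V.B f
    lit : ∀ a → a ↦ ℤ→ℚ a
    lit a = ↦-intro refl
    pow : ∀ a i → (a ℤ.^ i) ↦ (ℤ→ℚ a ^ i)
    pow a i = ↦-intro (ℤ→ℚ-^ a i)

  -- A subgroup of ℚ that contains 1 and has common denominator D is generated by its least positive
  -- multiple of 1/D, by division with remainder. As 1 is a multiple of the generator, the generator
  -- is 1/`index`.
  module Cyclic (G : ℚ → Set) (G? : ∀ q → Dec (G q)) (G-1 : G 1ℚ)
                (G-combine : ∀ {p q} z → G p → G q → G (p - ℤ→ℚ z * q))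
                (D : ℕ) {{D≢0 : ℕ.NonZero D}} (δ : ℚ) (δD : δ * ℤ→ℚ (ℤ.+ D) ≡ 1ℚ)
                (G-D : ∀ {q} → G q → IsInt (ℤ→ℚ (ℤ.+ D) * q)) where

    private
      -- The numerator is `suc m`, so that the least element found is positive.
      P : ℕ → Set
      P m = G (ℤ→ℚ (ℤ.+ suc m) * δ)

      P-D : P (ℕ.pred D)
      P-D = subst G (trans (sym δD) (trans (*-comm δ _) (cong (λ d → ℤ→ℚ (ℤ.+ d) * δ) (sym (ℕ.suc-pred D))))) G-1

      minimum = least {P = P} (λ m → G? (ℤ→ℚ (ℤ.+ suc m) * δ)) (ℕ.pred D) P-D
      m = proj₁ minimum
      j = suc m

      P-m : P m
      P-m = proj₁ (proj₂ (proj₂ minimum))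

      m-least : ∀ m′ → P m′ → m ℕ.≤ m′
      m-least = proj₂ (proj₂ (proj₂ minimum))

    generator : ℚ
    generator = ℤ→ℚ (ℤ.+ j) * δ

    G-generator : G generator
    G-generator = P-m

    private
      multiple : ∀ {p} → G p → ∃ λ q → p ≡ ℤ→ℚ q * generator
      multiple {p} Gp = q , trans p≡ (trans (cong (λ r → (ℤ→ℚ (ℤ.+ r) + ℤ→ℚ q * ℤ→ℚ (ℤ.+ j)) * δ) (remainder-0 ρ refl))
          (g₀ (ℤ→ℚ q) (ℤ→ℚ (ℤ.+ j)) δ))
        where
        z = proj₁ (G-D Gp)
        ρ = z %ℕ j
        q = z /ℕ j
        z≡ : ℤ→ℚ (ℤ.+ D) * p ≡ ℤ→ℚ (ℤ.+ ρ) + ℤ→ℚ q * ℤ→ℚ (ℤ.+ j)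
        z≡ = trans (proj₂ (G-D Gp)) (trans (cong ℤ→ℚ (a≡a%ℕn+[a/ℕn]*n z j))
          (trans (ℤ→ℚ-+ (ℤ.+ ρ) (q ℤ.* ℤ.+ j)) (cong (ℤ→ℚ (ℤ.+ ρ) +_) (ℤ→ℚ-* q (ℤ.+ j)))))
        p≡ : p ≡ (ℤ→ℚ (ℤ.+ ρ) + ℤ→ℚ q * ℤ→ℚ (ℤ.+ j)) * δ
        p≡ = trans (sym (*-identityˡ p)) (trans (cong (_* p) (sym δD)) (trans (g δ (ℤ→ℚ (ℤ.+ D)) p) (cong (_* δ) z≡)))
          where
          g : ∀ x d p → x * d * p ≡ d * p * x
          g = solve 3 (λ x d p → x :* d :* p := d :* p :* x) refl
        g₀ : ∀ q j x → (0ℚ + q * j) * x ≡ q * (j * x)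
        g₀ = solve 3 (λ q j x → (con 0ℚ :+ q :* j) :* x := q :* (j :* x)) refl
        g₁ : ∀ r q j x → (r + q * j) * x - q * (j * x) ≡ r * x
        g₁ = solve 4 (λ r q j x → (r :+ q :* j) :* x :- q :* (j :* x) := r :* x) refl
        remainder-0 : ∀ r → ρ ≡ r → ρ ≡ 0
        remainder-0 zero eq = eq
        remainder-0 (suc r) eq = ⊥-elim (ℕ.<-irrefl refl (ℕ.<-≤-trans (subst (ℕ._< j) eq (n%ℕd<d z j))
          (ℕ.s≤s (m-least r (subst (λ x → G (ℤ→ℚ (ℤ.+ x) * δ)) eq
            (subst G (trans (cong (_- ℤ→ℚ q * generator) p≡) (g₁ (ℤ→ℚ (ℤ.+ ρ)) (ℤ→ℚ q) (ℤ→ℚ (ℤ.+ j)) δ))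
              (G-combine q Gp G-generator)))))))

      k′ : ℤ
      k′ = proj₁ (multiple G-1)

      D≡k′j : ℤ.+ D ≡ k′ ℤ.* ℤ.+ j
      D≡k′j = ℤ→ℚ-injective (trans (sym (*-identityˡ _)) (trans (cong (_* ℤ→ℚ (ℤ.+ D)) (proj₂ (multiple G-1)))
        (trans (g (ℤ→ℚ k′) (ℤ→ℚ (ℤ.+ j)) δ (ℤ→ℚ (ℤ.+ D))) (trans (cong (ℤ→ℚ k′ * ℤ→ℚ (ℤ.+ j) *_) δD)
          (trans (*-identityʳ _) (sym (ℤ→ℚ-* k′ (ℤ.+ j))))))))
        where
        g : ∀ k j x d → k * (j * x) * d ≡ k * j * (x * d)
        g = solve 4 (λ k j x d → k :* (j :* x) :* d := k :* j :* (x :* d)) refl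

    index : ℕ
    index = ℤ.∣ k′ ∣

    private
      D≡kj : D ≡ index ℕ.* j
      D≡kj = trans (cong ℤ.∣_∣ D≡k′j) (ℤ.abs-* k′ (ℤ.+ j))

    index≢0 : ℕ.NonZero index
    index≢0 = ℕ.≢-nonZero (λ eq → ℕ.≢-nonZero⁻¹ D (trans D≡kj (cong (ℕ._* j) eq)))

    generator-inverse : generator * ℤ→ℚ (ℤ.+ index) ≡ 1ℚ
    generator-inverse = trans (g (ℤ→ℚ (ℤ.+ j)) δ (ℤ→ℚ (ℤ.+ index))) (trans (cong (δ *_)
        (trans (sym (ℤ→ℚ-* (ℤ.+ index) (ℤ.+ j))) (cong ℤ→ℚ (trans (sym (ℤ.pos-* index j)) (cong ℤ.+_ (sym D≡kj)))))) δD)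
      where
      g : ∀ j x k → j * x * k ≡ x * (k * j)
      g = solve 3 (λ j x k → j :* x :* k := x :* (k :* j)) refl

    index-int : ∀ {p} → G p → IsInt (ℤ→ℚ (ℤ.+ index) * p)
    index-int Gp = let q , p≡ = multiple Gp in q , trans (cong (ℤ→ℚ (ℤ.+ index) *_) p≡)
      (trans (g (ℤ→ℚ (ℤ.+ index)) (ℤ→ℚ q) generator) (trans (cong (ℤ→ℚ q *_) generator-inverse) (*-identityʳ _)))
      where
      g : ∀ k q y → k * (q * y) ≡ q * (y * k)
      g = solve 3 (λ k q y → k :* (q :* y) := q :* (y :* k)) refl

  -- Sending each representative to the one of its coset in the other system is injective. Applied
  -- in both directions this gives equality.
  index-unique : ∀ {f k l} → IsIndex f k → IsIndex f l → k ℕ.≤ l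
  index-unique {f} {k} {l} I J = Fin.injective⇒≤ {f = c} injective
    where
    open Integrality f
    module I = IsIndex I
    module J = IsIndex J
    c : Fin k → Fin l
    c i = proj₁ (J.covers (I.rep i) (I.integral i))
    near : ∀ i → IntA (I.rep i -ᴬ J.rep (c i))
    near i = InOrder⇒IntA (proj₂ (J.covers (I.rep i) (I.integral i)))
    injective : ∀ {i j} → c i ≡ c j → i ≡ j
    injective {i} {j} eq = I.distinct i j (IntA⇒InOrder (subst IntA (g (I.rep i) (I.rep j) (J.rep (c j)))
      (intA-sub (subst (λ x → IntA (I.rep i -ᴬ J.rep x)) eq (near i)) (near j))))
      where
      intA-sub : ∀ {u v} → IntA u → IntA v → IntA (u -ᴬ v)
      intA-sub (a , b , c) (d , e , g) = int-sub a d , int-sub b e , int-sub c g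
      g : ∀ u v w → (u -ᴬ w) -ᴬ (v -ᴬ w) ≡ u -ᴬ v
      g ⟨ a , b , c ⟩ ⟨ a′ , b′ , c′ ⟩ ⟨ d , e , g ⟩ = cong₃ (h a a′ d) (h b b′ e) (h c c′ g)
        where
        h : ∀ a b d → (a - d) - (b - d) ≡ a - b
        h = solve 3 (λ a b d → (a :- d) :- (b :- d) := a :- b) refl

  module Lattice (f : V ℤ) (Δ≢0 : Δ f ≢ 0ℤ) where

    open Integrality f public

    -- Cramer's rule for the trace form, whose Gram determinant is the discriminant.
    discriminant-clears : ∀ {u} → 𝒪 u → IntA (ℤ→ℚ (Δ f) ·ᴬ u)
    discriminant-clears {u@(⟨ a , b , c ⟩)} h =
      subst IsInt (trans (row₀ τ α β a b c) (cong (_* a) (sym (ℤ→ℚ-Δ f)))) (combine′ (proj₁ ints) (proj₁ (proj₂ ints)) (proj₁ (proj₂ (proj₂ ints)))) ,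
      subst IsInt (trans (row₁ τ α β a b c) (cong (_* b) (sym (ℤ→ℚ-Δ f)))) (combine′ (proj₁ (proj₂ ints)) (proj₁ (proj₂ (proj₂ (proj₂ ints)))) (proj₁ (proj₂ (proj₂ (proj₂ (proj₂ ints)))))) ,
      subst IsInt (trans (row₂ τ α β a b c) (cong (_* c) (sym (ℤ→ℚ-Δ f)))) (combine′ (proj₁ (proj₂ (proj₂ ints))) (proj₁ (proj₂ (proj₂ (proj₂ (proj₂ ints))))) (proj₂ (proj₂ (proj₂ (proj₂ (proj₂ ints))))))
      where
      3ℚ = 1ℚ + 1ℚ + 1ℚ
      -- By Newton's identities `s₁` to `s₄` are the power sums of the roots, and the `aᵢⱼ` are the
      -- cofactors of the Gram matrix with entries s_(i+j). The formulas are used both for rationals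
      -- and for solver expressions.
      module Power {R : Set} (_⊞_ _⊠_ : R → R → R) (⊟_ : R → R) (one τ α β : R) where
        three s₁ s₂ s₃ s₄ a₀₀ a₀₁ a₀₂ a₁₁ a₁₂ a₂₂ : R
        three = (one ⊞ one) ⊞ one
        s₁ = ⊟ τ
        s₂ = (τ ⊠ τ) ⊞ (⊟ (α ⊞ α))
        s₃ = ⊟ (((τ ⊠ s₂) ⊞ (α ⊠ s₁)) ⊞ (three ⊠ β))
        s₄ = ⊟ (((τ ⊠ s₃) ⊞ (α ⊠ s₂)) ⊞ (β ⊠ s₁))
        a₀₀ = (s₂ ⊠ s₄) ⊞ (⊟ (s₃ ⊠ s₃))
        a₀₁ = (s₂ ⊠ s₃) ⊞ (⊟ (s₁ ⊠ s₄))
        a₀₂ = (s₁ ⊠ s₃) ⊞ (⊟ (s₂ ⊠ s₂))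
        a₁₁ = (three ⊠ s₄) ⊞ (⊟ (s₂ ⊠ s₂))
        a₁₂ = (s₁ ⊠ s₂) ⊞ (⊟ (three ⊠ s₃))
        a₂₂ = (three ⊠ s₂) ⊞ (⊟ (s₁ ⊠ s₁))
      module Q = Power _+_ _*_ (-_) 1ℚ τ α β
      ints : IsInt Q.a₀₀ × IsInt Q.a₀₁ × IsInt Q.a₀₂ × IsInt Q.a₁₁ × IsInt Q.a₁₂ × IsInt Q.a₂₂
      ints = int-sub (int-* i₂ i₄) (int-* i₃ i₃) , int-sub (int-* i₂ i₃) (int-* i₁ i₄) , int-sub (int-* i₁ i₃) (int-* i₂ i₂) ,
        int-sub (int-* i₀ i₄) (int-* i₂ i₂) , int-sub (int-* i₁ i₂) (int-* i₀ i₃) , int-sub (int-* i₀ i₂) (int-* i₁ i₁)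
        where
        it = int ⟦ V.t f ⟧
        ia = int (V.A f)
        ib = int (V.B f)
        i₀ = int-+ (int-+ int-1 int-1) int-1
        i₁ = int-neg it
        i₂ = int-+ (int-* it it) (int-neg (int-+ ia ia))
        i₃ = int-neg (int-+ (int-+ (int-* it i₂) (int-* ia i₁)) (int-* i₀ ib))
        i₄ = int-neg (int-+ (int-+ (int-* it i₃) (int-* ia i₂)) (int-* ib i₁))
      combine′ : ∀ {x y z} → IsInt x → IsInt y → IsInt z → IsInt (x * Tr u + y * Tr (X u) + z * Tr (X (X u)))
      combine′ x y z = int-+ (int-+ (int-* x (bounded⇒Tr (𝒪-bounded h))) (int-* y (bounded⇒Tr (𝒪-bounded (𝒪-X h)))))
        (int-* z (bounded⇒Tr (𝒪-bounded (𝒪-X (𝒪-X h)))))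
      module P {n} (τ α β : Polynomial n) = Power _:+_ _:*_ (:-_) (con 1ℚ) τ α β
      Trᴾ : ∀ {n} (τ α β : Polynomial n) → Alg[ Polynomial n ] → Polynomial n
      Trᴾ τ α β u = trᴾ u (Sym.X τ α β u) (Sym.X τ α β (Sym.X τ α β u))
      comboᴾ : ∀ {n} (τ α β : Polynomial n) → Alg[ Polynomial n ] → (x y z : Polynomial n) → Polynomial n
      comboᴾ τ α β u x y z = x :* Trᴾ τ α β u :+ y :* Trᴾ τ α β (Sym.X τ α β u) :+ z :* Trᴾ τ α β (Sym.X τ α β (Sym.X τ α β u))
      Δᴾ : ∀ {n} (b c d : Polynomial n) → Polynomial n
      Δᴾ b c d = p b 2 :* p c 2 :- con (ℤ→ℚ (ℤ.+ 4)) :* p c 3 :- con (ℤ→ℚ (ℤ.+ 4)) :* p b 3 :* d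
        :+ con (ℤ→ℚ (ℤ.+ 18)) :* b :* c :* d :- con (ℤ→ℚ (ℤ.+ 27)) :* p d 2
        where
        p : Polynomial _ → ℕ → Polynomial _
        p x zero = con 1ℚ
        p x (suc n) = x :* p x n
      row₀ : ∀ τ α β a b c → _
      row₀ = solve 6 (λ τ α β a b c → comboᴾ τ α β ⟨ a , b , c ⟩ᴾ (P.a₀₀ τ α β) (P.a₀₁ τ α β) (P.a₀₂ τ α β) := Δᴾ τ α β :* a) refl
      row₁ : ∀ τ α β a b c → _
      row₁ = solve 6 (λ τ α β a b c → comboᴾ τ α β ⟨ a , b , c ⟩ᴾ (P.a₀₁ τ α β) (P.a₁₁ τ α β) (P.a₁₂ τ α β) := Δᴾ τ α β :* b) refl
      row₂ : ∀ τ α β a b c → _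
      row₂ = solve 6 (λ τ α β a b c → comboᴾ τ α β ⟨ a , b , c ⟩ᴾ (P.a₀₂ τ α β) (P.a₁₂ τ α β) (P.a₂₂ τ α β) := Δᴾ τ α β :* c) refl

-- A triangular basis of the integral elements and its index.

module IndexOfBasis where

  open import Data.Fin.Base as Fin using (Fin; toℕ; fromℕ<; remQuot; combine)
  import Data.Fin.Properties as Fin
  open import Data.Integer.Base as ℤ using (ℤ; 0ℤ)
  open import Data.Integer.DivMod using (_%ℕ_; _/ℕ_; n%ℕd<d; a≡a%ℕn+[a/ℕn]*n)
  import Data.Integer.Properties as ℤ
  open import Data.Integer.Divisibility.Signed using (divides; _∣_)
  open import Data.Nat.Base as ℕ using (ℕ; suc)
  import Data.Nat.Properties as ℕ
  open import Data.Product.Base using (∃; ∃₂; _×_; _,_; proj₁; proj₂)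
  open import Data.Rational.Base hiding (_/_; truncate)
  open import Data.Rational.Properties
  open import Relation.Binary.PropositionalEquality hiding ([_]; J)
  open import Relation.Nullary using (Dec)
  open import Relation.Nullary.Decidable using (map′)
  import Data.Rational.Solver
  open import Defs
  open Residues using (∣-<⇒≡)
  open RationalIntegers
  open CubicAlgebra
  open IntegralElements
  open Data.Rational.Solver.+-*-Solver using (solve; con; _:=_; _:+_; _:-_; _:*_; :-_)
  open OrderLattice

  ℕ→ℚ : ℕ → ℚ
  ℕ→ℚ n = ℤ→ℚ (ℤ.+ n)

  small-int : ∀ {h η i j} → η * ℕ→ℚ h ≡ 1ℚ → i ℕ.< h → j ℕ.< h → IsInt ((ℕ→ℚ i - ℕ→ℚ j) * η) → i ≡ j
  small-int {h} {η} {i} {j} ηh i<h j<h (z , eq) = ∣-<⇒≡ i<h j<h (divides z (ℤ→ℚ-injective {ℤ.+ i ℤ.- ℤ.+ j} {z ℤ.* ℤ.+ h}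
      (trans (ℤ→ℚ-sub (ℤ.+ i) (ℤ.+ j)) (trans (sym (*-identityʳ q)) (trans (cong (q *_) (sym ηh))
        (trans (sym (*-assoc q η (ℕ→ℚ h))) (trans (cong (_* ℕ→ℚ h) eq) (sym (ℤ→ℚ-* z (ℤ.+ h))))))))))
    where
    q = ℕ→ℚ i - ℕ→ℚ j

  module Basis (f : V ℤ) (Δ≢0 : Δ f ≢ 0ℤ) where

    open Lattice f Δ≢0 public

    D : ℕ
    D = ℤ.∣ Δ f ∣

    D≢0 : ℕ.NonZero D
    D≢0 = ℕ.≢-nonZero (λ eq → Δ≢0 (ℤ.∣i∣≡0⇒i≡0 eq))

    private
      instance
        D-nonZero : ℕ.NonZero D
        D-nonZero = D≢0
        Dℚ-nonZero : NonZero (ℕ→ℚ D)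
        Dℚ-nonZero = ≢-nonZero (ℤ→ℚ≢0 (λ eq → ℕ.≢-nonZero⁻¹ D (ℤ.+-injective eq)))

    δ : ℚ
    δ = 1/ ℕ→ℚ D

    δD : δ * ℕ→ℚ D ≡ 1ℚ
    δD = *-inverseˡ (ℕ→ℚ D)

    clear-abs : ∀ {q} → IsInt (ℤ→ℚ (Δ f) * q) → IsInt (ℕ→ℚ D * q)
    clear-abs {q} = go (Δ f)
      where
      go : ∀ z → IsInt (ℤ→ℚ z * q) → IsInt (ℕ→ℚ ℤ.∣ z ∣ * q)
      go (ℤ.+ n) h = h
      go ℤ.-[1+ n ] h = subst IsInt (g (ℕ→ℚ (suc n)) q) (int-neg h)
        where
        g : ∀ x q → - (- x * q) ≡ x * q
        g = solve 2 (λ x q → :- (:- x :* q) := x :* q) refl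

    -- Modulo integers a coordinate is one of D multiples of 1/D, which makes the searches for
    -- integral elements with prescribed last coordinates finite.
    reduce : ∀ {x} → IsInt (ℕ→ℚ D * x) → ∃ λ i → i ℕ.< D × ∃ λ w → x - ℤ→ℚ w ≡ ℕ→ℚ i * δ
    reduce {x} (z , eq) = z %ℕ D , n%ℕd<d z D , z /ℕ D , trans (cong (_- ℤ→ℚ w) x≡) (g (ℕ→ℚ (z %ℕ D)) (ℤ→ℚ w) (ℕ→ℚ D) δ δD)
      where
      w = z /ℕ D
      x≡ : x ≡ (ℕ→ℚ (z %ℕ D) + ℤ→ℚ w * ℕ→ℚ D) * δ
      x≡ = trans (sym (*-identityˡ x)) (trans (cong (_* x) (sym δD)) (trans (h δ (ℕ→ℚ D) x) (cong (_* δ)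
        (trans eq (trans (cong ℤ→ℚ (a≡a%ℕn+[a/ℕn]*n z D)) (trans (ℤ→ℚ-+ (ℤ.+ (z %ℕ D)) (w ℤ.* ℤ.+ D))
          (cong (ℕ→ℚ (z %ℕ D) +_) (ℤ→ℚ-* w (ℤ.+ D)))))))))
        where
        h : ∀ x d p → x * d * p ≡ d * p * x
        h = solve 3 (λ x d p → x :* d :* p := d :* p :* x) refl
      g : ∀ i w d x → x * d ≡ 1ℚ → (i + w * d) * x - w ≡ i * x
      g i w d x xd = trans (h i w d x) (trans (cong (λ e → i * x + w * e - w) xd) (h′ i w x))
        where
        h : ∀ i w d x → (i + w * d) * x - w ≡ i * x + w * (x * d) - w
        h = solve 4 (λ i w d x → (i :+ w :* d) :* x :- w := i :* x :+ w :* (x :* d) :- w) refl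
        h′ : ∀ i w x → i * x + w * 1ℚ - w ≡ i * x
        h′ = solve 3 (λ i w x → i :* x :+ w :* con 1ℚ :- w := i :* x) refl

    private
      shift₀ : ∀ {x y z} w → 𝒪 ⟨ x , y , z ⟩ → 𝒪 ⟨ x - ℤ→ℚ w , y , z ⟩
      shift₀ {x} {y} {z} w h = subst 𝒪 (cong₃ refl (g y) (g z)) (𝒪-- h (𝒪-int (int w , int-0 , int-0)))
        where
        g : ∀ y → y - 0ℚ ≡ y
        g = solve 1 (λ y → y :- con 0ℚ := y) refl

      shift₁ : ∀ {x y z} w → 𝒪 ⟨ x , y , z ⟩ → 𝒪 ⟨ x , y - ℤ→ℚ w , z ⟩
      shift₁ {x} {y} {z} w h = subst 𝒪 (cong₃ (g x) refl (g z)) (𝒪-- h (𝒪-int (int-0 , int w , int-0)))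
        where
        g : ∀ y → y - 0ℚ ≡ y
        g = solve 1 (λ y → y :- con 0ℚ := y) refl

    -- The generators 1/k and 1/h of these two groups are the diagonal entries of a triangular basis
    -- 1, a₁, b₁.
    G₁ G₂ : ℚ → Set
    G₁ q = ∃ λ x → 𝒪 ⟨ x , q , 0ℚ ⟩
    G₂ q = ∃₂ λ x y → 𝒪 ⟨ x , y , q ⟩

    opaque
      G₁? : ∀ q → Dec (G₁ q)
      G₁? q = map′ (λ (i , _ , h) → _ , h) from (ℕ.anyUpTo? (λ i → 𝒪? ⟨ ℕ→ℚ i * δ , q , 0ℚ ⟩) D)
        where
        from : G₁ q → ∃ λ i → i ℕ.< D × 𝒪 ⟨ ℕ→ℚ i * δ , q , 0ℚ ⟩
        from (x , h) = let i , i<D , w , eq = reduce (clear-abs (proj₁ (discriminant-clears h))) in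
          i , i<D , subst (λ x → 𝒪 ⟨ x , q , 0ℚ ⟩) eq (shift₀ w h)

      G₂? : ∀ q → Dec (G₂ q)
      G₂? q = map′ (λ (i , _ , j , _ , h) → _ , _ , h) from
          (ℕ.anyUpTo? (λ i → ℕ.anyUpTo? (λ j → 𝒪? ⟨ ℕ→ℚ i * δ , ℕ→ℚ j * δ , q ⟩) D) D)
        where
        from : G₂ q → ∃ λ i → i ℕ.< D × ∃ λ j → j ℕ.< D × 𝒪 ⟨ ℕ→ℚ i * δ , ℕ→ℚ j * δ , q ⟩
        from (x , y , h) =
          let i , i<D , w , eq = reduce (clear-abs (proj₁ (discriminant-clears h)))
              j , j<D , w′ , eq′ = reduce (clear-abs (proj₁ (proj₂ (discriminant-clears h))))
          in i , i<D , j , j<D , subst₂ (λ x y → 𝒪 ⟨ x , y , q ⟩) eq eq′ (shift₁ w′ (shift₀ w h))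

    private
      combination : ∀ z {u v} → 𝒪 u → 𝒪 v → 𝒪 (u -ᴬ (ℤ→ℚ z ·ᴬ v))
      combination z h k = 𝒪-- h (𝒪-· (int z) k)

      zero-sub : ∀ z → 0ℚ - z * 0ℚ ≡ 0ℚ
      zero-sub = solve 1 (λ z → con 0ℚ :- z :* con 0ℚ := con 0ℚ) refl

      module C₁ = Cyclic G₁ G₁? (0ℚ , 𝒪-int (int-0 , int-1 , int-0))
        (λ {p} {q} z (x , h) (y , k) → _ , subst (λ c → 𝒪 ⟨ x - ℤ→ℚ z * y , p - ℤ→ℚ z * q , c ⟩) (zero-sub (ℤ→ℚ z)) (combination z h k))
        D δ δD (λ (x , h) → clear-abs (proj₁ (proj₂ (discriminant-clears h))))

      module C₂ = Cyclic G₂ G₂? (0ℚ , 0ℚ , 𝒪-int (int-0 , int-0 , int-1))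
        (λ z (x , y , h) (x′ , y′ , k) → _ , _ , combination z h k)
        D δ δD (λ (x , y , h) → clear-abs (proj₂ (proj₂ (discriminant-clears h))))

    opaque
      k h : ℕ
      k = C₁.index
      h = C₂.index

      κ η x₁ x₂ y₂ : ℚ
      κ = C₁.generator
      η = C₂.generator
      x₁ = proj₁ C₁.G-generator
      x₂ = proj₁ C₂.G-generator
      y₂ = proj₁ (proj₂ C₂.G-generator)

      κk : κ * ℕ→ℚ k ≡ 1ℚ
      κk = C₁.generator-inverse

      ηh : η * ℕ→ℚ h ≡ 1ℚ
      ηh = C₂.generator-inverse

      k≢0 : ℕ.NonZero k
      k≢0 = C₁.index≢0

      h≢0 : ℕ.NonZero h
      h≢0 = C₂.index≢0

      𝒪-a : 𝒪 ⟨ x₁ , κ , 0ℚ ⟩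
      𝒪-a = proj₂ C₁.G-generator

      𝒪-b : 𝒪 ⟨ x₂ , y₂ , η ⟩
      𝒪-b = proj₂ (proj₂ C₂.G-generator)

      k-int : ∀ {x y} → 𝒪 ⟨ x , y , 0ℚ ⟩ → IsInt (ℕ→ℚ k * y)
      k-int h = C₁.index-int (_ , h)

      h-int : ∀ {x y z} → 𝒪 ⟨ x , y , z ⟩ → IsInt (ℕ→ℚ h * z)
      h-int h = C₂.index-int (_ , _ , h)

    a₁ b₁ : Alg
    a₁ = ⟨ x₁ , κ , 0ℚ ⟩
    b₁ = ⟨ x₂ , y₂ , η ⟩

    rep′ : ℕ → ℕ → Alg
    rep′ i j = (ℕ→ℚ i ·ᴬ a₁) +ᴬ (ℕ→ℚ j ·ᴬ b₁)

    rep : Fin (k ℕ.* h) → Alg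
    rep i = rep′ (toℕ (proj₁ (remQuot {k} h i))) (toℕ (proj₂ (remQuot {k} h i)))

    𝒪-rep′ : ∀ i j → 𝒪 (rep′ i j)
    𝒪-rep′ i j = 𝒪-+ (𝒪-· (int (ℤ.+ i)) 𝒪-a) (𝒪-· (int (ℤ.+ j)) 𝒪-b)

    distinct′ : ∀ {i i′ j j′} → i ℕ.< k → i′ ℕ.< k → j ℕ.< h → j′ ℕ.< h →
      IntA (rep′ i j -ᴬ rep′ i′ j′) → i ≡ i′ × j ≡ j′
    distinct′ {i} {i′} {j} {j′} i<k i′<k j<h j′<h (_ , m , l) = i≡i′ , j≡j′
      where
      g₂ : ∀ i i′ j j′ η → (i * 0ℚ + j * η) - (i′ * 0ℚ + j′ * η) ≡ (j - j′) * η
      g₂ = solve 5 (λ i i′ j j′ η → (i :* con 0ℚ :+ j :* η) :- (i′ :* con 0ℚ :+ j′ :* η) := (j :- j′) :* η) refl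
      g₁ : ∀ i i′ j κ y → (i * κ + j * y) - (i′ * κ + j * y) ≡ (i - i′) * κ
      g₁ = solve 5 (λ i i′ j κ y → (i :* κ :+ j :* y) :- (i′ :* κ :+ j :* y) := (i :- i′) :* κ) refl
      j≡j′ : j ≡ j′
      j≡j′ = small-int ηh j<h j′<h (subst IsInt (g₂ (ℕ→ℚ i) (ℕ→ℚ i′) (ℕ→ℚ j) (ℕ→ℚ j′) η) l)
      i≡i′ : i ≡ i′
      i≡i′ = small-int κk i<k i′<k (subst IsInt (trans (cong (λ z → (ℕ→ℚ i * κ + ℕ→ℚ j * y₂) - (ℕ→ℚ i′ * κ + ℕ→ℚ z * y₂)) (sym j≡j′))
        (g₁ (ℕ→ℚ i) (ℕ→ℚ i′) (ℕ→ℚ j) κ y₂)) m)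

    -- Peel off a multiple of b₁ and then of a₁, leaving an integral rational number.
    covers′ : ∀ u → 𝒪 u → ∃ λ i → i ℕ.< k × ∃ λ j → j ℕ.< h × IntA (u -ᴬ rep′ i j)
    covers′ u@(⟨ a , b , c ⟩) 𝒪u = i , n%ℕd<d z₁ k {{k≢0}} , j , n%ℕd<d z₂ h {{h≢0}} , result
      where
      z₂ = proj₁ (h-int 𝒪u)
      j = (z₂ %ℕ h) {{h≢0}}
      w₂ = (z₂ /ℕ h) {{h≢0}}
      split : ∀ d (d≢0 : ℕ.NonZero d) z ε q → ε * ℕ→ℚ d ≡ 1ℚ → ℕ→ℚ d * q ≡ ℤ→ℚ z →
        q - ℕ→ℚ ((z %ℕ d) {{d≢0}}) * ε - ℤ→ℚ ((z /ℕ d) {{d≢0}}) ≡ 0ℚ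
      split d d≢0 z ε q εd eq = trans (cong (λ q → q - r * ε - w) q≡) (trans (g₁ r w (ℕ→ℚ d) ε) (trans (cong (λ e → w * e - w) εd) (g₂ w)))
        where
        r = ℕ→ℚ ((z %ℕ d) {{d≢0}})
        w = ℤ→ℚ ((z /ℕ d) {{d≢0}})
        q≡ : q ≡ (r + w * ℕ→ℚ d) * ε
        q≡ = trans (sym (*-identityˡ q)) (trans (cong (_* q) (sym εd)) (trans (g₃ ε (ℕ→ℚ d) q) (cong (_* ε)
          (trans eq (trans (cong ℤ→ℚ (a≡a%ℕn+[a/ℕn]*n z d {{d≢0}})) (trans (ℤ→ℚ-+ (ℤ.+ ((z %ℕ d) {{d≢0}})) (((z /ℕ d) {{d≢0}}) ℤ.* ℤ.+ d))
            (cong (r +_) (ℤ→ℚ-* ((z /ℕ d) {{d≢0}}) (ℤ.+ d)))))))))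
          where
          g₃ : ∀ x d p → x * d * p ≡ d * p * x
          g₃ = solve 3 (λ x d p → x :* d :* p := d :* p :* x) refl
        g₁ : ∀ r w d ε → (r + w * d) * ε - r * ε - w ≡ w * (ε * d) - w
        g₁ = solve 4 (λ r w d ε → (r :+ w :* d) :* ε :- r :* ε :- w := w :* (ε :* d) :- w) refl
        g₂ : ∀ w → w * 1ℚ - w ≡ 0ℚ
        g₂ = solve 1 (λ w → w :* con 1ℚ :- w := con 0ℚ) refl
      c-zero : c - ℕ→ℚ j * η - ℤ→ℚ w₂ ≡ 0ℚ
      c-zero = split h h≢0 z₂ η c ηh (proj₂ (h-int 𝒪u))
      b′ = b - ℕ→ℚ j * y₂ - 0ℚ
      a′ = a - ℕ→ℚ j * x₂ - 0ℚ
      𝒪₁ : 𝒪 ⟨ a′ , b′ , 0ℚ ⟩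
      𝒪₁ = subst (λ c → 𝒪 ⟨ a′ , b′ , c ⟩) c-zero (𝒪-- (𝒪-- 𝒪u (𝒪-· (int (ℤ.+ j)) 𝒪-b)) (𝒪-int (int-0 , int-0 , int w₂)))
      z₁ = proj₁ (k-int 𝒪₁)
      i = (z₁ %ℕ k) {{k≢0}}
      w₁ = (z₁ /ℕ k) {{k≢0}}
      b-zero : b′ - ℕ→ℚ i * κ - ℤ→ℚ w₁ ≡ 0ℚ
      b-zero = split k k≢0 z₁ κ b′ κk (proj₂ (k-int 𝒪₁))
      a″ = a′ - ℕ→ℚ i * x₁ - 0ℚ
      𝒪₂ : 𝒪 ⟨ a″ , 0ℚ , 0ℚ ⟩
      𝒪₂ = subst₂ (λ b c → 𝒪 ⟨ a″ , b , c ⟩) b-zero (g (ℕ→ℚ i)) (𝒪-- (𝒪-- 𝒪₁ (𝒪-· (int (ℤ.+ i)) 𝒪-a)) (𝒪-int (int-0 , int w₁ , int-0)))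
        where
        g : ∀ i → 0ℚ - i * 0ℚ - 0ℚ ≡ 0ℚ
        g = solve 1 (λ i → con 0ℚ :- i :* con 0ℚ :- con 0ℚ := con 0ℚ) refl
      result : IntA (u -ᴬ rep′ i j)
      result = subst IsInt (g₀ a (ℕ→ℚ i) (ℕ→ℚ j) x₁ x₂) (𝒪-rational 𝒪₂) ,
        (w₁ , trans (g₁ b (ℕ→ℚ i) (ℕ→ℚ j) κ y₂ (ℤ→ℚ w₁)) (trans (cong (_+ ℤ→ℚ w₁) b-zero) (+-identityˡ _))) ,
        (w₂ , trans (g₂ c (ℕ→ℚ i) (ℕ→ℚ j) η (ℤ→ℚ w₂)) (trans (cong (_+ ℤ→ℚ w₂) c-zero) (+-identityˡ _)))
        where
        g₀ : ∀ a i j x₁ x₂ → (a - j * x₂ - 0ℚ) - i * x₁ - 0ℚ ≡ a - (i * x₁ + j * x₂)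
        g₀ = solve 5 (λ a i j x₁ x₂ → (a :- j :* x₂ :- con 0ℚ) :- i :* x₁ :- con 0ℚ := a :- (i :* x₁ :+ j :* x₂)) refl
        g₁ : ∀ b i j κ y w → b - (i * κ + j * y) ≡ (b - j * y - 0ℚ) - i * κ - w + w
        g₁ = solve 6 (λ b i j κ y w → b :- (i :* κ :+ j :* y) := (b :- j :* y :- con 0ℚ) :- i :* κ :- w :+ w) refl
        g₂ : ∀ c i j η w → c - (i * 0ℚ + j * η) ≡ c - j * η - w + w
        g₂ = solve 5 (λ c i j η w → c :- (i :* con 0ℚ :+ j :* η) := c :- j :* η :- w :+ w) refl

    isIndex : IsIndex f (k ℕ.* h)
    isIndex = record
      { rep = rep
      ; integral = λ i → integral (𝒪-rep′ (toℕ (proj₁ (remQuot {k} h i))) (toℕ (proj₂ (remQuot {k} h i))))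
      ; distinct = λ i j near →
          let eq₁ , eq₂ = distinct′ {toℕ (proj₁ (remQuot {k} h i))} {toℕ (proj₁ (remQuot {k} h j))}
                                    {toℕ (proj₂ (remQuot {k} h i))} {toℕ (proj₂ (remQuot {k} h j))}
                                    (Fin.toℕ<n (proj₁ (remQuot {k} h i))) (Fin.toℕ<n (proj₁ (remQuot {k} h j)))
                                    (Fin.toℕ<n (proj₂ (remQuot {k} h i))) (Fin.toℕ<n (proj₂ (remQuot {k} h j))) (InOrder⇒IntA near)
          in trans (sym (Fin.combine-remQuot {k} h i))
               (trans (cong₂ combine (Fin.toℕ-injective eq₁) (Fin.toℕ-injective eq₂)) (Fin.combine-remQuot {k} h j))
      ; covers = λ u hu → let i , i<k , j , j<h , near = covers′ u (𝒪-intro hu) in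
          combine (fromℕ< i<k) (fromℕ< j<h) , IntA⇒InOrder (subst (λ p → IntA (u -ᴬ rep′ (toℕ (proj₁ p)) (toℕ (proj₂ p))))
            (sym (Fin.remQuot-combine {k} {h} (fromℕ< i<k) (fromℕ< j<h)))
            (subst₂ (λ i j → IntA (u -ᴬ rep′ i j)) (sym (Fin.toℕ-fromℕ< i<k)) (sym (Fin.toℕ-fromℕ< j<h)) near))
      }

-- Normal form of the basis at an approximate double root R.

module IntegralStructure where

  open import Data.Integer.Base as ℤ using (ℤ; 0ℤ)
  import Data.Integer.Properties as ℤ
  open import Data.Integer.Divisibility.Signed hiding (quotient)
  open import Data.Nat.Base as ℕ using (ℕ)
  import Data.Nat.Properties as ℕ
  import Data.Nat.Tactic.RingSolver as ℕ-Solver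
  open import Data.Product.Base using (_,_; proj₁; proj₂)
  open import Data.Rational.Base hiding (_/_; truncate)
  open import Data.Rational.Properties
  open import Relation.Binary.PropositionalEquality hiding ([_]; J)
  import Data.Rational.Solver
  open Data.Rational.Solver.+-*-Solver using (Polynomial; solve; con; _:=_; _:+_; _:-_; _:*_; :-_)

  open import Defs
  open Valuations
  open Residues
  open LocalConditions
  open RationalIntegers
  open CubicAlgebra
  open IntegralElements
  open OrderLattice
  open IndexOfBasis

  valℚ derℚ : ℚ → ℚ → ℚ → ℚ → ℚ
  valℚ t A B r = r * r * r + t * (r * r) + A * r + B
  derℚ t A _ r = ℤ→ℚ (ℤ.+ 3) * (r * r) + ℤ→ℚ (ℤ.+ 2) * (t * r) + A

  der₂ℚ : ℚ → ℚ → ℚ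
  der₂ℚ t r = ℤ→ℚ (ℤ.+ 3) * r + t

  lit : ∀ a → a ↦ ℤ→ℚ a
  lit a = ↦-intro refl

  ℤ→ℚ-val : ∀ t A B r → ℤ→ℚ (val t A B r) ≡ valℚ (ℤ→ℚ t) (ℤ→ℚ A) (ℤ→ℚ B) (ℤ→ℚ r)
  ℤ→ℚ-val t A B r = _↦_.image (lit r ⟨*⟩ lit r ⟨*⟩ lit r ⟨+⟩ lit t ⟨*⟩ (lit r ⟨*⟩ lit r) ⟨+⟩ lit A ⟨*⟩ lit r ⟨+⟩ lit B)

  ℤ→ℚ-der : ∀ t A B r → ℤ→ℚ (der t A r) ≡ derℚ (ℤ→ℚ t) (ℤ→ℚ A) (ℤ→ℚ B) (ℤ→ℚ r)
  ℤ→ℚ-der t A B r = _↦_.image (lit (ℤ.+ 3) ⟨*⟩ (lit r ⟨*⟩ lit r) ⟨+⟩ lit (ℤ.+ 2) ⟨*⟩ (lit t ⟨*⟩ lit r) ⟨+⟩ lit A)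

  ℤ→ℚ-der₂ : ∀ t r → ℤ→ℚ (der₂ t r) ≡ der₂ℚ (ℤ→ℚ t) (ℤ→ℚ r)
  ℤ→ℚ-der₂ t r = _↦_.image (lit (ℤ.+ 3) ⟨*⟩ lit r ⟨+⟩ lit t)

  module Roots (f : V ℤ) where

    open Integrality f

    -- The classes of x - r and of the polynomial (f(x) - f(r))/(x - r).
    linear quotient : ℚ → Alg
    linear r = ⟨ - r , 1ℚ , 0ℚ ⟩
    quotient r = ⟨ α + r * τ + r * r , τ + r , 1ℚ ⟩

    private
      open Alg[_]
      X′ : ∀ {n} (τ α β : Polynomial n) → Alg[ Polynomial n ] → Alg[ Polynomial n ]
      X′ = Sym.X
      on : ∀ {n} → (Alg[ Polynomial n ] → Alg[ Polynomial n ] → Alg[ Polynomial n ] → Polynomial n) →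
        (τ α β : Polynomial n) → Alg[ Polynomial n ] → Polynomial n
      on m τ α β u = m u (X′ τ α β u) (X′ τ α β (X′ τ α β u))
      linᴾ quoᴾ : ∀ {n} (τ α β r : Polynomial n) → Alg[ Polynomial n ]
      linᴾ τ α β r = ⟨ :- r , con 1ℚ , con 0ℚ ⟩ᴾ
      quoᴾ τ α β r = ⟨ α :+ r :* τ :+ r :* r , τ :+ r , con 1ℚ ⟩ᴾ
      valᴾ derᴾ der₂ᴾ : ∀ {n} (τ α β r : Polynomial n) → Polynomial n
      valᴾ τ α β r = r :* r :* r :+ τ :* (r :* r) :+ α :* r :+ β
      derᴾ τ α β r = con (ℤ→ℚ (ℤ.+ 3)) :* (r :* r) :+ con (ℤ→ℚ (ℤ.+ 2)) :* (τ :* r) :+ α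
      der₂ᴾ τ α β r = con (ℤ→ℚ (ℤ.+ 3)) :* r :+ τ

    Tr-linear : ∀ r → Tr (linear r) ≡ - der₂ℚ τ r
    Tr-linear r = solve 4 (λ τ α β r → on trᴾ τ α β (linᴾ τ α β r) := :- der₂ᴾ τ α β r) refl τ α β r

    Mi-linear : ∀ r → Mi (linear r) ≡ derℚ τ α β r
    Mi-linear r = solve 4 (λ τ α β r → on minorsᴾ τ α β (linᴾ τ α β r) := derᴾ τ α β r) refl τ α β r

    No-linear : ∀ r → No (linear r) ≡ - valℚ τ α β r
    No-linear r = solve 4 (λ τ α β r → on detᴾ τ α β (linᴾ τ α β r) := :- valᴾ τ α β r) refl τ α β r

    Tr-quotient : ∀ r → Tr (quotient r) ≡ derℚ τ α β r
    Tr-quotient r = solve 4 (λ τ α β r → on trᴾ τ α β (quoᴾ τ α β r) := derᴾ τ α β r) refl τ α β r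

    Mi-quotient : ∀ r → Mi (quotient r) ≡ valℚ τ α β r * der₂ℚ τ r
    Mi-quotient r = solve 4 (λ τ α β r → on minorsᴾ τ α β (quoᴾ τ α β r) := valᴾ τ α β r :* der₂ᴾ τ α β r) refl τ α β r

    No-quotient : ∀ r → No (quotient r) ≡ valℚ τ α β r * valℚ τ α β r
    No-quotient r = solve 4 (λ τ α β r → on detᴾ τ α β (quoᴾ τ α β r) := valᴾ τ α β r :* valᴾ τ α β r) refl τ α β r

    -- Subtracting the trace times the element removes the x² term of the square; the x-coefficient
    -- that remains exhibits f(r).
    quotient-square₁ : ∀ r η → Alg.c₁ ((η ·ᴬ quotient r) ⊛ (η ·ᴬ quotient r) -ᴬ ((η * derℚ τ α β r) ·ᴬ (η ·ᴬ quotient r)))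
      ≡ - (valℚ τ α β r * (η * η))
    quotient-square₁ r η = solve 5 (λ τ α β r η → let b = η ∙ quoᴾ τ α β r in
      d₁ (Sym._⊗_ τ α β b b) :- (η :* derᴾ τ α β r) :* d₁ b := :- (valᴾ τ α β r :* (η :* η))) refl τ α β r η

    quotient-square₂ : ∀ r η → Alg.c₂ ((η ·ᴬ quotient r) ⊛ (η ·ᴬ quotient r) -ᴬ ((η * derℚ τ α β r) ·ᴬ (η ·ᴬ quotient r)))
      ≡ 0ℚ
    quotient-square₂ r η = solve 5 (λ τ α β r η → let b = η ∙ quoᴾ τ α β r in
      d₂ (Sym._⊗_ τ α β b b) :- (η :* derᴾ τ α β r) :* d₂ b := con 0ℚ) refl τ α β r η

    linear-square₂ : ∀ r κ → Alg.c₂ ((κ ·ᴬ linear r) ⊛ (κ ·ᴬ linear r)) ≡ κ * κ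
    linear-square₂ r κ = solve 5 (λ τ α β r κ → let a = κ ∙ linᴾ τ α β r in d₂ (Sym._⊗_ τ α β a a) := κ :* κ) refl τ α β r κ

    product₁ : ∀ x κ y z η → Alg.c₁ (⟨ x , κ , 0ℚ ⟩ ⊛ ⟨ z , y , η ⟩) ≡ x * y + κ * z - κ * (α * η)
    product₁ x κ y z η = solve 8 (λ τ α β x κ y z η → d₁ (Sym._⊗_ τ α β ⟨ x , κ , con 0ℚ ⟩ᴾ ⟨ z , y , η ⟩ᴾ)
      := x :* y :+ κ :* z :- κ :* (α :* η)) refl τ α β x κ y z η

    product₂ : ∀ x κ y z η → Alg.c₂ (⟨ x , κ , 0ℚ ⟩ ⊛ ⟨ z , y , η ⟩) ≡ x * η + κ * y - κ * (τ * η)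
    product₂ x κ y z η = solve 8 (λ τ α β x κ y z η → d₂ (Sym._⊗_ τ α β ⟨ x , κ , con 0ℚ ⟩ᴾ ⟨ z , y , η ⟩ᴾ)
      := x :* η :+ κ :* y :- κ :* (τ :* η)) refl τ α β x κ y z η

  unit-cancel : ∀ {q K} → q * K ≡ 1ℚ → ∀ y → q * (y * K) ≡ y
  unit-cancel {q} {K} qK y = trans (g q y K) (trans (cong (y *_) qK) (*-identityʳ y))
    where
    g : ∀ q y K → q * (y * K) ≡ y * (q * K)
    g = solve 3 (λ q y K → q :* (y :* K) := y :* (q :* K)) refl

  int-∣ : ∀ d z q → q * ℕ→ℚ d ≡ 1ℚ → IsInt (q * ℤ→ℚ z) → ℤ.+ d ∣ z
  int-∣ d z q qd (y , eq) = divides y (ℤ→ℚ-injective (trans (sym (unit-cancel {q} {ℕ→ℚ d} qd (ℤ→ℚ z)))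
    (trans (g q (ℤ→ℚ z) (ℕ→ℚ d)) (trans (cong (_* ℕ→ℚ d) eq) (sym (ℤ→ℚ-* y (ℤ.+ d)))))))
    where
    g : ∀ q z d → q * (z * d) ≡ q * z * d
    g = solve 3 (λ q z d → q :* (z :* d) := q :* z :* d) refl

  module Structure (f : V ℤ) (Δ≢0 : Δ f ≢ 0ℤ) where

    open Basis f Δ≢0 public
    open Roots f public

    private
      t = ⟦ V.t f ⟧
      A = V.A f
      B = V.B f

      -- The element k a₁ - x is integral and rational.
      z₀ : IsInt (ℕ→ℚ k * x₁)
      z₀ = subst IsInt (g₀ (ℕ→ℚ k) x₁) (𝒪-rational (subst₂ (λ b c → 𝒪 ⟨ ℕ→ℚ k * x₁ - 0ℚ , b , c ⟩)
          (trans (cong (_- 1ℚ) (trans (*-comm (ℕ→ℚ k) κ) κk)) refl) (g₂ (ℕ→ℚ k))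
          (𝒪-- (𝒪-· (int (ℤ.+ k)) 𝒪-a) (𝒪-int (int-0 , int-1 , int-0)))))
        where
        g₀ : ∀ k x → k * x - 0ℚ ≡ k * x
        g₀ = solve 2 (λ k x → k :* x :- con 0ℚ := k :* x) refl
        g₂ : ∀ k → k * 0ℚ - 0ℚ ≡ 0ℚ
        g₂ = solve 1 (λ k → k :* con 0ℚ :- con 0ℚ := con 0ℚ) refl

      w : IsInt (ℕ→ℚ h * (x₁ * η + κ * y₂ - κ * (τ * η)))
      w = subst (λ c → IsInt (ℕ→ℚ h * c)) (product₂ x₁ κ y₂ x₂ η) (h-int (𝒪-⊛ 𝒪-a 𝒪-b))

    -- Changing a₁ by an integer keeps the basis triangular. The integer W is h times the
    -- x²-coefficient of a₁ b₁, so (a₁ - W) b₁ has no x² term, and R is the rational number for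
    -- which a₁ - W = (x - R)/k. This choice forces b₁ to agree with the quotient at R up to its
    -- constant term.
    R : ℤ
    R = ℤ.+ k ℤ.* proj₁ w ℤ.- proj₁ z₀

    Rℚ : ℚ
    Rℚ = ℤ→ℚ R

    private
      W Z : ℚ
      W = ℤ→ℚ (proj₁ w)
      Z = ℤ→ℚ (proj₁ z₀)

      Rℚ≡ : Rℚ ≡ ℕ→ℚ k * W - Z
      Rℚ≡ = trans (ℤ→ℚ-sub (ℤ.+ k ℤ.* proj₁ w) (proj₁ z₀)) (cong (_- Z) (ℤ→ℚ-* (ℤ.+ k) (proj₁ w)))

      x₁≡ : x₁ ≡ κ * Z
      x₁≡ = trans (sym (unit-cancel {κ} {ℕ→ℚ k} κk x₁)) (cong (κ *_) (trans (*-comm x₁ (ℕ→ℚ k)) (proj₂ z₀)))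

      W≡ : W ≡ x₁ + κ * (ℕ→ℚ h * y₂) - κ * τ
      W≡ = trans (sym (proj₂ w)) (trans (g (ℕ→ℚ h) x₁ η κ y₂ τ) (trans (cong (λ e → x₁ * e + κ * (ℕ→ℚ h * y₂) - κ * (τ * e)) ηh) (g′ x₁ κ (ℕ→ℚ h * y₂) τ)))
        where
        g : ∀ h x η κ y τ → h * (x * η + κ * y - κ * (τ * η)) ≡ x * (η * h) + κ * (h * y) - κ * (τ * (η * h))
        g = solve 6 (λ h x η κ y τ → h :* (x :* η :+ κ :* y :- κ :* (τ :* η)) := x :* (η :* h) :+ κ :* (h :* y) :- κ :* (τ :* (η :* h))) refl
        g′ : ∀ x κ y τ → x * 1ℚ + κ * y - κ * (τ * 1ℚ) ≡ x + κ * y - κ * τ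
        g′ = solve 4 (λ x κ y τ → x :* con 1ℚ :+ κ :* y :- κ :* (τ :* con 1ℚ) := x :+ κ :* y :- κ :* τ) refl

      hy₂ : ℕ→ℚ h * y₂ ≡ τ + Rℚ
      hy₂ = trans (sym (*-identityˡ _)) (trans (cong (_* (ℕ→ℚ h * y₂)) (sym κk)) (trans
          (g κ (ℕ→ℚ k) (ℕ→ℚ h * y₂) τ Z) (trans (cong₂ (λ a b → ℕ→ℚ k * (a + κ * (ℕ→ℚ h * y₂) - κ * τ) - b * Z + b * τ) (sym x₁≡) κk)
            (trans (cong (λ a → ℕ→ℚ k * a - 1ℚ * Z + 1ℚ * τ) (sym W≡)) (trans (g′ (ℕ→ℚ k * W) Z τ) (cong (τ +_) (sym Rℚ≡)))))))
        where
        g : ∀ κ k y τ z → κ * k * y ≡ k * (κ * z + κ * y - κ * τ) - κ * k * z + κ * k * τ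
        g = solve 5 (λ κ k y τ z → κ :* k :* y := k :* (κ :* z :+ κ :* y :- κ :* τ) :- κ :* k :* z :+ κ :* k :* τ) refl
        g′ : ∀ kw z τ → kw - 1ℚ * z + 1ℚ * τ ≡ τ + (kw - z)
        g′ = solve 3 (λ kw z τ → kw :- con 1ℚ :* z :+ con 1ℚ :* τ := τ :+ (kw :- z)) refl

      y₂≡ : y₂ ≡ η * (τ + Rℚ)
      y₂≡ = trans (sym (unit-cancel {η} {ℕ→ℚ h} ηh y₂)) (cong (η *_) (trans (*-comm y₂ (ℕ→ℚ h)) hy₂))

    𝒪-linear : 𝒪 (κ ·ᴬ linear Rℚ)
    𝒪-linear = subst 𝒪 (cong₃ (trans (cong (_- W) x₁≡) c₀≡) (g₁ κ) (g₂ κ)) (𝒪-- 𝒪-a (𝒪-int (int (proj₁ w) , int-0 , int-0)))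
      where
      c₀≡ : κ * Z - W ≡ κ * (- Rℚ)
      c₀≡ = sym (trans (cong (λ r → κ * (- r)) Rℚ≡) (trans (g κ (ℕ→ℚ k) W Z) (trans (cong (λ e → κ * Z - e * W) κk) (cong (λ x → κ * Z - x) (*-identityˡ W)))))
        where
        g : ∀ κ k w z → κ * (- (k * w - z)) ≡ κ * z - κ * k * w
        g = solve 4 (λ κ k w z → κ :* (:- (k :* w :- z)) := κ :* z :- κ :* k :* w) refl
      g₁ : ∀ κ → κ - 0ℚ ≡ κ * 1ℚ
      g₁ = solve 1 (λ κ → κ :- con 0ℚ := κ :* con 1ℚ) refl
      g₂ : ∀ κ → 0ℚ - 0ℚ ≡ κ * 0ℚ
      g₂ = solve 1 (λ κ → con 0ℚ :- con 0ℚ := κ :* con 0ℚ) refl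

    private
      -- The product of (x - R)/k and b₁ has no x² term, so k clears its x-coefficient. That
      -- multiple is the amount by which the constant term of b₁ misses the one of the quotient
      -- divided by h.
      E : IsInt (x₂ - α * η - Rℚ * (η * (τ + Rℚ)))
      E = subst IsInt (trans (g (ℕ→ℚ k) κ Rℚ y₂ x₂ α η) (trans (cong (λ e → e * (x₂ - α * η - Rℚ * y₂)) κk)
            (trans (*-identityˡ _) (cong (λ y → x₂ - α * η - Rℚ * y) y₂≡))))
          (k-int (subst₂ (λ b c → 𝒪 ⟨ Alg.c₀ (a ⊛ b₁) , b , c ⟩) (product₁ (κ * - Rℚ) κ y₂ x₂ η)
            (trans (product₂ (κ * - Rℚ) κ y₂ x₂ η) (trans (cong (λ y → κ * - Rℚ * η + κ * y - κ * (τ * η)) y₂≡) (g₀ κ Rℚ η τ)))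
            (𝒪-⊛ 𝒪-linear′ 𝒪-b)))
        where
        a = ⟨ κ * - Rℚ , κ , 0ℚ ⟩
        𝒪-linear′ : 𝒪 a
        𝒪-linear′ = subst₂ (λ b c → 𝒪 ⟨ κ * - Rℚ , b , c ⟩) (*-identityʳ κ) (*-zeroʳ κ) 𝒪-linear
        g₀ : ∀ κ r η τ → κ * - r * η + κ * (η * (τ + r)) - κ * (τ * η) ≡ 0ℚ
        g₀ = solve 4 (λ κ r η τ → κ :* :- r :* η :+ κ :* (η :* (τ :+ r)) :- κ :* (τ :* η) := con 0ℚ) refl
        g : ∀ k κ r y x α η → k * (κ * - r * y + κ * x - κ * (α * η)) ≡ κ * k * (x - α * η - r * y)
        g = solve 7 (λ k κ r y x α η → k :* (κ :* :- r :* y :+ κ :* x :- κ :* (α :* η)) := κ :* k :* (x :- α :* η :- r :* y)) refl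

    𝒪-quotient : 𝒪 (η ·ᴬ quotient Rℚ)
    𝒪-quotient = subst 𝒪 (cong₃ (trans (cong (λ e → x₂ - e) (sym (proj₂ E))) (g x₂ α η Rℚ τ)) (trans (g₁ y₂) y₂≡) (g₂ η))
        (𝒪-- 𝒪-b (𝒪-int (int (proj₁ E) , int-0 , int-0)))
      where
      g : ∀ x α η r τ → x - (x - α * η - r * (η * (τ + r))) ≡ η * (α + r * τ + r * r)
      g = solve 5 (λ x α η r τ → x :- (x :- α :* η :- r :* (η :* (τ :+ r))) := η :* (α :+ r :* τ :+ r :* r)) refl
      g₁ : ∀ κ → κ - 0ℚ ≡ κ
      g₁ = solve 1 (λ κ → κ :- con 0ℚ := κ) refl
      g₂ : ∀ κ → κ - 0ℚ ≡ κ * 1ℚ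
      g₂ = solve 1 (λ κ → κ :- con 0ℚ := κ :* con 1ℚ) refl

    k∣der₂ : ℤ.+ k ∣ der₂ t R
    k∣der₂ = int-∣ k (der₂ t R) κ κk (subst IsInt (trans (cong -_ (trans (Tr-· κ (linear Rℚ)) (cong (κ *_) (Tr-linear Rℚ))))
        (trans (g κ (der₂ℚ τ Rℚ)) (cong (κ *_) (sym (ℤ→ℚ-der₂ t R))))) (int-neg (bounded⇒Tr (𝒪-bounded 𝒪-linear))))
      where
      g : ∀ κ x → - (κ * - x) ≡ κ * x
      g = solve 2 (λ κ x → :- (κ :* :- x) := κ :* x) refl

    Tr-quotient-int : IsInt (η * derℚ τ α β Rℚ)
    Tr-quotient-int = subst IsInt (trans (Tr-· η (quotient Rℚ)) (cong (η *_) (Tr-quotient Rℚ))) (bounded⇒Tr (𝒪-bounded 𝒪-quotient))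

    h∣der : ℤ.+ h ∣ der t A R
    h∣der = int-∣ h (der t A R) η ηh (subst (λ x → IsInt (η * x)) (sym (ℤ→ℚ-der t A B R)) Tr-quotient-int)

    private
      m₀ : IsInt (ℕ→ℚ h * (κ * κ))
      m₀ = subst (λ c → IsInt (ℕ→ℚ h * c)) (linear-square₂ Rℚ κ) (h-int (𝒪-⊛ 𝒪-linear 𝒪-linear))

    m : ℕ
    m = ℤ.∣ proj₁ m₀ ∣

    -- The square of (x - R)/k has x²-coefficient 1/k², and h clears all such coefficients.
    h≡mk² : h ≡ m ℕ.* (k ℕ.* k)
    h≡mk² = trans (cong ℤ.∣_∣ h≡) (trans (ℤ.abs-* (proj₁ m₀) (ℤ.+ k ℤ.* ℤ.+ k)) (cong (m ℕ.*_) (ℤ.abs-* (ℤ.+ k) (ℤ.+ k))))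
      where
      h≡ : ℤ.+ h ≡ proj₁ m₀ ℤ.* (ℤ.+ k ℤ.* ℤ.+ k)
      h≡ = ℤ→ℚ-injective (trans (g (ℕ→ℚ h)) (trans (cong (λ e → ℕ→ℚ h * (e * e)) (sym κk)) (trans (g′ (ℕ→ℚ h) κ (ℕ→ℚ k))
        (trans (cong (_* (ℕ→ℚ k * ℕ→ℚ k)) (proj₂ m₀)) (sym (trans (ℤ→ℚ-* (proj₁ m₀) (ℤ.+ k ℤ.* ℤ.+ k)) (cong (ℤ→ℚ (proj₁ m₀) *_) (ℤ→ℚ-* (ℤ.+ k) (ℤ.+ k)))))))))
        where
        g : ∀ h → h ≡ h * (1ℚ * 1ℚ)
        g = solve 1 (λ h → h := h :* (con 1ℚ :* con 1ℚ)) refl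
        g′ : ∀ h κ k → h * (κ * k * (κ * k)) ≡ h * (κ * κ) * (k * k)
        g′ = solve 3 (λ h κ k → h :* (κ :* k :* (κ :* k)) := h :* (κ :* κ) :* (k :* k)) refl

    m≢0 : ℕ.NonZero m
    m≢0 = ℕ.≢-nonZero (λ eq → ℕ.≢-nonZero⁻¹ h {{h≢0}} (trans h≡mk² (cong (ℕ._* (k ℕ.* k)) eq)))

    -- For b = `quotient`/h the element b² - Tr(b) b has no x² term and has x-coefficient -f(R)/h².
    -- Hence h² ∣ k f(R), and one factor k cancels in h² = k⁴ m².
    k³m²∣val : ℤ.+ (k ℕ.* k ℕ.* k ℕ.* (m ℕ.* m)) ∣ val t A B R
    k³m²∣val = divides F (ℤ.*-cancelʳ-≡ (val t A B R) (F ℤ.* ℤ.+ (k ℕ.* k ℕ.* k ℕ.* (m ℕ.* m))) (ℤ.+ k) {{k≢0}} cleared)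
      where
      square : IsInt (ℕ→ℚ k * - (valℚ τ α β Rℚ * (η * η)))
      square = k-int (subst₂ (λ b c → 𝒪 ⟨ Alg.c₀ u , b , c ⟩) (quotient-square₁ Rℚ η) (quotient-square₂ Rℚ η)
        (𝒪-- (𝒪-⊛ 𝒪-quotient 𝒪-quotient) (𝒪-· Tr-quotient-int 𝒪-quotient)))
        where u = (η ·ᴬ quotient Rℚ) ⊛ (η ·ᴬ quotient Rℚ) -ᴬ ((η * derℚ τ α β Rℚ) ·ᴬ (η ·ᴬ quotient Rℚ))
      F = ℤ.- proj₁ square
      vk : val t A B R ℤ.* ℤ.+ k ≡ F ℤ.* (ℤ.+ h ℤ.* ℤ.+ h)
      vk = ℤ→ℚ-injective (trans (ℤ→ℚ-* (val t A B R) (ℤ.+ k)) (trans (cong (_* ℕ→ℚ k) (ℤ→ℚ-val t A B R)) (trans (g (valℚ τ α β Rℚ) (ℕ→ℚ k))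
        (trans (cong (λ e → valℚ τ α β Rℚ * ℕ→ℚ k * (e * e)) (sym ηh)) (trans (g′ (valℚ τ α β Rℚ) (ℕ→ℚ k) η (ℕ→ℚ h))
          (trans (cong (λ x → - x * (ℕ→ℚ h * ℕ→ℚ h)) (proj₂ square)) (trans (cong₂ _*_ (sym (ℤ→ℚ-neg (proj₁ square))) (sym (ℤ→ℚ-* (ℤ.+ h) (ℤ.+ h))))
            (sym (ℤ→ℚ-* F (ℤ.+ h ℤ.* ℤ.+ h)))))))))) 
        where
        g : ∀ v k → v * k ≡ v * k * (1ℚ * 1ℚ)
        g = solve 2 (λ v k → v :* k := v :* k :* (con 1ℚ :* con 1ℚ)) refl
        g′ : ∀ v k η h → v * k * (η * h * (η * h)) ≡ - (k * - (v * (η * η))) * (h * h)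
        g′ = solve 4 (λ v k η h → v :* k :* (η :* h :* (η :* h)) := :- (k :* :- (v :* (η :* η))) :* (h :* h)) refl
      cleared : val t A B R ℤ.* ℤ.+ k ≡ F ℤ.* ℤ.+ (k ℕ.* k ℕ.* k ℕ.* (m ℕ.* m)) ℤ.* ℤ.+ k
      cleared = trans vk (trans (cong (F ℤ.*_) (trans (sym (ℤ.pos-* h h)) (trans (cong ℤ.+_ (trans (cong₂ ℕ._*_ h≡mk² h≡mk²) (g k m)))
        (ℤ.pos-* (k ℕ.* k ℕ.* k ℕ.* (m ℕ.* m)) k)))) (sym (ℤ.*-assoc F (ℤ.+ (k ℕ.* k ℕ.* k ℕ.* (m ℕ.* m))) (ℤ.+ k))))
        where
        g : ∀ k m → m ℕ.* (k ℕ.* k) ℕ.* (m ℕ.* (k ℕ.* k)) ≡ k ℕ.* k ℕ.* k ℕ.* (m ℕ.* m) ℕ.* k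
        g = ℕ-Solver.solve-∀

-- Divisibility of the index is equivalent to the local conditions.

module IndexDivisibility where

  open import Data.Empty using (⊥; ⊥-elim)
  open import Data.Integer.Base as ℤ using (ℤ; 0ℤ; 1ℤ)
  import Data.Integer.Properties as ℤ
  import Data.Integer.Tactic.RingSolver as ℤ-Solver
  open import Data.Integer.Divisibility.Signed hiding (quotient)
  open import Data.Nat.Base as ℕ using (ℕ; zero; suc)
  import Data.Nat.Divisibility as ℕ∣
  import Data.Nat.Properties as ℕ
  import Data.Nat.Tactic.RingSolver as ℕ-Solver
  open import Data.Nat.Primality using (Prime)
  open import Data.Product.Base using (∃; _,_; proj₁; proj₂)
  open import Data.Rational.Base hiding (_/_; truncate)
  open import Data.Rational.Properties
  open import Data.Sum.Base using ([_,_]′)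
  open import Relation.Binary.PropositionalEquality hiding ([_]; J)
  open import Relation.Nullary using (yes; no; ¬_)
  import Data.Rational.Solver
  open import Defs
  open Valuations
  open CommonRoots using (prime-∣*; pw-cancel)
  open Residues
  open LocalConditions
  open RationalIntegers
  open CubicAlgebra
  open IntegralElements
  open OrderLattice
  open IndexOfBasis
  open Data.Rational.Solver.+-*-Solver using (Polynomial; solve; con; _:=_; _:+_; _:-_; _:*_; :-_)
  open IntegralStructure

  v-* : ∀ {p} → Prime p → ∀ a b {{_ : ℕ.NonZero a}} {{_ : ℕ.NonZero b}} j → pw p j ∣ ℤ.+ (a ℕ.* b) → j ℕ.≤ v p a ℕ.+ v p b
  v-* {p} pr a b j h with j ℕ.≤? v p a ℕ.+ v p b
  ... | yes le = le
  ... | no ¬le = ⊥-elim (absurd (v-∣ p a) (v-∣ p b))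
    where
    i = v p a
    l = v p b
    g : ∀ a P b Q → (a ℤ.* P) ℤ.* (b ℤ.* Q) ≡ (P ℤ.* Q) ℤ.* (a ℤ.* b)
    g = ℤ-Solver.solve-∀
    comm : ∀ P π → P ℤ.* π ≡ π ℤ.* P
    comm = ℤ-Solver.solve-∀
    -- p divides neither cofactor, so it cannot divide their product
    not-more : ∀ a {{_ : ℕ.NonZero a}} a′ → ℤ.+ a ≡ a′ ℤ.* pw p (v p a) → ¬ ℤ.+ p ∣ a′
    not-more a a′ a≡ p∣a′ = ℕ.<-irrefl refl (v-max pr a (suc (v p a)) (subst₂ _∣_
      (trans (comm (ℤ.+ p) (pw p (v p a))) (sym (pw-suc p (v p a)))) (sym a≡) (*-mono-∣ p∣a′ (∣-refl {pw p (v p a)}))))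
    absurd : pw p i ∣ ℤ.+ a → pw p l ∣ ℤ.+ b → ⊥
    absurd (divides a′ a≡) (divides b′ b≡) = [ not-more a a′ a≡ , not-more b b′ b≡ ]′
      (prime-∣* {p} {a′} {b′} pr (pw-cancel pr (i ℕ.+ l) (ℤ.+ p) (a′ ℤ.* b′)
        (subst₂ _∣_ (pw-suc p (i ℕ.+ l)) (trans (ℤ.pos-* a b) (trans (cong₂ ℤ._*_ a≡ b≡) (trans (g a′ (pw p i) b′ (pw p l))
          (cong (ℤ._* (a′ ℤ.* b′)) (sym (pw-+ p i l)))))) (∣-trans (pw-∣ p (ℕ.≰⇒> ¬le)) h))))

  module _ {n : ℕ} {{n≢0 : ℕ.NonZero n}} where

    -- The index is k h = k³ m, so its exponent at p is 3κ + μ with κ and μ the exponents of k and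
    -- m. The same R serves every prime.
    Σ⇒V : ∀ f → Σ[ n ] f → ∃ λ r → Local.V n ⟦ V.t f ⟧ (V.A f) (V.B f) r
    Σ⇒V f (Δ≢0 , K , I , n∣K) = R , λ p pr →
        normalise (v p n) (v p k) (v p m) (weight p pr) (data-k p)
      where
      open Structure f Δ≢0
      instance
        k-nz : ℕ.NonZero k
        k-nz = k≢0
        m-nz : ℕ.NonZero m
        m-nz = m≢0
        kk-nz : ℕ.NonZero (k ℕ.* k)
        kk-nz = ℕ.m*n≢0 k k
        mkk-nz : ℕ.NonZero (m ℕ.* (k ℕ.* k))
        mkk-nz = ℕ.m*n≢0 m (k ℕ.* k)
      -- The index K in the hypothesis may come from other representatives; uniqueness identifies it
      -- with the index of the basis.
      K≡ : K ≡ k ℕ.* (m ℕ.* (k ℕ.* k))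
      K≡ = trans (ℕ.≤-antisym (index-unique I isIndex) (index-unique isIndex I)) (cong (k ℕ.*_) h≡mk²)
      weight : ∀ p → Prime p → v p n ℕ.≤ v p k ℕ.+ v p k ℕ.+ v p k ℕ.+ v p m
      weight p pr = ℕ.≤-trans (v-* pr k (m ℕ.* (k ℕ.* k)) (v p n) (∣-trans (v-∣ p n) (∣ᵤ⇒∣ (subst (n ℕ∣.∣_) K≡ n∣K))))
        (ℕ.≤-trans (ℕ.+-monoʳ-≤ (v p k) (ℕ.≤-trans (v-* pr m (k ℕ.* k) _ (v-∣ p (m ℕ.* (k ℕ.* k))))
          (ℕ.+-monoʳ-≤ (v p m) (v-* pr k k _ (v-∣ p (k ℕ.* k)))))) (ℕ.≤-reflexive (g (v p k) (v p m))))
        where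
        g : ∀ κ μ → κ ℕ.+ (μ ℕ.+ (κ ℕ.+ κ)) ≡ κ ℕ.+ κ ℕ.+ κ ℕ.+ μ
        g = ℕ-Solver.solve-∀
      data-k : ∀ p → Data p (v p k) (v p m) ⟦ V.t f ⟧ (V.A f) (V.B f) R
      data-k p = mkData (∣-trans (v-∣ p k) k∣der₂)
        (∣-trans (subst (pw p (v p k ℕ.+ v p k ℕ.+ v p m) ∣_) (trans (sym (trans (ℤ.pos-* (k ℕ.* k) m) (cong (ℤ._* ℤ.+ m) (ℤ.pos-* k k))))
          (cong ℤ.+_ (trans (ℕ.*-comm (k ℕ.* k) m) (sym h≡mk²))))
          (pw-∣* p (v p k ℕ.+ v p k) (v p m) (pw-∣* p (v p k) (v p k) (v-∣ p k) (v-∣ p k)) (v-∣ p m))) h∣der)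
        (∣-trans (subst (pw p (v p k ℕ.+ v p k ℕ.+ v p k ℕ.+ (v p m ℕ.+ v p m)) ∣_)
          (sym (trans (ℤ.pos-* (k ℕ.* k ℕ.* k) (m ℕ.* m)) (cong₂ ℤ._*_ (trans (ℤ.pos-* (k ℕ.* k) k) (cong (ℤ._* ℤ.+ k) (ℤ.pos-* k k))) (ℤ.pos-* m m))))
          (pw-∣* p (v p k ℕ.+ v p k ℕ.+ v p k) (v p m ℕ.+ v p m)
            (pw-∣* p (v p k ℕ.+ v p k) (v p k) (pw-∣* p (v p k) (v p k) (v-∣ p k) (v-∣ p k)) (v-∣ p k))
            (pw-∣* p (v p m) (v p m) (v-∣ p m) (v-∣ p m)))) k³m²∣val)

  pwℚ : ℕ → ℕ → ℚ
  pwℚ p a = ℤ→ℚ (pw p a)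

  pwℚ-+ : ∀ p a b → pwℚ p (a ℕ.+ b) ≡ pwℚ p a * pwℚ p b
  pwℚ-+ p a b = trans (cong ℤ→ℚ (pw-+ p a b)) (ℤ→ℚ-* (pw p a) (pw p b))

  record Inverse (p a : ℕ) (q : ℚ) : Set where
    constructor inverse-intro
    field unit : q * pwℚ p a ≡ 1ℚ

  inverse-+ : ∀ {p a b q r} → Inverse p a q → Inverse p b r → Inverse p (a ℕ.+ b) (q * r)
  inverse-+ {p} {a} {b} {q} {r} (inverse-intro h) (inverse-intro k) = inverse-intro (trans (cong (q * r *_) (pwℚ-+ p a b)) (trans (g q r (pwℚ p a) (pwℚ p b)) (trans (cong₂ _*_ h k) (*-identityˡ 1ℚ))))
    where
    g : ∀ q r x y → q * r * (x * y) ≡ q * x * (r * y)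
    g = solve 4 (λ q r x y → q :* r :* (x :* y) := q :* x :* (r :* y)) refl

  inverse : ∀ {p} → Prime p → ∀ a → ∃ λ q → Inverse p a q
  inverse {p} pr a = (1/ pwℚ p a) {{nz}} , inverse-intro (*-inverseˡ (pwℚ p a) {{nz}})
    where
    nz : NonZero (pwℚ p a)
    nz = ≢-nonZero (ℤ→ℚ≢0 {pw p a} (λ eq → ℕ.≢-nonZero⁻¹ ℤ.∣ pw p a ∣ {{pw-nonZero pr a}} (cong ℤ.∣_∣ eq)))

  inverse-int : ∀ {p a q z} → Inverse p a q → pw p a ∣ z → IsInt (q * ℤ→ℚ z)
  inverse-int {p} {a} {q} (inverse-intro h) (divides y refl) = y , trans (cong (q *_) (ℤ→ℚ-* y (pw p a))) (unit-cancel {q} {pwℚ p a} h (ℤ→ℚ y))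

  inverse-∣ : ∀ {p a q} z → Inverse p a q → IsInt (q * ℤ→ℚ z) → pw p a ∣ z
  inverse-∣ {p} {a} {q} z (inverse-intro h) i = subst (_∣ z) (sym (pw-def p a)) (int-∣ (p ℕ.^ a) z q (trans (cong (λ x → q * ℤ→ℚ x) (sym (pw-def p a))) h) i)

  module Converse (f : V ℤ) (Δ≢0 : Δ f ≢ 0ℤ) where

    open Structure f Δ≢0

    private
      t = ⟦ V.t f ⟧
      A = V.A f
      B = V.B f

    -- The data make the two scaled elements integral. The first has no x² term and x-coefficient
    -- p^(-κ), the second has x²-coefficient p^(-2κ-μ), so k and h are divisible by the
    -- corresponding powers.
    data⇒∣index : ∀ {p κ′ μ′} r → Prime p → Data p κ′ μ′ t A B r → pw p (κ′ ℕ.+ κ′ ℕ.+ κ′ ℕ.+ μ′) ∣ ℤ.+ (k ℕ.* h)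
    data⇒∣index {p} {κ′} {μ′} r pr (mkData h₂ h₁ h₀) = subst₂ _∣_ (cong (pw p) (exponents κ′ μ′)) (sym (ℤ.pos-* k h))
        (pw-∣* p κ′ a (inverse-∣ (ℤ.+ k) qK (subst IsInt (g₁ (ℕ→ℚ k) q) (k-int 𝒪-lin)))
          (inverse-∣ (ℤ.+ h) QH (subst IsInt (g₂ (ℕ→ℚ h) Q) (h-int 𝒪-quo))))
      where
      a = κ′ ℕ.+ κ′ ℕ.+ μ′
      q = proj₁ (inverse pr κ′)
      qK = proj₂ (inverse pr κ′)
      Q = proj₁ (inverse pr a)
      QH = proj₂ (inverse pr a)
      exponents : ∀ κ μ → κ ℕ.+ (κ ℕ.+ κ ℕ.+ μ) ≡ κ ℕ.+ κ ℕ.+ κ ℕ.+ μ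
      exponents = ℕ-Solver.solve-∀
      g₁ : ∀ k q → k * (q * 1ℚ) ≡ q * k
      g₁ = solve 2 (λ k q → k :* (q :* con 1ℚ) := q :* k) refl
      g₂ : ∀ k q → k * (q * 1ℚ) ≡ q * k
      g₂ = g₁
      ρ = ℤ→ℚ r
      assoc₂ : ∀ q x → q * q * x ≡ q * (q * x)
      assoc₂ = solve 2 (λ q x → q :* q :* x := q :* (q :* x)) refl
      assoc₃ : ∀ q x → q * q * q * x ≡ q * (q * (q * x))
      assoc₃ = solve 2 (λ q x → q :* q :* q :* x := q :* (q :* (q :* x))) refl
      neg₁ : ∀ q x → - (q * x) ≡ q * - x
      neg₁ = solve 2 (λ q x → :- (q :* x) := q :* :- x) refl
      neg₃ : ∀ q x → - (q * (q * (q * x))) ≡ q * (q * (q * - x))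
      neg₃ = solve 2 (λ q x → :- (q :* (q :* (q :* x))) := q :* (q :* (q :* :- x))) refl
      le₃ : ∀ κ μ → κ ℕ.+ κ ℕ.+ κ ℕ.≤ κ ℕ.+ κ ℕ.+ κ ℕ.+ (μ ℕ.+ μ)
      le₃ κ μ = ℕ.m≤m+n _ _
      𝒪-lin : 𝒪 ⟨ q * - ρ , q * 1ℚ , 0ℚ ⟩
      𝒪-lin = subst (λ c → 𝒪 ⟨ q * - ρ , q * 1ℚ , c ⟩) (*-zeroʳ q) (𝒪-intro (charInt⇒integral (q ·ᴬ linear ρ)
        ( subst IsInt (sym (trans (Tr-· q (linear ρ)) (trans (cong (q *_) (trans (Tr-linear ρ) (cong -_ (sym (ℤ→ℚ-der₂ t r))))) (sym (neg₁ q _)))))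
            (int-neg (inverse-int qK h₂))
        , subst IsInt (trans (assoc₂ q _) (sym (trans (Mi-· q (linear ρ)) (cong (λ x → q * (q * x)) (trans (Mi-linear ρ) (sym (ℤ→ℚ-der t A B r)))))))
            (inverse-int (inverse-+ {p} {κ′} {κ′} qK qK) (∣-trans (pw-∣ p (ℕ.m≤m+n (κ′ ℕ.+ κ′) μ′)) h₁))
        , subst IsInt (trans (cong -_ (assoc₃ q _)) (trans (neg₃ q _) (sym (trans (No-· q (linear ρ)) (cong (λ x → q * (q * (q * x)))
            (trans (No-linear ρ) (cong -_ (sym (ℤ→ℚ-val t A B r)))))))))
            (int-neg (inverse-int (inverse-+ {p} {κ′ ℕ.+ κ′} {κ′} (inverse-+ {p} {κ′} {κ′} qK qK) qK) (∣-trans (pw-∣ p (le₃ κ′ μ′)) h₀)))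
        )))
      -- The second coefficient is f(r) f″(r)/2 with exponent (3κ + 2μ) + κ = 2(2κ + μ), the norm is
      -- f(r)² with exponent 6κ + 4μ ≥ 3(2κ + μ).
      𝒪-quo : 𝒪 (Q ·ᴬ quotient ρ)
      𝒪-quo = 𝒪-intro (charInt⇒integral (Q ·ᴬ quotient ρ)
        ( subst IsInt (sym (trans (Tr-· Q (quotient ρ)) (cong (Q *_) (trans (Tr-quotient ρ) (sym (ℤ→ℚ-der t A B r)))))) (inverse-int QH h₁)
        , subst IsInt (trans (assoc₂ Q _) (sym (trans (Mi-· Q (quotient ρ)) (cong (λ x → Q * (Q * x))
            (trans (Mi-quotient ρ) (trans (cong₂ _*_ (sym (ℤ→ℚ-val t A B r)) (sym (ℤ→ℚ-der₂ t r))) (sym (ℤ→ℚ-* (val t A B r) (der₂ t r)))))))))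
            (inverse-int (inverse-+ {p} {a} {a} QH QH) (∣-trans (pw-∣ p (ℕ.≤-reflexive (e₂ κ′ μ′))) (pw-∣* p _ κ′ h₀ h₂)))
        , subst IsInt (trans (assoc₃ Q _) (sym (trans (No-· Q (quotient ρ)) (cong (λ x → Q * (Q * (Q * x)))
            (trans (No-quotient ρ) (trans (cong₂ _*_ (sym (ℤ→ℚ-val t A B r)) (sym (ℤ→ℚ-val t A B r))) (sym (ℤ→ℚ-* (val t A B r) (val t A B r)))))))))
            (inverse-int (inverse-+ {p} {a ℕ.+ a} {a} (inverse-+ {p} {a} {a} QH QH) QH)
              (∣-trans (pw-∣ p (ℕ.≤-trans (ℕ.m≤m+n _ μ′) (ℕ.≤-reflexive (e₃ κ′ μ′)))) (pw-∣* p b b h₀ h₀)))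
        ))
        where
        b = κ′ ℕ.+ κ′ ℕ.+ κ′ ℕ.+ (μ′ ℕ.+ μ′)
        e₂ : ∀ κ μ → κ ℕ.+ κ ℕ.+ μ ℕ.+ (κ ℕ.+ κ ℕ.+ μ) ≡ κ ℕ.+ κ ℕ.+ κ ℕ.+ (μ ℕ.+ μ) ℕ.+ κ
        e₂ = ℕ-Solver.solve-∀
        e₃ : ∀ κ μ → κ ℕ.+ κ ℕ.+ μ ℕ.+ (κ ℕ.+ κ ℕ.+ μ) ℕ.+ (κ ℕ.+ κ ℕ.+ μ) ℕ.+ μ
          ≡ κ ℕ.+ κ ℕ.+ κ ℕ.+ (μ ℕ.+ μ) ℕ.+ (κ ℕ.+ κ ℕ.+ κ ℕ.+ (μ ℕ.+ μ))
        e₃ = ℕ-Solver.solve-∀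

    Sol⇒Σ : ∀ {n} {{_ : ℕ.NonZero n}} → Local.Sol n t A B → Σ[ n ] f
    Sol⇒Σ {n} s = Δ≢0 , k ℕ.* h , isIndex , valuations⇒∣ n (k ℕ.* h) (λ p pr →
      let r , κ′ , μ′ , sh , D = s p pr in ∣-trans (pw-∣ p (shape-≤ sh)) (data⇒∣index r pr D))

  -- As a polynomial in B the discriminant is quadratic with leading coefficient -27. Its second
  -- difference with step L is -54 L², so it cannot vanish at three consecutive points.
  nonzero-shift : ∀ t A B L → L ≢ 0ℤ → ∃ λ i → Δ (cubic t A (B ℤ.+ i ℤ.* L)) ≢ 0ℤ
  nonzero-shift t A B L L≢0 with Δ (cubic t A (B ℤ.+ 0ℤ ℤ.* L)) ℤ.≟ 0ℤ | Δ (cubic t A (B ℤ.+ 1ℤ ℤ.* L)) ℤ.≟ 0ℤ | Δ (cubic t A (B ℤ.+ ℤ.+ 2 ℤ.* L)) ℤ.≟ 0ℤ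
  ... | no h | _ | _ = 0ℤ , h
  ... | yes _ | no h | _ = 1ℤ , h
  ... | yes _ | yes _ | no h = ℤ.+ 2 , h
  ... | yes h₀ | yes h₁ | yes h₂ = ⊥-elim (L≢0 ([ (λ ()) , (λ eq → [ (λ e → e) , (λ e → e) ]′ (ℤ.i*j≡0⇒i≡0∨j≡0 L eq)) ]′
      (ℤ.i*j≡0⇒i≡0∨j≡0 (ℤ.- ℤ.+ 54) (trans (sym (second-difference ⟦ t ⟧ A B L)) (cong₂ ℤ._+_ (cong₂ (λ x y → x ℤ.- ℤ.+ 2 ℤ.* y) h₀ h₁) h₂)))))
    where
    second-difference : ∀ b c B L → _
    second-difference = ZS.solve 4 (λ b c B L →
        let d₀ = B ZS.:+ ZS.con 0ℤ ZS.:* L ; d₁ = B ZS.:+ ZS.con 1ℤ ZS.:* L ; d₂ = B ZS.:+ ZS.con (ℤ.+ 2) ZS.:* L in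
        Δᴾ b c d₀ ZS.:- ZS.con (ℤ.+ 2) ZS.:* Δᴾ b c d₁ ZS.:+ Δᴾ b c d₂ ZS.:= ZS.con (ℤ.- ℤ.+ 54) ZS.:* (L ZS.:* L)) refl
      where
      import Data.Integer.Solver
      module ZS = Data.Integer.Solver.+-*-Solver
      Δᴾ : ∀ {n} (b c d : ZS.Polynomial n) → ZS.Polynomial n
      Δᴾ b c d = p b 2 ZS.:* p c 2 ZS.:- ZS.con (ℤ.+ 4) ZS.:* p c 3 ZS.:- ZS.con (ℤ.+ 4) ZS.:* p b 3 ZS.:* d
        ZS.:+ ZS.con (ℤ.+ 18) ZS.:* b ZS.:* c ZS.:* d ZS.:- ZS.con (ℤ.+ 27) ZS.:* p d 2
        where
        p : ZS.Polynomial _ → ℕ → ZS.Polynomial _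
        p x zero = ZS.con 1ℤ
        p x (suc n) = x ZS.:* p x n

  -- A detour through integral elements: B is moved by a multiple of n² to make the discriminant
  -- nonzero, the local roots then give divisibility of the index, and the normal form of the basis
  -- gives one root for all primes. By periodicity this root serves the original B.
  Sol⇒S : ∀ n {{_ : ℕ.NonZero n}} s A B → Local.Sol n ⟦ s ⟧ A B → Local.S n ⟦ s ⟧ A B
  Sol⇒S n {{n≢0}} s A B sol = V⇒S A B (proj₁ root) (V-period B (proj₁ root) (subst (n² ∣_) (back B (i ℤ.* n²)) (∣n⇒∣m*n (ℤ.- i) (∣-refl {n²}))) (proj₂ root))
    where
    open Local n ⟦ s ⟧
    n²≢0 : n² ≢ 0ℤ
    n²≢0 eq = ℕ.≢-nonZero⁻¹ (n ℕ.* n) {{ℕ.m*n≢0 n n}} (trans (sym (ℤ.abs-* (ℤ.+ n) (ℤ.+ n))) (cong ℤ.∣_∣ eq))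
    shift = nonzero-shift s A B n² n²≢0
    i = proj₁ shift
    back : ∀ B x → ℤ.- i ℤ.* n² ≡ B ℤ.- (B ℤ.+ i ℤ.* n²)
    back B x = g i n² B
      where
      g : ∀ i n B → ℤ.- i ℤ.* n ≡ B ℤ.- (B ℤ.+ i ℤ.* n)
      g = ℤ-Solver.solve-∀
    forth : ∀ i n B → i ℤ.* n ≡ (B ℤ.+ i ℤ.* n) ℤ.- B
    forth = ℤ-Solver.solve-∀
    f′ = cubic s A (B ℤ.+ i ℤ.* n²)
    root = Σ⇒V f′ (Converse.Sol⇒Σ f′ (proj₂ shift) (Sol-period (B ℤ.+ i ℤ.* n²)
      (subst (n² ∣_) (forth i n² B) (∣n⇒∣m*n i (∣-refl {n²}))) sol))

-- A lower bound for the mass of clopen sets containing the closure.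

module DensityBound where

  open import Data.Bool.Base as Bool using (Bool; true; false; if_then_else_)
  open import Data.Empty using (⊥-elim)
  open import Data.Fin.Base as Fin using (Fin; toℕ)
  import Data.Fin.Properties as Fin
  open import Data.Integer.Base as ℤ using (ℤ; 0ℤ)
  open import Data.Integer.DivMod using (_%ℕ_; n%ℕd<d)
  open import Data.Integer.Divisibility.Signed hiding (quotient)
  import Data.Integer.Properties as ℤ
  import Data.Integer.Tactic.RingSolver as ℤ-Solver
  open import Data.List.Base using (List; []; _∷_; _++_; length; map; filter; filterᵇ; downFrom; cartesianProduct)
  open import Data.List.Membership.Propositional using (_∈_)
  open import Data.List.Membership.Propositional.Properties
    using (∈-filter⁺; ∈-filter⁻; ∈-downFrom⁺; ∈-downFrom⁻; ∈-cartesianProductWith⁺; ∈-cartesianProduct⁻; ∈-allFin)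
  open import Data.List.Relation.Unary.Any using (here; there)
  open import Data.List.Relation.Unary.All using ([]; _∷_)
  open import Data.List.Relation.Unary.AllPairs using ([]; _∷_)
  open import Data.List.Relation.Unary.Unique.Propositional using (Unique)
  import Data.List.Relation.Unary.Unique.Propositional.Properties as Unique
  open import Data.Nat.Base as ℕ using (ℕ; zero; suc)
  import Data.Nat.Divisibility as ℕ∣
  import Data.Nat.DivMod as ℕ
  import Data.Nat.Properties as ℕ
  import Data.Nat.Tactic.RingSolver as ℕ-Solver
  open import Data.Product.Base using (_×_; _,_; proj₁; proj₂)
  open import Relation.Binary.PropositionalEquality hiding ([_]; J)
  open import Relation.Nullary using (Dec; yes; no; does)
  open import Relation.Nullary.Decidable using (T?)

  open import Defs
  open Residues using (∣-<⇒≡; %ℕ-∣)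
  open LocalConditions using (module Local)
  open ResidueCounts
  open IndexDivisibility

  ∑ : ℕ → (ℕ → ℕ) → ℕ
  ∑ zero    g = 0
  ∑ (suc k) g = g k ℕ.+ ∑ k g

  ∑-mono : ∀ k {g h} → (∀ i → i ℕ.< k → g i ℕ.≤ h i) → ∑ k g ℕ.≤ ∑ k h
  ∑-mono zero le = ℕ.z≤n
  ∑-mono (suc k) le = ℕ.+-mono-≤ (le k ℕ.≤-refl) (∑-mono k (λ i i<k → le i (ℕ.m<n⇒m<1+n i<k)))

  ∑-cong : ∀ k {g h} → (∀ i → g i ≡ h i) → ∑ k g ≡ ∑ k h
  ∑-cong zero eq = refl
  ∑-cong (suc k) eq = cong₂ ℕ._+_ (eq k) (∑-cong k eq)

  ∑-* : ∀ k m g → ∑ k (λ i → m ℕ.* g i) ≡ m ℕ.* ∑ k g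
  ∑-* zero m g = sym (ℕ.*-zeroʳ m)
  ∑-* (suc k) m g = trans (cong (m ℕ.* g k ℕ.+_) (∑-* k m g)) (sym (ℕ.*-distribˡ-+ m (g k) (∑ k g)))

  ∑-+ : ∀ k g h → ∑ k (λ i → g i ℕ.+ h i) ≡ ∑ k g ℕ.+ ∑ k h
  ∑-+ zero g h = refl
  ∑-+ (suc k) g h = trans (cong (g k ℕ.+ h k ℕ.+_) (∑-+ k g h)) (s (g k) (h k) (∑ k g) (∑ k h))
    where
    s : ∀ a b c d → a ℕ.+ b ℕ.+ (c ℕ.+ d) ≡ a ℕ.+ c ℕ.+ (b ℕ.+ d)
    s = ℕ-Solver.solve-∀

  ∑-const : ∀ k m → ∑ k (λ _ → m) ≡ k ℕ.* m
  ∑-const zero m = refl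
  ∑-const (suc k) m = cong (m ℕ.+_) (∑-const k m)

  ∑-split : ∀ a b g → ∑ (a ℕ.+ b) g ≡ ∑ a g ℕ.+ ∑ b (λ i → g (a ℕ.+ i))
  ∑-split a zero g = trans (cong (λ k → ∑ k g) (ℕ.+-identityʳ a)) (sym (ℕ.+-identityʳ _))
  ∑-split a (suc b) g = trans (cong (λ k → ∑ k g) (ℕ.+-suc a b)) (trans (cong (g (a ℕ.+ b) ℕ.+_) (∑-split a b g))
    (s (g (a ℕ.+ b)) (∑ a g) (∑ b (λ i → g (a ℕ.+ i)))))
    where
    s : ∀ x y z → x ℕ.+ (y ℕ.+ z) ≡ y ℕ.+ (x ℕ.+ z)
    s = ℕ-Solver.solve-∀

  ∑-blocks-≥ : ∀ m n {g h : ℕ → ℕ} K → (∀ j i → g i ℕ.≤ K ℕ.* h (j ℕ.* n ℕ.+ i)) → m ℕ.* ∑ n g ℕ.≤ K ℕ.* ∑ (m ℕ.* n) h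
  ∑-blocks-≥ zero n K le = ℕ.z≤n
  ∑-blocks-≥ (suc m) n {g} {h} K le = ℕ.≤-trans (ℕ.+-mono-≤
      (ℕ.≤-trans (∑-mono n (λ i _ → le m i)) (ℕ.≤-reflexive (∑-* n K _))) (∑-blocks-≥ m n K le))
    (ℕ.≤-reflexive (trans (sym (ℕ.*-distribˡ-+ K _ _)) (cong (K ℕ.*_) (trans (ℕ.+-comm _ (∑ (m ℕ.* n) h))
      (trans (sym (∑-split (m ℕ.* n) n h)) (cong (λ k → ∑ k h) (ℕ.+-comm (m ℕ.* n) n)))))))

  ∑-blocks-≤ : ∀ m n {g h : ℕ → ℕ} K → (∀ j i → h (j ℕ.* n ℕ.+ i) ℕ.≤ K ℕ.* g i) → ∑ (m ℕ.* n) h ℕ.≤ K ℕ.* (m ℕ.* ∑ n g)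
  ∑-blocks-≤ zero n K le = ℕ.z≤n
  ∑-blocks-≤ (suc m) n {g} {h} K le = ℕ.≤-trans (ℕ.≤-reflexive (trans (cong (λ k → ∑ k h) (ℕ.+-comm n (m ℕ.* n)))
      (trans (∑-split (m ℕ.* n) n h) (ℕ.+-comm (∑ (m ℕ.* n) h) _))))
    (ℕ.≤-trans (ℕ.+-mono-≤ (ℕ.≤-trans (∑-mono n (λ i _ → le m i)) (ℕ.≤-reflexive (∑-* n K g))) (∑-blocks-≤ m n K le))
      (ℕ.≤-reflexive (sym (ℕ.*-distribˡ-+ K (∑ n g) (m ℕ.* ∑ n g)))))

  ∑-periodic : ∀ m n {g : ℕ → ℕ} → (∀ j i → g (j ℕ.* n ℕ.+ i) ≡ g i) → ∑ (m ℕ.* n) g ≡ m ℕ.* ∑ n g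
  ∑-periodic m n {g} per = ℕ.≤-antisym
    (ℕ.≤-trans (∑-blocks-≤ m n {g} {g} 1 (λ j i → ℕ.≤-reflexive (trans (per j i) (sym (ℕ.*-identityˡ _))))) (ℕ.≤-reflexive (ℕ.*-identityˡ _)))
    (ℕ.≤-trans (∑-blocks-≥ m n {g} {g} 1 (λ j i → ℕ.≤-reflexive (trans (sym (per j i)) (sym (ℕ.*-identityˡ _))))) (ℕ.≤-reflexive (ℕ.*-identityˡ _)))

  bit : Bool → ℕ
  bit b = if b then 1 else 0

  module _ {p} {P : ℕ → Set p} (P? : ∀ x → Dec (P x)) where

    length-filter-∑ : ∀ k → length (filter P? (downFrom k)) ≡ ∑ k (λ i → bit (does (P? i)))
    length-filter-∑ zero = refl
    length-filter-∑ (suc k) with does (P? k)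
    ... | true  = cong suc (length-filter-∑ k)
    ... | false = length-filter-∑ k

  ∑T : (T → ℕ) → ℕ
  ∑T g = g t₋₁ ℕ.+ (g t₀ ℕ.+ (g t₁ ℕ.+ 0))

  ∑T-mono : ∀ {g h} → (∀ s → g s ℕ.≤ h s) → ∑T g ℕ.≤ ∑T h
  ∑T-mono le = ℕ.+-mono-≤ (le t₋₁) (ℕ.+-mono-≤ (le t₀) (ℕ.+-monoˡ-≤ 0 (le t₁)))

  ∑T-* : ∀ m g → ∑T (λ s → m ℕ.* g s) ≡ m ℕ.* ∑T g
  ∑T-* m g = d m (g t₋₁) (g t₀) (g t₁)
    where
    d : ∀ m a b c → m ℕ.* a ℕ.+ (m ℕ.* b ℕ.+ (m ℕ.* c ℕ.+ 0)) ≡ m ℕ.* (a ℕ.+ (b ℕ.+ (c ℕ.+ 0)))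
    d = ℕ-Solver.solve-∀

  Ts : List T
  Ts = t₋₁ ∷ t₀ ∷ t₁ ∷ []

  Ts-unique : Unique Ts
  Ts-unique = ((λ ()) ∷ (λ ()) ∷ []) ∷ ((λ ()) ∷ []) ∷ [] ∷ []

  ∈-Ts : ∀ s → s ∈ Ts
  ∈-Ts t₋₁ = here refl
  ∈-Ts t₀  = there (here refl)
  ∈-Ts t₁  = there (there (here refl))

  ∑L : ∀ {a} {X : Set a} → List X → (X → ℕ) → ℕ
  ∑L []       g = 0
  ∑L (x ∷ xs) g = g x ℕ.+ ∑L xs g

  ∑L-downFrom : ∀ k g → ∑L (downFrom k) g ≡ ∑ k g
  ∑L-downFrom zero    g = refl
  ∑L-downFrom (suc k) g = cong (g k ℕ.+_) (∑L-downFrom k g)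

  ∑L-cong : ∀ {a} {X : Set a} xs {g h : X → ℕ} → (∀ x → g x ≡ h x) → ∑L xs g ≡ ∑L xs h
  ∑L-cong []       eq = refl
  ∑L-cong (x ∷ xs) eq = cong₂ ℕ._+_ (eq x) (∑L-cong xs eq)

  module _ {a} {X : Set a} where

    lengthᵇ : (X → Bool) → List X → ℕ
    lengthᵇ p xs = length (filterᵇ p xs)

    lengthᵇ-∑ : ∀ p xs → lengthᵇ p xs ≡ ∑L xs (λ x → bit (p x))
    lengthᵇ-∑ p [] = refl
    lengthᵇ-∑ p (x ∷ xs) with p x
    ... | true  = cong suc (lengthᵇ-∑ p xs)
    ... | false = lengthᵇ-∑ p xs

  ∑L-++ : ∀ {a} {X : Set a} xs ys (g : X → ℕ) → ∑L (xs ++ ys) g ≡ ∑L xs g ℕ.+ ∑L ys g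
  ∑L-++ []       ys g = refl
  ∑L-++ (x ∷ xs) ys g = trans (cong (g x ℕ.+_) (∑L-++ xs ys g)) (sym (ℕ.+-assoc (g x) _ _))

  ∑L-map : ∀ {a b} {X : Set a} {Y : Set b} (f : X → Y) xs (g : Y → ℕ) → ∑L (map f xs) g ≡ ∑L xs (λ x → g (f x))
  ∑L-map f []       g = refl
  ∑L-map f (x ∷ xs) g = cong (g (f x) ℕ.+_) (∑L-map f xs g)

  ∑L-product : ∀ {a b} {X : Set a} {Y : Set b} (xs : List X) (ys : List Y) (g : X × Y → ℕ) →
    ∑L (cartesianProduct xs ys) g ≡ ∑L xs (λ x → ∑L ys (λ y → g (x , y)))
  ∑L-product []       ys g = refl
  ∑L-product (x ∷ xs) ys g = trans (∑L-++ (map (x ,_) ys) (cartesianProduct xs ys) g)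
    (cong₂ ℕ._+_ (∑L-map (x ,_) ys g) (∑L-product xs ys g))

  %ℕ-unique : ∀ n {{_ : ℕ.NonZero n}} a b → ℤ.+ n ∣ a ℤ.- b → a %ℕ n ≡ b %ℕ n
  %ℕ-unique n a b h = ∣-<⇒≡ (n%ℕd<d a n) (n%ℕd<d b n)
    (subst (ℤ.+ n ∣_) (g a b (ℤ.+ (a %ℕ n)) (ℤ.+ (b %ℕ n))) (∣m∣n⇒∣m+n (∣m∣n⇒∣m-n h (%ℕ-∣ a n)) (%ℕ-∣ b n)))
    where
    g : ∀ a b c d → (a ℤ.- b) ℤ.- (a ℤ.- c) ℤ.+ (b ℤ.- d) ≡ c ℤ.- d
    g = ℤ-Solver.solve-∀

  modℤ-unique : ∀ n {{_ : ℕ.NonZero n}} a b → ℤ.+ n ∣ a ℤ.- b → a modℤ n ≡ b modℤ n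
  modℤ-unique n a b h = Fin.toℕ-injective (trans (Fin.toℕ-fromℕ< (n%ℕd<d a n)) (trans (%ℕ-unique n a b h) (sym (Fin.toℕ-fromℕ< (n%ℕd<d b n)))))

  ℤ→Ẑ : ℤ → Ẑ
  ℤ→Ẑ a = record
    { residue = λ m → a modℤ m
    ; compatible = λ m k m∣k → trans (cong (ℕ._% m) (Fin.toℕ-fromℕ< (n%ℕd<d a k)))
        (trans (same m k m∣k) (sym (Fin.toℕ-fromℕ< (n%ℕd<d a m))))
    }
    where
    same : ∀ m k .{{_ : ℕ.NonZero m}} .{{_ : ℕ.NonZero k}} → m ℕ∣.∣ k → (a %ℕ k) ℕ.% m ≡ a %ℕ m
    same m k m∣k = ∣-<⇒≡ (ℕ.m%n<n (a %ℕ k) m) (n%ℕd<d a m)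
      (subst (ℤ.+ m ∣_) (g (ℤ.+ ((a %ℕ k) ℕ.% m)) (ℤ.+ (a %ℕ k)) a (ℤ.+ (a %ℕ m)))
        (∣m∣n⇒∣m-n (∣m∣n⇒∣m-n (%ℕ-∣ a m) (∣-trans (∣ᵤ⇒∣ m∣k) (%ℕ-∣ a k))) (%ℕ-∣ (ℤ.+ (a %ℕ k)) m)))
      where
      g : ∀ x y a z → (a ℤ.- z) ℤ.- (a ℤ.- y) ℤ.- (y ℤ.- x) ≡ x ℤ.- z
      g = ℤ-Solver.solve-∀

  module Density (n : ℕ) {{n≢0 : ℕ.NonZero n}} where

    c : T → ℤ → ℕ
    c s A = Count.c n ⟦ s ⟧ A

    C : T → ℕ
    C s = ∑ n (λ A → c s (ℤ.+ A))

    total : ℕ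
    total = ∑T C

    N : ℕ
    N = n ℕ.* n

    transport : ∀ s A A′ → ℤ.+ n ∣ A′ ℤ.- A → c s A ℕ.≤ 4 ℕ.* c s A′
    transport s A A′ h = subst (λ x → c s A ℕ.≤ 4 ℕ.* c s x) (g A A′) (Count.Transport.transport n ⟦ s ⟧ A (A′ ℤ.- A) h)
      where
      g : ∀ A A′ → A ℤ.+ (A′ ℤ.- A) ≡ A′
      g = ℤ-Solver.solve-∀

    module Cover (U : Clopen) (contains : ∀ x → Closure Σ[ n ] x → Clopen._∋_ U x) where

      open Clopen U renaming (level to Λ)

      member? : T → ℕ → ℕ → Bool
      member? s a b = member (cubic s ((ℤ.+ a) modℤ Λ) ((ℤ.+ b) modℤ Λ))

      -- An integral cubic approximates itself at every level, so it lies in the closure.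
      contains-Σ : ∀ f → Σ[ n ] f → member (mapV (_modℤ Λ) f) ≡ true
      contains-Σ f h = contains (mapV ℤ→Ẑ f) (λ m → f , h , refl)

      -- A cubic in S may have discriminant 0 and so lie outside Σ. Shifting B by a suitable
      -- multiple of Λ n² repairs this and keeps both the class modulo Λ and solvability.
      contains-S : ∀ s A B → Local.S n ⟦ s ⟧ A B → member (cubic s (A modℤ Λ) (B modℤ Λ)) ≡ true
      contains-S s A B h = subst (λ b → member (cubic s (A modℤ Λ) b) ≡ true)
          (modℤ-unique Λ (B ℤ.+ i ℤ.* L) B (subst (ℤ.+ Λ ∣_) (g B (i ℤ.* L)) (∣n⇒∣m*n i (divides n² (ℤ.*-comm (ℤ.+ Λ) n²)))))
          (contains-Σ (cubic s A (B ℤ.+ i ℤ.* L)) (Converse.Sol⇒Σ (cubic s A (B ℤ.+ i ℤ.* L)) (proj₂ shift)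
            (Sol-period (B ℤ.+ i ℤ.* L) (subst (n² ∣_) (g B (i ℤ.* L)) (∣n⇒∣m*n i (divides (ℤ.+ Λ) refl))) (S⇒Sol h))))
        where
        open Local n ⟦ s ⟧
        L = ℤ.+ Λ ℤ.* n²
        ΛN≢0 : ℕ.NonZero (Λ ℕ.* (n ℕ.* n))
        ΛN≢0 = ℕ.m*n≢0 Λ (n ℕ.* n) {{level≢0}} {{ℕ.m*n≢0 n n}}
        L≢0 : L ≢ 0ℤ
        L≢0 eq = ℕ.≢-nonZero⁻¹ (Λ ℕ.* (n ℕ.* n)) {{ΛN≢0}}
          (trans (sym (trans (ℤ.abs-* (ℤ.+ Λ) n²) (cong (Λ ℕ.*_) (ℤ.abs-* (ℤ.+ n) (ℤ.+ n))))) (cong ℤ.∣_∣ eq))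
        shift = nonzero-shift s A B L L≢0
        i = proj₁ shift
        g : ∀ B x → x ≡ (B ℤ.+ x) ℤ.- B
        g = ℤ-Solver.solve-∀

      M : T → ℕ → ℕ
      M s a = ∑ Λ (λ b → bit (member? s a b))

      +-∣ : ∀ m j i → ℤ.+ m ∣ ℤ.+ (j ℕ.* m ℕ.+ i) ℤ.- ℤ.+ i
      +-∣ m j i = divides (ℤ.+ j) (trans (cong (ℤ._- ℤ.+ i) (trans (ℤ.pos-+ (j ℕ.* m) i) (cong (ℤ._+ ℤ.+ i) (ℤ.pos-* j m))))
        (g (ℤ.+ j ℤ.* ℤ.+ m) (ℤ.+ i)))
        where
        g : ∀ x i → (x ℤ.+ i) ℤ.- i ≡ x
        g = ℤ-Solver.solve-∀

      bit-mono : ∀ {p} {P : Set p} (P? : Dec P) b → (P → b ≡ true) → bit (does P?) ℕ.≤ bit b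
      bit-mono (no _) b h = ℕ.z≤n
      bit-mono (yes p) b h rewrite h p = ℕ.≤-refl

      bit-cong : ∀ {p q} {P : Set p} {Q : Set q} (P? : Dec P) (Q? : Dec Q) → (P → Q) → (Q → P) → bit (does P?) ≡ bit (does Q?)
      bit-cong (yes p) (yes q) f g = refl
      bit-cong (yes p) (no ¬q) f g = ⊥-elim (¬q (f p))
      bit-cong (no ¬p) (yes q) f g = ⊥-elim (¬p (g q))
      bit-cong (no ¬p) (no ¬q) f g = refl

      -- both sides count residues of B in [0, Λ n²)
      column : ∀ s A → Λ ℕ.* c s (ℤ.+ A) ℕ.≤ N ℕ.* M s A
      column s A = ℕ.≤-trans (ℕ.≤-reflexive (trans (cong (Λ ℕ.*_) (length-filter-∑ (λ b → S? (ℤ.+ A) (ℤ.+ b)) N))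
          (sym (∑-periodic Λ N {indicator} periodic))))
        (ℕ.≤-trans (∑-mono (Λ ℕ.* N) (λ b _ → bit-mono (S? (ℤ.+ A) (ℤ.+ b)) (member? s A b) (contains-S s (ℤ.+ A) (ℤ.+ b))))
          (ℕ.≤-reflexive (trans (cong (λ k → ∑ k (λ b → bit (member? s A b))) (ℕ.*-comm Λ N))
            (∑-periodic N Λ (λ j i → cong (λ b → bit (member (cubic s ((ℤ.+ A) modℤ Λ) b))) (modℤ-unique Λ (ℤ.+ (j ℕ.* Λ ℕ.+ i)) (ℤ.+ i) (+-∣ Λ j i)))))))
        where
        open Local n ⟦ s ⟧
        indicator : ℕ → ℕ
        indicator b = bit (does (S? (ℤ.+ A) (ℤ.+ b)))
        N≡ : ℤ.+ N ≡ n²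
        N≡ = ℤ.pos-* n n
        flip : ∀ {i} a b → i ∣ a ℤ.- b → i ∣ b ℤ.- a
        flip a b h = subst (_ ∣_) (g a b) (∣m⇒∣-m h)
          where
          g : ∀ a b → ℤ.- (a ℤ.- b) ≡ b ℤ.- a
          g = ℤ-Solver.solve-∀
        periodic : ∀ j i → indicator (j ℕ.* N ℕ.+ i) ≡ indicator i
        periodic j i = bit-cong (S? (ℤ.+ A) (ℤ.+ (j ℕ.* N ℕ.+ i))) (S? (ℤ.+ A) (ℤ.+ i))
          (S-period (ℤ.+ i) (subst (_∣ ℤ.+ i ℤ.- ℤ.+ (j ℕ.* N ℕ.+ i)) N≡ (flip (ℤ.+ (j ℕ.* N ℕ.+ i)) (ℤ.+ i) (+-∣ N j i))))
          (S-period (ℤ.+ (j ℕ.* N ℕ.+ i)) (subst (_∣ ℤ.+ (j ℕ.* N ℕ.+ i) ℤ.- ℤ.+ i) N≡ (+-∣ N j i)))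

      -- Each A below n is compared by `transport` with its Λ translates below Λ n, which costs the
      -- factor 4; `column` is then summed over these.
      rows : ∀ s → Λ ℕ.* (Λ ℕ.* C s) ℕ.≤ 4 ℕ.* (N ℕ.* (n ℕ.* ∑ Λ (M s)))
      rows s = ℕ.≤-trans (ℕ.*-monoʳ-≤ Λ (∑-blocks-≥ Λ n 4 (λ j i → transport s (ℤ.+ i) (ℤ.+ (j ℕ.* n ℕ.+ i)) (+-∣ n j i))))
        (ℕ.≤-trans (ℕ.≤-reflexive (swap Λ 4 _)) (ℕ.*-monoʳ-≤ 4
          (ℕ.≤-trans (ℕ.≤-reflexive (sym (∑-* (Λ ℕ.* n) Λ _)))
          (ℕ.≤-trans (∑-mono (Λ ℕ.* n) (λ A _ → column s A))
          (ℕ.≤-reflexive (trans (∑-* (Λ ℕ.* n) N (M s)) (cong (N ℕ.*_) (trans (cong (λ k → ∑ k (M s)) (ℕ.*-comm Λ n))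
            (∑-periodic n Λ (λ j i → ∑-cong Λ (λ b → cong (λ a → bit (member (cubic s a ((ℤ.+ b) modℤ Λ)))) (modℤ-unique Λ (ℤ.+ (j ℕ.* Λ ℕ.+ i)) (ℤ.+ i) (+-∣ Λ j i))))))))))))) 
        where
        swap : ∀ a b x → a ℕ.* (b ℕ.* x) ≡ b ℕ.* (a ℕ.* x)
        swap = ℕ-Solver.solve-∀

      triples : List (T × ℕ × ℕ)
      triples = cartesianProduct Ts (cartesianProduct (downFrom Λ) (downFrom Λ))

      memberᵗ : T × ℕ × ℕ → Bool
      memberᵗ (s , a , b) = member? s a b

      members-≤ : ∑T (λ s → ∑ Λ (M s)) ℕ.≤ length (filterᵇ member (allV Λ))
      members-≤ = ℕ.≤-trans (ℕ.≤-reflexive (sym counted)) (injection-length toV unique into injective)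
        where
        counted : length (filterᵇ memberᵗ triples) ≡ ∑T (λ s → ∑ Λ (M s))
        counted = trans (lengthᵇ-∑ memberᵗ triples) (trans (∑L-product Ts (cartesianProduct (downFrom Λ) (downFrom Λ)) (λ x → bit (memberᵗ x)))
          (∑L-cong Ts (λ s → trans (∑L-product (downFrom Λ) (downFrom Λ) (λ x → bit (memberᵗ (s , x))))
            (trans (∑L-cong (downFrom Λ) (λ a → ∑L-downFrom Λ _)) (∑L-downFrom Λ _)))))
        toV : T × ℕ × ℕ → V (Fin Λ)
        toV (s , a , b) = cubic s ((ℤ.+ a) modℤ Λ) ((ℤ.+ b) modℤ Λ)
        unique : Unique (filterᵇ memberᵗ triples)
        unique = Unique.filter⁺ (λ x → T? (memberᵗ x))
          (Unique.cartesianProduct⁺ Ts-unique (Unique.cartesianProduct⁺ (Unique.downFrom⁺ Λ) (Unique.downFrom⁺ Λ)))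
        bounds : ∀ {s a b} → (s , a , b) ∈ filterᵇ memberᵗ triples → a ℕ.< Λ × b ℕ.< Λ × Bool.T (member? s a b)
        bounds x∈ =
          let x∈′ , t = ∈-filter⁻ (λ x → T? (memberᵗ x)) {xs = triples} x∈
              ab = ∈-cartesianProduct⁻ (downFrom Λ) (downFrom Λ) (proj₂ (∈-cartesianProduct⁻ Ts _ x∈′))
          in ∈-downFrom⁻ (proj₁ ab) , ∈-downFrom⁻ (proj₂ ab) , t
        into : ∀ {x} → x ∈ filterᵇ memberᵗ triples → toV x ∈ filterᵇ member (allV Λ)
        into {s , a , b} x∈ = ∈-filter⁺ (λ v → T? (member v))
          (∈-cartesianProductWith⁺ (λ s g → g s) (∈-Ts s)
            (∈-cartesianProductWith⁺ (λ a b s → cubic s a b) (∈-allFin ((ℤ.+ a) modℤ Λ)) (∈-allFin ((ℤ.+ b) modℤ Λ))))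
          (proj₂ (proj₂ (bounds x∈)))
        mod-injective : ∀ {a b} → a ℕ.< Λ → b ℕ.< Λ → (ℤ.+ a) modℤ Λ ≡ (ℤ.+ b) modℤ Λ → a ≡ b
        mod-injective {a} {b} a< b< eq = trans (sym (small a<)) (trans
          (trans (sym (Fin.toℕ-fromℕ< (n%ℕd<d (ℤ.+ a) Λ))) (trans (cong toℕ eq) (Fin.toℕ-fromℕ< (n%ℕd<d (ℤ.+ b) Λ)))) (small b<))
          where
          small : ∀ {a} → a ℕ.< Λ → (ℤ.+ a) %ℕ Λ ≡ a
          small a< = ℕ.m<n⇒m%n≡m a<
        injective : ∀ {x y} → x ∈ filterᵇ memberᵗ triples → y ∈ filterᵇ memberᵗ triples → toV x ≡ toV y → x ≡ y
        injective {s , a , b} {s′ , a′ , b′} x∈ y∈ eq =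
          let a< , b< , _ = bounds x∈ ; a′< , b′< , _ = bounds y∈ in
          cong₂ _,_ (cong V.t eq) (cong₂ _,_ (mod-injective a< a′< (cong V.A eq)) (mod-injective b< b′< (cong V.B eq)))

      -- After division by 12 n³ Λ² the right side is the mass of U, and the left side is the
      -- quantity ω.
      density : Λ ℕ.* Λ ℕ.* total ℕ.≤ 4 ℕ.* (n ℕ.* n ℕ.* n) ℕ.* length (filterᵇ member (allV Λ))
      density = ℕ.≤-trans (ℕ.≤-reflexive (trans (ℕ.*-assoc Λ Λ total) (trans (cong (Λ ℕ.*_) (sym (∑T-* Λ C))) (sym (∑T-* Λ (λ s → Λ ℕ.* C s))))))
        (ℕ.≤-trans (∑T-mono rows) (ℕ.≤-trans (ℕ.≤-reflexive (trans (cong₃′ (λ s → g n (∑ Λ (M s)))) (∑T-* (4 ℕ.* (n ℕ.* n ℕ.* n)) (λ s → ∑ Λ (M s)))))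
          (ℕ.*-monoʳ-≤ (4 ℕ.* (n ℕ.* n ℕ.* n)) members-≤)))
        where
        g : ∀ n x → 4 ℕ.* (n ℕ.* n ℕ.* (n ℕ.* x)) ≡ 4 ℕ.* (n ℕ.* n ℕ.* n) ℕ.* x
        g = ℕ-Solver.solve-∀
        cong₃′ : ∀ {g h : T → ℕ} → (∀ s → g s ≡ h s) → ∑T g ≡ ∑T h
        cong₃′ eq = cong₂ ℕ._+_ (eq t₋₁) (cong₂ ℕ._+_ (eq t₀) (cong (ℕ._+ 0) (eq t₁)))

-- Counting cubics with bounded A and clustered B.

module PointCount where

  open import Data.Empty using (⊥-elim)
  open import Data.Integer.Base as ℤ using (ℤ)
  import Data.Integer.Properties as ℤ
  import Data.Integer.Tactic.RingSolver as ℤ-Solver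
  open import Data.Integer.Divisibility.Signed using (_∣_; divides)
  open import Data.List.Base using (List; []; _∷_; length; map; filter; downFrom)
  open import Data.List.Membership.Propositional using (_∈_)
  open import Data.List.Membership.Propositional.Properties using (∈-filter⁻; ∈-map⁻; ∈-downFrom⁺)
  open import Data.List.Properties using (length-map)
  open import Data.List.Relation.Unary.All as All using (All; []; _∷_)
  open import Data.List.Relation.Unary.Any using (here; there)
  open import Data.List.Relation.Unary.AllPairs using ([]; _∷_)
  open import Data.List.Relation.Unary.Unique.Propositional using (Unique)
  import Data.List.Relation.Unary.Unique.Propositional.Properties as Unique
  open import Data.Nat.Base as ℕ using (ℕ; suc)
  import Data.Nat.DivMod as ℕ
  import Data.Nat.Properties as ℕ
  import Data.Nat.Tactic.RingSolver as ℕ-Solver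
  open import Data.Product.Base using (∃; _×_; _,_; proj₁; proj₂)
  open import Data.Sum.Base using (inj₁; inj₂)
  open import Relation.Binary.Definitions using (DecidableEquality)
  open import Relation.Binary.PropositionalEquality hiding ([_]; J)
  open import Relation.Nullary using (yes; no; does)

  open import Defs
  open LocalConditions using (module Local)
  open ResidueCounts hiding (least)
  open Windows using (module Window)
  open IndexDivisibility
  open DensityBound hiding (∑L-++)

  ∑L-+ : ∀ {a} {X : Set a} xs (g h : X → ℕ) → ∑L xs (λ x → g x ℕ.+ h x) ≡ ∑L xs g ℕ.+ ∑L xs h
  ∑L-+ [] g h = refl
  ∑L-+ (x ∷ xs) g h = trans (cong (g x ℕ.+ h x ℕ.+_) (∑L-+ xs g h)) (s (g x) (h x) (∑L xs g) (∑L xs h))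
    where
    s : ∀ a b c d → a ℕ.+ b ℕ.+ (c ℕ.+ d) ≡ a ℕ.+ c ℕ.+ (b ℕ.+ d)
    s = ℕ-Solver.solve-∀

  module _ {a b} {X : Set a} {K : Set b} (_≟_ : DecidableEquality K) (g : X → K) where

    class : K → List X → List X
    class k = filter (λ x → g x ≟ k)

    length-classes : ∀ ks xs → (∀ {x} → x ∈ xs → g x ∈ ks) → length xs ℕ.≤ ∑L ks (λ k → length (class k xs))
    length-classes ks [] _ = ℕ.z≤n
    length-classes ks (x ∷ xs) into = ℕ.≤-trans
      (ℕ.+-mono-≤ (hit ks (into (here refl))) (length-classes ks xs (λ x∈ → into (there x∈))))
      (ℕ.≤-reflexive (sym (trans (∑L-cong ks step) (∑L-+ ks _ _))))
      where
      step : ∀ k → length (class k (x ∷ xs)) ≡ bit (does (g x ≟ k)) ℕ.+ length (class k xs)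
      step k with g x ≟ k
      ... | yes _ = refl
      ... | no _ = refl
      hit : ∀ ks → g x ∈ ks → 1 ℕ.≤ ∑L ks (λ k → bit (does (g x ≟ k)))
      hit (k ∷ ks) (here refl) with g x ≟ g x
      ... | yes _ = ℕ.s≤s ℕ.z≤n
      ... | no ≢ = ⊥-elim (≢ refl)
      hit (k ∷ ks) (there k∈) = ℕ.≤-trans (hit ks k∈) (ℕ.m≤n+m _ (bit (does (g x ≟ k))))

  module _ {a b} {X : Set a} {Y : Set b} (f : X → Y) where

    unique-map : ∀ {xs} → Unique xs → (∀ {x y} → x ∈ xs → y ∈ xs → f x ≡ f y → x ≡ y) → Unique (map f xs)
    unique-map [] inj = []
    unique-map {x ∷ xs} (x∉ ∷ u) inj = All.tabulate distinct ∷ unique-map u (λ p q → inj (there p) (there q))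
      where
      distinct : ∀ {y} → y ∈ map f xs → f x ≢ y
      distinct y∈ eq with ∈-map⁻ f y∈
      ... | z , z∈ , refl = All.lookup x∉ z∈ (inj (here refl) (there z∈) eq)

  module _ {a} {X : Set a} (g : X → ℤ) where

    minimum : ∀ x xs → ∃ λ m → m ∈ x ∷ xs × (∀ {y} → y ∈ x ∷ xs → g m ℤ.≤ g y)
    minimum x [] = x , here refl , λ { (here refl) → ℤ.≤-refl }
    minimum x (y ∷ ys) with minimum y ys
    ... | m , m∈ , least with ℤ.≤-total (g x) (g m)
    ...   | inj₁ x≤m = x , here refl , λ { (here refl) → ℤ.≤-refl ; (there z∈) → ℤ.≤-trans x≤m (least z∈) }
    ...   | inj₂ m≤x = m , there m∈ , λ { (here refl) → m≤x ; (there z∈) → least z∈ }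

  _≟T_ : DecidableEquality T
  t₋₁ ≟T t₋₁ = yes refl
  t₋₁ ≟T t₀  = no λ ()
  t₋₁ ≟T t₁  = no λ ()
  t₀  ≟T t₋₁ = no λ ()
  t₀  ≟T t₀  = yes refl
  t₀  ≟T t₁  = no λ ()
  t₁  ≟T t₋₁ = no λ ()
  t₁  ≟T t₀  = no λ ()
  t₁  ≟T t₁  = yes refl

  -- A + a as a natural number, an index below 2a + 1 when ∣A∣ ≤ a.
  offset : ℕ → ℤ → ℕ
  offset a (ℤ.+ m)    = a ℕ.+ m
  offset a ℤ.-[1+ m ] = a ℕ.∸ suc m

  offset-≡ : ∀ a A → ℤ.∣ A ∣ ℕ.≤ a → A ≡ ℤ.- ℤ.+ a ℤ.+ ℤ.+ offset a A
  offset-≡ a (ℤ.+ m) _ = trans (g (ℤ.+ a) (ℤ.+ m)) (cong (λ x → ℤ.- ℤ.+ a ℤ.+ x) (sym (ℤ.pos-+ a m)))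
    where
    g : ∀ a m → m ≡ ℤ.- a ℤ.+ (a ℤ.+ m)
    g = ℤ-Solver.solve-∀
  offset-≡ a ℤ.-[1+ m ] m<a = trans (g (ℤ.+ suc m) (ℤ.+ (a ℕ.∸ suc m)))
      (cong (λ x → ℤ.- x ℤ.+ ℤ.+ (a ℕ.∸ suc m)) (trans (sym (ℤ.pos-+ (suc m) (a ℕ.∸ suc m))) (cong ℤ.+_ (ℕ.m+[n∸m]≡n m<a))))
    where
    g : ∀ m r → ℤ.- m ≡ ℤ.- (m ℤ.+ r) ℤ.+ r
    g = ℤ-Solver.solve-∀

  offset-< : ∀ a A → ℤ.∣ A ∣ ℕ.≤ a → offset a A ℕ.< suc (a ℕ.+ a)
  offset-< a (ℤ.+ m) m≤a = ℕ.s≤s (ℕ.+-monoʳ-≤ a m≤a)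
  offset-< a ℤ.-[1+ m ] _ = ℕ.s≤s (ℕ.≤-trans (ℕ.m∸n≤m a (suc m)) (ℕ.m≤m+n a a))

  module Counting (n : ℕ) {{n≢0 : ℕ.NonZero n}} (sign : V ℤ → ℕ) (sign<2 : ∀ f → sign f ℕ.< 2) where

    open Density n

    module _ (a ℓ : ℕ) {fs : List (V ℤ)} (unique : Unique fs) (in-Σ : ∀ {f} → f ∈ fs → Σ[ n ] f)
             (A-bound : ∀ {f} → f ∈ fs → ℤ.∣ V.A f ∣ ℕ.≤ a)
             (B-close : ∀ {f g} → f ∈ fs → g ∈ fs → V.t f ≡ V.t g → V.A f ≡ V.A g → sign f ≡ sign g → ℤ.∣ V.B f ℤ.- V.B g ∣ ℕ.≤ ℓ) where

      centre : ℕ → ℤ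
      centre i = ℤ.- ℤ.+ a ℤ.+ ℤ.+ i

      group : T → ℕ → ℕ → List (V ℤ)
      group s i b = class ℕ._≟_ sign b (class ℕ._≟_ (λ f → offset a (V.A f)) i (class _≟T_ V.t s fs))

      group-unique : ∀ s i b → Unique (group s i b)
      group-unique s i b = Unique.filter⁺ (λ f → sign f ℕ.≟ b) (Unique.filter⁺ (λ f → offset a (V.A f) ℕ.≟ i) (Unique.filter⁺ (λ f → V.t f ≟T s) unique))

      ∈-group : ∀ {s i b f} → f ∈ group s i b → f ∈ fs × V.t f ≡ s × V.A f ≡ centre i × sign f ≡ b
      ∈-group {s} {i} {b} {f} f∈ =
        let f∈₁ , sg = ∈-filter⁻ (λ f → sign f ℕ.≟ b) {xs = class ℕ._≟_ (λ f → offset a (V.A f)) i (class _≟T_ V.t s fs)} f∈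
            f∈₂ , off = ∈-filter⁻ (λ f → offset a (V.A f) ℕ.≟ i) {xs = class _≟T_ V.t s fs} f∈₁
            f∈₃ , ts = ∈-filter⁻ (λ f → V.t f ≟T s) {xs = fs} f∈₂
        in f∈₃ , ts , trans (offset-≡ a (V.A f) (A-bound f∈₃)) (cong (λ i → ℤ.- ℤ.+ a ℤ.+ ℤ.+ i) off) , sg

      -- Measured from the least B in the group, all members lie in one window of length ℓ, to which
      -- the window bound applies.
      length-group : ∀ s i b → length (group s i b) ℕ.* N ℕ.≤ c s (centre i) ℕ.* ℓ ℕ.+ n ℕ.* N
      length-group s i b = go (group s i b) (group-unique s i b) ∈-group
        where
        go : ∀ zs → Unique zs → (∀ {f} → f ∈ zs → f ∈ fs × V.t f ≡ s × V.A f ≡ centre i × sign f ≡ b) →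
          length zs ℕ.* N ℕ.≤ c s (centre i) ℕ.* ℓ ℕ.+ n ℕ.* N
        go [] _ _ = ℕ.z≤n
        go zs@(z ∷ zs′) u inf = subst (λ k → k ℕ.* N ℕ.≤ c s (centre i) ℕ.* ℓ ℕ.+ n ℕ.* N) (length-map distance zs)
            (Window.window n ⟦ s ⟧ (Sol⇒S n s) (centre i) lo ℓ (unique-map distance u injective) bounded)
          where
          least = minimum V.B z zs′
          f₀ = proj₁ least
          lo = V.B f₀
          distance : V ℤ → ℕ
          distance f = ℤ.∣ V.B f ℤ.- lo ∣
          position : ∀ {f} → f ∈ zs → lo ℤ.+ ℤ.+ distance f ≡ V.B f
          position {f} f∈ = trans (cong (λ x → lo ℤ.+ x) (ℤ.0≤i⇒+∣i∣≡i (ℤ.i≤j⇒0≤j-i (proj₂ (proj₂ least) f∈)))) (g lo (V.B f))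
            where
            g : ∀ x y → x ℤ.+ (y ℤ.- x) ≡ y
            g = ℤ-Solver.solve-∀
          injective : ∀ {f g} → f ∈ zs → g ∈ zs → distance f ≡ distance g → f ≡ g
          injective f∈ g∈ eq =
            let _ , t≡ , A≡ , _ = inf f∈ ; _ , t≡′ , A≡′ , _ = inf g∈ in
            cong-cubic (trans t≡ (sym t≡′)) (trans A≡ (sym A≡′)) (trans (sym (position f∈)) (trans (cong (λ d → lo ℤ.+ ℤ.+ d) eq) (position g∈)))
            where
            cong-cubic : ∀ {s s′ A A′ B B′} → s ≡ s′ → A ≡ A′ → B ≡ B′ → cubic s A B ≡ cubic s′ A′ B′
            cong-cubic refl refl refl = refl
          bounded : ∀ {d} → d ∈ map distance zs → d ℕ.≤ ℓ × Local.S n ⟦ s ⟧ (centre i) (lo ℤ.+ ℤ.+ d)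
          bounded d∈ with ∈-map⁻ distance d∈
          ... | f , f∈ , refl =
            let f∈fs , t≡ , A≡ , sg = inf f∈
                f₀∈fs , t≡₀ , A≡₀ , sg₀ = inf (proj₁ (proj₂ least))
                r , V₁ = Σ⇒V f (in-Σ f∈fs)
            in B-close f∈fs f₀∈fs (trans t≡ (sym t≡₀)) (trans A≡ (sym A≡₀)) (trans sg (sym sg₀)) ,
               subst (λ B → Local.S n ⟦ s ⟧ (centre i) B) (sym (position f∈))
                 (subst₂ (λ s A → Local.S n ⟦ s ⟧ A (V.B f)) t≡ A≡ (Local.V⇒S n ⟦ V.t f ⟧ (V.A f) (V.B f) r V₁))

      width : ℕ
      width = suc (a ℕ.+ a)

      -- the blocks [jn, (j+1)n) with -γ ≤ j < γ cover [-a, a]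
      γ : ℕ
      γ = suc (a ℕ./ n)

      γn≤a+n : γ ℕ.* n ℕ.≤ a ℕ.+ n
      γn≤a+n = ℕ.≤-trans (ℕ.+-monoʳ-≤ n (ℕ.m/n*n≤m a n)) (ℕ.≤-reflexive (ℕ.+-comm n a))

      a<γn : a ℕ.< γ ℕ.* n
      a<γn = subst (ℕ._< γ ℕ.* n) (sym (ℕ.m≡m%n+[m/n]*n a n)) (ℕ.+-monoˡ-< _ (ℕ.m%n<n a n))

      -- The factor 4 is that of `transport`, which compares every A with its residue modulo n.
      columns : ∀ s → ∑ width (λ i → c s (centre i)) ℕ.≤ 4 ℕ.* ((γ ℕ.+ γ) ℕ.* C s)
      columns s = ℕ.≤-trans (ℕ.m≤n+m _ (∑ o h)) (ℕ.≤-trans (ℕ.≤-reflexive (trans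
          (cong (∑ o h ℕ.+_) (∑-cong width (λ i → cong (c s) (recentre i)))) (sym (∑-split o width h))))
        (ℕ.≤-trans (∑-widen (o ℕ.+ width) ((γ ℕ.+ γ) ℕ.* n) fits) (∑-blocks-≤ (γ ℕ.+ γ) n 4 (λ j i → transport s (start (j ℕ.* n ℕ.+ i)) (ℤ.+ i) (divides (ℤ.+ γ ℤ.- ℤ.+ j) (residue j i))))))
        where
        o = γ ℕ.* n ℕ.∸ a
        start : ℕ → ℤ
        start i = ℤ.- ℤ.+ (γ ℕ.* n) ℤ.+ ℤ.+ i
        h : ℕ → ℕ
        h i = c s (start i)
        o+a : o ℕ.+ a ≡ γ ℕ.* n
        o+a = ℕ.m∸n+n≡m (ℕ.<⇒≤ a<γn)
        recentre : ∀ i → centre i ≡ start (o ℕ.+ i)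
        recentre i = trans (g (ℤ.+ a) (ℤ.+ i) (ℤ.+ o)) (cong₂ (λ x y → ℤ.- x ℤ.+ y) (trans (sym (ℤ.pos-+ o a)) (cong ℤ.+_ o+a)) (sym (ℤ.pos-+ o i)))
          where
          g : ∀ a i o → ℤ.- a ℤ.+ i ≡ ℤ.- (o ℤ.+ a) ℤ.+ (o ℤ.+ i)
          g = ℤ-Solver.solve-∀
        residue : ∀ j i → ℤ.+ i ℤ.- start (j ℕ.* n ℕ.+ i) ≡ (ℤ.+ γ ℤ.- ℤ.+ j) ℤ.* ℤ.+ n
        residue j i = trans (cong₂ (λ x y → ℤ.+ i ℤ.- (ℤ.- x ℤ.+ y)) (ℤ.pos-* γ n) (trans (ℤ.pos-+ (j ℕ.* n) i) (cong (ℤ._+ ℤ.+ i) (ℤ.pos-* j n))))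
          (g (ℤ.+ i) (ℤ.+ γ) (ℤ.+ j) (ℤ.+ n))
          where
          g : ∀ i γ j n → i ℤ.- (ℤ.- (γ ℤ.* n) ℤ.+ (j ℤ.* n ℤ.+ i)) ≡ (γ ℤ.- j) ℤ.* n
          g = ℤ-Solver.solve-∀
        fits : o ℕ.+ width ℕ.≤ (γ ℕ.+ γ) ℕ.* n
        fits = ℕ.≤-trans (ℕ.≤-reflexive (trans (s₁ o a) (cong (ℕ._+ suc a) o+a))) (ℕ.≤-trans (ℕ.+-monoʳ-≤ (γ ℕ.* n) a<γn) (ℕ.≤-reflexive (sym (ℕ.*-distribʳ-+ n γ γ))))
          where
          s₁ : ∀ o a → o ℕ.+ suc (a ℕ.+ a) ≡ o ℕ.+ a ℕ.+ suc a
          s₁ = ℕ-Solver.solve-∀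
        ∑-widen : ∀ k l → k ℕ.≤ l → ∑ k h ℕ.≤ ∑ l h
        ∑-widen k l k≤l = subst (λ l → ∑ k h ℕ.≤ ∑ l h) (ℕ.m+[n∸m]≡n k≤l) (ℕ.≤-trans (ℕ.m≤m+n (∑ k h) _) (ℕ.≤-reflexive (sym (∑-split k (l ℕ.∸ k) h))))

      -- 16 = 2 · 4 · 2 comes from the two signs, the factor of `transport`, and the blocks on both
      -- sides of 0; 6 = 3 · 2 comes from the values of t and the signs. The inequality is
      -- multiplied by n³ to stay within ℕ.
      count : n ℕ.* (length fs ℕ.* N) ℕ.≤ 16 ℕ.* (ℓ ℕ.* ((a ℕ.+ n) ℕ.* total)) ℕ.+ 6 ℕ.* (width ℕ.* (n ℕ.* (n ℕ.* N)))
      count = ℕ.≤-trans (ℕ.*-monoʳ-≤ n (ℕ.≤-trans (ℕ.*-monoˡ-≤ N partition) (ℕ.≤-trans (ℕ.≤-reflexive distribute)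
            (ℕ.≤-trans (∑T-mono (λ s → ∑-mono width (λ i _ → ℕ.+-mono-≤ (length-group s i 1) (ℕ.+-mono-≤ (length-group s i 0) (ℕ.≤-refl {0})))))
            (ℕ.≤-trans (ℕ.≤-reflexive regroup) (ℕ.+-monoˡ-≤ _ (ℕ.*-monoʳ-≤ (2 ℕ.* ℓ) (ℕ.≤-trans (∑T-mono columns) (ℕ.≤-reflexive collect)))))))))
        (ℕ.≤-trans (ℕ.≤-reflexive (r₁ n ℓ γ total (width ℕ.* (n ℕ.* N)))) (ℕ.≤-trans
          (ℕ.+-monoˡ-≤ _ (ℕ.*-monoʳ-≤ 16 (ℕ.*-monoʳ-≤ ℓ (ℕ.*-monoˡ-≤ total γn≤a+n)))) (ℕ.≤-reflexive (r₂ (16 ℕ.* (ℓ ℕ.* ((a ℕ.+ n) ℕ.* total))) n width N))))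
        where
        len : T → ℕ → ℕ → ℕ
        len s i b = length (group s i b)
        partition : length fs ℕ.≤ ∑T (λ s → ∑ width (λ i → len s i 1 ℕ.+ (len s i 0 ℕ.+ 0)))
        partition = ℕ.≤-trans (length-classes _≟T_ V.t Ts fs (λ {f} _ → ∈-Ts (V.t f))) (∑T-mono (λ s →
          ℕ.≤-trans (length-classes ℕ._≟_ (λ f → offset a (V.A f)) (downFrom width) (class _≟T_ V.t s fs)
              (λ {f} f∈ → ∈-downFrom⁺ (offset-< a (V.A f) (A-bound (proj₁ (∈-filter⁻ (λ f → V.t f ≟T s) {xs = fs} f∈))))))
          (ℕ.≤-trans (ℕ.≤-reflexive (∑L-downFrom width _)) (∑-mono width (λ i _ →
            length-classes ℕ._≟_ sign (downFrom 2) (class ℕ._≟_ (λ f → offset a (V.A f)) i (class _≟T_ V.t s fs)) (λ {f} _ → ∈-downFrom⁺ (sign<2 f)))))))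
        ∑T-cong : ∀ {g h} → (∀ s → g s ≡ h s) → ∑T g ≡ ∑T h
        ∑T-cong eq = cong₂ ℕ._+_ (eq t₋₁) (cong₂ ℕ._+_ (eq t₀) (cong (ℕ._+ 0) (eq t₁)))
        distribute : ∑T (λ s → ∑ width (λ i → len s i 1 ℕ.+ (len s i 0 ℕ.+ 0))) ℕ.* N
          ≡ ∑T (λ s → ∑ width (λ i → len s i 1 ℕ.* N ℕ.+ (len s i 0 ℕ.* N ℕ.+ 0)))
        distribute = trans (ℕ.*-comm _ N) (trans (sym (∑T-* N (λ s → ∑ width (λ i → len s i 1 ℕ.+ (len s i 0 ℕ.+ 0)))))
            (∑T-cong {λ s → N ℕ.* ∑ width (λ i → len s i 1 ℕ.+ (len s i 0 ℕ.+ 0))} {λ s → ∑ width (λ i → len s i 1 ℕ.* N ℕ.+ (len s i 0 ℕ.* N ℕ.+ 0))}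
              (λ s → trans (sym (∑-* width N (λ i → len s i 1 ℕ.+ (len s i 0 ℕ.+ 0)))) (∑-cong width (λ i → d N (len s i 1) (len s i 0))))))
          where
          d : ∀ N x y → N ℕ.* (x ℕ.+ (y ℕ.+ 0)) ≡ x ℕ.* N ℕ.+ (y ℕ.* N ℕ.+ 0)
          d = ℕ-Solver.solve-∀
        regroup : ∑T (λ s → ∑ width (λ i → (c s (centre i) ℕ.* ℓ ℕ.+ n ℕ.* N) ℕ.+ ((c s (centre i) ℕ.* ℓ ℕ.+ n ℕ.* N) ℕ.+ 0)))
          ≡ 2 ℕ.* ℓ ℕ.* ∑T (λ s → ∑ width (λ i → c s (centre i))) ℕ.+ 6 ℕ.* (width ℕ.* (n ℕ.* N))
        regroup = trans (∑T-cong {λ s → ∑ width (λ i → (c s (centre i) ℕ.* ℓ ℕ.+ n ℕ.* N) ℕ.+ ((c s (centre i) ℕ.* ℓ ℕ.+ n ℕ.* N) ℕ.+ 0))}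
            {λ s → 2 ℕ.* ℓ ℕ.* sums s ℕ.+ width ℕ.* (2 ℕ.* (n ℕ.* N))} (λ s → trans (∑-cong width (λ i → d (c s (centre i)) ℓ (n ℕ.* N)))
            (trans (∑-+ width (λ i → 2 ℕ.* ℓ ℕ.* c s (centre i)) (λ _ → 2 ℕ.* (n ℕ.* N)))
              (cong₂ ℕ._+_ (∑-* width (2 ℕ.* ℓ) (λ i → c s (centre i))) (∑-const width (2 ℕ.* (n ℕ.* N)))))))
          (e (2 ℕ.* ℓ) (sums t₋₁) (sums t₀) (sums t₁) width (n ℕ.* N))
          where
          sums : T → ℕ
          sums s = ∑ width (λ i → c s (centre i))
          d : ∀ x ℓ m → (x ℕ.* ℓ ℕ.+ m) ℕ.+ ((x ℕ.* ℓ ℕ.+ m) ℕ.+ 0) ≡ 2 ℕ.* ℓ ℕ.* x ℕ.+ 2 ℕ.* m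
          d = ℕ-Solver.solve-∀
          e : ∀ L x y z w m → L ℕ.* x ℕ.+ w ℕ.* (2 ℕ.* m) ℕ.+ (L ℕ.* y ℕ.+ w ℕ.* (2 ℕ.* m) ℕ.+ (L ℕ.* z ℕ.+ w ℕ.* (2 ℕ.* m) ℕ.+ 0))
            ≡ L ℕ.* (x ℕ.+ (y ℕ.+ (z ℕ.+ 0))) ℕ.+ 6 ℕ.* (w ℕ.* m)
          e = ℕ-Solver.solve-∀
        collect : ∑T (λ s → 4 ℕ.* ((γ ℕ.+ γ) ℕ.* C s)) ≡ 4 ℕ.* ((γ ℕ.+ γ) ℕ.* total)
        collect = trans (∑T-* 4 (λ s → (γ ℕ.+ γ) ℕ.* C s)) (cong (4 ℕ.*_) (∑T-* (γ ℕ.+ γ) C))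
        r₁ : ∀ n ℓ γ t m → n ℕ.* (2 ℕ.* ℓ ℕ.* (4 ℕ.* ((γ ℕ.+ γ) ℕ.* t)) ℕ.+ 6 ℕ.* m) ≡ 16 ℕ.* (ℓ ℕ.* (γ ℕ.* n ℕ.* t)) ℕ.+ n ℕ.* (6 ℕ.* m)
        r₁ = ℕ-Solver.solve-∀
        r₂ : ∀ x n w N → x ℕ.+ n ℕ.* (6 ℕ.* (w ℕ.* (n ℕ.* N))) ≡ x ℕ.+ 6 ℕ.* (w ℕ.* (n ℕ.* (n ℕ.* N)))
        r₂ = ℕ-Solver.solve-∀

-- Order and arithmetic of Cauchy reals.

module RealOrder where

  open import Data.Empty using (⊥-elim)
  open import Data.Nat.Base as ℕ using (ℕ)
  import Data.Nat.Properties as ℕ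
  open import Data.Product.Base using (∃; _×_; _,_; proj₁; proj₂)
  open import Data.Rational.Base hiding (_/_; truncate)
  open import Data.Rational.Properties
  open import Data.Sum.Base using (_⊎_; inj₁; inj₂)
  open import Relation.Binary.PropositionalEquality hiding ([_]; J)
  open import Relation.Nullary using (yes; no; ¬_)
  import Data.Rational.Solver
  open Data.Rational.Solver.+-*-Solver using (solve; con; _:=_; _:+_; _:-_; _:*_; :-_)

  open import Defs
  open ℝ

  ≤-by : ∀ {p q} d → 0ℚ ≤ d → q ≡ p + d → p ≤ q
  ≤-by {p} d 0≤d refl = subst (_≤ p + d) (+-identityʳ p) (+-monoʳ-≤ p 0≤d)

  <-by : ∀ {p q} d → 0ℚ < d → q ≡ p + d → p < q
  <-by {p} d 0<d refl = subst (_< p + d) (+-identityʳ p) (+-monoʳ-< p 0<d)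

  gap≥0 : ∀ {p q} → p ≤ q → 0ℚ ≤ q - p
  gap≥0 {p} {q} p≤q = subst (_≤ q - p) (+-inverseʳ p) (+-monoˡ-≤ (- p) p≤q)

  gap>0 : ∀ {p q} → p < q → 0ℚ < q - p
  gap>0 {p} {q} p<q = subst (_< q - p) (+-inverseʳ p) (+-monoˡ-< (- p) p<q)

  +-nonneg : ∀ {p q} → 0ℚ ≤ p → 0ℚ ≤ q → 0ℚ ≤ p + q
  +-nonneg h k = +-mono-≤ h k

  *-nonneg : ∀ {p q} → 0ℚ ≤ p → 0ℚ ≤ q → 0ℚ ≤ p * q
  *-nonneg {p} {q} h k = subst (_≤ p * q) (*-zeroˡ q) (*-monoʳ-≤-nonNeg q {{nonNegative k}} h)

  +-pos-nonneg : ∀ {p q} → 0ℚ < p → 0ℚ ≤ q → 0ℚ < p + q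
  +-pos-nonneg h k = +-mono-<-≤ h k

  *-positive : ∀ {p q} → 0ℚ < p → 0ℚ < q → 0ℚ < p * q
  *-positive {p} {q} h k = subst (_< p * q) (*-zeroˡ q) (*-monoˡ-<-pos q {{positive k}} h)

  square≥0 : ∀ p → 0ℚ ≤ p * p
  square≥0 p with ≤-total 0ℚ p
  ... | inj₁ h = *-nonneg h h
  ... | inj₂ h = subst (0ℚ ≤_) (g p) (*-nonneg (gap≥0 h) (gap≥0 h))
    where
    g : ∀ p → (0ℚ - p) * (0ℚ - p) ≡ p * p
    g = solve 1 (λ p → (con 0ℚ :- p) :* (con 0ℚ :- p) := p :* p) refl

  0<½ : 0ℚ < ½
  0<½ = positive⁻¹ ½

  Eventually : (ℕ → Set) → Set
  Eventually P = ∃ λ N → ∀ n → N ℕ.≤ n → P n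

  always : ∀ {P} → (∀ n → P n) → Eventually P
  always h = 0 , λ n _ → h n

  both : ∀ {P Q R : ℕ → Set} → (∀ n → P n → Q n → R n) → Eventually P → Eventually Q → Eventually R
  both f (N , h) (M , k) = N ℕ.⊔ M , λ n le →
    f n (h n (ℕ.≤-trans (ℕ.m≤m⊔n N M) le)) (k n (ℕ.≤-trans (ℕ.m≤n⊔m N M) le))

  mapE : ∀ {P Q : ℕ → Set} → (∀ n → P n → Q n) → Eventually P → Eventually Q
  mapE f (N , h) = N , λ n le → f n (h n le)

  contradictory : ∀ {P : ℕ → Set} → (∀ n → ¬ P n) → ¬ Eventually P
  contradictory f (N , h) = f N (h N ℕ.≤-refl)

  infixl 6 _-ℝ_

  _-ℝ_ : ℝ → ℝ → ℝ
  x -ℝ y = x +ℝ -ℝ y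

  NN : ℝ → Set
  NN x = 0ℝ ≤ℝ x

  Pos : ℝ → Set
  Pos x = 0ℝ <ℝ x

  half-ε : ∀ {ε} → 0ℚ < ε → 0ℚ < ½ * ε
  half-ε h = *-positive 0<½ h

  nn-pt : ∀ x → (∀ n → 0ℚ ≤ seq x n) → NN x
  nn-pt x h ε 0<ε = always λ n → ≤-by (seq x n + ε) (+-nonneg (h n) (<⇒≤ 0<ε)) (sym (+-identityˡ _))

  nn-+ : ∀ x y → NN x → NN y → NN (x +ℝ y)
  nn-+ x y hx hy ε 0<ε = both (λ n a b → ≤-by (seq x n + ½ * ε + (seq y n + ½ * ε)) (+-nonneg a b) (g (seq x n) (seq y n) ε))
      (hx (½ * ε) (half-ε 0<ε)) (hy (½ * ε) (half-ε 0<ε))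
    where
    g : ∀ x y ε → x + y + ε ≡ 0ℚ + (x + ½ * ε + (y + ½ * ε))
    g = solve 3 (λ x y ε → x :+ y :+ ε := con 0ℚ :+ (x :+ con ½ :* ε :+ (y :+ con ½ :* ε))) refl

  sub-nn : ∀ x y → x ≤ℝ y → NN (y -ℝ x)
  sub-nn x y h ε 0<ε = mapE (λ n le → ≤-by (seq y n + ε - seq x n) (gap≥0 le) (g (seq x n) (seq y n) ε)) (h ε 0<ε)
    where
    g : ∀ x y ε → y - x + ε ≡ 0ℚ + (y + ε - x)
    g = solve 3 (λ x y ε → y :- x :+ ε := con 0ℚ :+ (y :+ ε :- x)) refl

  -- The standard form of an inequality here: its difference is exhibited as a nonnegative real,
  -- with a termwise identity that a ring solver can check.
  le-by : ∀ x y d → NN d → (∀ n → seq y n ≡ seq x n + seq d n) → x ≤ℝ y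
  le-by x y d h eq ε 0<ε = mapE (λ n le → ≤-by (seq d n + ε) le (trans (cong (_+ ε) (eq n)) (+-assoc (seq x n) (seq d n) ε))) (h ε 0<ε)

  ≤-pt : ∀ x y → (∀ n → seq x n ≡ seq y n) → x ≤ℝ y
  ≤-pt x y eq = le-by x y 0ℝ (nn-pt 0ℝ (λ n → ≤-refl)) (λ n → sym (trans (+-identityʳ (seq x n)) (eq n)))

  ≤-transR : ∀ x y z → x ≤ℝ y → y ≤ℝ z → x ≤ℝ z
  ≤-transR x y z h k = le-by x z ((y -ℝ x) +ℝ (z -ℝ y)) (nn-+ (y -ℝ x) (z -ℝ y) (sub-nn x y h) (sub-nn y z k))
      (λ n → g (seq x n) (seq y n) (seq z n))
    where
    g : ∀ x y z → z ≡ x + (y - x + (z - y))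
    g = solve 3 (λ x y z → z := x :+ (y :- x :+ (z :- y))) refl

  nn-cong : ∀ x y → (∀ n → seq x n ≡ seq y n) → NN x → NN y
  nn-cong x y eq h = ≤-transR 0ℝ x y h (≤-pt x y eq)

  eventually-bounded : ∀ x → ∃ λ K → 0ℚ ≤ K × Eventually (λ n → (0ℚ ≤ K - seq x n) × (0ℚ ≤ K + seq x n))
  eventually-bounded x with cauchy x 1ℚ (positive⁻¹ 1ℚ)
  ... | N , h = ∣ a ∣ + 1ℚ , +-nonneg (0≤∣p∣ a) (<⇒≤ (positive⁻¹ 1ℚ)) , N , λ n le →
      let d = abs-≤ (h n N le ℕ.≤-refl) ; a≤ = abs-≤ {a} ≤-refl in
      subst (0ℚ ≤_) (g₁ ∣ a ∣ a (seq x n)) (+-nonneg (proj₁ a≤) (proj₁ d)) ,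
      subst (0ℚ ≤_) (g₂ ∣ a ∣ a (seq x n)) (+-nonneg (proj₂ a≤) (proj₂ d))
    where
    a = seq x N
    abs-≤ : ∀ {p b} → ∣ p ∣ ≤ b → 0ℚ ≤ b - p × 0ℚ ≤ b + p
    abs-≤ {p} {b} le with ∣p∣≡p∨∣p∣≡-p p
    ... | inj₁ eq = subst (λ q → 0ℚ ≤ b - q) eq (gap≥0 le) , +-nonneg (≤-trans (0≤∣p∣ p) le) (subst (0ℚ ≤_) eq (0≤∣p∣ p))
    ... | inj₂ eq = +-nonneg (≤-trans (0≤∣p∣ p) le) (subst (0ℚ ≤_) eq (0≤∣p∣ p)) ,
          subst (0ℚ ≤_) (trans (cong (λ q → b - q) eq) (n b p)) (gap≥0 le)
      where
      n : ∀ b p → b - - p ≡ b + p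
      n = solve 2 (λ b p → b :- :- p := b :+ p) refl
    g₁ : ∀ c a x → (c - a) + (1ℚ - (x - a)) ≡ c + 1ℚ - x
    g₁ = solve 3 (λ c a x → (c :- a) :+ (con 1ℚ :- (x :- a)) := c :+ con 1ℚ :- x) refl
    g₂ : ∀ c a x → (c + a) + (1ℚ + (x - a)) ≡ c + 1ℚ + x
    g₂ = solve 3 (λ c a x → (c :+ a) :+ (con 1ℚ :+ (x :- a)) := c :+ con 1ℚ :+ x) refl

  -- With eventual bounds K and L of ∣x∣ and ∣y∣, choose η such that η(K + L + 1 + ε) = ε. Then (x +
  -- η)(y + η) ≥ 0 yields x y ≥ -ε.
  nn-* : ∀ x y → NN x → NN y → NN (x *ℝ y)
  nn-* x y hx hy ε 0<ε =
    let K , 0≤K , bx = eventually-bounded x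
        L , 0≤L , by = eventually-bounded y
        M = K + L + 1ℚ + ε
        0<M : 0ℚ < M
        0<M = subst (0ℚ <_) (+-comm ε (K + L + 1ℚ)) (+-pos-nonneg 0<ε (+-nonneg (+-nonneg 0≤K 0≤L) (<⇒≤ (positive⁻¹ 1ℚ))))
        η , 0<η , ηM = divide M ε 0<M 0<ε
    in both (λ n (a , b) (p , q) → ≤-by
          ((seq x n + η) * (seq y n + η) + η * (K - seq x n) + η * (L - seq y n) + η * ((1ℚ - η) + ε))
          (+-nonneg (+-nonneg (+-nonneg (*-nonneg a b) (*-nonneg (<⇒≤ 0<η) p)) (*-nonneg (<⇒≤ 0<η) q))
            (*-nonneg (<⇒≤ 0<η) (+-nonneg (η≤1 K L ε η 0≤K 0≤L 0<ε 0<η ηM) (<⇒≤ 0<ε))))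
          (trans (cong (seq x n * seq y n +_) (sym ηM)) (g (seq x n) (seq y n) K L ε η)))
        (both (λ n → _,_) (hx η 0<η) (hy η 0<η))
        (both (λ n a b → proj₁ a , proj₁ b) bx by)
    where
    divide : ∀ M ε → 0ℚ < M → 0ℚ < ε → ∃ λ η → 0ℚ < η × η * M ≡ ε
    divide M ε 0<M 0<ε = ε * 1/ M , *-positive 0<ε (positive⁻¹ (1/ M) {{1/pos⇒pos M}}) ,
        trans (*-assoc ε (1/ M) M) (trans (cong (ε *_) (*-inverseˡ M)) (*-identityʳ ε))
      where
      instance
        M>0 : Positive M
        M>0 = positive 0<M
        M≢0 : NonZero M
        M≢0 = pos⇒nonZero M
    η≤1 : ∀ K L ε η → 0ℚ ≤ K → 0ℚ ≤ L → 0ℚ < ε → 0ℚ < η → η * (K + L + 1ℚ + ε) ≡ ε → 0ℚ ≤ 1ℚ - η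
    η≤1 K L ε η 0≤K 0≤L 0<ε 0<η eq with η ≤? 1ℚ
    ... | yes le = gap≥0 le
    ... | no ¬le = ⊥-elim (<-irrefl (sym eq) (<-by ((η - 1ℚ) * ε + η * (K + L + 1ℚ))
        (subst (0ℚ <_) (+-comm (η * (K + L + 1ℚ)) ((η - 1ℚ) * ε)) (+-pos-nonneg
          (*-positive 0<η (subst (0ℚ <_) (+-comm 1ℚ (K + L)) (+-pos-nonneg (positive⁻¹ 1ℚ) (+-nonneg 0≤K 0≤L))))
          (*-nonneg (<⇒≤ (gap>0 (≰⇒> ¬le))) (<⇒≤ 0<ε)))) (h K L ε η)))
      where
      h : ∀ K L ε η → η * (K + L + 1ℚ + ε) ≡ ε + ((η - 1ℚ) * ε + η * (K + L + 1ℚ))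
      h = solve 4 (λ K L ε η → η :* (K :+ L :+ con 1ℚ :+ ε) := ε :+ ((η :- con 1ℚ) :* ε :+ η :* (K :+ L :+ con 1ℚ))) refl
    g : ∀ x y K L ε η → x * y + η * (K + L + 1ℚ + ε) ≡ 0ℚ + ((x + η) * (y + η) + η * (K - x) + η * (L - y) + η * ((1ℚ - η) + ε))
    g = solve 6 (λ x y K L ε η → x :* y :+ η :* (K :+ L :+ con 1ℚ :+ ε)
          := con 0ℚ :+ ((x :+ η) :* (y :+ η) :+ η :* (K :- x) :+ η :* (L :- y) :+ η :* ((con 1ℚ :- η) :+ ε))) refl

  pos-+-nn : ∀ x y → Pos x → NN y → Pos (x +ℝ y)
  pos-+-nn x y (ε , 0<ε , hx) hy = ½ * ε , half-ε 0<ε ,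
    both (λ n a b → ≤-by (seq x n - (0ℚ + ε) + (seq y n + ½ * ε - 0ℚ)) (+-nonneg (gap≥0 a) (gap≥0 b)) (g (seq x n) (seq y n) ε))
      hx (hy (½ * ε) (half-ε 0<ε))
    where
    g : ∀ x y ε → x + y ≡ 0ℚ + ½ * ε + (x - (0ℚ + ε) + (y + ½ * ε - 0ℚ))
    g = solve 3 (λ x y ε → x :+ y := con 0ℚ :+ con ½ :* ε :+ (x :- (con 0ℚ :+ ε) :+ (y :+ con ½ :* ε :- con 0ℚ))) refl

  pos-* : ∀ x y → Pos x → Pos y → Pos (x *ℝ y)
  pos-* x y (ε , 0<ε , hx) (δ , 0<δ , hy) = ε * δ , *-positive 0<ε 0<δ ,
    both (λ n a b → ≤-by ((seq x n - (0ℚ + ε)) * (seq y n - (0ℚ + δ)) + ε * (seq y n - (0ℚ + δ)) + δ * (seq x n - (0ℚ + ε)))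
        (+-nonneg (+-nonneg (*-nonneg (gap≥0 a) (gap≥0 b)) (*-nonneg (<⇒≤ 0<ε) (gap≥0 b))) (*-nonneg (<⇒≤ 0<δ) (gap≥0 a)))
        (g (seq x n) (seq y n) ε δ)) hx hy
    where
    g : ∀ x y ε δ → x * y ≡ 0ℚ + ε * δ + ((x - (0ℚ + ε)) * (y - (0ℚ + δ)) + ε * (y - (0ℚ + δ)) + δ * (x - (0ℚ + ε)))
    g = solve 4 (λ x y ε δ → x :* y := con 0ℚ :+ ε :* δ :+ ((x :- (con 0ℚ :+ ε)) :* (y :- (con 0ℚ :+ δ))
          :+ ε :* (y :- (con 0ℚ :+ δ)) :+ δ :* (x :- (con 0ℚ :+ ε)))) refl

  sub-pos : ∀ x y → x <ℝ y → Pos (y -ℝ x)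
  sub-pos x y (ε , 0<ε , h) = ε , 0<ε , mapE (λ n le → ≤-by (seq y n - (seq x n + ε)) (gap≥0 le) (g (seq x n) (seq y n) ε)) h
    where
    g : ∀ x y ε → y - x ≡ 0ℚ + ε + (y - (x + ε))
    g = solve 3 (λ x y ε → y :- x := con 0ℚ :+ ε :+ (y :- (x :+ ε))) refl

  <⇒≤R : ∀ x y → x <ℝ y → x ≤ℝ y
  <⇒≤R x y (ε , 0<ε , h) δ 0<δ = mapE (λ n le → ≤-by (seq y n - (seq x n + ε) + ε + δ)
      (+-nonneg (+-nonneg (gap≥0 le) (<⇒≤ 0<ε)) (<⇒≤ 0<δ)) (g (seq x n) (seq y n) ε δ)) h
    where
    g : ∀ x y ε δ → y + δ ≡ x + (y - (x + ε) + ε + δ)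
    g = solve 4 (λ x y ε δ → y :+ δ := x :+ (y :- (x :+ ε) :+ ε :+ δ)) refl

  pos-not-≤ : ∀ x → Pos x → ¬ (NN (-ℝ x))
  pos-not-≤ x (ε , 0<ε , h) k = contradictory (λ n bad → <-irrefl refl (<-≤-trans (half-ε 0<ε) bad))
    (both (λ n a b → ≤-by (seq x n - (0ℚ + ε) + (- seq x n + ½ * ε - 0ℚ)) (+-nonneg (gap≥0 a) (gap≥0 b)) (g (seq x n) ε)) h (k (½ * ε) (half-ε 0<ε)))
    where
    g : ∀ x ε → 0ℚ ≡ ½ * ε + (x - (0ℚ + ε) + (- x + ½ * ε - 0ℚ))
    g = solve 2 (λ x ε → con 0ℚ := con ½ :* ε :+ (x :- (con 0ℚ :+ ε) :+ (:- x :+ con ½ :* ε :- con 0ℚ))) refl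

  -- Compare x and y at an index beyond which both are nearly constant.
  ≮⇒≥R : ∀ x y → ¬ x <ℝ y → y ≤ℝ x
  ≮⇒≥R x y x≮y ε 0<ε = go (cauchy x δ 0<δ) (cauchy y δ 0<δ)
    where
    δ = ½ * (½ * (½ * ε))
    0<δ : 0ℚ < δ
    0<δ = half-ε (half-ε (half-ε 0<ε))
    near : ∀ p q → ∣ p - q ∣ ≤ δ → 0ℚ ≤ δ - (p - q)
    near p q le = gap≥0 (≤-trans (p≤∣p∣ (p - q)) le)
      where
      p≤∣p∣ : ∀ p → p ≤ ∣ p ∣
      p≤∣p∣ p with ≤-total 0ℚ p
      ... | inj₁ h = ≤-reflexive (sym (0≤p⇒∣p∣≡p h))
      ... | inj₂ h = ≤-trans h (0≤∣p∣ p)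
    go : (∃ λ N → ∀ m n → N ℕ.≤ m → N ℕ.≤ n → ∣ seq x m - seq x n ∣ ≤ δ) →
         (∃ λ N → ∀ m n → N ℕ.≤ m → N ℕ.≤ n → ∣ seq y m - seq y n ∣ ≤ δ) → Eventually (λ n → seq y n ≤ seq x n + ε)
    go (N₁ , h₁) (N₂ , h₂) with seq y N ≤? seq x N + ½ * ε
      where N = N₁ ℕ.⊔ N₂
    ... | yes le = N , λ n N≤n → ≤-by
          ((seq x N + ½ * ε - seq y N) + (δ - (seq y n - seq y N)) + (δ - (seq x N - seq x n)) + δ + δ)
          (+-nonneg (+-nonneg (+-nonneg (+-nonneg (gap≥0 le) (near (seq y n) (seq y N) (h₂ n N (ℕ.≤-trans (ℕ.m≤n⊔m N₁ N₂) N≤n) (ℕ.m≤n⊔m N₁ N₂))))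
            (near (seq x N) (seq x n) (h₁ N n (ℕ.m≤m⊔n N₁ N₂) (ℕ.≤-trans (ℕ.m≤m⊔n N₁ N₂) N≤n)))) (<⇒≤ 0<δ)) (<⇒≤ 0<δ))
          (g (seq x N) (seq y N) (seq x n) (seq y n) ε)
      where
      N = N₁ ℕ.⊔ N₂
      g : ∀ X Y x y ε → x + ε ≡ y + ((X + ½ * ε - Y) + (½ * (½ * (½ * ε)) - (y - Y)) + (½ * (½ * (½ * ε)) - (X - x)) + ½ * (½ * (½ * ε)) + ½ * (½ * (½ * ε)))
      g = solve 5 (λ X Y x y ε → let d = con ½ :* (con ½ :* (con ½ :* ε)) in
        x :+ ε := y :+ ((X :+ con ½ :* ε :- Y) :+ (d :- (y :- Y)) :+ (d :- (X :- x)) :+ d :+ d)) refl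
    ... | no ¬le = ⊥-elim (x≮y (δ , 0<δ , N , λ n N≤n → ≤-by
          ((seq y N - (seq x N + ½ * ε)) + (δ - (seq x n - seq x N)) + (δ - (seq y N - seq y n)) + δ)
          (+-nonneg (+-nonneg (+-nonneg (<⇒≤ (gap>0 (≰⇒> ¬le))) (near (seq x n) (seq x N) (h₁ n N (ℕ.≤-trans (ℕ.m≤m⊔n N₁ N₂) N≤n) (ℕ.m≤m⊔n N₁ N₂))))
            (near (seq y N) (seq y n) (h₂ N n (ℕ.m≤n⊔m N₁ N₂) (ℕ.≤-trans (ℕ.m≤n⊔m N₁ N₂) N≤n)))) (<⇒≤ 0<δ))
          (g (seq x N) (seq y N) (seq x n) (seq y n) ε)))
      where
      N = N₁ ℕ.⊔ N₂
      g : ∀ X Y x y ε → y ≡ x + ½ * (½ * (½ * ε)) + ((Y - (X + ½ * ε)) + (½ * (½ * (½ * ε)) - (x - X)) + (½ * (½ * (½ * ε)) - (Y - y)) + ½ * (½ * (½ * ε)))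
      g = solve 5 (λ X Y x y ε → let d = con ½ :* (con ½ :* (con ½ :* ε)) in
        y := x :+ d :+ ((Y :- (X :+ con ½ :* ε)) :+ (d :- (x :- X)) :+ (d :- (Y :- y)) :+ d)) refl

  -- An inequality follows from the absurdity of the opposite strict one. Classical case
  -- distinctions are therefore admissible whenever the goal is an inequality.
  ≤-stable : ∀ x y → ¬ ¬ (x ≤ℝ y) → x ≤ℝ y
  ≤-stable x y h = ≮⇒≥R y x (λ y<x → h (λ x≤y → pos-not-≤ (x -ℝ y) (sub-pos y x y<x)
    (nn-cong (y -ℝ x) (-ℝ (x -ℝ y)) (λ n → g (seq x n) (seq y n)) (sub-nn x y x≤y))))
    where
    g : ∀ x y → y - x ≡ - (x - y)
    g = solve 2 (λ x y → y :- x := :- (x :- y)) refl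

  dichotomy : ∀ x → ¬ ¬ (NN (-ℝ x) ⊎ Pos x)
  dichotomy x k = k (inj₁ (nn-cong (0ℝ -ℝ x) (-ℝ x) (λ n → +-identityˡ _) (sub-nn x 0ℝ (≮⇒≥R 0ℝ x (λ pos → k (inj₂ pos))))))

  square-cancel : ∀ x y → NN y → (x *ℝ x) ≤ℝ (y *ℝ y) → x ≤ℝ y
  square-cancel x y 0≤y h = ≮⇒≥R y x (λ y<x → let d = sub-pos y x y<x in
    pos-not-≤ ((x -ℝ y) *ℝ ((x -ℝ y) +ℝ (y +ℝ y))) (pos-* (x -ℝ y) ((x -ℝ y) +ℝ (y +ℝ y)) d (pos-+-nn (x -ℝ y) (y +ℝ y) d (nn-+ y y 0≤y 0≤y)))
      (nn-cong ((y *ℝ y) -ℝ (x *ℝ x)) (-ℝ ((x -ℝ y) *ℝ ((x -ℝ y) +ℝ (y +ℝ y)))) (λ n → g (seq x n) (seq y n)) (sub-nn (x *ℝ x) (y *ℝ y) h)))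
    where
    g : ∀ x y → y * y - x * x ≡ - ((x - y) * ((x - y) + (y + y)))
    g = solve 2 (λ x y → y :* y :- x :* x := :- ((x :- y) :* ((x :- y) :+ (y :+ y)))) refl

-- Square roots of real numbers.

module SquareRoots where

  open import Data.Empty using (⊥-elim)
  open import Data.Integer.Base as ℤ using (ℤ; 0ℤ; 1ℤ)
  import Data.Integer.Properties as ℤ
  open import Data.Nat.Base as ℕ using (ℕ; zero; suc)
  import Data.Nat.Properties as ℕ
  open import Data.Product.Base using (_,_; proj₁; proj₂)
  open import Data.Rational.Base hiding (_/_; truncate)
  open import Data.Rational.Properties
  open import Data.Sum.Base using (inj₁; inj₂)
  open import Relation.Binary.PropositionalEquality hiding ([_]; J)
  open import Relation.Nullary using (yes; no)
  import Data.Rational.Solver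
  open import Defs
  open Data.Rational.Solver.+-*-Solver using (solve; con; _:=_; _:+_; _:-_; _:*_; :-_)
  open ℝ
  open ResidueCounts using (least)
  open RationalIntegers using (ℤ→ℚ-mkℚ; scale; ℤ→ℚ-+; ℤ→ℚ-*)
  open IndexOfBasis using (ℕ→ℚ)
  open RealOrder

  ℤ→ℚ-mono-≤ : ∀ {a b} → a ℤ.≤ b → ℤ→ℚ a ≤ ℤ→ℚ b
  ℤ→ℚ-mono-≤ {a} {b} le = subst₂ _≤_ (sym (ℤ→ℚ-mkℚ a)) (sym (ℤ→ℚ-mkℚ b))
    (*≤* (subst₂ ℤ._≤_ (sym (ℤ.*-identityʳ a)) (sym (ℤ.*-identityʳ b)) le))

  ℤ→ℚ-mono-< : ∀ {a b} → a ℤ.< b → ℤ→ℚ a < ℤ→ℚ b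
  ℤ→ℚ-mono-< {a} {b} lt = subst₂ _<_ (sym (ℤ→ℚ-mkℚ a)) (sym (ℤ→ℚ-mkℚ b))
    (*<* (subst₂ ℤ._<_ (sym (ℤ.*-identityʳ a)) (sym (ℤ.*-identityʳ b)) lt))

  0<ℕ→ℚ : ∀ n → 0ℚ < ℕ→ℚ (suc n)
  0<ℕ→ℚ n = ℤ→ℚ-mono-< {0ℤ} {ℤ.+ suc n} (ℤ.+<+ (ℕ.s≤s ℕ.z≤n))

  0≤ℕ→ℚ : ∀ n → 0ℚ ≤ ℕ→ℚ n
  0≤ℕ→ℚ n = ℤ→ℚ-mono-≤ {0ℤ} {ℤ.+ n} (ℤ.+≤+ ℕ.z≤n)

  opaque
    mesh : ℕ → ℚ
    mesh n = (1/ ℕ→ℚ (suc n)) {{pos⇒nonZero (ℕ→ℚ (suc n)) {{positive (0<ℕ→ℚ n)}}}}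

    mesh-inverse : ∀ n → mesh n * ℕ→ℚ (suc n) ≡ 1ℚ
    mesh-inverse n = *-inverseˡ (ℕ→ℚ (suc n)) {{pos⇒nonZero (ℕ→ℚ (suc n)) {{positive (0<ℕ→ℚ n)}}}}

    0<mesh : ∀ n → 0ℚ < mesh n
    0<mesh n = positive⁻¹ (mesh n) {{1/pos⇒pos (ℕ→ℚ (suc n)) {{positive (0<ℕ→ℚ n)}}}}

  numerator-bound : ∀ q → 0ℚ ≤ q → q ≤ ℕ→ℚ ℤ.∣ ↥ q ∣
  numerator-bound q 0≤q = ≤-trans (≤-by (q * (ℤ→ℚ (↧ q) - 1ℚ)) (*-nonneg 0≤q (gap≥0 (ℤ→ℚ-mono-≤ {1ℤ} {↧ q} (ℤ.+≤+ (ℕ.s≤s ℕ.z≤n)))))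
      (trans (sym (scale q)) (g q (ℤ→ℚ (↧ q))))) (ℤ→ℚ-mono-≤ {↥ q} {ℤ.+ ℤ.∣ ↥ q ∣} i≤∣i∣)
    where
    i≤∣i∣ : ∀ {i} → i ℤ.≤ ℤ.+ ℤ.∣ i ∣
    i≤∣i∣ {ℤ.+ n} = ℤ.≤-refl
    i≤∣i∣ {ℤ.-[1+ n ]} = ℤ.-≤+
    g : ∀ q d → q * d ≡ q + q * (d - 1ℚ)
    g = solve 2 (λ q d → q :* d := q :+ q :* (d :- con 1ℚ)) refl

  mesh-small : ∀ ε → 0ℚ < ε → Eventually (λ n → mesh n ≤ ε)
  mesh-small ε 0<ε = ℕ.pred (↧ₙ ε) , λ n le → ≤-by (mesh n * ((ε * ℤ→ℚ (↧ ε) - 1ℚ) + ε * (ℕ→ℚ (suc n) - ℤ→ℚ (↧ ε))))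
      (*-nonneg (<⇒≤ (0<mesh n)) (+-nonneg (gap≥0 (subst (1ℚ ≤_) (sym (scale ε)) (ℤ→ℚ-mono-≤ {1ℤ} {↥ ε} (numerator≥1 ε 0<ε))))
        (*-nonneg (<⇒≤ 0<ε) (gap≥0 (ℤ→ℚ-mono-≤ {↧ ε} {ℤ.+ suc n} (ℤ.+≤+ (ℕ.≤-trans (ℕ.≤-reflexive (sym (ℕ.suc-pred (↧ₙ ε)))) (ℕ.s≤s le))))))))
      (trans (sym (*-identityʳ ε)) (trans (cong (ε *_) (sym (mesh-inverse n))) (g (mesh n) ε (ℤ→ℚ (↧ ε)) (ℕ→ℚ (suc n)))))
    where
    g : ∀ m ε d n → ε * (m * n) ≡ m + m * ((ε * d - 1ℚ) + ε * (n - d))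
    g = solve 4 (λ m ε d n → ε :* (m :* n) := m :+ m :* ((ε :* d :- con 1ℚ) :+ ε :* (n :- d))) refl
    numerator≥1 : ∀ ε → 0ℚ < ε → 1ℤ ℤ.≤ ↥ ε
    numerator≥1 ε (*<* lt) = ℤ.i<j⇒suc[i]≤j (subst₂ ℤ._<_ (ℤ.*-zeroˡ (↧ ε)) (ℤ.*-identityʳ (↥ ε)) lt)

  -- The largest multiple of the mesh whose square is at most q.
  module _ (q : ℚ) (0≤q : 0ℚ ≤ q) (n : ℕ) where

    private
      grid : ℕ → ℚ
      grid j = ℕ→ℚ j * mesh n

      Beyond : ℕ → Set
      Beyond j = q < grid (suc j) * grid (suc j)

      K = suc ℤ.∣ ↥ q ∣

      far : Beyond (ℕ.pred (K ℕ.* suc n))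
      far = subst (q <_) (sym (cong₂ _*_ grid-K grid-K)) (≤-<-trans (numerator-bound q 0≤q)
          (<-by (k * k + k + 1ℚ) (subst (0ℚ <_) (+-comm 1ℚ (k * k + k)) (+-pos-nonneg (positive⁻¹ 1ℚ) (+-nonneg (*-nonneg 0≤k 0≤k) 0≤k)))
            (trans (cong₂ _*_ K≡ K≡) (g k))))
        where
        k = ℕ→ℚ ℤ.∣ ↥ q ∣
        0≤k = 0≤ℕ→ℚ ℤ.∣ ↥ q ∣
        K≡ : ℕ→ℚ K ≡ 1ℚ + k
        K≡ = ℤ→ℚ-+ 1ℤ (ℤ.+ ℤ.∣ ↥ q ∣)
        g : ∀ k → (1ℚ + k) * (1ℚ + k) ≡ k + (k * k + k + 1ℚ)
        g = solve 1 (λ k → (con 1ℚ :+ k) :* (con 1ℚ :+ k) := k :+ (k :* k :+ k :+ con 1ℚ)) refl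
        grid-K : grid (suc (ℕ.pred (K ℕ.* suc n))) ≡ ℕ→ℚ K
        grid-K = trans (cong (λ j → ℕ→ℚ j * mesh n) (ℕ.suc-pred (K ℕ.* suc n))) (trans
          (cong (_* mesh n) (trans (cong ℤ→ℚ (ℤ.pos-* K (suc n))) (ℤ→ℚ-* (ℤ.+ K) (ℤ.+ suc n))))
          (trans (h (ℕ→ℚ K) (ℕ→ℚ (suc n)) (mesh n)) (trans (cong (ℕ→ℚ K *_) (mesh-inverse n)) (*-identityʳ _))))
          where
          h : ∀ k n m → k * n * m ≡ k * (m * n)
          h = solve 3 (λ k n m → k :* n :* m := k :* (m :* n)) refl

      found = least {P = Beyond} (λ j → q <? grid (suc j) * grid (suc j)) (ℕ.pred (K ℕ.* suc n)) far

    opaque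
      root : ℚ
      root = grid (proj₁ found)

      0≤root : 0ℚ ≤ root
      0≤root = *-nonneg (0≤ℕ→ℚ (proj₁ found)) (<⇒≤ (0<mesh n))

      root-lower : root * root ≤ q
      root-lower = go (proj₁ found) (proj₂ (proj₂ (proj₂ found)))
        where
        go : ∀ j → (∀ k → Beyond k → j ℕ.≤ k) → grid j * grid j ≤ q
        go zero _ = subst (_≤ q) (sym (g (mesh n))) 0≤q
          where
          g : ∀ m → 0ℚ * m * (0ℚ * m) ≡ 0ℚ
          g = solve 1 (λ m → con 0ℚ :* m :* (con 0ℚ :* m) := con 0ℚ) refl
        go (suc j) min = ≮⇒≥ (λ beyond → ℕ.<-irrefl refl (min j beyond))

      root-upper : q < (root + mesh n) * (root + mesh n)
      root-upper = subst (λ r → q < r * r) (trans (cong (_* mesh n) (ℤ→ℚ-+ 1ℤ (ℤ.+ proj₁ found))) (g (ℕ→ℚ (proj₁ found)) (mesh n)))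
          (proj₁ (proj₂ (proj₂ found)))
        where
        g : ∀ j m → (1ℚ + j) * m ≡ j * m + m
        g = solve 2 (λ j m → (con 1ℚ :+ j) :* m := j :* m :+ m) refl

  absℝ-near : ∀ p q {ε} → ∣ p - q ∣ ≤ ε → 0ℚ ≤ ε - (∣ p ∣ - ∣ q ∣)
  absℝ-near p q {ε} le = ≤-trans (gap≥0 (≤-trans (∣p+q∣≤∣p∣+∣q∣ q (p - q)) (+-monoʳ-≤ ∣ q ∣ le)))
      (≤-reflexive (trans (cong (λ x → ∣ q ∣ + ε - ∣ x ∣) (h p q)) (g ∣ p ∣ ∣ q ∣ ε)))
    where
    h : ∀ p q → q + (p - q) ≡ p
    h = solve 2 (λ p q → q :+ (p :- q) := p) refl
    g : ∀ p q ε → q + ε - p ≡ ε - (p - q)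
    g = solve 3 (λ p q ε → q :+ ε :- p := ε :- (p :- q)) refl

  module _ (x : ℝ) where

    private
      s : ℕ → ℚ
      s n = root ∣ seq x n ∣ (0≤∣p∣ _) n

      lower : ∀ n → s n * s n ≤ ∣ seq x n ∣
      lower n = root-lower ∣ seq x n ∣ (0≤∣p∣ _) n

      upper : ∀ n → ∣ seq x n ∣ ≤ (s n + mesh n) * (s n + mesh n)
      upper n = <⇒≤ (root-upper ∣ seq x n ∣ (0≤∣p∣ _) n)

      0≤s : ∀ n → 0ℚ ≤ s n
      0≤s n = 0≤root ∣ seq x n ∣ (0≤∣p∣ _) n

      -- If s m > s n + ε then ∣x m∣ - ∣x n∣ ≥ (s n + ε)² - (s n + ε/2)² > ε²/2.
      step : ∀ m n ε → 0ℚ < ε → mesh n ≤ ½ * ε → ∣ seq x m - seq x n ∣ ≤ ½ * (ε * ε) → s m ≤ s n + ε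
      step m n ε 0<ε small close with s m ≤? s n + ε
      ... | yes le = le
      ... | no ¬le = ⊥-elim (<-irrefl refl (<-≤-trans positive-sum (≤-reflexive sum≡0)))
        where
        a = s m
        b = s n
        δ = mesh n
        h₁ = gap≥0 (lower m)
        h₂ = gap≥0 (upper n)
        h₃ = absℝ-near (seq x m) (seq x n) close
        d = a - (b + ε)
        e = ½ * ε - δ
        0≤d = <⇒≤ (gap>0 (≰⇒> ¬le))
        0≤e = gap≥0 small
        0≤b = 0≤s n
        0≤ε = <⇒≤ 0<ε
        0≤δ = <⇒≤ (0<mesh n)
        X = ∣ seq x m ∣
        Y = ∣ seq x n ∣
        positive-sum : 0ℚ < ½ * (½ * (ε * ε)) + (b * ε + d * (b + ε + (b + ε) + d) + e * (b + δ + (b + ½ * ε)) + (X - a * a) + ((b + δ) * (b + δ) - Y) + (½ * (ε * ε) - (X - Y)))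
        positive-sum = +-pos-nonneg (half-ε (half-ε (*-positive 0<ε 0<ε))) (+-nonneg (+-nonneg (+-nonneg (+-nonneg (+-nonneg (*-nonneg 0≤b 0≤ε)
          (*-nonneg 0≤d (+-nonneg (+-nonneg (+-nonneg 0≤b 0≤ε) (+-nonneg 0≤b 0≤ε)) 0≤d)))
          (*-nonneg 0≤e (+-nonneg (+-nonneg 0≤b 0≤δ) (+-nonneg 0≤b (<⇒≤ (half-ε 0<ε)))))) h₁) h₂) h₃)
        sum≡0 : ½ * (½ * (ε * ε)) + (b * ε + d * (b + ε + (b + ε) + d) + e * (b + δ + (b + ½ * ε)) + (X - a * a) + ((b + δ) * (b + δ) - Y) + (½ * (ε * ε) - (X - Y))) ≡ 0ℚ
        sum≡0 = solve 6 (λ a b δ ε X Y → let d = a :- (b :+ ε) ; e = con ½ :* ε :- δ in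
          con ½ :* (con ½ :* (ε :* ε)) :+ (b :* ε :+ d :* (b :+ ε :+ (b :+ ε) :+ d) :+ e :* (b :+ δ :+ (b :+ con ½ :* ε)) :+ (X :- a :* a)
            :+ ((b :+ δ) :* (b :+ δ) :- Y) :+ (con ½ :* (ε :* ε) :- (X :- Y))) := con 0ℚ) refl a b δ ε X Y

    -- Taking ∣x∣ makes every rational approximation nonnegative, even when x itself is nonnegative
    -- only as a limit.
    sqrt∣_∣ : ℝ
    sqrt∣_∣ = mkℝ s λ ε 0<ε →
        let N₁ , h₁ = cauchy x (½ * (ε * ε)) (half-ε (*-positive 0<ε 0<ε))
            N₂ , h₂ = mesh-small (½ * ε) (half-ε 0<ε)
        in N₁ ℕ.⊔ N₂ , λ m n m≥ n≥ →
          let m₁ = ℕ.≤-trans (ℕ.m≤m⊔n N₁ N₂) m≥ ; m₂ = ℕ.≤-trans (ℕ.m≤n⊔m N₁ N₂) m≥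
              n₁ = ℕ.≤-trans (ℕ.m≤m⊔n N₁ N₂) n≥ ; n₂ = ℕ.≤-trans (ℕ.m≤n⊔m N₁ N₂) n≥
          in abs-intro (s m) (s n) (step m n ε 0<ε (h₂ n n₂) (h₁ m n m₁ n₁)) (step n m ε 0<ε (h₂ m m₂) (h₁ n m n₁ m₁))
      where
      abs-intro : ∀ p q {ε} → p ≤ q + ε → q ≤ p + ε → ∣ p - q ∣ ≤ ε
      abs-intro p q {ε} h k with ∣p∣≡p∨∣p∣≡-p (p - q)
      ... | inj₁ eq = subst (_≤ ε) (sym eq) (≤-by (q + ε - p) (gap≥0 h) (g p q ε))
        where
        g : ∀ p q ε → ε ≡ p - q + (q + ε - p)
        g = solve 3 (λ p q ε → ε := p :- q :+ (q :+ ε :- p)) refl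
      ... | inj₂ eq = subst (_≤ ε) (sym eq) (≤-by (p + ε - q) (gap≥0 k) (g p q ε))
        where
        g : ∀ p q ε → ε ≡ - (p - q) + (p + ε - q)
        g = solve 3 (λ p q ε → ε := :- (p :- q) :+ (p :+ ε :- q)) refl

    private
      r = sqrt∣_∣

    sqrt-nn : NN r
    sqrt-nn = nn-pt r 0≤s

    sqrt-≤ : NN x → (r *ℝ r) ≤ℝ x
    sqrt-≤ 0≤x ε 0<ε = mapE (λ n le → ≤-trans (lower n) (abs-≤ n le)) (0≤x (½ * ε) (half-ε 0<ε))
      where
      abs-≤ : ∀ n → 0ℚ ≤ seq x n + ½ * ε → ∣ seq x n ∣ ≤ seq x n + ε
      abs-≤ n le with ∣p∣≡p∨∣p∣≡-p (seq x n)
      ... | inj₁ eq = ≤-by ε (<⇒≤ 0<ε) (cong (_+ ε) (sym eq))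
      ... | inj₂ eq = ≤-by (seq x n + ½ * ε + (seq x n + ½ * ε)) (+-nonneg le le) (trans (g (seq x n) ε) (cong (_+ (seq x n + ½ * ε + (seq x n + ½ * ε))) (sym eq)))
        where
        g : ∀ x ε → x + ε ≡ - x + (x + ½ * ε + (x + ½ * ε))
        g = solve 2 (λ x ε → x :+ ε := :- x :+ (x :+ con ½ :* ε :+ (x :+ con ½ :* ε))) refl

    -- Termwise x ≤ (r + mesh)², and the mesh, regarded as a real number, is both nonnegative and
    -- nonpositive.
    sqrt-≥ : x ≤ℝ (r *ℝ r)
    sqrt-≥ = ≤-transR x ((r +ℝ m) *ℝ (r +ℝ m)) (r *ℝ r)
        (λ ε 0<ε → always λ n → ≤-trans (≤-trans (p≤∣p∣ (seq x n)) (upper n)) (≤-by ε (<⇒≤ 0<ε) refl))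
        (le-by ((r +ℝ m) *ℝ (r +ℝ m)) (r *ℝ r) ((-ℝ m) *ℝ (r +ℝ r +ℝ m)) (zero-product (r +ℝ r +ℝ m) (nn-+ (r +ℝ r) m (nn-+ r r sqrt-nn sqrt-nn) 0≤m))
          (λ n → g (s n) (mesh n)))
      where
      p≤∣p∣ : ∀ p → p ≤ ∣ p ∣
      p≤∣p∣ p with ≤-total 0ℚ p
      ... | inj₁ h = ≤-reflexive (sym (0≤p⇒∣p∣≡p h))
      ... | inj₂ h = ≤-trans h (0≤∣p∣ p)
      m : ℝ
      m = mkℝ mesh λ ε 0<ε → let N , h = mesh-small ε 0<ε in N , λ i j i≥ j≥ →
          near (mesh i) (mesh j) (<⇒≤ (0<mesh i)) (<⇒≤ (0<mesh j)) (h i i≥) (h j j≥)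
        where
        near : ∀ p q {ε} → 0ℚ ≤ p → 0ℚ ≤ q → p ≤ ε → q ≤ ε → ∣ p - q ∣ ≤ ε
        near p q {ε} 0≤p 0≤q p≤ q≤ with ∣p∣≡p∨∣p∣≡-p (p - q)
        ... | inj₁ eq = subst (_≤ ε) (sym eq) (≤-by (ε - p + q) (+-nonneg (gap≥0 p≤) 0≤q) (g p q ε))
          where
          g : ∀ p q ε → ε ≡ p - q + (ε - p + q)
          g = solve 3 (λ p q ε → ε := p :- q :+ (ε :- p :+ q)) refl
        ... | inj₂ eq = subst (_≤ ε) (sym eq) (≤-by (ε - q + p) (+-nonneg (gap≥0 q≤) 0≤p) (g p q ε))
          where
          g : ∀ p q ε → ε ≡ - (p - q) + (ε - q + p)
          g = solve 3 (λ p q ε → ε := :- (p :- q) :+ (ε :- q :+ p)) refl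
      0≤m : NN m
      0≤m = nn-pt m (λ n → <⇒≤ (0<mesh n))
      0≤-m : NN (-ℝ m)
      0≤-m ε 0<ε = mapE (λ n le → ≤-by (ε - mesh n) (gap≥0 le) (h (mesh n) ε)) (mesh-small ε 0<ε)
        where
        h : ∀ m ε → - m + ε ≡ 0ℚ + (ε - m)
        h = solve 2 (λ m ε → :- m :+ ε := con 0ℚ :+ (ε :- m)) refl
      zero-product : ∀ y → NN y → NN ((-ℝ m) *ℝ y)
      zero-product y hy = nn-* (-ℝ m) y 0≤-m hy
      g : ∀ r m → r * r ≡ (r + m) * (r + m) + - m * (r + r + m)
      g = solve 2 (λ r m → r :* r := (r :+ m) :* (r :+ m) :+ :- m :* (r :+ r :+ m)) refl

-- Bounds for A and B in terms of the height.

module RootBounds where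

  open import Data.Empty using (⊥)
  open import Data.Integer.Base using (ℤ)
  open import Data.Product.Base using (_×_; _,_; proj₁; proj₂)
  open import Data.Rational.Base hiding (_/_; truncate)
  open import Data.Rational.Properties
  open import Data.Sum.Base using ([_,_]′)
  open import Relation.Binary.PropositionalEquality hiding ([_]; J)
  open import Relation.Nullary using (¬_)
  import Data.Rational.Solver
  open import Defs
  open RealOrder
  open Data.Rational.Solver.+-*-Solver using (Polynomial; solve; con; _:=_; _:+_; _:-_; _:*_; :-_)
  open ℝ
  open ℂ
  open SquareRoots

  Zero : ℝ → Set
  Zero x = NN x × NN (-ℝ x)

  ≃0⇒zero : ∀ x → x ≃ℝ 0ℝ → Zero x
  ≃0⇒zero x (h , k) = k , nn-cong (0ℝ -ℝ x) (-ℝ x) (λ n → +-identityˡ (- seq x n)) (sub-nn x 0ℝ h)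

  zero⇒≃0 : ∀ x → Zero x → x ≃ℝ 0ℝ
  zero⇒≃0 x (h , k) = le-by x 0ℝ (-ℝ x) k (λ n → sym (+-inverseʳ (seq x n))) , h

  zero-cong : ∀ x y → (∀ n → seq x n ≡ seq y n) → Zero x → Zero y
  zero-cong x y eq (h , k) = nn-cong x y eq h , nn-cong (-ℝ x) (-ℝ y) (λ n → cong -_ (eq n)) k

  zero-+ : ∀ x y → Zero x → Zero y → Zero (x +ℝ y)
  zero-+ x y (h , k) (h′ , k′) = nn-+ x y h h′ , nn-cong ((-ℝ x) +ℝ (-ℝ y)) (-ℝ (x +ℝ y)) (λ n → g (seq x n) (seq y n)) (nn-+ (-ℝ x) (-ℝ y) k k′)
    where
    g : ∀ x y → - x + - y ≡ - (x + y)
    g = solve 2 (λ x y → :- x :+ :- y := :- (x :+ y)) refl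

  zero-0 : Zero 0ℝ
  zero-0 = nn-pt 0ℝ (λ _ → ≤-refl) , nn-pt (-ℝ 0ℝ) (λ _ → ≤-refl)

  zero-neg : ∀ x → Zero x → Zero (-ℝ x)
  zero-neg x (h , k) = k , nn-cong x (-ℝ (-ℝ x)) (λ n → g (seq x n)) h
    where
    g : ∀ x → x ≡ - - x
    g = solve 1 (λ x → x := :- :- x) refl

  ½ℝ : ℝ
  ½ℝ = ℚ→ℝ ½

  nn-½ : NN ½ℝ
  nn-½ = nn-pt ½ℝ (λ _ → <⇒≤ 0<½)

  nn-square : ∀ x → NN (x *ℝ x)
  nn-square x = nn-pt (x *ℝ x) (λ n → square≥0 (seq x n))

  -- x y = (x (y+1)² - x (y-1)²)/4
  zero-* : ∀ x y → Zero x → Zero (x *ℝ y)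
  zero-* x y (h , k) = part (x *ℝ y) x h k (λ n → g₁ (seq x n) (seq y n)) , part (-ℝ (x *ℝ y)) (-ℝ x) k (proj₂ (zero-neg x (h , k))) (λ n → g₂ (seq x n) (seq y n))
    where
    s₊ s₋ : ℝ
    s₊ = (y +ℝ 1ℝ) *ℝ (y +ℝ 1ℝ)
    s₋ = (y -ℝ 1ℝ) *ℝ (y -ℝ 1ℝ)
    part : ∀ w z → NN z → NN (-ℝ z) → (∀ n → ½ * (½ * (seq z n * seq s₊ n + - seq z n * seq s₋ n)) ≡ seq w n) → NN w
    part w z hz kz eq = nn-cong (½ℝ *ℝ (½ℝ *ℝ (z *ℝ s₊ +ℝ (-ℝ z) *ℝ s₋))) w eq
      (nn-* ½ℝ (½ℝ *ℝ (z *ℝ s₊ +ℝ (-ℝ z) *ℝ s₋)) nn-½ (nn-* ½ℝ (z *ℝ s₊ +ℝ (-ℝ z) *ℝ s₋) nn-½ (nn-+ (z *ℝ s₊) ((-ℝ z) *ℝ s₋) (nn-* z s₊ hz (nn-square (y +ℝ 1ℝ))) (nn-* (-ℝ z) s₋ kz (nn-square (y -ℝ 1ℝ))))))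
    g₁ : ∀ x y → ½ * (½ * (x * ((y + 1ℚ) * (y + 1ℚ)) + - x * ((y - 1ℚ) * (y - 1ℚ)))) ≡ x * y
    g₁ = solve 2 (λ x y → con ½ :* (con ½ :* (x :* ((y :+ con 1ℚ) :* (y :+ con 1ℚ)) :+ :- x :* ((y :- con 1ℚ) :* (y :- con 1ℚ)))) := x :* y) refl
    g₂ : ∀ x y → ½ * (½ * (- x * ((y + 1ℚ) * (y + 1ℚ)) + - - x * ((y - 1ℚ) * (y - 1ℚ)))) ≡ - (x * y)
    g₂ = solve 2 (λ x y → con ½ :* (con ½ :* (:- x :* ((y :+ con 1ℚ) :* (y :+ con 1ℚ)) :+ :- :- x :* ((y :- con 1ℚ) :* (y :- con 1ℚ)))) := :- (x :* y)) refl

  zero-cancel : ∀ x y → Pos x → Zero (x *ℝ y) → Zero y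
  zero-cancel x y 0<x (h , k) =
    ≮⇒≥R y 0ℝ (λ y<0 → pos-not-≤ (x *ℝ (0ℝ -ℝ y)) (pos-* x (0ℝ -ℝ y) 0<x (sub-pos y 0ℝ y<0))
      (nn-cong (x *ℝ y) (-ℝ (x *ℝ (0ℝ -ℝ y))) (λ n → g (seq x n) (seq y n)) h)) ,
    nn-cong (0ℝ -ℝ y) (-ℝ y) (λ n → +-identityˡ (- seq y n)) (sub-nn y 0ℝ (≮⇒≥R 0ℝ y (λ 0<y → pos-not-≤ (x *ℝ y) (pos-* x y 0<x 0<y) k)))
    where
    g : ∀ x y → x * y ≡ - (x * (0ℚ - y))
    g = solve 2 (λ x y → x :* y := :- (x :* (con 0ℚ :- y))) refl

  -- ∣x∣ ≤ a
  Bound : ℝ → ℝ → Set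
  Bound x a = NN (a -ℝ x) × NN (a +ℝ x)

  bound-* : ∀ x a y b → Bound x a → Bound y b → Bound (x *ℝ y) (a *ℝ b)
  bound-* x a y b (h , k) (h′ , k′) =
    nn-cong (½ℝ *ℝ ((a -ℝ x) *ℝ (b +ℝ y) +ℝ (a +ℝ x) *ℝ (b -ℝ y))) (a *ℝ b -ℝ x *ℝ y) (λ n → g₁ (seq x n) (seq a n) (seq y n) (seq b n))
      (nn-* ½ℝ ((a -ℝ x) *ℝ (b +ℝ y) +ℝ (a +ℝ x) *ℝ (b -ℝ y)) nn-½ (nn-+ ((a -ℝ x) *ℝ (b +ℝ y)) ((a +ℝ x) *ℝ (b -ℝ y)) (nn-* (a -ℝ x) (b +ℝ y) h k′) (nn-* (a +ℝ x) (b -ℝ y) k h′))) ,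
    nn-cong (½ℝ *ℝ ((a -ℝ x) *ℝ (b -ℝ y) +ℝ (a +ℝ x) *ℝ (b +ℝ y))) (a *ℝ b +ℝ x *ℝ y) (λ n → g₂ (seq x n) (seq a n) (seq y n) (seq b n))
      (nn-* ½ℝ ((a -ℝ x) *ℝ (b -ℝ y) +ℝ (a +ℝ x) *ℝ (b +ℝ y)) nn-½ (nn-+ ((a -ℝ x) *ℝ (b -ℝ y)) ((a +ℝ x) *ℝ (b +ℝ y)) (nn-* (a -ℝ x) (b -ℝ y) h h′) (nn-* (a +ℝ x) (b +ℝ y) k k′)))
    where
    g₁ : ∀ x a y b → ½ * ((a - x) * (b + y) + (a + x) * (b - y)) ≡ a * b - x * y
    g₁ = solve 4 (λ x a y b → con ½ :* ((a :- x) :* (b :+ y) :+ (a :+ x) :* (b :- y)) := a :* b :- x :* y) refl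
    g₂ : ∀ x a y b → ½ * ((a - x) * (b - y) + (a + x) * (b + y)) ≡ a * b + x * y
    g₂ = solve 4 (λ x a y b → con ½ :* ((a :- x) :* (b :- y) :+ (a :+ x) :* (b :+ y)) := a :* b :+ x :* y) refl

  bound-+ : ∀ x a y b → Bound x a → Bound y b → Bound (x +ℝ y) (a +ℝ b)
  bound-+ x a y b (h , k) (h′ , k′) =
    nn-cong ((a -ℝ x) +ℝ (b -ℝ y)) ((a +ℝ b) -ℝ (x +ℝ y)) (λ n → g₁ (seq x n) (seq a n) (seq y n) (seq b n)) (nn-+ (a -ℝ x) (b -ℝ y) h h′) ,
    nn-cong ((a +ℝ x) +ℝ (b +ℝ y)) ((a +ℝ b) +ℝ (x +ℝ y)) (λ n → g₂ (seq x n) (seq a n) (seq y n) (seq b n)) (nn-+ (a +ℝ x) (b +ℝ y) k k′)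
    where
    g₁ : ∀ x a y b → (a - x) + (b - y) ≡ (a + b) - (x + y)
    g₁ = solve 4 (λ x a y b → (a :- x) :+ (b :- y) := (a :+ b) :- (x :+ y)) refl
    g₂ : ∀ x a y b → (a + x) + (b + y) ≡ (a + b) + (x + y)
    g₂ = solve 4 (λ x a y b → (a :+ x) :+ (b :+ y) := (a :+ b) :+ (x :+ y)) refl

  bound-cong : ∀ x y a → Bound x a → Zero (y -ℝ x) → Bound y a
  bound-cong x y a (h , k) (z , z′) =
    nn-cong ((a -ℝ x) +ℝ (-ℝ (y -ℝ x))) (a -ℝ y) (λ n → g₁ (seq x n) (seq y n) (seq a n)) (nn-+ (a -ℝ x) (-ℝ (y -ℝ x)) h z′) ,
    nn-cong ((a +ℝ x) +ℝ (y -ℝ x)) (a +ℝ y) (λ n → g₂ (seq x n) (seq y n) (seq a n)) (nn-+ (a +ℝ x) (y -ℝ x) k z)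
    where
    g₁ : ∀ x y a → (a - x) + - (y - x) ≡ a - y
    g₁ = solve 3 (λ x y a → (a :- x) :+ :- (y :- x) := a :- y) refl
    g₂ : ∀ x y a → (a + x) + (y - x) ≡ a + y
    g₂ = solve 3 (λ x y a → (a :+ x) :+ (y :- x) := a :+ y) refl

  bound-neg : ∀ x a → Bound x a → Bound (-ℝ x) a
  bound-neg x a (h , k) = nn-cong (a +ℝ x) (a -ℝ (-ℝ x)) (λ n → g (seq x n) (seq a n)) k , h
    where
    g : ∀ x a → a + x ≡ a - - x
    g = solve 2 (λ x a → a :+ x := a :- :- x) refl

  bound-square : ∀ x a → NN a → (x *ℝ x) ≤ℝ (a *ℝ a) → Bound x a
  bound-square x a 0≤a h = sub-nn x a (square-cancel x a 0≤a h) ,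
    nn-cong (a -ℝ (-ℝ x)) (a +ℝ x) (λ n → g (seq x n) (seq a n)) (sub-nn (-ℝ x) a (square-cancel (-ℝ x) a 0≤a
      (≤-transR ((-ℝ x) *ℝ (-ℝ x)) (x *ℝ x) (a *ℝ a) (≤-pt ((-ℝ x) *ℝ (-ℝ x)) (x *ℝ x) (λ n → g′ (seq x n))) h)))
    where
    g : ∀ x a → a - - x ≡ a + x
    g = solve 2 (λ x a → a :- :- x := a :+ x) refl
    g′ : ∀ x → - x * - x ≡ x * x
    g′ = solve 1 (λ x → :- x :* :- x := x :* x) refl

  square-mono : ∀ x y → NN x → x ≤ℝ y → (x *ℝ x) ≤ℝ (y *ℝ y)
  square-mono x y 0≤x h = le-by (x *ℝ x) (y *ℝ y) ((y -ℝ x) *ℝ ((y -ℝ x) +ℝ (x +ℝ x)))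
      (nn-* (y -ℝ x) ((y -ℝ x) +ℝ (x +ℝ x)) d (nn-+ (y -ℝ x) (x +ℝ x) d (nn-+ x x 0≤x 0≤x))) (λ n → g (seq x n) (seq y n))
    where
    d = sub-nn x y h
    g : ∀ x y → y * y ≡ x * x + (y - x) * ((y - x) + (x + x))
    g = solve 2 (λ x y → y :* y := x :* x :+ (y :- x) :* ((y :- x) :+ (x :+ x))) refl

  reℚ imℚ : ℚ → ℚ → ℚ → ℚ → ℚ → ℚ
  reℚ t A B a b = a * a * a - (1ℚ + 1ℚ + 1ℚ) * (a * (b * b)) + t * (a * a - b * b) + A * a + B
  imℚ t A _ a b = b * ((1ℚ + 1ℚ + 1ℚ) * (a * a) - b * b + (1ℚ + 1ℚ) * (t * a) + A)

  module Roots (f : V ℤ) (r : ℝ) (height : IsHeight f r) where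

    t A B : ℚ
    t = ℤ→ℚ ⟦ V.t f ⟧
    A = ℤ→ℚ (V.A f)
    B = ℤ→ℚ (V.B f)

    tR AR BR : ℝ
    tR = ℚ→ℝ t
    AR = ℚ→ℝ A
    BR = ℚ→ℝ B

    private
      evalᴾ : ∀ {n} (t A B a b : Polynomial n) → Polynomial n × Polynomial n
      evalᴾ t A B a b = (((zz ×ᴾ z) +ᴾ ((t , con 0ℚ) ×ᴾ zz)) +ᴾ ((A , con 0ℚ) ×ᴾ z)) +ᴾ (B , con 0ℚ)
        where
        _×ᴾ_ _+ᴾ_ : Polynomial _ × Polynomial _ → Polynomial _ × Polynomial _ → Polynomial _ × Polynomial _
        (a , b) ×ᴾ (c , d) = a :* c :+ :- (b :* d) , a :* d :+ b :* c
        (a , b) +ᴾ (c , d) = a :+ c , b :+ d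
        z zz : Polynomial _ × Polynomial _
        z = a , b
        zz = z ×ᴾ z

    re-eval : ∀ a b n → seq (re (evalℂ f (a +i b))) n ≡ reℚ t A B (seq a n) (seq b n)
    re-eval a b n = solve 5 (λ t A B a b → proj₁ (evalᴾ t A B a b) :=
      a :* a :* a :- (con 1ℚ :+ con 1ℚ :+ con 1ℚ) :* (a :* (b :* b)) :+ t :* (a :* a :- b :* b) :+ A :* a :+ B) refl t A B (seq a n) (seq b n)

    im-eval : ∀ a b n → seq (im (evalℂ f (a +i b))) n ≡ imℚ t A B (seq a n) (seq b n)
    im-eval a b n = solve 5 (λ t A B a b → proj₂ (evalᴾ t A B a b) :=
      b :* ((con 1ℚ :+ con 1ℚ :+ con 1ℚ) :* (a :* a) :- b :* b :+ (con 1ℚ :+ con 1ℚ) :* (t :* a) :+ A)) refl t A B (seq a n) (seq b n)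

    isRoot : ∀ a b x y → Zero x → Zero y → (∀ n → seq x n ≡ reℚ t A B (seq a n) (seq b n)) →
      (∀ n → seq y n ≡ imℚ t A B (seq a n) (seq b n)) → IsRoot f (a +i b)
    isRoot a b x y zx zy hx hy =
      zero⇒≃0 (re (evalℂ f (a +i b))) (zero-cong x (re (evalℂ f (a +i b))) (λ n → trans (hx n) (sym (re-eval a b n))) zx) ,
      zero⇒≃0 (im (evalℂ f (a +i b))) (zero-cong y (im (evalℂ f (a +i b))) (λ n → trans (hy n) (sym (im-eval a b n))) zy)

    isRealRoot : ∀ a x → Zero x → (∀ n → seq x n ≡ reℚ t A B (seq a n) 0ℚ) → IsRoot f (a +i 0ℝ)
    isRealRoot a x zx hx = isRoot a 0ℝ x 0ℝ zx zero-0 hx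
      (λ n → sym (*-zeroˡ ((1ℚ + 1ℚ + 1ℚ) * (seq a n * seq a n) - 0ℚ * 0ℚ + (1ℚ + 1ℚ) * (t * seq a n) + A)))

    private
      z = proj₁ (proj₁ height)
      u = re z
      v = im z
      z-root : IsRoot f z
      z-root = proj₁ (proj₂ (proj₁ height))
      z-abs : IsAbs z r
      z-abs = proj₂ (proj₂ (proj₁ height))

    0≤r : NN r
    0≤r = proj₁ z-abs

    -- `IsHeight` compares the height with real numbers that are absolute values of roots, so the
    -- absolute value has to be constructed as a square root.
    root-bound : ∀ a b → IsRoot f (a +i b) → (a *ℝ a +ℝ b *ℝ b) ≤ℝ (r *ℝ r)
    root-bound a b h = ≤-transR (a *ℝ a +ℝ b *ℝ b) (s *ℝ s) (r *ℝ r)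
        (≤-transR (a *ℝ a +ℝ b *ℝ b) D (s *ℝ s) (≤-pt (a *ℝ a +ℝ b *ℝ b) D (λ n → g (seq a n) (seq b n))) (sqrt-≥ D))
        (square-mono s r (sqrt-nn D) (proj₂ height (a +i b) s h (sqrt-nn D ,
          ≤-transR (s ^ℝ 2) (s *ℝ s) D (≤-pt (s ^ℝ 2) (s *ℝ s) (λ n → cong (seq s n *_) (*-identityʳ (seq s n)))) (sqrt-≤ D 0≤D) ,
          ≤-transR D (s *ℝ s) (s ^ℝ 2) (sqrt-≥ D) (≤-pt (s *ℝ s) (s ^ℝ 2) (λ n → sym (cong (seq s n *_) (*-identityʳ (seq s n))))))))
      where
      D = a ^ℝ 2 +ℝ b ^ℝ 2
      s = sqrt∣ D ∣
      g : ∀ a b → a * a + b * b ≡ a * (a * 1ℚ) + b * (b * 1ℚ)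
      g = solve 2 (λ a b → a :* a :+ b :* b := a :* (a :* con 1ℚ) :+ b :* (b :* con 1ℚ)) refl
      0≤D : NN D
      0≤D = nn-cong (a *ℝ a +ℝ b *ℝ b) D (λ n → g (seq a n) (seq b n)) (nn-+ (a *ℝ a) (b *ℝ b) (nn-square a) (nn-square b))

    root-bound₁ : ∀ a b → IsRoot f (a +i b) → Bound a r
    root-bound₁ a b h = bound-square a r 0≤r (≤-transR (a *ℝ a) (a *ℝ a +ℝ b *ℝ b) (r *ℝ r)
      (le-by (a *ℝ a) (a *ℝ a +ℝ b *ℝ b) (b *ℝ b) (nn-square b) (λ n → refl)) (root-bound a b h))

    3r² r³ : ℝ
    3r² = r *ℝ r +ℝ r *ℝ (r +ℝ r)
    r³ = r *ℝ (r *ℝ r)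

    Goal : Set
    Goal = Bound AR 3r² × Bound BR r³

    -- f = (x - ξ)(x² + p x + q)
    factored : ∀ ξ p q → Zero (AR -ℝ (q -ℝ ξ *ℝ p)) → Zero (BR +ℝ ξ *ℝ q) → Bound ξ r → Bound p (r +ℝ r) → Bound q (r *ℝ r) → Goal
    factored ξ p q zA zB bξ bp bq =
      bound-cong (q -ℝ ξ *ℝ p) AR 3r² (bound-+ q (r *ℝ r) (-ℝ (ξ *ℝ p)) (r *ℝ (r +ℝ r)) bq
        (bound-neg (ξ *ℝ p) (r *ℝ (r +ℝ r)) (bound-* ξ r p (r +ℝ r) bξ bp))) zA ,
      bound-cong (-ℝ (ξ *ℝ q)) BR r³ (bound-neg (ξ *ℝ q) r³ (bound-* ξ r q (r *ℝ r) bξ bq))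
        (zero-cong (BR +ℝ ξ *ℝ q) (BR -ℝ (-ℝ (ξ *ℝ q))) (λ n → g B (seq ξ n * seq q n)) zB)
      where
      g : ∀ b x → b + x ≡ b - - x
      g = solve 2 (λ b x → b :+ x := b :- :- x) refl

    private
      e₁ e₂ : ℝ
      e₁ = re (evalℂ f z)
      e₂ = im (evalℂ f z)
      z₁ : Zero e₁
      z₁ = ≃0⇒zero e₁ (proj₁ z-root)
      z₂ : Zero e₂
      z₂ = ≃0⇒zero e₂ (proj₂ z-root)
      three two : ∀ {n} → Polynomial n
      three = con 1ℚ :+ con 1ℚ :+ con 1ℚ
      two = con 1ℚ :+ con 1ℚ
      reᴾ imᴾ : ∀ {n} (t A B a b : Polynomial n) → Polynomial n
      reᴾ t A B a b = a :* a :* a :- three :* (a :* (b :* b)) :+ t :* (a :* a :- b :* b) :+ A :* a :+ B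
      imᴾ t A B a b = b :* (three :* (a :* a) :- b :* b :+ two :* (t :* a) :+ A)

    module NonReal where

      -- The root z = u + iv and its conjugate give the factor x² - 2u x + u² + v², and the sum of
      -- the roots gives ξ. The imaginary part of f(z) is v w, so w vanishes when v is apart from 0.
      w ξ p q : ℝ
      w = 1ℝ *ℝ (u *ℝ u +ℝ (u *ℝ u +ℝ u *ℝ u) -ℝ v *ℝ v +ℝ (tR *ℝ u +ℝ tR *ℝ u) +ℝ AR)
      ξ = -ℝ (tR +ℝ (u +ℝ u))
      p = -ℝ (u +ℝ u)
      q = u *ℝ u +ℝ v *ℝ v

      private
        wᴾ : ∀ {n} (t A u v : Polynomial n) → Polynomial n
        wᴾ t A u v = con 1ℚ :* (u :* u :+ (u :* u :+ u :* u) :- v :* v :+ (t :* u :+ t :* u) :+ A)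

      im≡ : ∀ n → seq e₂ n ≡ seq v n * seq w n
      im≡ n = trans (im-eval u v n) (solve 5 (λ t A B u v → imᴾ t A B u v := v :* wᴾ t A u v) refl t A B (seq u n) (seq v n))

      goal : Zero w → Goal
      goal zw = factored ξ p q
          (zero-cong w (AR -ℝ (q -ℝ ξ *ℝ p)) (λ n → solve 4 (λ t A u v → wᴾ t A u v :=
            A :- ((u :* u :+ v :* v) :- (:- (t :+ (u :+ u))) :* (:- (u :+ u)))) refl t A (seq u n) (seq v n)) zw)
          (zero-cong (e₁ +ℝ w *ℝ (-ℝ u)) (BR +ℝ ξ *ℝ q) (λ n → trans (cong (_+ seq w n * - seq u n) (re-eval u v n))
            (solve 5 (λ t A B u v → reᴾ t A B u v :+ wᴾ t A u v :* :- u := B :+ (:- (t :+ (u :+ u))) :* (u :* u :+ v :* v)) refl t A B (seq u n) (seq v n)))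
            (zero-+ e₁ (w *ℝ (-ℝ u)) z₁ (zero-* w (-ℝ u) zw)))
          (root-bound₁ ξ 0ℝ ξ-root)
          (bound-neg (u +ℝ u) (r +ℝ r) (bound-+ u r u r (root-bound₁ u v z-root) (root-bound₁ u v z-root)))
          (sub-nn q (r *ℝ r) (root-bound u v z-root) , nn-+ (r *ℝ r) q (nn-square r) (nn-+ (u *ℝ u) (v *ℝ v) (nn-square u) (nn-square v)))
        where
        ξ-root : IsRoot f (ξ +i 0ℝ)
        ξ-root = isRealRoot ξ (e₁ +ℝ w *ℝ (ξ -ℝ u)) (zero-+ e₁ (w *ℝ (ξ -ℝ u)) z₁ (zero-* w (ξ -ℝ u) zw))
          (λ n → trans (cong (_+ seq w n * (seq ξ n - seq u n)) (re-eval u v n))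
            (solve 5 (λ t A B u v → let ξ = :- (t :+ (u :+ u)) in reᴾ t A B u v :+ wᴾ t A u v :* (ξ :- u) := reᴾ t A B ξ (con 0ℚ)) refl t A B (seq u n) (seq v n)))

    module Real (zv : Zero v) where

      -- f = (x - u)(x² + p x + q) + E, and D is the discriminant of the quadratic factor.
      E p q D : ℝ
      E = u *ℝ (u *ℝ u) +ℝ tR *ℝ (u *ℝ u) +ℝ AR *ℝ u +ℝ BR
      p = tR +ℝ u
      q = AR +ℝ p *ℝ u
      D = p *ℝ p -ℝ (q +ℝ q +ℝ (q +ℝ q))

      private
        Eᴾ pᴾ qᴾ Dᴾ : ∀ {n} (t A B u : Polynomial n) → Polynomial n
        Eᴾ t A B u = u :* (u :* u) :+ t :* (u :* u) :+ A :* u :+ B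
        pᴾ t A B u = t :+ u
        qᴾ t A B u = A :+ (t :+ u) :* u
        Dᴾ t A B u = (t :+ u) :* (t :+ u) :- (qᴾ t A B u :+ qᴾ t A B u :+ (qᴾ t A B u :+ qᴾ t A B u))

      zE : Zero E
      zE = zero-cong (e₁ +ℝ v *ℝ x) E (λ n → trans (cong (_+ seq v n * seq x n) (re-eval u v n))
          (solve 5 (λ t A B u v → reᴾ t A B u v :+ v :* (v :* (u :+ (u :+ u) :+ t)) := Eᴾ t A B u) refl t A B (seq u n) (seq v n)))
          (zero-+ e₁ (v *ℝ x) z₁ (zero-* v x zv))
        where x = v *ℝ (u +ℝ (u +ℝ u) +ℝ tR)

      finish : Bound p (r +ℝ r) → Bound q (r *ℝ r) → Goal
      finish bp bq = factored u p q
        (zero-cong 0ℝ (AR -ℝ (q -ℝ u *ℝ p)) (λ n → solve 4 (λ t A B u → con 0ℚ := A :- (qᴾ t A B u :- u :* (t :+ u))) refl t A B (seq u n)) zero-0)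
        (zero-cong E (BR +ℝ u *ℝ q) (λ n → solve 4 (λ t A B u → Eᴾ t A B u := B :+ u :* qᴾ t A B u) refl t A B (seq u n)) zE)
        (root-bound₁ u v z-root) bp bq

      zero-sqrt : ∀ x → NN x → Zero (½ℝ *ℝ (½ℝ *ℝ (sqrt∣ x ∣ *ℝ sqrt∣ x ∣ -ℝ x)))
      zero-sqrt x 0≤x = zero-cong (d *ℝ (½ℝ *ℝ ½ℝ)) (½ℝ *ℝ (½ℝ *ℝ d)) (λ n → g (seq d n))
          (zero-* d (½ℝ *ℝ ½ℝ) (sub-nn x (s *ℝ s) (sqrt-≥ x) ,
            nn-cong (x -ℝ s *ℝ s) (-ℝ d) (λ n → g′ (seq x n) (seq s n)) (sub-nn (s *ℝ s) x (sqrt-≤ x 0≤x))))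
        where
        s = sqrt∣ x ∣
        d = s *ℝ s -ℝ x
        g : ∀ d → d * (½ * ½) ≡ ½ * (½ * d)
        g = solve 1 (λ d → d :* (con ½ :* con ½) := con ½ :* (con ½ :* d)) refl
        g′ : ∀ x s → x - s * s ≡ - (s * s - x)
        g′ = solve 2 (λ x s → x :- s :* s := :- (s :* s :- x)) refl

      module Split (0≤D : NN D) where
        -- The quadratic formula. The value of the quadratic factor at either candidate is `d`,
        -- which vanishes since s² = D.
        s d x₊ x₋ : ℝ
        s = sqrt∣ D ∣
        d = ½ℝ *ℝ (½ℝ *ℝ (s *ℝ s -ℝ D))
        x₊ = ½ℝ *ℝ (-ℝ p +ℝ s)
        x₋ = ½ℝ *ℝ (-ℝ p -ℝ s)

        zd : Zero d
        zd = zero-sqrt D 0≤D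

        private
          dᴾ : ∀ {n} (t A B u s : Polynomial n) → Polynomial n
          dᴾ t A B u s = con ½ :* (con ½ :* (s :* s :- Dᴾ t A B u))

        root₊ : IsRoot f (x₊ +i 0ℝ)
        root₊ = isRealRoot x₊ (E +ℝ d *ℝ (x₊ -ℝ u)) (zero-+ E (d *ℝ (x₊ -ℝ u)) zE (zero-* d (x₊ -ℝ u) zd))
          (λ n → solve 5 (λ t A B u s → let x = con ½ :* (:- pᴾ t A B u :+ s) in
            Eᴾ t A B u :+ dᴾ t A B u s :* (x :- u) := reᴾ t A B x (con 0ℚ)) refl t A B (seq u n) (seq s n))

        root₋ : IsRoot f (x₋ +i 0ℝ)
        root₋ = isRealRoot x₋ (E +ℝ d *ℝ (x₋ -ℝ u)) (zero-+ E (d *ℝ (x₋ -ℝ u)) zE (zero-* d (x₋ -ℝ u) zd))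
          (λ n → solve 5 (λ t A B u s → let x = con ½ :* (:- pᴾ t A B u :- s) in
            Eᴾ t A B u :+ dᴾ t A B u s :* (x :- u) := reᴾ t A B x (con 0ℚ)) refl t A B (seq u n) (seq s n))

        goal : Goal
        goal = finish
          (bound-cong (-ℝ (x₊ +ℝ x₋)) p (r +ℝ r) (bound-neg (x₊ +ℝ x₋) (r +ℝ r) (bound-+ x₊ r x₋ r b₊ b₋))
            (zero-cong 0ℝ (p -ℝ (-ℝ (x₊ +ℝ x₋))) (λ n → solve 2 (λ p s → con 0ℚ := p :- (:- (con ½ :* (:- p :+ s) :+ con ½ :* (:- p :- s)))) refl (seq p n) (seq s n)) zero-0))
          (bound-cong (x₊ *ℝ x₋) q (r *ℝ r) (bound-* x₊ r x₋ r b₊ b₋)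
            (zero-cong d (q -ℝ x₊ *ℝ x₋) (λ n → solve 5 (λ t A B u s → let p = pᴾ t A B u in
              dᴾ t A B u s := qᴾ t A B u :- (con ½ :* (:- p :+ s)) :* (con ½ :* (:- p :- s))) refl t A B (seq u n) (seq s n)) zd))
          where
          b₊ = root-bound₁ x₊ 0ℝ root₊
          b₋ = root-bound₁ x₋ 0ℝ root₋

      module Complex (0≤-D : NN (-ℝ D)) where
        s d a b : ℝ
        s = sqrt∣ -ℝ D ∣
        d = ½ℝ *ℝ (½ℝ *ℝ (s *ℝ s -ℝ (-ℝ D)))
        a = ½ℝ *ℝ (-ℝ p)
        b = ½ℝ *ℝ s

        zd : Zero d
        zd = zero-sqrt (-ℝ D) 0≤-D

        private
          dᴾ : ∀ {n} (t A B u s : Polynomial n) → Polynomial n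
          dᴾ t A B u s = con ½ :* (con ½ :* (s :* s :- (:- Dᴾ t A B u)))

        z′-root : IsRoot f (a +i b)
        z′-root = isRoot a b (E +ℝ d *ℝ (u -ℝ a)) (d *ℝ (-ℝ b)) (zero-+ E (d *ℝ (u -ℝ a)) zE (zero-* d (u -ℝ a) zd)) (zero-* d (-ℝ b) zd)
          (λ n → solve 5 (λ t A B u s → let a = con ½ :* (:- pᴾ t A B u) in
            Eᴾ t A B u :+ dᴾ t A B u s :* (u :- a) := reᴾ t A B a (con ½ :* s)) refl t A B (seq u n) (seq s n))
          (λ n → solve 5 (λ t A B u s → let a = con ½ :* (:- pᴾ t A B u) in
            dᴾ t A B u s :* (:- (con ½ :* s)) := imᴾ t A B a (con ½ :* s)) refl t A B (seq u n) (seq s n))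

        goal : Goal
        goal = finish
          (bound-cong (-ℝ (a +ℝ a)) p (r +ℝ r) (bound-neg (a +ℝ a) (r +ℝ r) (bound-+ a r a r ba ba))
            (zero-cong 0ℝ (p -ℝ (-ℝ (a +ℝ a))) (λ n → solve 1 (λ p → con 0ℚ := p :- (:- (con ½ :* (:- p) :+ con ½ :* (:- p)))) refl (seq p n)) zero-0))
          (bound-cong m q (r *ℝ r) (sub-nn m (r *ℝ r) (root-bound a b z′-root) , nn-+ (r *ℝ r) m (nn-square r) (nn-+ (a *ℝ a) (b *ℝ b) (nn-square a) (nn-square b)))
            (zero-cong (-ℝ d) (q -ℝ m) (λ n → solve 5 (λ t A B u s → let a = con ½ :* (:- pᴾ t A B u) ; b = con ½ :* s in
              :- dᴾ t A B u s := qᴾ t A B u :- (a :* a :+ b :* b)) refl t A B (seq u n) (seq s n)) (zero-neg d zd)))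
          where
          m = a *ℝ a +ℝ b *ℝ b
          ba = root-bound₁ a b z′-root

    -- Neither the vanishing of v nor the sign of D can be decided. The inequalities in `Goal` are
    -- stable, so the cases may be distinguished under a double negation.
    goal : Goal
    goal = (stable (3r² -ℝ AR) (λ g → proj₁ (proj₁ g)) , stable (3r² +ℝ AR) (λ g → proj₂ (proj₁ g))) ,
           (stable (r³ -ℝ BR) (λ g → proj₁ (proj₂ g)) , stable (r³ +ℝ BR) (λ g → proj₂ (proj₂ g)))
      where
      onReal : ¬ Goal → Zero v → ⊥
      onReal k zv = dichotomy (Real.D zv)
        [ (λ D≤0 → k (Real.Complex.goal zv D≤0)) , (λ 0<D → k (Real.Split.goal zv (<⇒≤R 0ℝ (Real.D zv) 0<D))) ]′

      neg-involutive : ∀ x → - - x ≡ x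
      neg-involutive = solve 1 (λ x → :- :- x := x) refl

      onNeg : ¬ Goal → NN (-ℝ v) → ⊥
      onNeg k v≤0 = dichotomy (-ℝ v)
        [ (λ 0≤v → onReal k (nn-cong (-ℝ (-ℝ v)) v (λ n → neg-involutive (seq v n)) 0≤v , v≤0))
        , (λ 0<-v → k (NonReal.goal (zero-cancel (-ℝ v) NonReal.w 0<-v (zero-cong (-ℝ e₂) ((-ℝ v) *ℝ NonReal.w)
            (λ n → trans (cong -_ (NonReal.im≡ n)) (neg-distribˡ-* (seq v n) (seq NonReal.w n))) (zero-neg e₂ z₂))))) ]′

      some : ¬ ¬ Goal
      some k = dichotomy v
        [ onNeg k , (λ 0<v → k (NonReal.goal (zero-cancel v NonReal.w 0<v (zero-cong e₂ (v *ℝ NonReal.w) NonReal.im≡ z₂)))) ]′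

      stable : ∀ x → (Goal → NN x) → NN x
      stable x h = ≤-stable 0ℝ x (λ k → some (λ g → k (h g)))

-- Spacing of B when the discriminant is bounded.

module DiscriminantGaps where

  open import Data.Integer.Base as ℤ using (ℤ; +_; -[1+_]; 0ℤ; 1ℤ)
  import Data.Integer.Properties as ℤ
  import Data.Integer.Tactic.RingSolver as ℤ-Solver
  open import Data.List.Base using ([]; _∷_)
  open import Data.List.Membership.Propositional using (_∈_)
  open import Data.List.Relation.Unary.Any using (here; there)
  open import Data.Empty using (⊥-elim)
  open import Data.Nat.Base as ℕ using (ℕ; suc)
  import Data.Nat.Properties as ℕ
  import Data.Nat.Tactic.RingSolver as ℕ-Solver
  open import Data.Product.Base using (∃; _×_; _,_)
  open import Data.Sum.Base using (_⊎_; inj₁; inj₂)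
  open import Relation.Binary.PropositionalEquality hiding ([_]; J)

  open import Defs

  -- A property such as lying below a real bound passes to the largest value in a finite list. This
  -- takes the place of rounding the bound.
  max-image : ∀ {a} {X : Set a} (g : X → ℕ) (P : ℕ → Set) xs → P 0 → (∀ {x} → x ∈ xs → P (g x)) →
    ∃ λ m → P m × (∀ {x} → x ∈ xs → g x ℕ.≤ m)
  max-image g P []       p0 h = 0 , p0 , λ ()
  max-image {X = X} g P (x ∷ xs) p0 h with max-image g P xs p0 (λ x∈ → h (there x∈))
  ... | m , pm , le = g x ℕ.⊔ m , pick (ℕ.⊔-sel (g x) m) , bound
    where
    pick : g x ℕ.⊔ m ≡ g x ⊎ g x ℕ.⊔ m ≡ m → P (g x ℕ.⊔ m)
    pick (inj₁ eq) = subst P (sym eq) (h (here refl))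
    pick (inj₂ eq) = subst P (sym eq) pm
    bound : ∀ {y : X} → y ∈ x ∷ xs → g y ℕ.≤ g x ℕ.⊔ m
    bound (here refl) = ℕ.m≤m⊔n (g x) m
    bound (there y∈)  = ℕ.≤-trans (le y∈) (ℕ.m≤n⊔m (g x) m)

  sgn : ℤ → ℕ
  sgn (+ _)    = 0
  sgn -[1+ _ ] = 1

  sgn<2 : ∀ i → sgn i ℕ.< 2
  sgn<2 (+ _)    = ℕ.s≤s ℕ.z≤n
  sgn<2 -[1+ _ ] = ℕ.s≤s (ℕ.s≤s ℕ.z≤n)

  ∣i-j∣≤∣i+j∣ : ∀ i j → sgn i ≡ sgn j → ℤ.∣ i ℤ.- j ∣ ℕ.≤ ℤ.∣ i ℤ.+ j ∣
  ∣i-j∣≤∣i+j∣ (+ m) (+ k) _ = subst (λ i → ℤ.∣ i ∣ ℕ.≤ m ℕ.+ k) (sym (ℤ.[+m]-[+n]≡m⊖n m k))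
    (ℕ.≤-trans (ℤ.∣m⊝n∣≤m⊔n m k) (ℕ.m⊔n≤m+n m k))
  ∣i-j∣≤∣i+j∣ -[1+ m ] -[1+ k ] _ = ℕ.≤-trans (ℤ.∣m⊝n∣≤m⊔n (suc k) (suc m))
    (ℕ.≤-trans (ℕ.m⊔n≤m+n (suc k) (suc m)) (ℕ.≤-reflexive (g k m)))
    where
    g : ∀ k m → suc k ℕ.+ suc m ≡ suc (suc (m ℕ.+ k))
    g = ℕ-Solver.solve-∀

  -- The resolvent Q = 27 f(-t/3), for which Q² + 27 Δ = 4 (t² - 3A)³ depends on t and A only.
  resolvent : V ℤ → ℤ
  resolvent f = + 27 ℤ.* V.B f ℤ.- + 9 ℤ.* (V.A f ℤ.* ⟦ V.t f ⟧) ℤ.+ + 2 ℤ.* ⟦ V.t f ⟧ ℤ.^ 3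

  sign : V ℤ → ℕ
  sign f = sgn (resolvent f)

  -- For equal signs ∣Q - Q′∣ ≤ ∣Q + Q′∣. With b = ∣B - B′∣ this gives (27 b)² ≤ ∣Q² - Q′²∣ = 27 ∣Δ
  -- g - Δ f∣.
  close : ∀ f g → V.t f ≡ V.t g → V.A f ≡ V.A g → sign f ≡ sign g →
    27 ℕ.* (ℤ.∣ V.B f ℤ.- V.B g ∣ ℕ.* ℤ.∣ V.B f ℤ.- V.B g ∣) ℕ.≤ ℤ.∣ Δ f ∣ ℕ.+ ℤ.∣ Δ g ∣
  close f@(cubic t A B) g@(cubic .t .A B′) refl refl same = ℕ.*-cancelˡ-≤ 27
      (ℕ.≤-trans (ℕ.≤-reflexive left) (ℕ.≤-trans (ℕ.*-monoʳ-≤ d (∣i-j∣≤∣i+j∣ q q′ same))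
        (ℕ.≤-trans (ℕ.≤-reflexive right) (ℕ.*-monoʳ-≤ 27 (ℕ.≤-trans (ℤ.∣i-j∣≤∣i∣+∣j∣ (Δ g) (Δ f)) (ℕ.≤-reflexive (ℕ.+-comm ℤ.∣ Δ g ∣ ℤ.∣ Δ f ∣)))))))
    where
    q q′ : ℤ
    q = resolvent f
    q′ = resolvent g
    d b : ℕ
    d = ℤ.∣ q ℤ.- q′ ∣
    b = ℤ.∣ B ℤ.- B′ ∣
    diff : ∀ τ A B B′ → (+ 27 ℤ.* B ℤ.- + 9 ℤ.* (A ℤ.* τ) ℤ.+ + 2 ℤ.* (τ ℤ.* (τ ℤ.* (τ ℤ.* 1ℤ)))) ℤ.- (+ 27 ℤ.* B′ ℤ.- + 9 ℤ.* (A ℤ.* τ) ℤ.+ + 2 ℤ.* (τ ℤ.* (τ ℤ.* (τ ℤ.* 1ℤ))))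
      ≡ + 27 ℤ.* (B ℤ.- B′)
    diff = ℤ-Solver.solve-∀
    d≡ : d ≡ 27 ℕ.* b
    d≡ = trans (cong ℤ.∣_∣ (diff ⟦ t ⟧ A B B′)) (ℤ.abs-* (+ 27) (B ℤ.- B′))
    left : 27 ℕ.* (27 ℕ.* (b ℕ.* b)) ≡ d ℕ.* d
    left = trans (s b) (sym (cong₂ ℕ._*_ d≡ d≡))
      where
      s : ∀ b → 27 ℕ.* (27 ℕ.* (b ℕ.* b)) ≡ 27 ℕ.* b ℕ.* (27 ℕ.* b)
      s = ℕ-Solver.solve-∀
    squares : ∀ τ A B B′ → ((+ 27 ℤ.* B ℤ.- + 9 ℤ.* (A ℤ.* τ) ℤ.+ + 2 ℤ.* (τ ℤ.* (τ ℤ.* (τ ℤ.* 1ℤ)))) ℤ.- (+ 27 ℤ.* B′ ℤ.- + 9 ℤ.* (A ℤ.* τ) ℤ.+ + 2 ℤ.* (τ ℤ.* (τ ℤ.* (τ ℤ.* 1ℤ)))))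
        ℤ.* ((+ 27 ℤ.* B ℤ.- + 9 ℤ.* (A ℤ.* τ) ℤ.+ + 2 ℤ.* (τ ℤ.* (τ ℤ.* (τ ℤ.* 1ℤ)))) ℤ.+ (+ 27 ℤ.* B′ ℤ.- + 9 ℤ.* (A ℤ.* τ) ℤ.+ + 2 ℤ.* (τ ℤ.* (τ ℤ.* (τ ℤ.* 1ℤ)))))
      ≡ + 27 ℤ.* (((τ ℤ.* (τ ℤ.* 1ℤ)) ℤ.* (A ℤ.* (A ℤ.* 1ℤ)) ℤ.- + 4 ℤ.* (A ℤ.* (A ℤ.* (A ℤ.* 1ℤ))) ℤ.- + 4 ℤ.* (τ ℤ.* (τ ℤ.* (τ ℤ.* 1ℤ))) ℤ.* B′ ℤ.+ + 18 ℤ.* τ ℤ.* A ℤ.* B′ ℤ.- + 27 ℤ.* (B′ ℤ.* (B′ ℤ.* 1ℤ)))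
        ℤ.- ((τ ℤ.* (τ ℤ.* 1ℤ)) ℤ.* (A ℤ.* (A ℤ.* 1ℤ)) ℤ.- + 4 ℤ.* (A ℤ.* (A ℤ.* (A ℤ.* 1ℤ))) ℤ.- + 4 ℤ.* (τ ℤ.* (τ ℤ.* (τ ℤ.* 1ℤ))) ℤ.* B ℤ.+ + 18 ℤ.* τ ℤ.* A ℤ.* B ℤ.- + 27 ℤ.* (B ℤ.* (B ℤ.* 1ℤ))))
    squares = ℤ-Solver.solve-∀
    right : d ℕ.* ℤ.∣ q ℤ.+ q′ ∣ ≡ 27 ℕ.* ℤ.∣ Δ g ℤ.- Δ f ∣
    right = trans (sym (ℤ.abs-* (q ℤ.- q′) (q ℤ.+ q′))) (trans (cong ℤ.∣_∣ (squares ⟦ t ⟧ A B B′)) (ℤ.abs-* (+ 27) (Δ g ℤ.- Δ f)))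

  -- If A = B = 0 then 0 is a multiple root. The lemma keeps Y away from 0 as soon as some cubic is
  -- counted.
  A≢0∨B≢0 : ∀ f → Δ f ≢ 0ℤ → 1 ℕ.≤ ℤ.∣ V.A f ∣ ⊎ 1 ℕ.≤ ℤ.∣ V.B f ∣
  A≢0∨B≢0 (cubic t (+ suc _) _)        _ = inj₁ (ℕ.s≤s ℕ.z≤n)
  A≢0∨B≢0 (cubic t -[1+ _ ] _)         _ = inj₁ (ℕ.s≤s ℕ.z≤n)
  A≢0∨B≢0 (cubic t (+ 0) (+ suc _))    _ = inj₂ (ℕ.s≤s ℕ.z≤n)
  A≢0∨B≢0 (cubic t (+ 0) -[1+ _ ])     _ = inj₂ (ℕ.s≤s ℕ.z≤n)
  A≢0∨B≢0 (cubic t₋₁ (+ 0) (+ 0))      h = ⊥-elim (h refl)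
  A≢0∨B≢0 (cubic t₀ (+ 0) (+ 0))       h = ⊥-elim (h refl)
  A≢0∨B≢0 (cubic t₁ (+ 0) (+ 0))       h = ⊥-elim (h refl)

-- The point count and the measure as rational inequalities.

module MeasureBound where

  open import Data.Integer.Base as ℤ using (ℤ)
  import Data.Integer.Properties as ℤ
  import Data.Integer.Tactic.RingSolver as ℤ-Solver
  open import Data.List.Base using (length; filterᵇ)
  open import Data.Nat.Base as ℕ using (ℕ; suc)
  import Data.Nat.Properties as ℕ
  import Data.Nat.Tactic.RingSolver as ℕ-Solver
  open import Data.Rational.Base hiding (truncate)
  open import Data.Rational.Properties
  import Data.Rational.Unnormalised.Base as ℚᵘ
  import Data.Rational.Unnormalised.Properties as ℚᵘ
  open import Data.Product.Base using (_,_)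
  open import Relation.Binary.PropositionalEquality hiding ([_]; J)
  import Data.Rational.Solver
  open Data.Rational.Solver.+-*-Solver using (solve; con; _:=_; _:*_)

  open import Defs
  open RationalIntegers
  open IndexOfBasis using (ℕ→ℚ)
  open DensityBound using (module Density)
  open RealOrder
  open SquareRoots

  ℕ→ℚ-* : ∀ a b → ℕ→ℚ (a ℕ.* b) ≡ ℕ→ℚ a * ℕ→ℚ b
  ℕ→ℚ-* a b = trans (cong ℤ→ℚ (ℤ.pos-* a b)) (ℤ→ℚ-* (ℤ.+ a) (ℤ.+ b))

  ℕ→ℚ-+ : ∀ a b → ℕ→ℚ (a ℕ.+ b) ≡ ℕ→ℚ a + ℕ→ℚ b
  ℕ→ℚ-+ a b = trans (cong ℤ→ℚ (ℤ.pos-+ a b)) (ℤ→ℚ-+ (ℤ.+ a) (ℤ.+ b))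

  ℕ→ℚ-≤ : ∀ {a b} → a ℕ.≤ b → ℕ→ℚ a ≤ ℕ→ℚ b
  ℕ→ℚ-≤ {a} {b} a≤b = ℤ→ℚ-mono-≤ {ℤ.+ a} {ℤ.+ b} (ℤ.+≤+ a≤b)

  positive-ℕ→ℚ : ∀ m .{{_ : ℕ.NonZero m}} → 0ℚ < ℕ→ℚ m
  positive-ℕ→ℚ (suc m) = 0<ℕ→ℚ m

  i/d*d≡i : ∀ i d .{{_ : ℕ.NonZero d}} → i / d * ℕ→ℚ d ≡ ℤ→ℚ i
  i/d*d≡i i d@(suc k) = toℚᵘ-injective
      (ℚᵘ.≃-trans (toℚᵘ-homo-* (i / d) (ℕ→ℚ d))
      (ℚᵘ.≃-trans (ℚᵘ.*-cong (toℚᵘ-fromℚᵘ (ℚᵘ.mkℚᵘ i k)) (toℚᵘ-fromℚᵘ (ℚᵘ.mkℚᵘ (ℤ.+ d) 0)))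
      (ℚᵘ.≃-trans (ℚᵘ.*≡* (g i (ℤ.+ d))) (ℚᵘ.≃-sym (toℚᵘ-fromℚᵘ (ℚᵘ.mkℚᵘ i 0))))))
    where
    g : ∀ i d → i ℤ.* d ℤ.* ℤ.+ 1 ≡ i ℤ.* (d ℤ.* ℤ.+ 1)
    g = ℤ-Solver.solve-∀

  module _ (n : ℕ) {{n≢0 : ℕ.NonZero n}} where

    open Density n using (total)

    private
      n³ : ℕ
      n³ = n ℕ.* n ℕ.* n
      instance
        12n³≢0 : ℕ.NonZero (12 ℕ.* n³)
        12n³≢0 = ℕ.m*n≢0 12 n³ {{_}} {{ℕ.m*n≢0 (n ℕ.* n) n {{ℕ.m*n≢0 n n}}}}

    opaque
      ω : ℚ
      ω = ℤ.+ total / (12 ℕ.* n³)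

      ω-total : ω * ℕ→ℚ (12 ℕ.* n³) ≡ ℕ→ℚ total
      ω-total = i/d*d≡i (ℤ.+ total) (12 ℕ.* n³)

    0≤ω : 0ℚ ≤ ω
    0≤ω = *-cancelʳ-≤-pos (ℕ→ℚ (12 ℕ.* n³)) {{positive (positive-ℕ→ℚ (12 ℕ.* n³))}}
      (subst₂ _≤_ (sym (*-zeroˡ (ℕ→ℚ (12 ℕ.* n³)))) (sym ω-total) (0≤ℕ→ℚ total))

    module _ (U : Clopen) (contains : ∀ x → Closure Σ[ n ] x → Clopen._∋_ U x) where

      open Clopen U renaming (level to Λ)

      private
        M : ℕ
        M = length (filterᵇ member (allV Λ))
        instance
          Λ²≢0 : ℕ.NonZero (Λ ℕ.* Λ)
          Λ²≢0 = ℕ.m*n≢0 Λ Λ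
          3Λ²≢0 : ℕ.NonZero (3 ℕ.* (Λ ℕ.* Λ))
          3Λ²≢0 = ℕ.m*n≢0 3 (Λ ℕ.* Λ)
          12n³Λ²≢0 : ℕ.NonZero (12 ℕ.* n³ ℕ.* (Λ ℕ.* Λ))
          12n³Λ²≢0 = ℕ.m*n≢0 (12 ℕ.* n³) (Λ ℕ.* Λ)

        mass-members : mass U * ℕ→ℚ (3 ℕ.* (Λ ℕ.* Λ)) ≡ ℕ→ℚ M
        mass-members = i/d*d≡i (ℤ.+ M) (3 ℕ.* (Λ ℕ.* Λ))

        left : ω * ℕ→ℚ (12 ℕ.* n³ ℕ.* (Λ ℕ.* Λ)) ≡ ℕ→ℚ (Λ ℕ.* Λ ℕ.* total)
        left = trans (cong (ω *_) (ℕ→ℚ-* (12 ℕ.* n³) (Λ ℕ.* Λ))) (trans (sym (*-assoc ω (ℕ→ℚ (12 ℕ.* n³)) (ℕ→ℚ (Λ ℕ.* Λ))))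
          (trans (cong (_* ℕ→ℚ (Λ ℕ.* Λ)) ω-total) (trans (*-comm (ℕ→ℚ total) (ℕ→ℚ (Λ ℕ.* Λ))) (sym (ℕ→ℚ-* (Λ ℕ.* Λ) total)))))

        right : ℕ→ℚ (4 ℕ.* n³ ℕ.* M) ≡ mass U * ℕ→ℚ (12 ℕ.* n³ ℕ.* (Λ ℕ.* Λ))
        right = trans (ℕ→ℚ-* (4 ℕ.* n³) M) (trans (*-comm (ℕ→ℚ (4 ℕ.* n³)) (ℕ→ℚ M)) (trans (cong (_* ℕ→ℚ (4 ℕ.* n³)) (sym mass-members))
          (trans (*-assoc (mass U) (ℕ→ℚ (3 ℕ.* (Λ ℕ.* Λ))) (ℕ→ℚ (4 ℕ.* n³))) (cong (mass U *_) (trans (sym (ℕ→ℚ-* (3 ℕ.* (Λ ℕ.* Λ)) (4 ℕ.* n³))) (cong ℕ→ℚ (g n³ (Λ ℕ.* Λ))))))))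
          where
          g : ∀ m l → 3 ℕ.* l ℕ.* (4 ℕ.* m) ≡ 12 ℕ.* m ℕ.* l
          g = ℕ-Solver.solve-∀

      ω≤mass : ω ≤ mass U
      ω≤mass = *-cancelʳ-≤-pos (ℕ→ℚ (12 ℕ.* n³ ℕ.* (Λ ℕ.* Λ))) {{positive (positive-ℕ→ℚ (12 ℕ.* n³ ℕ.* (Λ ℕ.* Λ)))}}
        (subst₂ _≤_ (sym left) right (ℕ→ℚ-≤ (Density.Cover.density n U contains)))

    ω≤ν : ∀ {ν} → Isν Σ[ n ] ν → ℚ→ℝ ω ≤ℝ ν
    ω≤ν (_ , greatest) = greatest (ℚ→ℝ ω) (λ U contains ε 0<ε → 0 , λ _ _ →
      ≤-trans (ω≤mass U contains) (≤-by ε (<⇒≤ 0<ε) refl))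

    module _ (len a ℓ : ℕ) (count : n ℕ.* (len ℕ.* (n ℕ.* n)) ℕ.≤
        16 ℕ.* (ℓ ℕ.* ((a ℕ.+ n) ℕ.* total)) ℕ.+ 6 ℕ.* (suc (a ℕ.+ a) ℕ.* (n ℕ.* (n ℕ.* (n ℕ.* n))))) where

      private
        l α λ′ ν̂ : ℚ
        l = ℕ→ℚ len
        α = ℕ→ℚ a
        λ′ = ℕ→ℚ ℓ
        ν̂ = ℕ→ℚ n

        left : ℕ→ℚ (n ℕ.* (len ℕ.* (n ℕ.* n))) ≡ l * ℕ→ℚ n³
        left = trans (cong ℕ→ℚ (g n len)) (ℕ→ℚ-* len n³)
          where
          g : ∀ n l → n ℕ.* (l ℕ.* (n ℕ.* n)) ≡ l ℕ.* (n ℕ.* n ℕ.* n)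
          g = ℕ-Solver.solve-∀

        right : ℕ→ℚ (16 ℕ.* (ℓ ℕ.* ((a ℕ.+ n) ℕ.* total)) ℕ.+ 6 ℕ.* (suc (a ℕ.+ a) ℕ.* (n ℕ.* (n ℕ.* (n ℕ.* n))))) ≡
          (ℕ→ℚ 192 * (ω * (α + ν̂) * λ′) + ℕ→ℚ 6 * ((1ℚ + (α + α)) * ν̂)) * ℕ→ℚ n³
        right = trans (ℕ→ℚ-+ (16 ℕ.* (ℓ ℕ.* ((a ℕ.+ n) ℕ.* total))) (6 ℕ.* (suc (a ℕ.+ a) ℕ.* (n ℕ.* (n ℕ.* (n ℕ.* n)))))) (trans (cong₂ _+_ first second) (sym (*-distribʳ-+ (ℕ→ℚ n³) (ℕ→ℚ 192 * (ω * (α + ν̂) * λ′)) (ℕ→ℚ 6 * ((1ℚ + (α + α)) * ν̂)))))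
          where
          first : ℕ→ℚ (16 ℕ.* (ℓ ℕ.* ((a ℕ.+ n) ℕ.* total))) ≡ ℕ→ℚ 192 * (ω * (α + ν̂) * λ′) * ℕ→ℚ n³
          first = trans (ℕ→ℚ-* 16 (ℓ ℕ.* ((a ℕ.+ n) ℕ.* total))) (trans (cong (ℕ→ℚ 16 *_) (trans (ℕ→ℚ-* ℓ ((a ℕ.+ n) ℕ.* total)) (cong (λ′ *_) (trans (ℕ→ℚ-* (a ℕ.+ n) total)
            (cong₂ _*_ (ℕ→ℚ-+ a n) (trans (sym ω-total) (cong (ω *_) (ℕ→ℚ-* 12 n³)))))))) (g λ′ (α + ν̂) ω (ℕ→ℚ n³)))
            where
            g : ∀ l h w m → ℕ→ℚ 16 * (l * (h * (w * (ℕ→ℚ 12 * m)))) ≡ ℕ→ℚ 192 * (w * h * l) * m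
            g = solve 4 (λ l h w m → con (ℕ→ℚ 16) :* (l :* (h :* (w :* (con (ℕ→ℚ 12) :* m)))) := con (ℕ→ℚ 192) :* (w :* h :* l) :* m) refl
          second : ℕ→ℚ (6 ℕ.* (suc (a ℕ.+ a) ℕ.* (n ℕ.* (n ℕ.* (n ℕ.* n))))) ≡ ℕ→ℚ 6 * ((1ℚ + (α + α)) * ν̂) * ℕ→ℚ n³
          second = trans (cong ℕ→ℚ (g (suc (a ℕ.+ a)) n)) (trans (ℕ→ℚ-* (6 ℕ.* (suc (a ℕ.+ a) ℕ.* n)) n³) (cong (_* ℕ→ℚ n³) (trans (ℕ→ℚ-* 6 (suc (a ℕ.+ a) ℕ.* n)) (cong (ℕ→ℚ 6 *_)
            (trans (ℕ→ℚ-* (suc (a ℕ.+ a)) n) (cong (_* ν̂) (trans (ℕ→ℚ-+ 1 (a ℕ.+ a)) (cong (1ℚ +_) (ℕ→ℚ-+ a a)))))))))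
            where
            g : ∀ w n → 6 ℕ.* (w ℕ.* (n ℕ.* (n ℕ.* (n ℕ.* n)))) ≡ 6 ℕ.* (w ℕ.* n) ℕ.* (n ℕ.* n ℕ.* n)
            g = ℕ-Solver.solve-∀

        instance
          n³≢0 : ℕ.NonZero n³
          n³≢0 = ℕ.m*n≢0 (n ℕ.* n) n {{ℕ.m*n≢0 n n}}

      -- The count divided by n³, with `total` written as 12 n³ ω; this is the origin of 192 = 16 ·
      -- 12.
      length-bound : ℕ→ℚ len ≤ ℕ→ℚ 192 * (ω * (ℕ→ℚ a + ℕ→ℚ n) * ℕ→ℚ ℓ) + ℕ→ℚ 6 * ((1ℚ + (ℕ→ℚ a + ℕ→ℚ a)) * ℕ→ℚ n)
      length-bound = *-cancelʳ-≤-pos (ℕ→ℚ n³) {{positive (positive-ℕ→ℚ n³)}} (subst₂ _≤_ left right (ℕ→ℚ-≤ count))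

-- Real estimates and the final constant.

module Assembly where

  open import Data.Empty using (⊥; ⊥-elim)
  open import Data.Integer.Base as ℤ using (ℤ; -[1+_])
  import Data.Integer.Properties as ℤ
  open import Data.List.Base using (List; []; _∷_; length; cartesianProduct)
  open import Data.List.Membership.Propositional using (_∈_)
  open import Data.List.Membership.Propositional.Properties using (∈-cartesianProduct⁺; ∈-cartesianProduct⁻)
  open import Data.List.Relation.Unary.All as All using (All; []; _∷_)
  open import Data.List.Relation.Unary.Any using (here)
  open import Data.Nat.Base as ℕ using (ℕ)
  import Data.Nat.Properties as ℕ
  open import Data.Rational.Base hiding (truncate)
  open import Data.Rational.Properties
  open import Data.Product.Base using (∃; _×_; _,_; proj₁; proj₂)
  open import Data.Sum.Base using (_⊎_; inj₁; inj₂; [_,_]′)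
  open import Relation.Binary.PropositionalEquality hiding ([_]; J)
  open import Relation.Nullary using (Dec; yes; no; ¬_)
  open import Relation.Nullary.Decidable using (_×-dec_)
  import Data.Rational.Solver
  open Data.Rational.Solver.+-*-Solver using (solve; con; _:=_; _:+_; _:-_; _:*_; :-_)

  open import Defs
  open ℝ
  open RationalIntegers
  open IndexOfBasis using (ℕ→ℚ)
  open PointCount using (module Counting; _≟T_)
  open RealOrder
  open SquareRoots
  open RootBounds
  open DiscriminantGaps
  open MeasureBound

  infixl 6 _⊕_
  infixl 7 _⊗_

  -- A real with seq val = f that is nonnegative. The sequence is an index so that the
  -- certificates below are compared syntactically: unfolding rational expressions is exponential.
  record Nonneg (f : ℕ → ℚ) : Set where
    constructor certify
    field
      val  : ℝ
      nn   : NN val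
      val≡ : ∀ i → seq val i ≡ f i
  open Nonneg

  _⊕_ : ∀ {f g} → Nonneg f → Nonneg g → Nonneg (λ i → f i + g i)
  x ⊕ y = certify (val x +ℝ val y) (nn-+ (val x) (val y) (nn x) (nn y)) (λ i → cong₂ _+_ (val≡ x i) (val≡ y i))

  _⊗_ : ∀ {f g} → Nonneg f → Nonneg g → Nonneg (λ i → f i * g i)
  x ⊗ y = certify (val x *ℝ val y) (nn-* (val x) (val y) (nn x) (nn y)) (λ i → cong₂ _*_ (val≡ x i) (val≡ y i))

  rat : ∀ q → 0ℚ ≤ q → Nonneg (λ _ → q)
  rat q 0≤q = certify (ℚ→ℝ q) (nn-pt (ℚ→ℝ q) (λ _ → 0≤q)) (λ _ → refl)

  nat : ∀ m → Nonneg (λ _ → ℕ→ℚ m)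
  nat m = rat (ℕ→ℚ m) (0≤ℕ→ℚ m)

  nat-gap : ∀ {a b} → a ℕ.≤ b → Nonneg (λ _ → ℕ→ℚ b - ℕ→ℚ a)
  nat-gap {a} {b} a≤b = rat (ℕ→ℚ b - ℕ→ℚ a) (gap≥0 (ℕ→ℚ-≤ a≤b))

  half : ∀ {f} → Nonneg f → Nonneg (λ i → ½ * f i)
  half x = rat ½ (<⇒≤ 0<½) ⊗ x

  real : ∀ x → NN x → Nonneg (seq x)
  real x h = certify x h (λ _ → refl)

  convert : ∀ {f g} → Nonneg f → (∀ i → f i ≡ g i) → Nonneg g
  convert x eq = certify (val x) (nn x) (λ i → trans (val≡ x i) (eq i))

  difference : ∀ x y → x ≤ℝ y → Nonneg (λ i → seq y i - seq x i)
  difference x y h = certify (y -ℝ x) (sub-nn x y h) (λ _ → refl)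

  by-constant : ∀ q y {f} → Nonneg f → (∀ i → seq y i ≡ q + f i) → ℚ→ℝ q ≤ℝ y
  by-constant q y d eq = le-by (ℚ→ℝ q) y (val d) (nn d) (λ i → trans (eq i) (cong (q +_) (sym (val≡ d i))))

  by-difference : ∀ x y → Nonneg (λ i → seq y i - seq x i) → x ≤ℝ y
  by-difference x y d = le-by x y (val d) (nn d) (λ i → trans (g (seq x i) (seq y i)) (cong (seq x i +_) (sym (val≡ d i))))
    where
    g : ∀ x y → y ≡ x + (y - x)
    g = solve 2 (λ x y → y := x :+ (y :- x)) refl

  incompatible : ∀ c {f g} → 0ℚ < c → Nonneg f → Nonneg g → (∀ i → g i ≡ - (c + f i)) → ⊥
  incompatible c 0<c x y eq = pos-not-≤ (ℚ→ℝ c +ℝ val x)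
    (pos-+-nn (ℚ→ℝ c) (val x) (c , 0<c , 0 , λ _ _ → ≤-reflexive (+-identityˡ c)) (nn x))
    (nn-cong (val y) (-ℝ (ℚ→ℝ c +ℝ val x)) (λ i → trans (val≡ y i) (trans (eq i) (cong (λ t → - (c + t)) (sym (val≡ x i))))) (nn y))

  nonneg-⊓ : ∀ x y q → Nonneg (λ i → seq x i - q) → Nonneg (λ i → seq y i - q) → Nonneg (λ i → seq (x ⊓ℝ y) i - q)
  nonneg-⊓ x y q h k = certify ((x ⊓ℝ y) -ℝ ℚ→ℝ q)
      (λ ε 0<ε → both {λ i → 0ℚ ≤ seq (val h) i + ε} {λ i → 0ℚ ≤ seq (val k) i + ε} (λ i → pick i ε (⊓-sel (seq x i) (seq y i))) (nn h ε 0<ε) (nn k ε 0<ε))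
      (λ _ → refl)
    where
    pick : ∀ i ε → seq x i ⊓ seq y i ≡ seq x i ⊎ seq x i ⊓ seq y i ≡ seq y i → 0ℚ ≤ seq (val h) i + ε → 0ℚ ≤ seq (val k) i + ε → 0ℚ ≤ seq x i ⊓ seq y i - q + ε
    pick i ε (inj₁ eq) p _ = subst (λ m → 0ℚ ≤ m - q + ε) (sym eq) (subst (λ m → 0ℚ ≤ m + ε) (val≡ h i) p)
    pick i ε (inj₂ eq) _ p = subst (λ m → 0ℚ ≤ m - q + ε) (sym eq) (subst (λ m → 0ℚ ≤ m + ε) (val≡ k i) p)

  abs-bound : ∀ z x → Bound (ℤ→ℝ z) x → Nonneg (λ i → seq x i - ℕ→ℚ ℤ.∣ z ∣)
  abs-bound (ℤ.+ m)  x (h , _) = certify (x -ℝ ℕ→ℝ m) h (λ _ → refl)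
  abs-bound -[1+ m ] x (_ , k) = certify (x +ℝ ℤ→ℝ -[1+ m ]) k (λ _ → refl)

  seq-3r² : ∀ r i → seq (r *ℝ r +ℝ r *ℝ (r +ℝ r)) i ≡ seq r i * seq r i + seq r i * (seq r i + seq r i)
  seq-3r² r i = refl

  seq-r³ : ∀ r i → seq (r *ℝ (r *ℝ r)) i ≡ seq r i * (seq r i * seq r i)
  seq-r³ r i = refl

  when : ∀ {P : Set} → Dec P → ℕ → ℕ
  when (yes _) k = k
  when (no _)  k = 0

  when-holds : ∀ (Q : ℕ → Set) {P : Set} (d : Dec P) k → Q 0 → (P → Q k) → Q (when d k)
  when-holds Q (yes p) k q₀ q = q p
  when-holds Q (no _)  k q₀ q = q₀

  when-yes : ∀ {P : Set} (d : Dec P) k → P → when d k ≡ k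
  when-yes (yes _) k p = refl
  when-yes (no ¬p) k p = ⊥-elim (¬p p)

  -- The reals `Y2`, `Y3` and `M` stand for Y², Y³ and the minimum. They are given by termwise
  -- formulas and, for the minimum, by the fact that a rational below both terms is below it.
  module _ (n : ℕ) {{n≢0 : ℕ.NonZero n}} (X Y Y2 Y3 M ν √X : ℝ) (0<Y : 0ℝ <ℝ Y)
    (y2≡ : ∀ i → seq Y2 i ≡ seq Y i * seq Y i) (y3≡ : ∀ i → seq Y3 i ≡ seq Y i * seq Y2 i)
    (M-⊓ : ∀ q → Nonneg (λ i → seq Y3 i - q) → Nonneg (λ i → seq √X i - q) → Nonneg (λ i → seq M i - q))
    (isν : Isν Σ[ n ] ν) (isSqrt : IsSqrt X √X) where

    private
      y y2 y3 m : ℕ → ℚ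
      y = seq Y
      y2 = seq Y2
      y3 = seq Y3
      m = seq M

      Y⁺ : Nonneg y
      Y⁺ = real Y (<⇒≤R 0ℝ Y 0<Y)
      Y2⁺ : Nonneg y2
      Y2⁺ = convert (Y⁺ ⊗ Y⁺) (λ i → sym (y2≡ i))
      Y3⁺ : Nonneg y3
      Y3⁺ = convert (Y⁺ ⊗ Y2⁺) (λ i → sym (y3≡ i))
      √X⁺ : Nonneg (seq √X)
      √X⁺ = real √X (proj₁ isSqrt)

      minus-0 : ∀ x → x ≡ x - ½ * ℕ→ℚ 0
      minus-0 = solve 1 (λ x → x := x :- con ½ :* con (ℕ→ℚ 0)) refl

      -- The factor ½ accommodates the trivial bound ∣B - B′∣ ≤ 2Y³.
      Half : ℕ → Set
      Half b = Nonneg (λ i → m i - ½ * ℕ→ℚ b)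

      half-0 : Half 0
      half-0 = M-⊓ (½ * ℕ→ℚ 0) (convert Y3⁺ (λ i → minus-0 (y3 i))) (convert √X⁺ (λ i → minus-0 (seq √X i)))

      M⁺ : Nonneg m
      M⁺ = convert half-0 (λ i → sym (minus-0 (m i)))

      ω⁺ : Nonneg (λ _ → ω n)
      ω⁺ = rat (ω n) (0≤ω n)
      ν-ω : Nonneg (λ i → seq ν i - ω n)
      ν-ω = difference (ℚ→ℝ (ω n)) ν (ω≤ν n {ν} isν)
      ν⁺ : Nonneg (seq ν)
      ν⁺ = convert (ν-ω ⊕ ω⁺) (λ i → g (seq ν i) (ω n))
        where
        g : ∀ v w → v - w + w ≡ v
        g = solve 2 (λ v w → v :- w :+ w := v) refl

      rhs : ℝ
      rhs = ℕ→ℝ 192 *ℝ ℕ→ℝ 6 *ℝ (ν *ℝ (Y2 +ℝ ℕ→ℝ n) *ℝ M +ℝ ℕ→ℝ n *ℝ Y2)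

      seq-rhs : ∀ i → seq rhs i ≡ ℕ→ℚ 192 * ℕ→ℚ 6 * (seq ν i * (y2 i + ℕ→ℚ n) * m i + ℕ→ℚ n * y2 i)
      seq-rhs i = refl

      rhs⁺ : Nonneg (λ i → ℕ→ℚ 192 * ℕ→ℚ 6 * (seq ν i * (y2 i + ℕ→ℚ n) * m i + ℕ→ℚ n * y2 i))
      rhs⁺ = nat 192 ⊗ nat 6 ⊗ (ν⁺ ⊗ (Y2⁺ ⊕ nat n) ⊗ M⁺ ⊕ nat n ⊗ Y2⁺)

      record Bounds (f : V ℤ) : Set where
        field
          A-bound : Nonneg (λ i → y2 i + (y2 i + y2 i) - ℕ→ℚ ℤ.∣ V.A f ∣)
          B-bound : Nonneg (λ i → y3 i - ℕ→ℚ ℤ.∣ V.B f ∣)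
          Δ-bound : Nonneg (λ i → seq X i - ℕ→ℚ ℤ.∣ Δ f ∣)
      open Bounds

      bounds : ∀ {f} → Counted n X Y f → Bounds f
      bounds {f} (_ , Δ<X , r , height , r<Y) = record
        { A-bound = convert (convert (abs-bound (V.A f) 3r² (proj₁ roots)) (λ i → cong (_- ℕ→ℚ α) (seq-3r² r i)) ⊕ (D ⊕ (D ⊕ D)))
            (λ i → trans (gA (y i) (seq r i) (ℕ→ℚ α)) (sym (cong (λ s → s + (s + s) - ℕ→ℚ α) (y2≡ i))))
        ; B-bound = convert (convert (abs-bound (V.B f) r³ (proj₂ roots)) (λ i → cong (_- ℕ→ℚ β) (seq-r³ r i)) ⊕ d ⊗ (Y⁺ ⊗ Y⁺ ⊕ Y⁺ ⊗ r⁺ ⊕ r⁺ ⊗ r⁺))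
            (λ i → trans (gB (y i) (seq r i) (ℕ→ℚ β)) (sym (cong (_- ℕ→ℚ β) (trans (y3≡ i) (cong (y i *_) (y2≡ i))))))
        ; Δ-bound = difference (ℕ→ℝ ℤ.∣ Δ f ∣) X (<⇒≤R (ℕ→ℝ ℤ.∣ Δ f ∣) X Δ<X) }
        where
        α β : ℕ
        α = ℤ.∣ V.A f ∣
        β = ℤ.∣ V.B f ∣
        open Roots f r height using (3r²; r³) renaming (goal to roots)
        r⁺ : Nonneg (seq r)
        r⁺ = real r (Roots.0≤r f r height)
        d : Nonneg (λ i → y i - seq r i)
        d = difference r Y (<⇒≤R r Y r<Y)
        D : Nonneg (λ i → (y i - seq r i) * ((y i - seq r i) + (seq r i + seq r i)))
        D = d ⊗ (d ⊕ (r⁺ ⊕ r⁺))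
        gA : ∀ y r a → (r * r + r * (r + r) - a) + ((y - r) * ((y - r) + (r + r)) + ((y - r) * ((y - r) + (r + r)) + (y - r) * ((y - r) + (r + r))))
          ≡ y * y + (y * y + y * y) - a
        gA = solve 3 (λ y r a → let d = (y :- r) :* ((y :- r) :+ (r :+ r)) ; s = y :* y in
          (r :* r :+ r :* (r :+ r) :- a) :+ (d :+ (d :+ d)) := s :+ (s :+ s) :- a) refl
        gB : ∀ y r b → (r * (r * r) - b) + (y - r) * (y * y + y * r + r * r) ≡ y * (y * y) - b
        gB = solve 3 (λ y r b → (r :* (r :* r) :- b) :+ (y :- r) :* (y :* y :+ y :* r :+ r :* r) := y :* (y :* y) :- b) refl

      half-close : ∀ f g → Bounds f → Bounds g → V.t f ≡ V.t g → V.A f ≡ V.A g → sign f ≡ sign g → Half ℤ.∣ V.B f ℤ.- V.B g ∣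
      half-close f g bf bg t≡ A≡ s≡ = M-⊓ (½ * ℕ→ℚ b)
          (convert (half (B-bound bf ⊕ B-bound bg ⊕ nat-gap (ℤ.∣i-j∣≤∣i∣+∣j∣ (V.B f) (V.B g))))
            (λ i → trans (cong (λ s → ½ * (y3 i - ℕ→ℚ β + (y3 i - ℕ→ℚ β′) + (s - ℕ→ℚ b))) (ℕ→ℚ-+ β β′)) (g₁ (y3 i) (ℕ→ℚ β) (ℕ→ℚ β′) (ℕ→ℚ b))))
          (convert (difference (ℕ→ℝ b) √X b≤√X ⊕ half (nat b)) (λ i → g₂ (seq √X i) (ℕ→ℚ b)))
        where
        b β β′ δ δ′ : ℕ
        b = ℤ.∣ V.B f ℤ.- V.B g ∣
        β = ℤ.∣ V.B f ∣
        β′ = ℤ.∣ V.B g ∣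
        δ = ℤ.∣ Δ f ∣
        δ′ = ℤ.∣ Δ g ∣
        g₁ : ∀ y p q b → ½ * (y - p + (y - q) + (p + q - b)) ≡ y - ½ * b
        g₁ = solve 4 (λ y p q b → con ½ :* (y :- p :+ (y :- q) :+ (p :+ q :- b)) := y :- con ½ :* b) refl
        g₂ : ∀ x b → x - b + ½ * b ≡ x - ½ * b
        g₂ = solve 2 (λ x b → x :- b :+ con ½ :* b := x :- con ½ :* b) refl
        -- The constant 27 is weakened to 2, so that half the sum of the two discriminant bounds
        -- gives b² ≤ X.
        two : b ℕ.* b ℕ.+ b ℕ.* b ℕ.≤ δ ℕ.+ δ′
        two = ℕ.≤-trans (subst (ℕ._≤ 27 ℕ.* (b ℕ.* b)) (cong (b ℕ.* b ℕ.+_) (ℕ.+-identityʳ (b ℕ.* b))) (ℕ.*-monoˡ-≤ (b ℕ.* b) {2} {27} (ℕ.s≤s (ℕ.s≤s ℕ.z≤n)))) (close f g t≡ A≡ s≡)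
        g₃ : ∀ x p q s → ½ * (x - p + (x - q) + (p + q - (s + s))) ≡ x - s
        g₃ = solve 4 (λ x p q s → con ½ :* (x :- p :+ (x :- q) :+ (p :+ q :- (s :+ s))) := x :- s) refl
        b²≤X : (ℕ→ℝ b *ℝ ℕ→ℝ b) ≤ℝ X
        b²≤X = by-difference (ℕ→ℝ b *ℝ ℕ→ℝ b) X (convert (half (Δ-bound bf ⊕ Δ-bound bg ⊕ nat-gap two))
          (λ i → trans (cong₂ (λ s t → ½ * (seq X i - ℕ→ℚ δ + (seq X i - ℕ→ℚ δ′) + (s - t))) (ℕ→ℚ-+ δ δ′)
            (trans (ℕ→ℚ-+ (b ℕ.* b) (b ℕ.* b)) (cong₂ _+_ (ℕ→ℚ-* b b) (ℕ→ℚ-* b b)))) (g₃ (seq X i) (ℕ→ℚ δ) (ℕ→ℚ δ′) (ℕ→ℚ b * ℕ→ℚ b))))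
        b≤√X : ℕ→ℝ b ≤ℝ √X
        b≤√X = square-cancel (ℕ→ℝ b) √X (proj₁ isSqrt) (≤-transR (ℕ→ℝ b *ℝ ℕ→ℝ b) X (√X *ℝ √X) b²≤X
          (≤-transR X (√X ^ℝ 2) (√X *ℝ √X) (proj₂ (proj₂ isSqrt)) (≤-pt (√X ^ℝ 2) (√X *ℝ √X) (λ i → cong (seq √X i *_) (*-identityʳ (seq √X i))))))

      same? : ∀ f g → Dec (V.t f ≡ V.t g × V.A f ≡ V.A g × sign f ≡ sign g)
      same? f g = (V.t f ≟T V.t g) ×-dec ((V.A f ℤ.≟ V.A g) ×-dec (sign f ℕ.≟ sign g))

      -- Zero across different groups, so that the maximum over all pairs bounds the spread inside
      -- each group.
      gap : V ℤ × V ℤ → ℕ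
      gap (f , g) = when (same? f g) ℤ.∣ V.B f ℤ.- V.B g ∣

      gap-half : ∀ f g → Bounds f → Bounds g → Half (gap (f , g))
      gap-half f g bf bg = when-holds Half (same? f g) _ half-0 λ (t≡ , A≡ , s≡) → half-close f g bf bg t≡ A≡ s≡

      gap-same : ∀ f g → V.t f ≡ V.t g → V.A f ≡ V.A g → sign f ≡ sign g → gap (f , g) ≡ ℤ.∣ V.B f ℤ.- V.B g ∣
      gap-same f g t≡ A≡ s≡ = when-yes (same? f g) _ (t≡ , A≡ , s≡)

      -- A nonzero A gives 1 ≤ 3Y², and a nonzero B gives 1 ≤ Y³.
      4y2-1 : ∀ {f} → Σ[ n ] f → Bounds f → Nonneg (λ i → (y2 i + y2 i) + (y2 i + y2 i) - ℕ→ℚ 1)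
      4y2-1 {f} (Δ≢0 , _) bf = [ fromA , fromB ]′ (A≢0∨B≢0 f Δ≢0)
        where
        fromA : 1 ℕ.≤ ℤ.∣ V.A f ∣ → Nonneg (λ i → (y2 i + y2 i) + (y2 i + y2 i) - ℕ→ℚ 1)
        fromA 1≤A = convert (A-bound bf ⊕ nat-gap 1≤A ⊕ Y2⁺) (λ i → g (y2 i) (ℕ→ℚ ℤ.∣ V.A f ∣) (ℕ→ℚ 1))
          where
          g : ∀ y a e → (y + (y + y) - a) + (a - e) + y ≡ (y + y) + (y + y) - e
          g = solve 3 (λ y a e → (y :+ (y :+ y) :- a) :+ (a :- e) :+ y := (y :+ y) :+ (y :+ y) :- e) refl
        4Y2 : ℝ
        4Y2 = (Y2 +ℝ Y2) +ℝ (Y2 +ℝ Y2)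
        fromB : 1 ℕ.≤ ℤ.∣ V.B f ∣ → Nonneg (λ i → (y2 i + y2 i) + (y2 i + y2 i) - ℕ→ℚ 1)
        fromB 1≤B = certify (4Y2 -ℝ 1ℝ) (sub-nn 1ℝ 4Y2 (≮⇒≥R 4Y2 1ℝ contra)) (λ _ → refl)
          where
          -- 4 Y² < 1 would give Y ≤ 1/2 and then 4 Y³ < Y ≤ 1/2, against 1 ≤ |B| ≤ Y³.
          contra : ¬ (4Y2 <ℝ 1ℝ)
          contra 4Y2<1 = incompatible c (positive⁻¹ c) (half (half (Y⁺ ⊗ N ⊕ difference Y ½ℝ Y≤½))) (B-bound bf ⊕ nat-gap 1≤B)
              (λ i → trans (cong (λ s → (s - ℕ→ℚ ℤ.∣ V.B f ∣) + (ℕ→ℚ ℤ.∣ V.B f ∣ - ℕ→ℚ 1)) (y3≡ i)) (g₂ (y i) (y2 i) (ℕ→ℚ ℤ.∣ V.B f ∣)))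
            where
            N : Nonneg (λ i → ℕ→ℚ 1 - ((y2 i + y2 i) + (y2 i + y2 i)))
            N = certify (1ℝ -ℝ 4Y2) (sub-nn 4Y2 1ℝ (<⇒≤R 4Y2 1ℝ 4Y2<1)) (λ _ → refl)
            Y≤½ : Y ≤ℝ ½ℝ
            Y≤½ = square-cancel Y ½ℝ nn-½ (by-difference (Y *ℝ Y) (½ℝ *ℝ ½ℝ) (convert (half (half N)) (λ i → trans (g (y2 i)) (cong (λ s → ½ * ½ - s) (y2≡ i)))))
              where
              g : ∀ s → ½ * (½ * (ℕ→ℚ 1 - ((s + s) + (s + s)))) ≡ ½ * ½ - s
              g = solve 1 (λ s → con ½ :* (con ½ :* (con (ℕ→ℚ 1) :- ((s :+ s) :+ (s :+ s)))) := con ½ :* con ½ :- s) refl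
            c : ℚ
            c = 1ℚ - ½ * (½ * ½)
            g₂ : ∀ y s b → (y * s - b) + (b - ℕ→ℚ 1) ≡ - (c + ½ * (½ * (y * (ℕ→ℚ 1 - ((s + s) + (s + s))) + (½ - y))))
            g₂ = solve 3 (λ y s b → (y :* s :- b) :+ (b :- con (ℕ→ℚ 1))
              := :- (con c :+ con ½ :* (con ½ :* (y :* (con (ℕ→ℚ 1) :- ((s :+ s) :+ (s :+ s))) :+ (con ½ :- y))))) refl

      -- The bound a ≤ 3Y² gives a + n ≤ 3(Y² + n), and ℓ ≤ 2M gives the remaining factor of 6. The
      -- added terms are products of these nonnegative differences and of ν - ω.
      first : ∀ v y m w a ℓ n → ℕ→ℚ 6 * (v * (y + n) * m) ≡
        w * (a + n) * ℓ
          + ((v - w) * (((y + n) + ((y + n) + (y + n))) * (m + m))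
            + w * (((y + (y + y) - a) + (n + n)) * (m + m))
            + w * ((a + n) * ((m - ½ * ℓ) + (m - ½ * ℓ))))
      first = solve 7 (λ v y m w a ℓ n → con (ℕ→ℚ 6) :* (v :* (y :+ n) :* m) :=
        w :* (a :+ n) :* ℓ
          :+ ((v :- w) :* (((y :+ n) :+ ((y :+ n) :+ (y :+ n))) :* (m :+ m))
            :+ w :* (((y :+ (y :+ y) :- a) :+ (n :+ n)) :* (m :+ m))
            :+ w :* ((a :+ n) :* ((m :- con ½ :* ℓ) :+ (m :- con ½ :* ℓ))))) refl

      -- 1 + 2a ≤ 4Y² + 6Y², which is where 10 comes from. The coefficient k stays free and may be
      -- any number from 10 on.
      second : ∀ k y a n → k * (n * y) ≡ (1ℚ + (a + a)) * n
        + n * (((y + (y + y) - a) + (y + (y + y) - a)) + ((y + y) + (y + y) - ℕ→ℚ 1) + (k - ℕ→ℚ 10) * y)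
      second = solve 4 (λ k y a n → k :* (n :* y) := (con 1ℚ :+ (a :+ a)) :* n
        :+ n :* (((y :+ (y :+ y) :- a) :+ (y :+ (y :+ y) :- a)) :+ ((y :+ y) :+ (y :+ y) :- con (ℕ→ℚ 1)) :+ (k :- con (ℕ→ℚ 10)) :* y)) refl

      -- The product k s serves as one constant for both terms: s is the loss in the first term, and
      -- k covers the loss in the second.
      combine : ∀ k s p q l P P′ Q Q′ → s * p ≡ P + P′ → k * q ≡ Q + Q′ →
        k * s * (p + q) ≡ l + (((k * P + s * Q) - l) + k * P′ + s * Q′)
      combine k s p q l P P′ Q Q′ eq₁ eq₂ = trans (g₁ k s p q) (trans (cong₂ (λ x y → k * x + s * y) eq₁ eq₂) (g₂ k s l P P′ Q Q′))
        where
        g₁ : ∀ k s p q → k * s * (p + q) ≡ k * (s * p) + s * (k * q)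
        g₁ = solve 4 (λ k s p q → k :* s :* (p :+ q) := k :* (s :* p) :+ s :* (k :* q)) refl
        g₂ : ∀ k s l P P′ Q Q′ → k * (P + P′) + s * (Q + Q′) ≡ l + (((k * P + s * Q) - l) + k * P′ + s * Q′)
        g₂ = solve 7 (λ k s l P P′ Q Q′ → k :* (P :+ P′) :+ s :* (Q :+ Q′) := l :+ (((k :* P :+ s :* Q) :- l) :+ k :* P′ :+ s :* Q′)) refl

      module _ (len a ℓ : ℕ) (bound : ℕ→ℚ len ≤ ℕ→ℚ 192 * (ω n * (ℕ→ℚ a + ℕ→ℚ n) * ℕ→ℚ ℓ) + ℕ→ℚ 6 * ((1ℚ + (ℕ→ℚ a + ℕ→ℚ a)) * ℕ→ℚ n))
               (a-bound : Nonneg (λ i → y2 i + (y2 i + y2 i) - ℕ→ℚ a)) (ℓ-bound : Half ℓ)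
               (4Y2≥1 : Nonneg (λ i → (y2 i + y2 i) + (y2 i + y2 i) - ℕ→ℚ 1)) where

        length≤rhs : ℕ→ℝ len ≤ℝ rhs
        length≤rhs = by-constant (ℕ→ℚ len) rhs (E₁ ⊕ nat 192 ⊗ E₂ ⊕ nat 6 ⊗ E₃)
            (λ i → trans (seq-rhs i) (combine (ℕ→ℚ 192) (ℕ→ℚ 6) (seq ν i * (y2 i + ℕ→ℚ n) * m i) (ℕ→ℚ n * y2 i) (ℕ→ℚ len)
              (ω n * (ℕ→ℚ a + ℕ→ℚ n) * ℕ→ℚ ℓ) _ ((1ℚ + (ℕ→ℚ a + ℕ→ℚ a)) * ℕ→ℚ n) _
              (first (seq ν i) (y2 i) (m i) (ω n) (ℕ→ℚ a) (ℕ→ℚ ℓ) (ℕ→ℚ n)) (second (ℕ→ℚ 192) (y2 i) (ℕ→ℚ a) (ℕ→ℚ n))))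
          where
          E₁ = rat (ℕ→ℚ 192 * (ω n * (ℕ→ℚ a + ℕ→ℚ n) * ℕ→ℚ ℓ) + ℕ→ℚ 6 * ((1ℚ + (ℕ→ℚ a + ℕ→ℚ a)) * ℕ→ℚ n) - ℕ→ℚ len) (gap≥0 bound)
          H = Y2⁺ ⊕ nat n
          E₂ = ν-ω ⊗ ((H ⊕ (H ⊕ H)) ⊗ (M⁺ ⊕ M⁺)) ⊕ ω⁺ ⊗ ((a-bound ⊕ (nat n ⊕ nat n)) ⊗ (M⁺ ⊕ M⁺)) ⊕ ω⁺ ⊗ ((nat a ⊕ nat n) ⊗ (ℓ-bound ⊕ ℓ-bound))
          E₃ = nat n ⊗ ((a-bound ⊕ a-bound) ⊕ 4Y2≥1 ⊕ nat-gap {10} {192} (ℕ.m≤m+n 10 182) ⊗ Y2⁺)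

    count≤ : Card≤ (Counted n X Y) rhs
    -- The bound 1 ≤ 4Y² rests on a counted cubic, so the empty list is settled by the nonnegativity
    -- of the right side.
    count≤ [] _ _ = nn-cong (val rhs⁺) rhs (λ i → trans (val≡ rhs⁺ i) (sym (seq-rhs i))) (nn rhs⁺)
    count≤ fs@(f₀ ∷ _) unique counted =
      length≤rhs (length fs) a ℓ (length-bound n (length fs) a ℓ counting) a-bound ℓ-bound
        (4y2-1 (proj₁ (All.lookup counted (here refl))) (bounds (All.lookup counted (here refl))))
      where
      g : ∀ s → s + (s + s) ≡ s + (s + s) - ℕ→ℚ 0
      g = solve 1 (λ s → s :+ (s :+ s) := s :+ (s :+ s) :- con (ℕ→ℚ 0)) refl
      pairs : List (V ℤ × V ℤ)
      pairs = cartesianProduct fs fs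
      heights : ∃ λ a → Nonneg (λ i → y2 i + (y2 i + y2 i) - ℕ→ℚ a) × (∀ {f} → f ∈ fs → ℤ.∣ V.A f ∣ ℕ.≤ a)
      heights = max-image (λ f → ℤ.∣ V.A f ∣) (λ a → Nonneg (λ i → y2 i + (y2 i + y2 i) - ℕ→ℚ a)) fs
        (convert (Y2⁺ ⊕ (Y2⁺ ⊕ Y2⁺)) (λ i → g (y2 i))) (λ f∈ → A-bound (bounds (All.lookup counted f∈)))
      gaps : ∃ λ ℓ → Half ℓ × (∀ {p} → p ∈ pairs → gap p ℕ.≤ ℓ)
      gaps = max-image gap Half pairs half-0 (λ {p} p∈ → let f∈ , g∈ = ∈-cartesianProduct⁻ fs fs p∈ in
        gap-half (proj₁ p) (proj₂ p) (bounds (All.lookup counted f∈)) (bounds (All.lookup counted g∈)))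
      a ℓ : ℕ
      a = proj₁ heights
      ℓ = proj₁ gaps
      a-bound = proj₁ (proj₂ heights)
      ℓ-bound = proj₁ (proj₂ gaps)
      counting = Counting.count n sign (λ f → sgn<2 (resolvent f)) a ℓ unique (λ f∈ → proj₁ (All.lookup counted f∈)) (proj₂ (proj₂ heights))
        (λ {f} {g} f∈ g∈ t≡ A≡ s≡ → subst (ℕ._≤ ℓ) (gap-same f g t≡ A≡ s≡) (proj₂ (proj₂ gaps) (∈-cartesianProduct⁺ f∈ g∈)))

  card-bound : ∀ n {{n≢0 : ℕ.NonZero n}} X Y → 0ℝ <ℝ Y → ∀ ν √X → Isν Σ[ n ] ν → IsSqrt X √X → Card≤ (Counted n X Y)
    (ℕ→ℝ 192 *ℝ ℕ→ℝ 6 *ℝ (ν *ℝ (Y ^ℝ 2 +ℝ ℕ→ℝ n) *ℝ (Y ^ℝ 3 ⊓ℝ √X) +ℝ ℕ→ℝ n *ℝ Y ^ℝ 2))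
  card-bound n X Y 0<Y ν √X = count≤ n X Y (Y ^ℝ 2) (Y ^ℝ 3) (Y ^ℝ 3 ⊓ℝ √X) ν √X 0<Y
    (λ i → cong (seq Y i *_) (*-identityʳ (seq Y i))) (λ i → refl) (nonneg-⊓ (Y ^ℝ 3) √X)

open import Defs
open import Data.Nat.Base using (ℕ; NonZero; ≢-nonZero; ≢-nonZero⁻¹)
open import Data.Product.Base using (∃; _,_)

theorem3p6 : ∃ λ (C : ℝ) →
    ∀ (n : ℕ) .{{_ : NonZero n}} (X Y : ℝ) → 0ℝ <ℝ X → 0ℝ <ℝ Y →
    ∀ (ν √X : ℝ) → Isν Σ[ n ] ν → IsSqrt X √X →
    Card≤ (Counted n X Y)
    (C *ℝ (ν *ℝ (Y ^ℝ 2 +ℝ ℕ→ℝ n) *ℝ (Y ^ℝ 3 ⊓ℝ √X) +ℝ ℕ→ℝ n *ℝ Y ^ℝ 2))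
theorem3p6 = ℕ→ℝ 192 *ℝ ℕ→ℝ 6 , λ n X Y _ 0<Y ν √X →
  Assembly.card-bound n {{≢-nonZero (≢-nonZero⁻¹ n)}} X Y 0<Y ν √X
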